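{- Let $d \geq 1$ and let $1+t^{i_1}+t^{i_2}+t^{i_3}+t^{i_4}$ be a polynomial with positive integers $i_1 \leq i_2 \leq i_3 \leq i_4 \leq d$. Then there exists a lattice polytope $\mathcal{P}\subset\mathbb{R}^d$ of dimension $d$ whose $\delta$-polynomial equals $1+t^{i_1}+t^{i_2}+t^{i_3}+t^{i_4}$ if and only if $(i_1,i_2,i_3,i_4)$ satisfies one of the following: \begin{enumerate} \item[(0)] $i_1+i_4=i_2+i_3 \leq d+1$, and $i_k+i_\ell \geq i_{k+\ell}$ for all $1 \leq k \leq \ell \leq 4$ with $k+\ell \leq 4$; \item[(1)] $(i_1,i_2,i_3,i_4)=(1,1,1,2)$ and $d \geq 2$; \item[(2)] $(i_1,i_2,i_3,i_4)=(1,2,2,2)$ and $d \geq 3$; \item[(3)] $(i_1,i_2,i_3,i_4)=(1,2,3,3)$ and $d \geq 5$. \end{enumerate} Moreover, the $\delta$-polynomials in cases (1), (2) and (3) cannot be obtained as the $\delta$-polynomial of any $d$-dimensional lattice simplex.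
   Context: A lattice polytope is a convex polytope all of whose vertices lie in $\mathbb{Z}^d$. For a $d$-dimensional lattice polytope $\mathcal{P}\subset\mathbb{R}^d$, let $L_{\mathcal{P}}(n)=|n\mathcal{P}\cap\mathbb{Z}^d|$ for positive integers $n$. The $\delta$-polynomial of $\mathcal{P}$ is $\delta(\mathcal{P},t)=(1-t)^{d+1}\left[1+\sum_{n\ge1}L_{\mathcal{P}}(n)t^n\right]$, which is a polynomial of degree at most $d$; its value at $t=1$ is the normalized volume of $\mathcal{P}$ ($d!$ times its Euclidean volume). In particular the polytopes in question have normalized volume $5$. -}

module Defs where

open import Data.Nat as ℕ using (ℕ; zero; suc; _≤ᵇ_; _≡ᵇ_)
open import Data.Nat.Combinatorics using (_C_)
open import Data.Integer as ℤ using (ℤ; +_)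
open import Data.Rational as ℚ using (ℚ; 0ℚ; _/_)
open import Data.Fin using (Fin; zero; suc)
open import Data.Vec using (Vec; lookup)
open import Data.List using (List; length; map; upTo; foldr)
open import Data.List.Membership.Propositional using (_∈_)
open import Data.List.Relation.Unary.Unique.Propositional using (Unique)
open import Data.Product using (Σ; ∃; _×_)
open import Data.Bool using (if_then_else_)
open import Relation.Binary.PropositionalEquality using (_≡_)

Point : ℕ → Set
Point d = Vec ℤ d

toℚ : ℤ → ℚ
toℚ z = z / 1

sumℚ : {m : ℕ} → (Fin m → ℚ) → ℚ
sumℚ {zero}  f = 0ℚ
sumℚ {suc m} f = f zero ℚ.+ sumℚ (λ i → f (suc i))

-- x ∈ n · conv(vs): x is a nonnegative (rational) combination of the
-- points vs with total weight n.
InDilate : {d k : ℕ} → Vec (Point d) k → ℕ → Point d → Set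
InDilate {d} {k} vs n x =
  Σ (Fin k → ℚ) λ c →
    ((i : Fin k) → 0ℚ ℚ.≤ c i) ×
    (sumℚ c ≡ toℚ (+ n)) ×
    ((j : Fin d) → sumℚ (λ i → c i ℚ.* toℚ (lookup (lookup vs i) j)) ≡ toℚ (lookup x j))

-- Affine independence of a finite family of points (over ℚ, equivalently ℝ).
AffIndep : {d m : ℕ} → (Fin m → Point d) → Set
AffIndep {d} {m} w =
  (c : Fin m → ℚ) → sumℚ c ≡ 0ℚ →
  ((j : Fin d) → sumℚ (λ i → c i ℚ.* toℚ (lookup (w i) j)) ≡ 0ℚ) →
  (i : Fin m) → c i ≡ 0ℚ

FullDim : {d k : ℕ} → Vec (Point d) k → Set
FullDim {d} {k} vs = Σ (Fin (suc d) → Fin k) λ σ → AffIndep (λ i → lookup vs (σ i))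

LatticeCount : {d k : ℕ} → Vec (Point d) k → ℕ → ℕ → Set
LatticeCount {d} vs n m =
  Σ (List (Point d)) λ xs →
    Unique xs ×
    ((x : Point d) → x ∈ xs → InDilate vs n x) ×
    ((x : Point d) → InDilate vs n x → x ∈ xs) ×
    (length xs ≡ m)

sumℤ : List ℤ → ℤ
sumℤ = foldr ℤ._+_ (+ 0)

sign : ℕ → ℤ
sign zero = + 1
sign (suc j) = ℤ.- sign j

-- Coefficient of t^k in (1-t)^(d+1) · Σ_{n≥0} L(n) t^n.
deltaCoef : ℕ → (ℕ → ℕ) → ℕ → ℤ
deltaCoef d L k =
  sumℤ (map (λ j → if j ≤ᵇ k then sign j ℤ.* (+ ((suc d) C j)) ℤ.* (+ L (k ℕ.∸ j)) else + 0)
            (upTo (suc (suc d))))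

HasDelta : {d k : ℕ} → Vec (Point d) k → (ℕ → ℤ) → Set
HasDelta {d} vs h =
  Σ (ℕ → ℕ) λ L →
    (L 0 ≡ 1) ×
    ((n : ℕ) → LatticeCount vs (suc n) (L (suc n))) ×
    ((k : ℕ) → deltaCoef d L k ≡ h k)

ind : ℕ → ℕ → ℕ
ind i k = if i ≡ᵇ k then 1 else 0

hpoly : ℕ → ℕ → ℕ → ℕ → ℕ → ℤ
hpoly i₁ i₂ i₃ i₄ k = + (ind 0 k ℕ.+ ind i₁ k ℕ.+ ind i₂ k ℕ.+ ind i₃ k ℕ.+ ind i₄ k)

ExistsPolytope : ℕ → (ℕ → ℤ) → Set
ExistsPolytope d h = Σ ℕ λ k → Σ (Vec (Point d) k) λ vs → FullDim vs × HasDelta vs h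

ExistsSimplex : ℕ → (ℕ → ℤ) → Set
ExistsSimplex d h = Σ (Vec (Point d) (suc d)) λ vs → AffIndep (lookup vs) × HasDelta vs h

iseq : ℕ → ℕ → ℕ → ℕ → ℕ → ℕ
iseq i₁ i₂ i₃ i₄ 1 = i₁
iseq i₁ i₂ i₃ i₄ 2 = i₂
iseq i₁ i₂ i₃ i₄ 3 = i₃
iseq i₁ i₂ i₃ i₄ 4 = i₄
iseq i₁ i₂ i₃ i₄ _ = 0

Cond0 : ℕ → ℕ → ℕ → ℕ → ℕ → Set
Cond0 d i₁ i₂ i₃ i₄ =
  (i₁ ℕ.+ i₄ ≡ i₂ ℕ.+ i₃) × (i₂ ℕ.+ i₃ ℕ.≤ suc d) ×
  ((k ℓ : ℕ) → 1 ℕ.≤ k → k ℕ.≤ ℓ → k ℕ.+ ℓ ℕ.≤ 4 →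
     iseq i₁ i₂ i₃ i₄ (k ℕ.+ ℓ) ℕ.≤ iseq i₁ i₂ i₃ i₄ k ℕ.+ iseq i₁ i₂ i₃ i₄ ℓ)

Cond1 Cond2 Cond3 : ℕ → ℕ → ℕ → ℕ → ℕ → Set
Cond1 d i₁ i₂ i₃ i₄ = (i₁ ≡ 1) × (i₂ ≡ 1) × (i₃ ≡ 1) × (i₄ ≡ 2) × (2 ℕ.≤ d)
Cond2 d i₁ i₂ i₃ i₄ = (i₁ ≡ 1) × (i₂ ≡ 2) × (i₃ ≡ 2) × (i₄ ≡ 2) × (3 ℕ.≤ d)
Cond3 d i₁ i₂ i₃ i₄ = (i₁ ≡ 1) × (i₂ ≡ 2) × (i₃ ≡ 3) × (i₄ ≡ 3) × (5 ℕ.≤ d)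

{-# OPTIONS --safe #-}
module Submission where

-- A generic linear programme selects, for each generic vector, one simplicial cone containing it,
-- and so cuts the cone over a polytope into half-open simplicial cones.  Every lattice point is
-- then uniquely a lattice point of a half-open box plus a natural combination of generators, so
-- the δ-polynomial is the generating function of the degrees of the five box points; with all
-- inequalities strict the same decomposition counts interior points.
--
-- For a simplex the box points form a group of order five, and their degrees are governed by the
-- residues k c mod 5: this is condition (0).  In general all lattice points of the polytope may be
-- taken as generators; there are d + 1 + #{k : iₖ = 1} of them.  Without an extra lattice point the
-- polytope is a simplex.  With at least two, translates of the generators by interior points
-- (Stanley) leave only small exponents.  With exactly one, the generators satisfy one linear
-- relation; comparing boxes shows that its positive coefficients sum to at least 4, so sums of two
-- and three generators are distinct and force i₂ = 2 and i₃ ≤ 3.  Hibi's inequality and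
-- a sign argument in dimension four remove the remaining low-dimensional cases.
--
-- Conversely, (0) is realised by simplices with a unimodular facet, and (1)–(3) by the convex hull
-- of the standard simplex and one further point.

open import Defs
open import Data.Nat as ℕ using (ℕ; zero; suc)
import Data.Nat.Properties as ℕP using (*-cancelʳ-≡; *-cancelˡ-≡; *-cancelˡ-≤; *-comm; *-distribˡ-+; *-identityʳ; *-monoʳ-<; *-zeroʳ; +-assoc; +-cancelʳ-<; +-cancelʳ-≡; +-cancelʳ-≤; +-cancelˡ-≡; +-cancelˡ-≤; +-comm; +-commutativeSemigroup; +-identityʳ; +-mono-≤; +-monoʳ-≤; +-monoˡ-≤; +-suc; +-∸-assoc; 1+n≢0; 1+n≢n; 1+n≰n; <-irrefl; <-≤-trans; <⇒≢; <⇒≱; m+[n∸m]≡n; m+n≡0⇒m≡0; m+n≡0⇒n≡0; m<m+n; m∸n+n≡m; m∸n≤m; m≤m*n; m≤m+n; m≤n*m; m≤n+m; m≤n⇒m<n∨m≡n; m≤n⇒m≤1+n; n<1+n; n∸n≡0; n≢0⇒n>0; n≤0⇒n≡0; n≤1+n; suc-injective; ≤-<-trans; ≤-antisym; ≤-pred; ≤-refl; ≤-reflexive; ≤-total; ≤-totalOrder; ≤-trans; ≮⇒≥; ≰⇒>)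
import Data.Nat.DivMod as DM using ([m+kn]%n≡m%n; m%n<n; m<n⇒m%n≡m; m≡m%n+[m/n]*n)
import Data.Nat.Solver
open import Data.Nat.ListAction using (sum)
import Data.Nat.ListAction.Properties as LA using (sum-↭)
open import Data.Integer as ℤ using (ℤ)
import Data.Integer.Properties as ℤP using (*-distribʳ-+; *-identityʳ; *-identityˡ; *-monoʳ-≤-nonNeg; +-assoc; +-comm; +-identityʳ; +-identityˡ; +-injective; +-monoʳ-<; +-monoˡ-≤; -1*i≡-i; -[1+-injective; 0≤i⇒+∣i∣≡i; <⇒≱; drop‿+<+; drop‿+≤+; i-j≡0⇒i≡j; i<j⇒i≤pred[j]; i<j⇒suc[i]≤j; i≤j+i; i≤j⇒0≤j-i; m-n≡m⊖n; neg-distrib-+; neg-distribˡ-*; neg-involutive; pos-*; pos-+; ≤-antisym; ≤-reflexive; ≮⇒≥; ≰⇒>; ⊖-≤; ⊖-≥)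
import Data.Integer.DivMod as ℤD using (a≡a%n+[a/n]*n; n%d<d)
import Data.Integer.Solver
open import Data.Bool using (Bool; true; false; if_then_else_)
import Data.Bool.Properties as BoolP using (_≟_)
open import Data.Fin using (Fin; zero; suc; toℕ; fromℕ<; punchIn; punchOut)
import Data.Fin.Properties as FinP using (_≟_; all?; any?; punchIn-punchOut; suc-injective; toℕ-fromℕ<; toℕ-injective; toℕ<n)
open import Data.Vec as Vec using (Vec; []; _∷_; lookup; tabulate; zipWith; replicate; _[_]≔_)
import Data.Vec.Properties as VecP using (lookup-map; lookup-replicate; lookup-zipWith; lookup∘tabulate; lookup∘update; lookup∘update′; ∷-injectiveʳ; ∷-injectiveˡ; ≡-dec)
import Data.Vec.Membership.Propositional.Properties as VecM using (∈-fromList⁻; ∈-lookup)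
open import Data.List as List using (List; []; _∷_; map; _++_; filter; length; upTo; applyUpTo; allFin; cartesianProduct)
import Data.List.Properties as ListP using (++-identityʳ; filter-accept; filter-reject; length-++; length-map; length-tabulate; length-upTo; map-applyUpTo; map-∘)
open import Data.List.Membership.Propositional using (_∈_; _∉_)
open import Data.List.Membership.Propositional.Properties using (∈-++⁺ʳ; ∈-++⁺ˡ; ∈-++⁻; ∈-allFin; ∈-cartesianProduct⁺; ∈-cartesianProduct⁻; ∈-filter⁺; ∈-filter⁻; ∈-map⁺; ∈-map⁻; ∈-tabulate⁻; ∈-upTo⁺; ∈-upTo⁻; ∈-∃++)
open import Data.List.Relation.Unary.Any using (here; there)
open import Data.List.Relation.Unary.All as All using (All; []; _∷_)
import Data.List.Relation.Unary.All.Properties as AllP using (map⁺)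
open import Data.List.Relation.Unary.AllPairs using ([]; _∷_)
open import Data.List.Relation.Unary.Unique.Propositional using (Unique)
import Data.List.Relation.Unary.Unique.Propositional.Properties as UP using (++⁺; allFin⁺; cartesianProduct⁺; filter⁺; map⁺; tabulate⁺; upTo⁺)
import Data.List.Relation.Unary.Sorted.TotalOrder.Properties as SP using (↗↭↗⇒≋)
open import Data.List.Relation.Unary.Linked using ([-]; _∷_)
open import Data.List.Relation.Binary.Pointwise using ([]; _∷_)
import Data.List.Relation.Binary.Permutation.Propositional as Perm
open Perm using (_↭_; ↭-refl; ↭-sym; ↭-trans; ↭-reflexive; ↭⇒↭ₛ; prep)
import Data.List.Relation.Binary.Permutation.Propositional.Properties as PP using (drop-∷; map⁺; shift; ↭-length; ∈-resp-↭)
open import Data.Product using (Σ; ∃; _×_; _,_; proj₁; proj₂)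
open import Data.Sum using (_⊎_; inj₁; inj₂)
open import Data.Empty using (⊥; ⊥-elim)
open import Function using (_∘_; id)
open import Function.Bundles using (_⇔_; mk⇔)
open import Relation.Nullary using (¬_; Dec; yes; no)
open import Relation.Nullary.Decidable using (from-yes; toWitness; _×-dec_; _→-dec_; ¬?; decidable-stable; does)
open import Relation.Binary.Definitions using (tri<; tri≈; tri>)
open import Relation.Binary.PropositionalEquality using (_≡_; refl; _≢_; sym; trans; cong; cong₂; subst; subst₂; module ≡-Reasoning)

module NS = Data.Nat.Solver.+-*-Solver
module Z = Data.Integer.Solver.+-*-Solver

-- All arithmetic is rational, so "infinitely close" has to be finite: the finitely many bases give
-- finitely many hyperplanes, a generic vector avoids them, and pairs (coordinate of a point,
-- coordinate of the generic vector), ordered lexicographically, decide to which cone a boundary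
-- point belongs. Moving points towards an inner vector q counts all lattice points; moving them
-- towards -q counts the interior ones with the same boxes, reflected: Ehrhart reciprocity. The
-- number 5 enters as a prime. Any nonzero box point of a simplex generates the group. For a
-- relation with some coefficient ±1, the box sizes are proportional to the positive coefficients,
-- so the sum of these divides 5; a sum of at most 3 is then 1. Without a coefficient ±1 all nonzero
-- ones are at least 2 in absolute value. Either way a sum of at most 3 leaves one term on each
-- side, hence two equal vertices. The apexes for (1)-(3) have positive barycentric coordinates of
-- sum 5 and negative ones of sum -4, namely -4, or -3 and -1. The simplices for (0) come from a
-- linear system for the numbers of coordinates with given residue modulo 5.

Mask : ℕ → Set
Mask = Vec Bool

size : ∀ {N} → Mask N → ℕ
size [] = 0
size (true ∷ σ) = suc (size σ)
size (false ∷ σ) = size σ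

-- Counting with lists, and generating functions

module Counting where

  open import Data.Nat using (_≤ᵇ_; _∸_)
  open import Data.Nat.Combinatorics using (_C_; nCk+nC[k+1]≡[n+1]C[k+1]; nCn≡1; nCk≡nC[n∸k]; k>n⇒nCk≡0)
  open import Data.Integer using (+_)
  open Z

  ∈-↭ : ∀ {A : Set} {x : A} {ys} → x ∈ ys → ∃ λ zs → ys ↭ x ∷ zs
  ∈-↭ {x = x} p with ∈-∃++ p
  ... | as , bs , refl = as ++ bs , PP.shift x as bs

  ∈-tail : ∀ {A : Set} {x y : A} {ys} → x ∈ y ∷ ys → x ≢ y → x ∈ ys
  ∈-tail (here e) ne = ⊥-elim (ne e)
  ∈-tail (there p) ne = p

  -- The surplus of `ys` is collected in a list of its own; comparing lengths afterwards turns every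
  -- cardinality argument below, bijections included, into a matter of inclusions.
  unique⊆⇒↭ : ∀ {A : Set} {xs ys : List A} → Unique xs → (∀ {x} → x ∈ xs → x ∈ ys) → ∃ λ zs → ys ↭ xs ++ zs
  unique⊆⇒↭ {xs = []} {ys} u s = ys , ↭-refl
  unique⊆⇒↭ {xs = x ∷ xs} (h ∷ u) s with ∈-↭ (s (here refl))
  ... | ys' , p with unique⊆⇒↭ {ys = ys'} u (λ {z} z∈ → ∈-tail (PP.∈-resp-↭ p (s (there z∈))) (λ e → All.lookup h z∈ (sym e)))
  ... | zs , q = zs , ↭-trans p (prep x q)

  unique⊆⇒≤ : ∀ {A : Set} {xs ys : List A} → Unique xs → (∀ {x} → x ∈ xs → x ∈ ys) → length xs ℕ.≤ length ys
  unique⊆⇒≤ {xs = xs} {ys} u s with unique⊆⇒↭ u s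
  ... | zs , p = subst (length xs ℕ.≤_) (sym (trans (PP.↭-length p) (ListP.length-++ xs))) (ℕP.m≤m+n _ _)

  unique⊆≥⇒↭ : ∀ {A : Set} {xs ys : List A} → Unique xs → (∀ {x} → x ∈ xs → x ∈ ys) → length ys ℕ.≤ length xs → ys ↭ xs
  unique⊆≥⇒↭ {xs = xs} {ys} u s le with unique⊆⇒↭ u s
  ... | [] , p = subst (ys ↭_) (ListP.++-identityʳ xs) p
  ... | z ∷ zs , p = ⊥-elim (ℕP.<⇒≱ (ℕP.m<m+n (length xs) {suc (length zs)} (ℕ.s≤s ℕ.z≤n)) (subst (ℕ._≤ length xs) (trans (PP.↭-length p) (ListP.length-++ xs)) le))

  unique-map : ∀ {A B : Set} {f : A → B} {xs} → (∀ {x y} → x ∈ xs → y ∈ xs → f x ≡ f y → x ≡ y) → Unique xs → Unique (map f xs)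
  unique-map {xs = []} inj u = []
  unique-map {f = f} {xs = x ∷ xs} inj (h ∷ u) =
    AllP.map⁺ (All.tabulate (λ {y} y∈ e → All.lookup h y∈ (inj (here refl) (there y∈) e)))
    ∷ unique-map (λ p q → inj (there p) (there q)) u

  unique-set : ∀ {A : Set} {xs ys : List A} → Unique xs → Unique ys → (∀ {x} → x ∈ xs → x ∈ ys) → (∀ {x} → x ∈ ys → x ∈ xs) → ys ↭ xs
  unique-set u v s t = unique⊆≥⇒↭ u s (unique⊆⇒≤ v t)

  -- A dependent sum of lists; the tag keeps the elements of different fibres apart.
  tagged : ∀ {A B : Set} → (A → List B) → List A → List (A × B)
  tagged f [] = []
  tagged f (x ∷ xs) = map (x ,_) (f x) ++ tagged f xs

  ∈-tagged⁺ : ∀ {A B : Set} (f : A → List B) {xs a b} → a ∈ xs → b ∈ f a → (a , b) ∈ tagged f xs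
  ∈-tagged⁺ f (here refl) q = ∈-++⁺ˡ (∈-map⁺ _ q)
  ∈-tagged⁺ f {x ∷ xs} (there p) q = ∈-++⁺ʳ (map (x ,_) (f x)) (∈-tagged⁺ f p q)

  ∈-tagged⁻ : ∀ {A B : Set} (f : A → List B) {xs a b} → (a , b) ∈ tagged f xs → a ∈ xs × b ∈ f a
  ∈-tagged⁻ f {x ∷ xs} p with ∈-++⁻ (map (x ,_) (f x)) p
  ... | inj₁ q with ∈-map⁻ _ q
  ...   | _ , b∈ , refl = here refl , b∈
  ∈-tagged⁻ f {x ∷ xs} p | inj₂ q with ∈-tagged⁻ f q
  ... | a∈ , b∈ = there a∈ , b∈

  unique-tagged : ∀ {A B : Set} (f : A → List B) {xs} → Unique xs → (∀ a → Unique (f a)) → Unique (tagged f xs)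
  unique-tagged f {[]} u v = []
  unique-tagged f {x ∷ xs} (h ∷ u) v = UP.++⁺ (UP.map⁺ (λ { refl → refl }) (v x)) (unique-tagged f u v) disj
    where
    disj : ∀ {z} → z ∈ map (x ,_) (f x) × z ∈ tagged f xs → ⊥
    disj (p , q) with ∈-map⁻ _ p
    ... | _ , _ , refl = All.lookup h (proj₁ (∈-tagged⁻ f q)) refl

  length-tagged : ∀ {A B : Set} (f : A → List B) xs → length (tagged f xs) ≡ sum (map (λ a → length (f a)) xs)
  length-tagged f [] = refl
  length-tagged f (x ∷ xs) = trans (ListP.length-++ (map (x ,_) (f x))) (cong₂ ℕ._+_ (ListP.length-map _ (f x)) (length-tagged f xs))

  -- The coefficient of t^n in 1/(1 - t)^D. The recursion expresses that 1 - t times 1/(1 - t)^(D+1)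
  -- is 1/(1 - t)^D, the form in which a backward difference can use it.
  cnt : ℕ → ℕ → ℕ
  cnt zero zero = 1
  cnt zero (suc n) = 0
  cnt (suc D) zero = cnt D zero
  cnt (suc D) (suc n) = cnt D (suc n) ℕ.+ cnt (suc D) n

  inc : ∀ {N} → Vec ℕ (suc N) → Vec ℕ (suc N)
  inc (m ∷ y) = suc m ∷ y

  -- The recursion follows that of `cnt`: a vector of sum n + 1 either vanishes at the first free
  -- place or arises by `inc` from one of sum n.
  comps : ∀ {N} → Mask N → ℕ → List (Vec ℕ N)
  comps [] zero = [] ∷ []
  comps [] (suc n) = []
  comps (false ∷ σ) n = map (0 ∷_) (comps σ n)
  comps (true ∷ σ) zero = map (0 ∷_) (comps σ 0)
  comps (true ∷ σ) (suc n) = map (0 ∷_) (comps σ (suc n)) ++ map inc (comps (true ∷ σ) n)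

  length-comps : ∀ {N} (σ : Mask N) n → length (comps σ n) ≡ cnt (size σ) n
  length-comps [] zero = refl
  length-comps [] (suc n) = refl
  length-comps (false ∷ σ) n = trans (ListP.length-map _ (comps σ n)) (length-comps σ n)
  length-comps (true ∷ σ) zero = trans (ListP.length-map _ (comps σ 0)) (length-comps σ 0)
  length-comps (true ∷ σ) (suc n) = trans (ListP.length-++ (map (0 ∷_) (comps σ (suc n))))
    (cong₂ ℕ._+_ (trans (ListP.length-map _ (comps σ (suc n))) (length-comps σ (suc n)))
                 (trans (ListP.length-map _ (comps (true ∷ σ) n)) (length-comps (true ∷ σ) n)))

  SuppN : ∀ {N} → Mask N → Vec ℕ N → Set
  SuppN σ y = ∀ i → lookup σ i ≡ false → lookup y i ≡ 0

  inc-inj : ∀ {N} {x y : Vec ℕ (suc N)} → inc x ≡ inc y → x ≡ y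
  inc-inj {x = a ∷ x} {b ∷ y} refl = refl

  unique-comps : ∀ {N} (σ : Mask N) n → Unique (comps σ n)
  unique-comps [] zero = [] ∷ []
  unique-comps [] (suc n) = []
  unique-comps (false ∷ σ) n = UP.map⁺ VecP.∷-injectiveʳ (unique-comps σ n)
  unique-comps (true ∷ σ) zero = UP.map⁺ VecP.∷-injectiveʳ (unique-comps σ 0)
  unique-comps (true ∷ σ) (suc n) = UP.++⁺ (UP.map⁺ VecP.∷-injectiveʳ (unique-comps σ (suc n))) (UP.map⁺ inc-inj (unique-comps (true ∷ σ) n)) disj
    where
    disj : ∀ {z} → z ∈ map (0 ∷_) (comps σ (suc n)) × z ∈ map inc (comps (true ∷ σ) n) → ⊥
    disj (p , q) with ∈-map⁻ _ p | ∈-map⁻ inc q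
    ... | _ , _ , refl | (_ ∷ _) , _ , ()

  ∈-comps⁺ : ∀ {N} (σ : Mask N) y → SuppN σ y → y ∈ comps σ (Vec.sum y)
  ∈-comps⁺ [] [] s = here refl
  ∈-comps⁺ (false ∷ σ) (m ∷ y) s with s zero refl
  ... | refl = ∈-map⁺ _ (∈-comps⁺ σ y (λ i → s (suc i)))
  ∈-comps⁺ (true ∷ σ) (zero ∷ y) s = go (Vec.sum y) (∈-comps⁺ σ y (λ i → s (suc i)))
    where
    go : ∀ n → y ∈ comps σ n → (0 ∷ y) ∈ comps (true ∷ σ) n
    go zero p = ∈-map⁺ _ p
    go (suc n) p = ∈-++⁺ˡ (∈-map⁺ _ p)
  ∈-comps⁺ (true ∷ σ) (suc m ∷ y) s = ∈-++⁺ʳ (map (0 ∷_) (comps σ (suc (m ℕ.+ Vec.sum y))))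
    (∈-map⁺ inc (∈-comps⁺ (true ∷ σ) (m ∷ y) (λ { (suc i) e → s (suc i) e })))

  ∈-comps⁻ : ∀ {N} (σ : Mask N) n {y} → y ∈ comps σ n → SuppN σ y × Vec.sum y ≡ n
  ∈-comps⁻ [] zero (here refl) = (λ ()) , refl
  ∈-comps⁻ (false ∷ σ) n p with ∈-map⁻ _ p
  ... | y , q , refl with ∈-comps⁻ σ n q
  ...   | s , e = (λ { zero _ → refl ; (suc i) → s i }) , e
  ∈-comps⁻ (true ∷ σ) zero p with ∈-map⁻ _ p
  ... | y , q , refl with ∈-comps⁻ σ 0 q
  ...   | s , e = (λ { (suc i) → s i }) , e
  ∈-comps⁻ (true ∷ σ) (suc n) p with ∈-++⁻ (map (0 ∷_) (comps σ (suc n))) p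
  ... | inj₁ p' with ∈-map⁻ _ p'
  ...   | y , q , refl with ∈-comps⁻ σ (suc n) q
  ...     | s , e = (λ { (suc i) → s i }) , e
  ∈-comps⁻ (true ∷ σ) (suc n) p | inj₂ p' with ∈-map⁻ inc p'
  ... | (m ∷ y) , q , refl with ∈-comps⁻ (true ∷ σ) n q
  ...   | s , e = (λ { (suc i) → s (suc i) }) , cong suc e

  -- Multiplication of a generating function by t^e, without truncated subtraction.
  shift : (ℕ → ℕ) → ℕ → ℕ → ℕ
  shift f zero n = f n
  shift f (suc e) zero = 0
  shift f (suc e) (suc n) = shift f e n

  shift-≤ : ∀ f {e n} → e ℕ.≤ n → shift f e n ≡ f (n ∸ e)
  shift-≤ f {zero} h = refl
  shift-≤ f {suc e} {suc n} (ℕ.s≤s h) = shift-≤ f h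

  shift-> : ∀ f {e n} → n ℕ.< e → shift f e n ≡ 0
  shift-> f {suc e} {zero} h = refl
  shift-> f {suc e} {suc n} (ℕ.s≤s h) = shift-> f h

  sumTo : (ℕ → ℤ) → ℕ → ℤ
  sumTo f zero = + 0
  sumTo f (suc n) = f 0 ℤ.+ sumTo (f ∘ suc) n

  sumTo-applyUpTo : ∀ f n → sumℤ (applyUpTo f n) ≡ sumTo f n
  sumTo-applyUpTo f zero = refl
  sumTo-applyUpTo f (suc n) = cong (λ t → f 0 ℤ.+ t) (sumTo-applyUpTo (f ∘ suc) n)

  sumTo-cong : ∀ {f g} n → (∀ i → f i ≡ g i) → sumTo f n ≡ sumTo g n
  sumTo-cong zero h = refl
  sumTo-cong (suc n) h = cong₂ ℤ._+_ (h 0) (sumTo-cong n (λ i → h (suc i)))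

  sumTo-0 : ∀ n → sumTo (λ _ → + 0) n ≡ + 0
  sumTo-0 zero = refl
  sumTo-0 (suc n) = trans (ℤP.+-identityˡ _) (sumTo-0 n)

  sumTo-- : ∀ f g n → sumTo (λ i → f i ℤ.- g i) n ≡ sumTo f n ℤ.- sumTo g n
  sumTo-- f g zero = refl
  sumTo-- f g (suc n) = trans (cong (λ t → (f 0 ℤ.- g 0) ℤ.+ t) (sumTo-- (f ∘ suc) (g ∘ suc) n))
    (solve 4 (λ a b c d → (a :- b) :+ (c :- d) := (a :+ c) :- (b :+ d)) refl (f 0) (g 0) (sumTo (f ∘ suc) n) (sumTo (g ∘ suc) n))

  sumTo-last : ∀ f n → sumTo f (suc n) ≡ sumTo f n ℤ.+ f n
  sumTo-last f zero = trans (ℤP.+-identityʳ (f 0)) (sym (ℤP.+-identityˡ (f 0)))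
  sumTo-last f (suc n) = trans (cong (λ t → f 0 ℤ.+ t) (sumTo-last (f ∘ suc) n)) (sym (ℤP.+-assoc (f 0) _ _))

  -- The δ-polynomial as an iterated difference

  dterm : ℕ → (ℕ → ℤ) → ℕ → ℕ → ℤ
  dterm m L k j = if j ≤ᵇ k then sign j ℤ.* (+ (m C j)) ℤ.* L (k ∸ j) else + 0

  dsum : ℕ → (ℕ → ℤ) → ℕ → ℤ
  dsum m L k = sumTo (dterm m L k) (suc m)

  ≤ᵇ-suc : ∀ j k → (suc j ≤ᵇ suc k) ≡ (j ≤ᵇ k)
  ≤ᵇ-suc zero k = refl
  ≤ᵇ-suc (suc j) k = refl

  nC0≡1 : ∀ n → n C 0 ≡ 1
  nC0≡1 n = trans (nCk≡nC[n∸k] {0} {n} ℕ.z≤n) (nCn≡1 n)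

  -- Pascal's rule; the sign change in `sign (suc j)` makes the second part a subtraction.
  dterm-suc : ∀ m L k j → dterm (suc m) L (suc k) (suc j) ≡ dterm m L (suc k) (suc j) ℤ.- dterm m L k j
  dterm-suc m L k j rewrite ≤ᵇ-suc j k with j ≤ᵇ k
  ... | false = refl
  ... | true = trans (cong (λ t → ℤ.- sign j ℤ.* t ℤ.* L (k ∸ j)) (trans (cong (+_) (sym (nCk+nC[k+1]≡[n+1]C[k+1] m j))) (ℤP.pos-+ (m C j) (m C suc j))))
    (solve 4 (λ s a b l → (:- s) :* (a :+ b) :* l := (:- s) :* b :* l :- s :* a :* l) refl (sign j) (+ (m C j)) (+ (m C suc j)) (L (k ∸ j)))

  dterm-0 : ∀ m L k → dterm (suc m) L k 0 ≡ dterm m L k 0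
  dterm-0 m L k = cong (λ t → + 1 ℤ.* (+ t) ℤ.* L k) (trans (nC0≡1 (suc m)) (sym (nC0≡1 m)))

  dterm-big : ∀ m L k → dterm m L k (suc m) ≡ + 0
  dterm-big m L k with suc m ≤ᵇ k
  ... | false = refl
  ... | true = trans (cong (λ t → sign (suc m) ℤ.* (+ t) ℤ.* L (k ∸ suc m)) (k>n⇒nCk≡0 (ℕP.n<1+n m)))
    (solve 2 (λ s l → s :* con (+ 0) :* l := con (+ 0)) refl (sign (suc m)) (L (k ∸ suc m)))

  ∇ : (ℕ → ℤ) → ℕ → ℤ
  ∇ L zero = L zero
  ∇ L (suc k) = L (suc k) ℤ.- L k

  -- One more factor 1 - t is one more backward difference. The sum for m + 1 has one summand more,
  -- which vanishes by `dterm-big`.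
  dsum-suc : ∀ m L k → dsum (suc m) L k ≡ ∇ (dsum m L) k
  dsum-suc m L zero = trans (cong₂ ℤ._+_ (dterm-0 m L 0) (trans (sumTo-0 (suc m)) (sym (sumTo-0 m)))) refl
  dsum-suc m L (suc k) = begin
    dterm (suc m) L (suc k) 0 ℤ.+ sumTo (λ j → dterm (suc m) L (suc k) (suc j)) (suc m)
      ≡⟨ cong₂ ℤ._+_ (dterm-0 m L (suc k)) (trans (sumTo-cong (suc m) (dterm-suc m L k)) (sumTo-- (λ j → dterm m L (suc k) (suc j)) (dterm m L k) (suc m))) ⟩
    dterm m L (suc k) 0 ℤ.+ (sumTo (λ j → dterm m L (suc k) (suc j)) (suc m) ℤ.- dsum m L k)
      ≡⟨ sym (ℤP.+-assoc (dterm m L (suc k) 0) _ _) ⟩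
    sumTo (dterm m L (suc k)) (suc (suc m)) ℤ.- dsum m L k
      ≡⟨ cong (ℤ._- dsum m L k) (trans (sumTo-last (dterm m L (suc k)) (suc m)) (trans (cong (λ t → dsum m L (suc k) ℤ.+ t) (dterm-big m L (suc k))) (ℤP.+-identityʳ (dsum m L (suc k))))) ⟩
    dsum m L (suc k) ℤ.- dsum m L k ∎
    where open ≡-Reasoning

  dsum-0 : ∀ L k → dsum 0 L k ≡ L k
  dsum-0 L k = trans (ℤP.+-identityʳ _) (trans (cong (λ t → + 1 ℤ.* (+ t) ℤ.* L k) (nC0≡1 0)) (ℤP.*-identityˡ (L k)))

  dsum-cong : ∀ m {L L'} k → (∀ n → L n ≡ L' n) → dsum m L k ≡ dsum m L' k
  dsum-cong m {L} {L'} k h = sumTo-cong (suc m) λ j → lem j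
    where
    lem : ∀ j → dterm m L k j ≡ dterm m L' k j
    lem j with j ≤ᵇ k
    ... | false = refl
    ... | true = cong (λ t → sign j ℤ.* (+ (m C j)) ℤ.* t) (h (k ∸ j))

  ∇-cong : ∀ {L L'} k → (∀ n → L n ≡ L' n) → ∇ L k ≡ ∇ L' k
  ∇-cong zero h = h 0
  ∇-cong (suc k) h = cong₂ ℤ._-_ (h (suc k)) (h k)

  -- The coefficient of t^n in Σ t^e divided by (1 - t)^D, with e running through `es`.
  counts : ℕ → List ℕ → ℕ → ℕ
  counts D es n = sum (map (λ e → shift (cnt D) e n) es)

  shift-∇ : ∀ D e n → shift (cnt (suc D)) e (suc n) ≡ shift (cnt D) e (suc n) ℕ.+ shift (cnt (suc D)) e n
  shift-∇ D zero n = refl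
  shift-∇ D (suc zero) zero = sym (ℕP.+-identityʳ _)
  shift-∇ D (suc (suc e)) zero = refl
  shift-∇ D (suc e) (suc n) = shift-∇ D e n

  shift-00 : ∀ D e → shift (cnt (suc D)) e 0 ≡ shift (cnt D) e 0
  shift-00 D zero = refl
  shift-00 D (suc e) = refl

  counts-∇ : ∀ D es n → counts (suc D) es (suc n) ≡ counts D es (suc n) ℕ.+ counts (suc D) es n
  counts-∇ D [] n = refl
  counts-∇ D (e ∷ es) n = trans (cong₂ ℕ._+_ (shift-∇ D e n) (counts-∇ D es n)) (ℕ-lem (shift (cnt D) e (suc n)) _ _ _)
    where
    open import Algebra.Properties.CommutativeSemigroup ℕP.+-commutativeSemigroup using (interchange)
    ℕ-lem : ∀ a b c d → (a ℕ.+ b) ℕ.+ (c ℕ.+ d) ≡ (a ℕ.+ c) ℕ.+ (b ℕ.+ d)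
    ℕ-lem a b c d = interchange a b c d

  counts-0 : ∀ D es → counts (suc D) es 0 ≡ counts D es 0
  counts-0 D [] = refl
  counts-0 D (e ∷ es) = cong₂ ℕ._+_ (shift-00 D e) (counts-0 D es)

  ∇-counts : ∀ D es k → ∇ (λ n → + counts (suc D) es n) k ≡ + counts D es k
  ∇-counts D es zero = cong +_ (counts-0 D es)
  ∇-counts D es (suc k) = trans (cong (ℤ._- (+ counts (suc D) es k)) (trans (cong +_ (counts-∇ D es k)) (ℤP.pos-+ (counts D es (suc k)) _)))
    (solve 2 (λ a b → (a :+ b) :- b := a) refl (+ counts D es (suc k)) (+ counts (suc D) es k))

  -- Each difference lowers the exponent of the denominator by one (`∇-counts`); the induction moves
  -- one unit from m to D.
  dsum-counts : ∀ m D es k → dsum m (λ n → + counts (m ℕ.+ D) es n) k ≡ + counts D es k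
  dsum-counts zero D es k = dsum-0 (λ n → + counts D es n) k
  dsum-counts (suc m) D es k = trans (dsum-suc m (λ n → + counts (suc m ℕ.+ D) es n) k) (trans (∇-cong k (λ n → trans (cong (λ z → dsum m (λ i → + counts z es i) n) (sym (ℕP.+-suc m D))) (dsum-counts m (suc D) es n))) (∇-counts D es k))

  mult : List ℕ → ℕ → ℕ
  mult es k = sum (map (λ e → ind e k) es)

  shift-ind : ∀ e k → shift (cnt 0) e k ≡ ind e k
  shift-ind zero zero = refl
  shift-ind zero (suc k) = refl
  shift-ind (suc e) zero = refl
  shift-ind (suc e) (suc k) = shift-ind e k

  counts-mult : ∀ es k → counts 0 es k ≡ mult es k
  counts-mult [] k = refl
  counts-mult (e ∷ es) k = cong₂ ℕ._+_ (shift-ind e k) (counts-mult es k)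

  -- After d + 1 differences the denominator has disappeared, since `cnt 0` is the series 1.
  deltaCoef-counts : ∀ d L es → (∀ n → L n ≡ counts (suc d) es n) → ∀ k → deltaCoef d L k ≡ + mult es k
  deltaCoef-counts d L es h k = begin
    deltaCoef d L k ≡⟨ cong sumℤ (ListP.map-applyUpTo id (dterm (suc d) (λ n → + L n) k) (suc (suc d))) ⟩
    sumℤ (applyUpTo (dterm (suc d) (λ n → + L n) k) (suc (suc d))) ≡⟨ sumTo-applyUpTo (dterm (suc d) (λ n → + L n) k) (suc (suc d)) ⟩
    dsum (suc d) (λ n → + L n) k ≡⟨ dsum-cong (suc d) k (λ n → cong +_ (h n)) ⟩
    dsum (suc d) (λ n → + counts (suc d) es n) k ≡⟨ dsum-cong (suc d) k (λ n → cong (λ z → + counts z es n) (sym (ℕP.+-identityʳ (suc d)))) ⟩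
    dsum (suc d) (λ n → + counts (suc d ℕ.+ 0) es n) k ≡⟨ dsum-counts (suc d) 0 es k ⟩
    + counts 0 es k ≡⟨ cong +_ (counts-mult es k) ⟩
    + mult es k ∎
    where open ≡-Reasoning

  ind-refl : ∀ e → ind e e ≡ 1
  ind-refl zero = refl
  ind-refl (suc e) = ind-refl e

  ind-≢ : ∀ {e k} → e ≢ k → ind e k ≡ 0
  ind-≢ {zero} {zero} ne = ⊥-elim (ne refl)
  ind-≢ {zero} {suc k} ne = refl
  ind-≢ {suc e} {zero} ne = refl
  ind-≢ {suc e} {suc k} ne = ind-≢ {e} {k} (λ x → ne (cong suc x))

  mult-∈ : ∀ es k → mult es k ≢ 0 → k ∈ es
  mult-∈ [] k h = ⊥-elim (h refl)
  mult-∈ (e ∷ es) k h with e ℕ.≟ k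
  ... | yes refl = here refl
  ... | no ne = there (mult-∈ es k (λ z → h (cong₂ ℕ._+_ (ind-≢ ne) z)))

  mult-↭ : ∀ {es es'} k → es ↭ es' → mult es k ≡ mult es' k
  mult-↭ k p = LA.sum-↭ (PP.map⁺ (λ e → ind e k) p)

  -- This turns a δ-polynomial, given by its coefficients, back into the list of its exponents.
  mult⇒↭ : ∀ es es' → (∀ k → mult es k ≡ mult es' k) → es ↭ es'
  mult⇒↭ [] [] h = ↭-refl
  mult⇒↭ [] (e ∷ es') h with trans (h e) (cong (ℕ._+ mult es' e) (ind-refl e))
  ... | ()
  mult⇒↭ (e ∷ es) es' h with ∈-↭ (mult-∈ es' e (λ z → ℕP.1+n≢0 (trans (cong (ℕ._+ mult es e) (sym (ind-refl e))) (trans (h e) z))))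
  ... | es'' , p = ↭-trans (prep e (mult⇒↭ es es'' (λ k → ℕP.+-cancelˡ-≡ (ind e k) _ _ (trans (h k) (mult-↭ k p))))) (↭-sym p)

module Polytopes where

  open Counting
  open import Data.Rational as ℚ using (ℚ; 0ℚ; 1ℚ; _+_; _*_; -_; _-_; _≤_; _<_; mkℚ)
  open import Data.Rational.Properties using (*-assoc; *-comm; *-distribʳ-+; *-distribˡ-+; *-identityʳ; *-identityˡ; *-inverseˡ; *-monoʳ-<-pos; *-monoʳ-≤-nonNeg; *-monoʳ-≤-nonPos; *-monoˡ-≤-nonNeg; *-zeroʳ; *-zeroˡ; +-comm; +-identityʳ; +-identityˡ; +-inverseʳ; +-mono-<-≤; +-mono-≤; +-mono-≤-<; +-monoʳ-<; +-monoʳ-≤; +-monoˡ-<; +-monoˡ-≤; 1/pos⇒pos; <-asym; <-cmp; <-irrefl; <-≤-trans; <⇒≤; neg-antimono-<; neg-antimono-≤; neg-distrib-+; neg-distribˡ-*; neg-injective; positive⁻¹; toℚᵘ-cancel-<; toℚᵘ-cancel-≤; toℚᵘ-fromℚᵘ; toℚᵘ-homo-*; toℚᵘ-homo-+; toℚᵘ-homo‿-; toℚᵘ-injective; toℚᵘ-mono-≤; ≤-<-trans; ≤-antisym; ≤-refl; ≤-reflexive; ≤-total; ≤-trans; ≮⇒≥; ≰⇒>; +-assoc)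
  import Data.Rational.Unnormalised as ℚᵘ
  import Data.Rational.Unnormalised.Properties as ℚᵘP
  open import Data.Rational.Solver using (module +-*-Solver)
  open +-*-Solver

  -- Rational vectors

  <⇒≱ : ∀ {p q} → p < q → ¬ (q ≤ p)
  <⇒≱ h h' = <-irrefl refl (<-≤-trans h h')

  toℚᵘ-toℚ : ∀ z → ℚ.toℚᵘ (toℚ z) ℚᵘ.≃ ℚᵘ.mkℚᵘ z 0
  toℚᵘ-toℚ z = toℚᵘ-fromℚᵘ (ℚᵘ.mkℚᵘ z 0)

  toℚ-+ : ∀ a b → toℚ (a ℤ.+ b) ≡ toℚ a + toℚ b
  toℚ-+ a b = toℚᵘ-injective (ℚᵘP.≃-trans (toℚᵘ-toℚ (a ℤ.+ b))
    (ℚᵘP.≃-trans (ℚᵘ.*≡* (cong (ℤ._* (ℤ.+ 1)) (sym (cong₂ ℤ._+_ (ℤP.*-identityʳ a) (ℤP.*-identityʳ b)))))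
    (ℚᵘP.≃-sym (ℚᵘP.≃-trans (toℚᵘ-homo-+ (toℚ a) (toℚ b)) (ℚᵘP.+-cong (toℚᵘ-toℚ a) (toℚᵘ-toℚ b))))))

  toℚ-* : ∀ a b → toℚ (a ℤ.* b) ≡ toℚ a * toℚ b
  toℚ-* a b = toℚᵘ-injective (ℚᵘP.≃-trans (toℚᵘ-toℚ (a ℤ.* b))
    (ℚᵘP.≃-sym (ℚᵘP.≃-trans (toℚᵘ-homo-* (toℚ a) (toℚ b)) (ℚᵘP.*-cong (toℚᵘ-toℚ a) (toℚᵘ-toℚ b)))))

  toℚ-neg : ∀ a → toℚ (ℤ.- a) ≡ - toℚ a
  toℚ-neg a = toℚᵘ-injective (ℚᵘP.≃-trans (toℚᵘ-toℚ (ℤ.- a))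
    (ℚᵘP.≃-sym (ℚᵘP.≃-trans (toℚᵘ-homo‿- (toℚ a)) (ℚᵘP.-‿cong (toℚᵘ-toℚ a)))))

  toℚ-- : ∀ a b → toℚ (a ℤ.- b) ≡ toℚ a - toℚ b
  toℚ-- a b = trans (toℚ-+ a (ℤ.- b)) (cong (toℚ a +_) (toℚ-neg b))

  toℚ-mono-≤ : ∀ {a b} → a ℤ.≤ b → toℚ a ≤ toℚ b
  toℚ-mono-≤ {a} {b} p = toℚᵘ-cancel-≤ (ℚᵘP.≤-respˡ-≃ (ℚᵘP.≃-sym (toℚᵘ-toℚ a))
    (ℚᵘP.≤-respʳ-≃ (ℚᵘP.≃-sym (toℚᵘ-toℚ b)) (ℚᵘ.*≤* (ℤP.*-monoʳ-≤-nonNeg (ℤ.+ 1) p))))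

  toℚ-cancel-≤ : ∀ {a b} → toℚ a ≤ toℚ b → a ℤ.≤ b
  toℚ-cancel-≤ {a} {b} p with ℚᵘP.≤-respˡ-≃ (toℚᵘ-toℚ a) (ℚᵘP.≤-respʳ-≃ (toℚᵘ-toℚ b) (toℚᵘ-mono-≤ p))
  ... | ℚᵘ.*≤* q = subst₂ ℤ._≤_ (ℤP.*-identityʳ a) (ℤP.*-identityʳ b) q

  toℚ-injective : ∀ {a b} → toℚ a ≡ toℚ b → a ≡ b
  toℚ-injective e = ℤP.≤-antisym (toℚ-cancel-≤ (≤-reflexive e)) (toℚ-cancel-≤ (≤-reflexive (sym e)))

  toℚ-mono-< : ∀ {a b} → a ℤ.< b → toℚ a < toℚ b
  toℚ-mono-< {a} {b} p = ≰⇒> λ q → ℤP.<⇒≱ p (toℚ-cancel-≤ q)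

  toℚ-cancel-< : ∀ {a b} → toℚ a < toℚ b → a ℤ.< b
  toℚ-cancel-< p = ℤP.≰⇒> λ q → <⇒≱ p (toℚ-mono-≤ q)

  p-q≡0⇒p≡q : ∀ p q → p - q ≡ 0ℚ → p ≡ q
  p-q≡0⇒p≡q p q e = trans (solve 2 (λ p q → p := (p :- q) :+ q) refl p q) (trans (cong (_+ q) e) (+-identityˡ q))

  p≤q⇒0≤q-p : ∀ {p q} → p ≤ q → 0ℚ ≤ q - p
  p≤q⇒0≤q-p {p} {q} h = subst (_≤ q - p) (+-inverseʳ p) (+-monoˡ-≤ (- p) h)

  0≤q-p⇒p≤q : ∀ {p q} → 0ℚ ≤ q - p → p ≤ q
  0≤q-p⇒p≤q {p} {q} h = subst₂ _≤_ (+-identityˡ p) (solve 2 (λ p q → (q :- p) :+ p := q) refl p q) (+-monoˡ-≤ p h)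

  p<q⇒0<q-p : ∀ {p q} → p < q → 0ℚ < q - p
  p<q⇒0<q-p {p} {q} h = subst (_< q - p) (+-inverseʳ p) (+-monoˡ-< (- p) h)

  0<q-p⇒p<q : ∀ {p q} → 0ℚ < q - p → p < q
  0<q-p⇒p<q {p} {q} h = subst₂ _<_ (+-identityˡ p) (solve 2 (λ p q → (q :- p) :+ p := q) refl p q) (+-monoˡ-< p h)

  *-0≤ : ∀ {p q} → 0ℚ ≤ p → 0ℚ ≤ q → 0ℚ ≤ p * q
  *-0≤ {p} {q} hp hq = subst (_≤ p * q) (*-zeroʳ p) (*-monoˡ-≤-nonNeg p {{ℚ.nonNegative hp}} hq)

  *-0< : ∀ {p q} → 0ℚ < p → 0ℚ < q → 0ℚ < p * q
  *-0< {p} {q} hp hq = subst (_< p * q) (*-zeroʳ p) (*-monoʳ-<-pos p {{ℚ.positive hp}} hq)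

  +-0≤ : ∀ {p q} → 0ℚ ≤ p → 0ℚ ≤ q → 0ℚ ≤ p + q
  +-0≤ {p} {q} hp hq = subst (_≤ p + q) (+-identityˡ 0ℚ) (+-mono-≤ hp hq)

  +-0<ˡ : ∀ {p q} → 0ℚ < p → 0ℚ ≤ q → 0ℚ < p + q
  +-0<ˡ {p} {q} hp hq = subst (_< p + q) (+-identityˡ 0ℚ) (+-mono-<-≤ hp hq)

  +-0<ʳ : ∀ {p q} → 0ℚ ≤ p → 0ℚ < q → 0ℚ < p + q
  +-0<ʳ {p} {q} hp hq = subst (_< p + q) (+-identityˡ 0ℚ) (+-mono-≤-< hp hq)

  neg-< : ∀ {p} → p < 0ℚ → 0ℚ < - p
  neg-< h = neg-antimono-< h

  neg-≤ : ∀ {p} → p ≤ 0ℚ → 0ℚ ≤ - p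
  neg-≤ h = neg-antimono-≤ h

  ≤∧≢⇒< : ∀ {p q} → p ≤ q → p ≢ q → p < q
  ≤∧≢⇒< h ne = ≰⇒> λ h' → ne (≤-antisym h h')

  inv : (p : ℚ) → p ≢ 0ℚ → ℚ
  inv p ne = (ℚ.1/ p) {{ℚ.≢-nonZero ne}}

  inv-* : ∀ p ne → inv p ne * p ≡ 1ℚ
  inv-* p ne = *-inverseˡ p {{ℚ.≢-nonZero ne}}

  0≢1ℚ : 1ℚ ≢ 0ℚ
  0≢1ℚ ()

  0<1ℚ : 0ℚ < 1ℚ
  0<1ℚ = ℚ.*<* (ℤ.+<+ (ℕ.s≤s ℕ.z≤n))

  inv-pos : ∀ {p} (h : 0ℚ < p) (ne : p ≢ 0ℚ) → 0ℚ < inv p ne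
  inv-pos {p} h ne = positive⁻¹ _ {{1/pos⇒pos p {{ℚ.positive h}}}}

  *-cancel-0 : ∀ p q → p ≢ 0ℚ → p * q ≡ 0ℚ → q ≡ 0ℚ
  *-cancel-0 p q ne e = begin
    q ≡⟨ sym (*-identityˡ q) ⟩
    1ℚ * q ≡⟨ cong (_* q) (sym (inv-* p ne)) ⟩
    inv p ne * p * q ≡⟨ *-assoc (inv p ne) p q ⟩
    inv p ne * (p * q) ≡⟨ cong (inv p ne *_) e ⟩
    inv p ne * 0ℚ ≡⟨ *-zeroʳ (inv p ne) ⟩
    0ℚ ∎
    where open ≡-Reasoning

  trichotomy : ∀ p → (p < 0ℚ) ⊎ (p ≡ 0ℚ) ⊎ (0ℚ < p)
  trichotomy p with <-cmp p 0ℚ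
  ... | tri< a _ _ = inj₁ a
  ... | tri≈ _ b _ = inj₂ (inj₁ b)
  ... | tri> _ _ c = inj₂ (inj₂ c)

  floor-spec : ∀ p → Σ ℤ λ z → (0ℚ ≤ p - toℚ z) × (p - toℚ z < 1ℚ)
  floor-spec p@(mkℚ n d-1 c) = z , p≤q⇒0≤q-p lo , up
    where
    d : ℕ
    d = suc d-1
    z : ℤ
    z = n ℤ./ (ℤ.+ d)
    r : ℕ
    r = n ℤ.% (ℤ.+ d)
    n≡ : n ≡ ℤ.+ r ℤ.+ z ℤ.* (ℤ.+ d)
    n≡ = ℤD.a≡a%n+[a/n]*n n (ℤ.+ d)
    lo : toℚ z ≤ p
    lo = toℚᵘ-cancel-≤ (ℚᵘP.≤-respˡ-≃ (ℚᵘP.≃-sym (toℚᵘ-toℚ z))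
      (ℚᵘ.*≤* (subst (z ℤ.* (ℤ.+ d) ℤ.≤_) (sym (trans (ℤP.*-identityʳ n) n≡)) (ℤP.i≤j+i (z ℤ.* (ℤ.+ d)) (ℤ.+ r)))))
    up' : p < toℚ (z ℤ.+ ℤ.+ 1)
    up' = toℚᵘ-cancel-< (ℚᵘP.<-respʳ-≃ (ℚᵘP.≃-sym (toℚᵘ-toℚ (z ℤ.+ ℤ.+ 1)))
      (ℚᵘ.*<* (subst₂ ℤ._<_ (sym (trans (ℤP.*-identityʳ n) (trans n≡ (ℤP.+-comm (ℤ.+ r) (z ℤ.* (ℤ.+ d))))))
         (sym (trans (ℤP.*-distribʳ-+ (ℤ.+ d) z (ℤ.+ 1)) (cong (λ t → z ℤ.* (ℤ.+ d) ℤ.+ t) (ℤP.*-identityˡ (ℤ.+ d)))))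
         (ℤP.+-monoʳ-< (z ℤ.* (ℤ.+ d)) (ℤ.+<+ (ℤD.n%d<d n (ℤ.+ d)))))))
    up : p - toℚ z < 1ℚ
    up = 0<q-p⇒p<q (subst (0ℚ <_) (trans (cong (_- p) (toℚ-+ z (ℤ.+ 1))) (solve 3 (λ a b p → (a :+ b) :- p := b :- (p :- a)) refl (toℚ z) 1ℚ p)) (p<q⇒0<q-p up'))

  Vecℚ : ℕ → Set
  Vecℚ n = Fin n → ℚ

  Σ-cong : ∀ {n} {f g : Vecℚ n} → (∀ i → f i ≡ g i) → sumℚ f ≡ sumℚ g
  Σ-cong {zero} h = refl
  Σ-cong {suc n} h = cong₂ _+_ (h zero) (Σ-cong (λ i → h (suc i)))

  Σ-+ : ∀ {n} (f g : Vecℚ n) → sumℚ (λ i → f i + g i) ≡ sumℚ f + sumℚ g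
  Σ-+ {zero} f g = refl
  Σ-+ {suc n} f g = trans (cong ((f zero + g zero) +_) (Σ-+ (λ i → f (suc i)) (λ i → g (suc i))))
    (solve 4 (λ a b c d → (a :+ b) :+ (c :+ d) := (a :+ c) :+ (b :+ d)) refl (f zero) (g zero) (sumℚ (λ i → f (suc i))) (sumℚ (λ i → g (suc i))))

  Σ-*ˡ : ∀ {n} c (f : Vecℚ n) → sumℚ (λ i → c * f i) ≡ c * sumℚ f
  Σ-*ˡ {zero} c f = sym (*-zeroʳ c)
  Σ-*ˡ {suc n} c f = trans (cong (c * f zero +_) (Σ-*ˡ c (λ i → f (suc i)))) (sym (*-distribˡ-+ c (f zero) _))

  Σ-0 : ∀ {n} {f : Vecℚ n} → (∀ i → f i ≡ 0ℚ) → sumℚ f ≡ 0ℚ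
  Σ-0 {zero} h = refl
  Σ-0 {suc n} h = trans (cong₂ _+_ (h zero) (Σ-0 (λ i → h (suc i)))) (+-identityˡ 0ℚ)

  Σ-swap : ∀ {m n} (f : Fin m → Fin n → ℚ) → sumℚ (λ i → sumℚ (f i)) ≡ sumℚ (λ j → sumℚ (λ i → f i j))
  Σ-swap {zero} {n} f = sym (Σ-0 {n} {λ j → 0ℚ} (λ _ → refl))
  Σ-swap {suc m} f = trans (cong (sumℚ (f zero) +_) (Σ-swap (λ i → f (suc i)))) (sym (Σ-+ (f zero) (λ j → sumℚ (λ i → f (suc i) j))))

  Σ-single : ∀ {n} {f : Vecℚ n} p → (∀ i → i ≢ p → f i ≡ 0ℚ) → sumℚ f ≡ f p
  Σ-single {suc n} {f} zero h = trans (cong (f zero +_) (Σ-0 (λ i → h (suc i) λ ()))) (+-identityʳ (f zero))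
  Σ-single {suc n} {f} (suc p) h = trans (cong₂ _+_ (h zero λ ()) (Σ-single p (λ i ne → h (suc i) λ e → ne (FinP.suc-injective e)))) (+-identityˡ _)

  Σ-≥0 : ∀ {n} {f : Vecℚ n} → (∀ i → 0ℚ ≤ f i) → 0ℚ ≤ sumℚ f
  Σ-≥0 {zero} h = ≤-refl
  Σ-≥0 {suc n} h = +-0≤ (h zero) (Σ-≥0 (λ i → h (suc i)))

  Σ->0 : ∀ {n} {f : Vecℚ n} → (∀ i → 0ℚ ≤ f i) → ∀ p → 0ℚ < f p → 0ℚ < sumℚ f
  Σ->0 {suc n} h zero hp = +-0<ˡ hp (Σ-≥0 (λ i → h (suc i)))
  Σ->0 {suc n} h (suc p) hp = +-0<ʳ (h zero) (Σ->0 (λ i → h (suc i)) p hp)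

  Σ-neg : ∀ {n} (f : Vecℚ n) → sumℚ (λ i → - f i) ≡ - sumℚ f
  Σ-neg {zero} f = refl
  Σ-neg {suc n} f = trans (cong (- f zero +_) (Σ-neg (λ i → f (suc i)))) (sym (neg-distrib-+ (f zero) _))

  Σ-- : ∀ {n} (f g : Vecℚ n) → sumℚ (λ i → f i - g i) ≡ sumℚ f - sumℚ g
  Σ-- f g = trans (Σ-+ f (λ i → - g i)) (cong (sumℚ f +_) (Σ-neg g))

  infix 8 _∙_
  _∙_ : ∀ {n} → Vecℚ n → Vecℚ n → ℚ
  f ∙ g = sumℚ (λ i → f i * g i)

  ∙-congˡ : ∀ {n} {f f' : Vecℚ n} (g : Vecℚ n) → (∀ i → f i ≡ f' i) → f ∙ g ≡ f' ∙ g
  ∙-congˡ g h = Σ-cong (λ i → cong (_* g i) (h i))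

  ∙-congʳ : ∀ {n} (f : Vecℚ n) {g g' : Vecℚ n} → (∀ i → g i ≡ g' i) → f ∙ g ≡ f ∙ g'
  ∙-congʳ f h = Σ-cong (λ i → cong (f i *_) (h i))

  ∙-comm : ∀ {n} (f g : Vecℚ n) → f ∙ g ≡ g ∙ f
  ∙-comm f g = Σ-cong (λ i → *-comm (f i) (g i))

  ∙-+ˡ : ∀ {n} (f f' g : Vecℚ n) → (λ i → f i + f' i) ∙ g ≡ f ∙ g + f' ∙ g
  ∙-+ˡ f f' g = trans (Σ-cong (λ i → *-distribʳ-+ (g i) (f i) (f' i))) (Σ-+ (λ i → f i * g i) (λ i → f' i * g i))

  ∙-*ˡ : ∀ {n} c (f g : Vecℚ n) → (λ i → c * f i) ∙ g ≡ c * f ∙ g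
  ∙-*ˡ c f g = trans (Σ-cong (λ i → *-assoc c (f i) (g i))) (Σ-*ˡ c (λ i → f i * g i))

  ∙-negˡ : ∀ {n} (f g : Vecℚ n) → (λ i → - f i) ∙ g ≡ - (f ∙ g)
  ∙-negˡ f g = trans (Σ-cong (λ i → sym (neg-distribˡ-* (f i) (g i)))) (Σ-neg (λ i → f i * g i))

  ∙--ˡ : ∀ {n} (f f' g : Vecℚ n) → (λ i → f i - f' i) ∙ g ≡ f ∙ g - f' ∙ g
  ∙--ˡ f f' g = trans (∙-+ˡ f (λ i → - f' i) g) (cong (f ∙ g +_) (∙-negˡ f' g))

  ∙-+ʳ : ∀ {n} (g f f' : Vecℚ n) → g ∙ (λ i → f i + f' i) ≡ g ∙ f + g ∙ f'
  ∙-+ʳ g f f' = trans (∙-comm g _) (trans (∙-+ˡ f f' g) (cong₂ _+_ (∙-comm f g) (∙-comm f' g)))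

  ∙-*ʳ : ∀ {n} c (g f : Vecℚ n) → g ∙ (λ i → c * f i) ≡ c * g ∙ f
  ∙-*ʳ c g f = trans (∙-comm g _) (trans (∙-*ˡ c f g) (cong (c *_) (∙-comm f g)))

  ∙-0ˡ : ∀ {n} {f : Vecℚ n} (g : Vecℚ n) → (∀ i → f i ≡ 0ℚ) → f ∙ g ≡ 0ℚ
  ∙-0ˡ g h = Σ-0 (λ i → trans (cong (_* g i) (h i)) (*-zeroˡ (g i)))

  δ : ∀ {n} → Fin n → Vecℚ n
  δ p i with p FinP.≟ i
  ... | yes _ = 1ℚ
  ... | no _ = 0ℚ

  δ-diag : ∀ {n} (p : Fin n) → δ p p ≡ 1ℚ
  δ-diag p with p FinP.≟ p
  ... | yes _ = refl
  ... | no ne = ⊥-elim (ne refl)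

  δ-off : ∀ {n} (p i : Fin n) → i ≢ p → δ p i ≡ 0ℚ
  δ-off p i ne with p FinP.≟ i
  ... | yes e = ⊥-elim (ne (sym e))
  ... | no _ = refl

  ∙-δˡ : ∀ {n} p (g : Vecℚ n) → δ p ∙ g ≡ g p
  ∙-δˡ p g = trans (Σ-single p (λ i ne → trans (cong (_* g i) (δ-off p i ne)) (*-zeroˡ (g i))))
    (trans (cong (_* g p) (δ-diag p)) (*-identityˡ (g p)))

  -- Gaussian elimination with prescribed support

  Supp : ∀ {N} → Mask N → Vecℚ N → Set
  Supp σ y = ∀ i → lookup σ i ≡ false → y i ≡ 0ℚ

  size-remove : ∀ {N} (σ : Mask N) p → lookup σ p ≡ true → size σ ≡ suc (size (σ [ p ]≔ false))
  size-remove (true ∷ σ) zero e = refl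
  size-remove (true ∷ σ) (suc p) e = cong suc (size-remove σ p e)
  size-remove (false ∷ σ) (suc p) e = size-remove σ p e

  size-0 : ∀ {N} (σ : Mask N) → (∀ i → lookup σ i ≢ true) → size σ ≡ 0
  size-0 [] h = refl
  size-0 (true ∷ σ) h = ⊥-elim (h zero refl)
  size-0 (false ∷ σ) h = size-0 σ (λ i → h (suc i))

  size-all : ∀ {N} (σ : Mask N) → (∀ i → lookup σ i ≡ true) → size σ ≡ N
  size-all [] h = refl
  size-all (true ∷ σ) h = cong suc (size-all σ (λ i → h (suc i)))
  size-all (false ∷ σ) h with h zero
  ... | ()

  size≤ : ∀ {N} (σ : Mask N) → size σ ℕ.≤ N
  size≤ [] = ℕ.z≤n
  size≤ (true ∷ σ) = ℕ.s≤s (size≤ σ)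
  size≤ (false ∷ σ) = ℕP.m≤n⇒m≤1+n (size≤ σ)

  size-full : ∀ {N} (σ : Mask N) → size σ ≡ N → ∀ i → lookup σ i ≡ true
  size-full (true ∷ σ) e zero = refl
  size-full (true ∷ σ) e (suc i) = size-full σ (ℕP.suc-injective e) i
  size-full {suc N} (false ∷ σ) e i = ⊥-elim (ℕP.<⇒≢ (ℕ.s≤s (size≤ σ)) e)

  ¬true⇒false : ∀ {b} → b ≢ true → b ≡ false
  ¬true⇒false {true} h = ⊥-elim (h refl)
  ¬true⇒false {false} h = refl

  true≢false : ∀ {b} → b ≡ true → b ≡ false → ⊥
  true≢false refl ()

  _≟ₘ_ : (a b : Bool) → Dec (a ≡ b)
  _≟ₘ_ = BoolP._≟_

  NonZeroV : ∀ {N} → Vecℚ N → Set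
  NonZeroV y = ∃ λ i → y i ≢ 0ℚ

  remove-false : ∀ {N} (σ : Mask N) p i → lookup (σ [ p ]≔ false) i ≡ false → i ≡ p ⊎ lookup σ i ≡ false
  remove-false σ p i e with i FinP.≟ p
  ... | yes i≡p = inj₁ i≡p
  ... | no ne = inj₂ (trans (sym (VecP.lookup∘update′ ne σ false)) e)

  Kernel : ∀ {k N} → (Fin k → Vecℚ N) → Vecℚ N → Set
  Kernel M y = ∀ r → M r ∙ y ≡ 0ℚ

  -- Elimination row by row: a nonzero entry of the first row inside σ is a pivot, its column leaves
  -- the mask and the other rows are cleared. The alternative provides nonzero solutions, a decision
  -- of independence, and a bound on the size of independent sets.
  ker : ∀ {k N} (M : Fin k → Vecℚ N) (σ : Mask N) →
    (∃ λ y → Supp σ y × NonZeroV y × Kernel M y)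
    ⊎ ((∀ y → Supp σ y → Kernel M y → ∀ i → y i ≡ 0ℚ) × size σ ℕ.≤ k)
  ker {zero} M σ with FinP.any? (λ i → lookup σ i ≟ₘ true)
  ... | yes (p , hp) = inj₁ (δ p , (λ i e → δ-off p i λ { refl → true≢false hp e })
          , (p , λ e → 0≢1ℚ (trans (sym (δ-diag p)) e)) , λ ())
  ... | no h = inj₂ ((λ y s _ i → s i (¬true⇒false (λ e → h (i , e)))) , ℕP.≤-reflexive (size-0 σ (λ i e → h (i , e))))
  ker {suc k} M σ with FinP.any? (λ i → (lookup σ i ≟ₘ true) ×-dec ¬? (M zero i ℚ.≟ 0ℚ))
  ... | no h = go (ker (λ r → M (suc r)) σ)
    where
    row0 : ∀ y → Supp σ y → M zero ∙ y ≡ 0ℚ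
    row0 y s = Σ-0 λ i → lem i
      where
      lem : ∀ i → M zero i * y i ≡ 0ℚ
      lem i with lookup σ i in e
      ... | false = trans (cong (M zero i *_) (s i e)) (*-zeroʳ (M zero i))
      ... | true = trans (cong (_* y i) (decidable-stable (M zero i ℚ.≟ 0ℚ) (λ ne → h (i , e , ne)))) (*-zeroˡ (y i))
    go : _ → _
    go (inj₁ (y , s , nz , K)) = inj₁ (y , s , nz , λ { zero → row0 y s ; (suc r) → K r })
    go (inj₂ (ind , le)) = inj₂ ((λ y s K → ind y s (λ r → K (suc r))) , ℕP.m≤n⇒m≤1+n le)
  ... | yes (p , hp , ne) = go (ker M' σ')
    where
    v : ℚ
    v = inv (M zero p) ne
    c : Fin k → ℚ
    c r = M (suc r) p * v
    M' : Fin k → Vecℚ _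
    M' r i = M (suc r) i - c r * M zero i
    σ' : Mask _
    σ' = σ [ p ]≔ false
    M'∙ : ∀ r y → M' r ∙ y ≡ M (suc r) ∙ y - c r * M zero ∙ y
    M'∙ r y = trans (∙--ˡ (M (suc r)) (λ i → c r * M zero i) y) (cong (λ t → M (suc r) ∙ y - t) (∙-*ˡ (c r) (M zero) y))
    cp : ∀ r → c r * M zero p ≡ M (suc r) p
    cp r = trans (*-assoc (M (suc r) p) v (M zero p)) (trans (cong (M (suc r) p *_) (inv-* (M zero p) ne)) (*-identityʳ _))
    M'p : ∀ r → M' r p ≡ 0ℚ
    M'p r = trans (cong (λ t → M (suc r) p - t) (cp r)) (+-inverseʳ (M (suc r) p))
    go : _ → _
    go (inj₁ (y' , s , (i₀ , nz) , K)) = inj₁ (y , sy , (i₀ , nzy) , Ky)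
      where
      t : ℚ
      -- The pivot variable is solved from the first row; the cleared rows have entry 0 in its
      -- column.
      t = - (v * M zero ∙ y')
      y : Vecℚ _
      y i = y' i + t * δ p i
      yp : ∀ i → i ≢ p → y i ≡ y' i
      yp i ip = trans (cong (y' i +_) (trans (cong (t *_) (δ-off p i ip)) (*-zeroʳ t))) (+-identityʳ (y' i))
      sy : Supp σ y
      sy i e with i FinP.≟ p
      ... | yes refl = ⊥-elim (true≢false hp e)
      ... | no ip = trans (yp i ip) (s i (trans (VecP.lookup∘update′ ip σ false) e))
      nzy : y i₀ ≢ 0ℚ
      nzy e with i₀ FinP.≟ p
      ... | yes refl = nz (s p (VecP.lookup∘update p σ false))
      ... | no ip = nz (trans (sym (yp i₀ ip)) e)
      M∙y : ∀ r → M r ∙ y ≡ M r ∙ y' + t * M r p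
      M∙y r = trans (∙-+ʳ (M r) y' (λ i → t * δ p i)) (cong (M r ∙ y' +_)
        (trans (∙-*ʳ t (M r) (δ p)) (cong (t *_) (trans (∙-comm (M r) (δ p)) (∙-δˡ p (M r))))))
      Ky : Kernel M y
      Ky zero = trans (M∙y zero) (trans (solve 3 (λ a v m → a :+ (:- (v :* a)) :* m := a :- (v :* m) :* a) refl (M zero ∙ y') v (M zero p))
        (trans (cong (λ z → M zero ∙ y' - z * M zero ∙ y') (inv-* (M zero p) ne)) (trans (cong (λ z → M zero ∙ y' - z) (*-identityˡ _)) (+-inverseʳ (M zero ∙ y')))))
      Ky (suc r) = trans (M∙y (suc r)) (trans (solve 4 (λ a b m v → b :+ (:- (v :* a)) :* m := b :- (m :* v) :* a) refl (M zero ∙ y') (M (suc r) ∙ y') (M (suc r) p) v)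
        (trans (sym (M'∙ r y')) (K r)))
    go (inj₂ (ind , le)) = inj₂ (ind' , subst (ℕ._≤ suc k) (sym (size-remove σ p hp)) (ℕ.s≤s le))
      where
      off : ∀ y → Supp σ y → Kernel M y → ∀ i → i ≢ p → y i ≡ 0ℚ
      off y s K i ip = trans (sym (y'off i ip)) (y'0 i)
        where
        y' : Vecℚ _
        y' i = y i - y p * δ p i
        y'off : ∀ i → i ≢ p → y' i ≡ y i
        y'off i ip = trans (cong (λ z → y i - z) (trans (cong (y p *_) (δ-off p i ip)) (*-zeroʳ (y p)))) (+-identityʳ (y i))
        s' : Supp σ' y'
        s' i e with i FinP.≟ p
        ... | yes refl = trans (cong (λ z → y p - z) (trans (cong (y p *_) (δ-diag p)) (*-identityʳ (y p)))) (+-inverseʳ (y p))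
        ... | no ip = trans (y'off i ip) (s i (trans (sym (VecP.lookup∘update′ ip σ false)) e))
        K' : Kernel M' y'
        K' r = begin
          M' r ∙ y' ≡⟨ ∙-comm (M' r) y' ⟩
          y' ∙ M' r ≡⟨ ∙--ˡ y (λ i → y p * δ p i) (M' r) ⟩
          y ∙ M' r - (λ i → y p * δ p i) ∙ M' r ≡⟨ cong₂ _-_ (∙-comm y (M' r)) (trans (∙-*ˡ (y p) (δ p) (M' r)) (cong (y p *_) (trans (∙-δˡ p (M' r)) (M'p r)))) ⟩
          M' r ∙ y - y p * 0ℚ ≡⟨ cong₂ _-_ (trans (M'∙ r y) (cong₂ (λ a b → a - c r * b) (K (suc r)) (K zero))) (*-zeroʳ (y p)) ⟩
          (0ℚ - c r * 0ℚ) - 0ℚ ≡⟨ solve 1 (λ c → (con 0ℚ :- c :* con 0ℚ) :- con 0ℚ := con 0ℚ) refl (c r) ⟩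
          0ℚ ∎
          where open ≡-Reasoning
        y'0 : ∀ i → y' i ≡ 0ℚ
        y'0 = ind y' s' K'
      ind' : ∀ y → Supp σ y → Kernel M y → ∀ i → y i ≡ 0ℚ
      ind' y s K i with i FinP.≟ p
      ... | no ip = off y s K i ip
      ... | yes refl = *-cancel-0 (M zero p) (y p) ne (trans (sym (Σ-single p (λ j jp → trans (cong (M zero j *_) (off y s K j jp)) (*-zeroʳ (M zero j))))) (K zero))

  -- Linear programming over ℚ

  Stable : ℚ → ℚ × ℚ → Set
  Stable ε (u , v) = ∀ t → 0ℚ < t → t ≤ ε → (0ℚ < u → 0ℚ < u + t * v) × (u < 0ℚ → u + t * v < 0ℚ)

  stable-pos : ∀ u v → 0ℚ < u → ∃ λ ε → 0ℚ < ε × ∀ t → 0ℚ < t → t ≤ ε → 0ℚ < u + t * v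
  stable-pos u v hu with <-≤-connex v 0ℚ
    where <-≤-connex : ∀ a b → (a < b) ⊎ (b ≤ a)
          <-≤-connex a b with a ℚ.<? b
          ... | yes p = inj₁ p
          ... | no p = inj₂ (≮⇒≥ p)
  ... | inj₂ v≥0 = 1ℚ , 0<1ℚ , λ t ht _ → +-0<ˡ hu (*-0≤ (<⇒≤ ht) v≥0)
  ... | inj₁ v<0 = ε , *-0< hu is , λ t ht le → <-≤-trans pos (+-monoʳ-≤ u (*-monoʳ-≤-nonPos v {{ℚ.nonPositive (<⇒≤ v<0)}} le))
    where
    s : ℚ
    s = u - v
    hs : 0ℚ < s
    hs = +-0<ˡ hu (<⇒≤ (neg-< v<0))
    s≢0 : s ≢ 0ℚ
    s≢0 e = <-irrefl (sym e) hs
    is : 0ℚ < inv s s≢0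
    is = inv-pos hs s≢0
    ε : ℚ
    -- This is u/(u - v), for which u + ε v equals u²/(u - v), still positive.
    ε = u * inv s s≢0
    pos : 0ℚ < u + ε * v
    pos = subst (0ℚ <_) (begin
      u * inv s s≢0 * u ≡⟨ solve 3 (λ u i v → u :* i :* u := u :* (i :* (u :- v)) :+ u :* i :* v) refl u (inv s s≢0) v ⟩
      u * (inv s s≢0 * s) + ε * v ≡⟨ cong (λ z → u * z + ε * v) (inv-* s s≢0) ⟩
      u * 1ℚ + ε * v ≡⟨ cong (_+ ε * v) (*-identityʳ u) ⟩
      u + ε * v ∎) (*-0< (*-0< hu is) hu)
      where open ≡-Reasoning

  stable-one : ∀ p → ∃ λ ε → 0ℚ < ε × Stable ε p
  stable-one (u , v) with trichotomy u
  ... | inj₂ (inj₁ refl) = 1ℚ , 0<1ℚ , λ t _ _ → (λ h → ⊥-elim (<-irrefl refl h)) , (λ h → ⊥-elim (<-irrefl refl h))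
  ... | inj₂ (inj₂ hu) with stable-pos u v hu
  ...   | ε , hε , f = ε , hε , λ t ht le → (λ _ → f t ht le) , (λ h → ⊥-elim (<-asym h hu))
  stable-one (u , v) | inj₁ hu with stable-pos (- u) (- v) (neg-< hu)
  ... | ε , hε , f = ε , hε , λ t ht le → (λ h → ⊥-elim (<-asym h hu)) ,
        (λ _ → subst₂ _<_ (solve 3 (λ u t v → :- (:- u :+ t :* (:- v)) := u :+ t :* v) refl u t v) refl (neg-antimono-< (f t ht le)))

  both-≤ : ∀ a b → 0ℚ < a → 0ℚ < b → ∃ λ c → 0ℚ < c × c ≤ a × c ≤ b
  both-≤ a b ha hb with ≤-total a b
  ... | inj₁ h = a , ha , ≤-refl , h
  ... | inj₂ h = b , hb , h , ≤-refl

  stable : ∀ ps → ∃ λ ε → 0ℚ < ε × (∀ {p} → p ∈ ps → Stable ε p)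
  stable [] = 1ℚ , 0<1ℚ , λ ()
  stable (p ∷ ps) with stable-one p | stable ps
  ... | ε₁ , h₁ , f₁ | ε₂ , h₂ , f₂ with both-≤ ε₁ ε₂ h₁ h₂
  ... | ε , h , l₁ , l₂ = ε , h , λ { (here refl) t ht le → f₁ t ht (≤-trans le l₁) ; (there q) t ht le → f₂ q t ht (≤-trans le l₂) }

  argmin : ∀ {A : Set} (f : A → ℚ) (xs : List A) {x} → x ∈ xs → ∃ λ m → m ∈ xs × (∀ {z} → z ∈ xs → f m ≤ f z)
  argmin f (a ∷ []) _ = a , here refl , λ { (here refl) → ≤-refl }
  argmin f (a ∷ b ∷ xs) _ with argmin f (b ∷ xs) (here refl)
  ... | m , m∈ , h with ≤-total (f a) (f m)
  ... | inj₁ le = a , here refl , λ { (here refl) → ≤-refl ; (there q) → ≤-trans le (h q) }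
  ... | inj₂ le = m , there m∈ , λ { (here refl) → le ; (there q) → h q }

  -- A functional vanishing at c is repaired by moving c along a coordinate on which it is nonzero.
  -- `stable` keeps the step so small that the functionals treated before stay nonzero, and adding a
  -- nonnegative amount keeps c positive.
  avoid : ∀ {N} (φs : List (Vecℚ N)) → (∀ {φ} → φ ∈ φs → NonZeroV φ) →
    ∃ λ (c : Vecℚ N) → (∀ i → 0ℚ < c i) × (∀ {φ} → φ ∈ φs → φ ∙ c ≢ 0ℚ)
  avoid [] h = (λ _ → 1ℚ) , (λ _ → 0<1ℚ) , λ ()
  avoid (φ ∷ φs) h with avoid φs (λ p → h (there p))
  ... | c , cp , g with φ ∙ c ℚ.≟ 0ℚ
  ... | no ne = c , cp , λ { (here refl) → ne ; (there p) → g p }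
  ... | yes e with h (here refl) | stable (map (λ ψ → (ψ ∙ c) , ψ (proj₁ (h (here refl)))) φs)
  ... | j , nz | ε , hε , st = c' , (λ i → +-0<ˡ (cp i) (*-0≤ (<⇒≤ hε) (δ≥0 i))) , λ { (here refl) → no₁ ; (there p) → no₂ p }
    where
    c' : Vecℚ _
    c' i = c i + ε * δ j i
    δ≥0 : ∀ i → 0ℚ ≤ δ j i
    δ≥0 i with j FinP.≟ i
    ... | yes _ = <⇒≤ 0<1ℚ
    ... | no _ = ≤-refl
    ∙c' : ∀ ψ → ψ ∙ c' ≡ ψ ∙ c + ε * ψ j
    ∙c' ψ = trans (∙-+ʳ ψ c (λ i → ε * δ j i)) (cong (ψ ∙ c +_) (trans (∙-*ʳ ε ψ (δ j)) (cong (ε *_) (trans (∙-comm ψ (δ j)) (∙-δˡ j ψ)))))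
    no₁ : φ ∙ c' ≢ 0ℚ
    no₁ z = nz (*-cancel-0 ε (φ j) (λ q → <-irrefl (sym q) hε) (trans (sym (trans (cong (_+ ε * φ j) e) (+-identityˡ _))) (trans (sym (∙c' φ)) z)))
    no₂ : ∀ {ψ} → ψ ∈ φs → ψ ∙ c' ≢ 0ℚ
    no₂ {ψ} p z with trichotomy (ψ ∙ c) | st (∈-map⁺ (λ ψ → (ψ ∙ c) , ψ j) p) ε hε ≤-refl
    ... | inj₁ lt | _ , f = <-irrefl (trans (sym (∙c' ψ)) z) (f lt)
    ... | inj₂ (inj₁ q) | _ = g p q
    ... | inj₂ (inj₂ gt) | f , _ = <-irrefl (sym (trans (sym (∙c' ψ)) z)) (f gt)

  allMasks : ∀ N → List (Mask N)
  allMasks zero = [] ∷ []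
  allMasks (suc N) = map (true ∷_) (allMasks N) ++ map (false ∷_) (allMasks N)

  ∈-allMasks : ∀ {N} (σ : Mask N) → σ ∈ allMasks N
  ∈-allMasks [] = here refl
  ∈-allMasks (true ∷ σ) = ∈-++⁺ˡ (∈-map⁺ _ (∈-allMasks σ))
  ∈-allMasks {suc N} (false ∷ σ) = ∈-++⁺ʳ (map (true ∷_) (allMasks N)) (∈-map⁺ _ (∈-allMasks σ))

  unique-allMasks : ∀ N → Unique (allMasks N)
  unique-allMasks zero = [] ∷ []
  unique-allMasks (suc N) = UP.++⁺ (UP.map⁺ VecP.∷-injectiveʳ (unique-allMasks N)) (UP.map⁺ VecP.∷-injectiveʳ (unique-allMasks N)) disj
    where
    disj : ∀ {z} → z ∈ map (true ∷_) (allMasks N) × z ∈ map (false ∷_) (allMasks N) → ⊥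
    disj (p , q) with ∈-map⁻ _ p | ∈-map⁻ _ q
    ... | _ , _ , refl | _ , _ , ()

  idx : ∀ {N} (σ : Mask N) → Fin (size σ) → Fin N
  idx (true ∷ σ) zero = zero
  idx (true ∷ σ) (suc r) = suc (idx σ r)
  idx (false ∷ σ) r = suc (idx σ r)

  idx-surj : ∀ {N} (σ : Mask N) i → lookup σ i ≡ true → ∃ λ r → idx σ r ≡ i
  idx-surj (true ∷ σ) zero e = zero , refl
  idx-surj (true ∷ σ) (suc i) e with idx-surj σ i e
  ... | r , refl = suc r , refl
  idx-surj (false ∷ σ) (suc i) e with idx-surj σ i e
  ... | r , refl = r , refl

  size-add : ∀ {N} (σ : Mask N) p → lookup σ p ≡ false → size (σ [ p ]≔ true) ≡ suc (size σ)
  size-add (false ∷ σ) zero e = refl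
  size-add (true ∷ σ) (suc p) e = cong suc (size-add σ p e)
  size-add (false ∷ σ) (suc p) e = size-add σ p e

  mask-ext : ∀ {N} {σ τ : Mask N} → (∀ i → lookup σ i ≡ lookup τ i) → σ ≡ τ
  mask-ext {σ = []} {[]} h = refl
  mask-ext {σ = a ∷ σ} {b ∷ τ} h = cong₂ _∷_ (h zero) (mask-ext (λ i → h (suc i)))

  -- More unknowns than equations; geometrically, fewer than D vectors lie in a hyperplane.
  annihilator : ∀ {k D} (v : Fin k → Vecℚ D) → k ℕ.< D → ∃ λ f → NonZeroV f × (∀ r → v r ∙ f ≡ 0ℚ)
  annihilator {k} {D} v lt with ker v (replicate D true)
  ... | inj₁ (f , _ , nz , K) = f , nz , K
  ... | inj₂ (_ , le) = ⊥-elim (ℕP.<⇒≱ lt (subst (ℕ._≤ k) (size-all (replicate D true) (λ i → VecP.lookup-replicate i true)) le))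

  -- Cones, bases and coordinates

  module Cone {N D : ℕ} (A : Fin D → Vecℚ N) where

    col : Fin N → Vecℚ D
    col i j = A j i

    Rep : Vecℚ N → Vecℚ D → Set
    Rep y w = ∀ j → A j ∙ y ≡ w j

    InCone : Vecℚ D → Set
    InCone w = ∃ λ y → (∀ i → 0ℚ ≤ y i) × Rep y w

    Spanning : Set
    Spanning = ∀ f → (∀ i → f ∙ col i ≡ 0ℚ) → ∀ j → f j ≡ 0ℚ

    rep-+ : ∀ {y y' w w'} → Rep y w → Rep y' w' → Rep (λ i → y i + y' i) (λ j → w j + w' j)
    rep-+ {y} {y'} h h' j = trans (∙-+ʳ (A j) y y') (cong₂ _+_ (h j) (h' j))

    rep-* : ∀ c {y w} → Rep y w → Rep (λ i → c * y i) (λ j → c * w j)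
    rep-* c {y} h j = trans (∙-*ʳ c (A j) y) (cong (c *_) (h j))

    rep-cong : ∀ {y y' w w'} → (∀ i → y i ≡ y' i) → (∀ j → w j ≡ w' j) → Rep y w → Rep y' w'
    rep-cong {y} {y'} hy hw h j = trans (∙-congʳ (A j) (λ i → sym (hy i))) (trans (h j) (hw j))

    rep-δ : ∀ i → Rep (δ i) (col i)
    rep-δ i j = trans (∙-comm (A j) (δ i)) (∙-δˡ i (A j))

    cone-+ : ∀ {w w'} → InCone w → InCone w' → InCone (λ j → w j + w' j)
    cone-+ (y , p , h) (y' , p' , h') = (λ i → y i + y' i) , (λ i → +-0≤ (p i) (p' i)) , rep-+ h h'

    cone-* : ∀ {c w} → 0ℚ ≤ c → InCone w → InCone (λ j → c * w j)
    cone-* {c} hc (y , p , h) = (λ i → c * y i) , (λ i → *-0≤ hc (p i)) , rep-* c h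

    cone-cong : ∀ {w w'} → (∀ j → w j ≡ w' j) → InCone w → InCone w'
    cone-cong e (y , p , h) = y , p , rep-cong (λ _ → refl) e h

    -- An exchange of two sums. It carries sign conditions on the generators over to the points of
    -- the cone.
    rep-dual : ∀ {y w} f → Rep y w → f ∙ w ≡ y ∙ (λ i → f ∙ col i)
    rep-dual {y} {w} f h = begin
      sumℚ (λ j → f j * w j) ≡⟨ Σ-cong (λ j → trans (cong (f j *_) (sym (h j))) (sym (Σ-*ˡ (f j) (λ i → A j i * y i)))) ⟩
      sumℚ (λ j → sumℚ (λ i → f j * (A j i * y i))) ≡⟨ Σ-swap (λ j i → f j * (A j i * y i)) ⟩
      sumℚ (λ i → sumℚ (λ j → f j * (A j i * y i))) ≡⟨ Σ-cong (λ i → trans (Σ-cong (λ j → solve 3 (λ a b c → a :* (b :* c) := c :* (a :* b)) refl (f j) (A j i) (y i))) (Σ-*ˡ (y i) (λ j → f j * A j i))) ⟩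
      y ∙ (λ i → f ∙ col i) ∎
      where open ≡-Reasoning

    Indep : Mask N → Set
    Indep σ = ∀ y → Supp σ y → Kernel A y → ∀ i → y i ≡ 0ℚ

    indep? : ∀ σ → Dec (Indep σ)
    indep? σ with ker A σ
    ... | inj₁ (y , s , (i , nz) , K) = no λ h → nz (h y s K i)
    ... | inj₂ (h , _) = yes h

    Basis : Mask N → Set
    Basis σ = Indep σ × size σ ≡ D

    basis? : ∀ σ → Dec (Basis σ)
    basis? σ = indep? σ ×-dec (size σ ℕ.≟ D)

    rep-unique : ∀ {σ y y' w} → Indep σ → Supp σ y → Supp σ y' → Rep y w → Rep y' w → ∀ i → y i ≡ y' i
    rep-unique {σ} {y} {y'} {w} ind s s' h h' i = p-q≡0⇒p≡q (y i) (y' i) (ind (λ i → y i - y' i)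
      (λ i e → trans (cong₂ _-_ (s i e) (s' i e)) (+-inverseʳ 0ℚ))
      (λ j → trans (∙-comm (A j) (λ i → y i - y' i)) (trans (∙--ˡ y y' (A j))
        (trans (cong₂ _-_ (trans (∙-comm y (A j)) (h j)) (trans (∙-comm y' (A j)) (h' j))) (+-inverseʳ (w j))))) i)

    aug : Vecℚ D → Fin D → Vecℚ (suc N)
    aug w j zero = w j
    aug w j (suc i) = A j i

    abstract
      -- In dimension D the vector w is dependent on D independent columns, and the relation can be
      -- solved for w. The value 0 in the other branches is a default for masks that are not bases.
      coord : Mask N → Vecℚ D → Vecℚ N
      coord σ w with ker (aug w) (true ∷ σ)
      ... | inj₂ _ = λ _ → 0ℚ
      ... | inj₁ (y , _) with y zero ℚ.≟ 0ℚ
      ... | yes _ = λ _ → 0ℚ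
      ... | no ne = λ i → - inv (y zero) ne * y (suc i)

      coord-spec : ∀ {σ} w → Basis σ → Supp σ (coord σ w) × Rep (coord σ w) w
      coord-spec {σ} w (ind , sz) with ker (aug w) (true ∷ σ)
      ... | inj₂ (_ , le) = ⊥-elim (ℕP.1+n≰n (subst (λ z → suc z ℕ.≤ D) sz le))
      ... | inj₁ (y , s , (i₀ , nz) , K) with y zero ℚ.≟ 0ℚ
      ... | yes e = ⊥-elim (nz (lem i₀))
        where
        lem : ∀ i → y i ≡ 0ℚ
        lem zero = e
        lem (suc i) = ind (λ i → y (suc i)) (λ i → s (suc i)) (λ j → trans (sym (trans (cong (_+ A j ∙ (λ i → y (suc i))) (trans (cong (w j *_) e) (*-zeroʳ (w j)))) (+-identityˡ _))) (K j)) i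
      ... | no ne = (λ i e → trans (cong (- inv (y zero) ne *_) (s (suc i) e)) (*-zeroʳ (- inv (y zero) ne))) , λ j → begin
          A j ∙ (λ i → - v * y' i) ≡⟨ ∙-*ʳ (- v) (A j) y' ⟩
          - v * A j ∙ y' ≡⟨ solve 4 (λ v a w z → :- v :* a := w :* (v :* z) :- v :* (w :* z :+ a)) refl v (A j ∙ y') (w j) (y zero) ⟩
          w j * (v * y zero) - v * (w j * y zero + A j ∙ y') ≡⟨ cong₂ (λ a b → w j * a - v * b) (inv-* (y zero) ne) (K j) ⟩
          w j * 1ℚ - v * 0ℚ ≡⟨ cong₂ _-_ (*-identityʳ (w j)) (*-zeroʳ v) ⟩
          w j - 0ℚ ≡⟨ +-identityʳ (w j) ⟩
          w j ∎
        where
        open ≡-Reasoning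
        v : ℚ
        v = inv (y zero) ne
        y' : Vecℚ N
        y' i = y (suc i)

    coord-unique : ∀ {σ y w} → Basis σ → Supp σ y → Rep y w → ∀ i → y i ≡ coord σ w i
    coord-unique {σ} {y} {w} b s h = rep-unique {σ} (proj₁ b) s (proj₁ (coord-spec w b)) h (proj₂ (coord-spec w b))

    coord-+* : ∀ {σ} → Basis σ → ∀ x t v i → coord σ (λ j → x j + t * v j) i ≡ coord σ x i + t * coord σ v i
    coord-+* {σ} b x t v i = sym (coord-unique {σ} {λ i → coord σ x i + t * coord σ v i} b
      (λ i e → trans (cong₂ _+_ (proj₁ (coord-spec x b) i e) (trans (cong (t *_) (proj₁ (coord-spec v b) i e)) (*-zeroʳ t))) (+-identityʳ 0ℚ))
      (rep-+ (proj₂ (coord-spec x b)) (rep-* t (proj₂ (coord-spec v b)))) i)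

    coord-col : ∀ {σ} → Basis σ → ∀ i → lookup σ i ≡ true → ∀ j → coord σ (col i) j ≡ δ i j
    coord-col {σ} b i e j = sym (coord-unique {σ} {δ i} b (λ k e' → δ-off i k λ { refl → true≢false e e' }) (rep-δ i) j)

    coord-cong : ∀ {σ} → Basis σ → ∀ {w w'} → (∀ j → w j ≡ w' j) → ∀ i → coord σ w i ≡ coord σ w' i
    coord-cong {σ} b {w} {w'} h i = coord-unique {σ} b (proj₁ (coord-spec w b)) (rep-cong (λ _ → refl) h (proj₂ (coord-spec w b))) i

    comb-coord : Mask N → Vecℚ N → Vecℚ N
    comb-coord σ z j = sumℚ (λ i → z i * coord σ (col i) j)

    ∙-comb-coord : ∀ σ z (a : Vecℚ N) → a ∙ comb-coord σ z ≡ sumℚ (λ i → z i * a ∙ coord σ (col i))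
    ∙-comb-coord σ z a = begin
      sumℚ (λ j → a j * comb-coord σ z j) ≡⟨ Σ-cong (λ j → sym (Σ-*ˡ (a j) (λ i → z i * coord σ (col i) j))) ⟩
      sumℚ (λ j → sumℚ (λ i → a j * (z i * coord σ (col i) j))) ≡⟨ Σ-swap (λ j i → a j * (z i * coord σ (col i) j)) ⟩
      sumℚ (λ i → sumℚ (λ j → a j * (z i * coord σ (col i) j))) ≡⟨ Σ-cong (λ i → trans (Σ-cong (λ j → solve 3 (λ a b c → a :* (b :* c) := b :* (a :* c)) refl (a j) (z i) (coord σ (col i) j))) (Σ-*ˡ (z i) (λ j → a j * coord σ (col i) j))) ⟩
      sumℚ (λ i → z i * a ∙ coord σ (col i)) ∎
      where open ≡-Reasoning

    -- Coordinates are linear in the vector, so expanding each generator in the basis σ turns any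
    -- representation of w into the one supported on σ.
    comb-coord-eq : ∀ {σ z w} → Basis σ → Rep z w → ∀ j → comb-coord σ z j ≡ coord σ w j
    comb-coord-eq {σ} {z} {w} b h = coord-unique {σ} b
      (λ j e → Σ-0 (λ i → trans (cong (z i *_) (proj₁ (coord-spec (col i) b) j e)) (*-zeroʳ (z i))))
      (λ k → trans (∙-comb-coord σ z (A k)) (trans (Σ-cong (λ i → trans (cong (z i *_) (proj₂ (coord-spec (col i) b) k)) (*-comm (z i) (A k i)))) (h k)))

    module _ (span : Spanning) where

      -- While fewer than D columns are chosen, some nonzero f kills them all, and as the columns
      -- span, f is nonzero on another column p. Applying f to a relation shows that its coefficient
      -- at p is 0, so p may be added; n counts the columns still missing.
      extend : ∀ n τ → n ℕ.+ size τ ≡ D → Indep τ → ∃ λ σ → Basis σ × (∀ i → lookup τ i ≡ true → lookup σ i ≡ true)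
      extend zero τ e ind = τ , (ind , e) , λ _ p → p
      extend (suc n) τ e ind = result
        where
        f-spec : ∃ λ f → NonZeroV f × (∀ r → col (idx τ r) ∙ f ≡ 0ℚ)
        f-spec = annihilator (λ r → col (idx τ r)) (subst (size τ ℕ.<_) e (ℕ.s≤s (ℕP.m≤n+m (size τ) n)))
        f : Vecℚ D
        f = proj₁ f-spec
        fτ : ∀ i → lookup τ i ≡ true → f ∙ col i ≡ 0ℚ
        fτ i h with idx-surj τ i h
        ... | r , refl = trans (∙-comm f (col i)) (proj₂ (proj₂ f-spec) r)
        result : ∃ λ σ → Basis σ × (∀ i → lookup τ i ≡ true → lookup σ i ≡ true)
        result with FinP.any? (λ i → ¬? (f ∙ col i ℚ.≟ 0ℚ))
        ... | no h = ⊥-elim (proj₂ (proj₁ (proj₂ f-spec)) (span f (λ i → decidable-stable (f ∙ col i ℚ.≟ 0ℚ) (λ ne → h (i , ne))) _))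
        ... | yes (p , fp) with extend n τ' (trans (cong (n ℕ.+_) (size-add τ p p∉)) (trans (ℕP.+-suc n (size τ)) e)) ind'
          where
          p∉ : lookup τ p ≡ false
          p∉ = ¬true⇒false (λ h → fp (fτ p h))
          τ' : Mask N
          τ' = τ [ p ]≔ true
          ind' : Indep τ'
          ind' y s K = ind y sτ K
            where
            off : ∀ i → i ≢ p → y i * (f ∙ col i) ≡ 0ℚ
            off i ip with lookup τ i in e
            ... | true = trans (cong (y i *_) (fτ i e)) (*-zeroʳ (y i))
            ... | false = trans (cong (_* (f ∙ col i)) (s i (trans (VecP.lookup∘update′ ip τ true) e))) (*-zeroˡ (f ∙ col i))
            yp0 : y p ≡ 0ℚ
            yp0 = *-cancel-0 (f ∙ col p) (y p) fp (trans (*-comm (f ∙ col p) (y p)) (trans (sym (Σ-single p off)) (trans (sym (rep-dual {y} {λ _ → 0ℚ} f K)) (trans (∙-comm f (λ _ → 0ℚ)) (∙-0ˡ f (λ _ → refl))))))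
            sτ : Supp τ y
            sτ i e with i FinP.≟ p
            ... | yes refl = yp0
            ... | no ip = s i (trans (VecP.lookup∘update′ ip τ true) e)
        ... | σ , b , sub = σ , b , λ i h → sub i (upd i h)
          where
          upd : ∀ i → lookup τ i ≡ true → lookup (τ [ p ]≔ true) i ≡ true
          upd i h with i FinP.≟ p
          ... | yes refl = VecP.lookup∘update p τ true
          ... | no ip = trans (VecP.lookup∘update′ ip τ true) h

  -- Positivity of u + ε v for an infinitesimal ε > 0.
  LexPos : ℚ → ℚ → Set
  LexPos u v = (0ℚ < u) ⊎ (u ≡ 0ℚ × 0ℚ < v)

  -- The row of ones puts all generators at height one. Relations then have coefficient sum 0, so a
  -- nonzero relation has a positive entry and the ratio test always finds a candidate.
  record HomogeneousVectors : Set where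
    constructor homogeneous
    field
      {N D} : ℕ
      A : Fin D → Vecℚ N
      span : Cone.Spanning A
      r₀ : Fin D
      ones : ∀ i → A r₀ i ≡ 1ℚ

  module LP (𝓛 : HomogeneousVectors) where
    open HomogeneousVectors 𝓛
    open Cone A

    kernel-Σ : ∀ {κ} → Kernel A κ → sumℚ κ ≡ 0ℚ
    kernel-Σ {κ} K = trans (Σ-cong (λ i → sym (trans (cong (_* κ i) (ones i)) (*-identityˡ (κ i))))) (K r₀)

    positive-entry : ∀ {κ : Vecℚ N} → NonZeroV κ → sumℚ κ ≡ 0ℚ → ∃ λ p → 0ℚ < κ p
    positive-entry {κ} (i , nz) s with FinP.any? (λ p → 0ℚ ℚ.<? κ p)
    ... | yes h = h
    ... | no h = ⊥-elim (<-irrefl (sym (trans (Σ-neg κ) (cong -_ s))) (Σ->0 (λ j → neg-≤ (≮⇒≥ (λ q → h (j , q)))) i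
        (neg-< (≤∧≢⇒< (≮⇒≥ (λ q → h (i , q))) nz))))

    -- The ratio test of the simplex method: t is the least quotient y/κ over the positive entries
    -- of κ, the longest step keeping y - t κ nonnegative, and at p the new vector vanishes.
    ratio-min : ∀ (y κ : Vecℚ N) → (∃ λ p → 0ℚ < κ p) → (∀ i → 0ℚ ≤ y i) →
      ∃ λ p → ∃ λ t → 0ℚ < κ p × t * κ p ≡ y p × 0ℚ ≤ t × (∀ i → 0ℚ ≤ y i - t * κ i)
    ratio-min y κ (p₀ , hp₀) y≥0 = p , r p , κp , rκ p κp , r≥0 p κp , nn
      where
      r : Fin N → ℚ
      r i with 0ℚ ℚ.<? κ i
      ... | yes h = y i * inv (κ i) (λ e → <-irrefl (sym e) h)
      -- Entries with κ ≤ 0 impose no bound; they are outside the list over which the minimum is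
      -- taken, and 0 is a default.
      ... | no _ = 0ℚ
      rκ : ∀ i → 0ℚ < κ i → r i * κ i ≡ y i
      rκ i h with 0ℚ ℚ.<? κ i
      ... | no n = ⊥-elim (n h)
      ... | yes h = trans (*-assoc (y i) (inv (κ i) (λ e → <-irrefl (sym e) h)) (κ i)) (trans (cong (y i *_) (inv-* (κ i) (λ e → <-irrefl (sym e) h))) (*-identityʳ (y i)))
      r≥0 : ∀ i → 0ℚ < κ i → 0ℚ ≤ r i
      r≥0 i h with 0ℚ ℚ.<? κ i
      ... | no n = ⊥-elim (n h)
      ... | yes h = *-0≤ (y≥0 i) (<⇒≤ (inv-pos h (λ e → <-irrefl (sym e) h)))
      P? : ∀ i → Dec (0ℚ < κ i)
      P? i = 0ℚ ℚ.<? κ i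
      m : _
      m = argmin r (filter P? (allFin N)) (∈-filter⁺ P? (∈-allFin p₀) hp₀)
      p : Fin N
      p = proj₁ m
      κp : 0ℚ < κ p
      κp = proj₂ (∈-filter⁻ P? {xs = allFin N} (proj₁ (proj₂ m)))
      nn : ∀ i → 0ℚ ≤ y i - r p * κ i
      nn i with 0ℚ ℚ.<? κ i
      ... | yes h = p≤q⇒0≤q-p (≤-trans (*-monoʳ-≤-nonNeg (κ i) {{ℚ.nonNegative (<⇒≤ h)}} (proj₂ (proj₂ m) (∈-filter⁺ P? (∈-allFin i) h))) (≤-reflexive (rκ i h)))
      ... | no h = subst (0ℚ ≤_) (solve 3 (λ y r k → y :+ r :* (:- k) := y :- r :* k) refl (y i) (r p) (κ i))
            (+-0≤ (y≥0 i) (*-0≤ (r≥0 p κp) (neg-≤ (≮⇒≥ h))))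

    rep-shift : ∀ {y κ w} t → Rep y w → Kernel A κ → Rep (λ i → y i - t * κ i) w
    rep-shift {y} {κ} {w} t h K j = trans (∙-comm (A j) _) (trans (∙--ˡ y (λ i → t * κ i) (A j))
      (trans (cong₂ _-_ (trans (∙-comm y (A j)) (h j)) (trans (∙-*ˡ t κ (A j)) (trans (cong (t *_) (trans (∙-comm κ (A j)) (K j))) (*-zeroʳ t)))) (+-identityʳ (w j))))

    -- No column outside a basis has reduced cost 0, so weak optimality conditions become strict.
    Generic-ω : Vecℚ N → Set
    Generic-ω ω = ∀ σ → Basis σ → ∀ i → lookup σ i ≡ false → ω ∙ coord σ (col i) ≢ ω i

    -- No basic solution for v is degenerate: v avoids all hyperplanes spanned by a basis without
    -- one of its columns.
    GenericV : Vecℚ D → Set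
    GenericV v = ∀ σ → Basis σ → ∀ i → lookup σ i ≡ true → coord σ v i ≢ 0ℚ

    generic-ω : ∃ λ ω → Generic-ω ω
    generic-ω = proj₁ av , λ σ b i e z → proj₂ (proj₂ av) (∈-map⁺ φ (∈-filter⁺ P? (∈-cartesianProduct⁺ (∈-allMasks σ) (∈-allFin i)) (b , e)))
        (trans (∙--ˡ (δ i) (coord σ (col i)) (proj₁ av)) (trans (cong₂ _-_ (∙-δˡ i (proj₁ av)) (trans (∙-comm (coord σ (col i)) (proj₁ av)) z)) (+-inverseʳ (proj₁ av i))))
      where
      φ : Mask N × Fin N → Vecℚ N
      φ (σ , i) j = δ i j - coord σ (col i) j
      P? : (σi : Mask N × Fin N) → Dec (Basis (proj₁ σi) × lookup (proj₁ σi) (proj₂ σi) ≡ false)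
      P? (σ , i) = basis? σ ×-dec (lookup σ i ≟ₘ false)
      φs : List (Vecℚ N)
      φs = map φ (filter P? (cartesianProduct (allMasks N) (allFin N)))
      nz : ∀ {ψ} → ψ ∈ φs → NonZeroV ψ
      nz p with ∈-map⁻ φ p
      ... | (σ , i) , q , refl with ∈-filter⁻ P? {xs = cartesianProduct (allMasks N) (allFin N)} q
      ... | _ , (b , e) = i , λ z → 0≢1ℚ (trans (sym (cong₂ _-_ (δ-diag i) (proj₁ (coord-spec (col i) b) i e))) z)
      av : ∃ λ c → (∀ i → 0ℚ < c i) × (∀ {ψ} → ψ ∈ φs → ψ ∙ c ≢ 0ℚ)
      av = avoid φs nz

    generic-c : ∃ λ (c : Vecℚ N) → (∀ i → 0ℚ < c i) × GenericV (λ j → A j ∙ c)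
    generic-c = proj₁ av , proj₁ (proj₂ av) , λ σ b j e z → proj₂ (proj₂ av) (∈-map⁺ φ (∈-filter⁺ P? (∈-cartesianProduct⁺ (∈-allMasks σ) (∈-allFin j)) (b , e)))
        (trans (∙-comm (φ (σ , j)) (proj₁ av)) (trans (comb-coord-eq {z = proj₁ av} b (λ _ → refl) j) z))
      where
      φ : Mask N × Fin N → Vecℚ N
      φ (σ , j) i = coord σ (col i) j
      P? : (σi : Mask N × Fin N) → Dec (Basis (proj₁ σi) × lookup (proj₁ σi) (proj₂ σi) ≡ true)
      P? (σ , i) = basis? σ ×-dec (lookup σ i ≟ₘ true)
      φs : List (Vecℚ N)
      φs = map φ (filter P? (cartesianProduct (allMasks N) (allFin N)))
      nz : ∀ {ψ} → ψ ∈ φs → NonZeroV ψ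
      nz p with ∈-map⁻ φ p
      ... | (σ , i) , q , refl with ∈-filter⁻ P? {xs = cartesianProduct (allMasks N) (allFin N)} q
      ... | _ , (b , e) = i , λ z → 0≢1ℚ (trans (sym (trans (coord-col b i e i) (δ-diag i))) z)
      av : ∃ λ c → (∀ i → 0ℚ < c i) × (∀ {ψ} → ψ ∈ φs → ψ ∙ c ≢ 0ℚ)
      av = avoid φs nz

    module Opt (ω : Vecℚ N) where

      ω-shift : ∀ y κ t → ω ∙ (λ i → y i - t * κ i) ≡ ω ∙ y - t * ω ∙ κ
      ω-shift y κ t = trans (∙-comm ω _) (trans (∙--ˡ y (λ i → t * κ i) ω) (cong₂ _-_ (∙-comm y ω) (trans (∙-*ˡ t κ ω) (cong (t *_) (∙-comm κ ω)))))

      -- A relation inside the support is subtracted until an entry vanishes, with its sign chosen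
      -- so that the cost ω does not grow. The support shrinks each time, which n counts.
      caratheodory : ∀ n τ y {w} → size τ ℕ.≤ n → Supp τ y → (∀ i → 0ℚ ≤ y i) → Rep y w →
        ∃ λ τ' → ∃ λ y' → Indep τ' × Supp τ' y' × (∀ i → 0ℚ ≤ y' i) × Rep y' w × ω ∙ y' ≤ ω ∙ y
      caratheodory n τ y le s y≥0 h with ker A τ
      ... | inj₂ (ind , _) = τ , y , ind , s , y≥0 , h , ≤-refl
      ... | inj₁ (κ₀ , s₀ , nz₀ , K₀) = go (oriented (≤-total 0ℚ (ω ∙ κ₀)))
        where
        oriented : _ → ∃ λ κ → Supp τ κ × NonZeroV κ × Kernel A κ × 0ℚ ≤ ω ∙ κ
        oriented (inj₁ q) = κ₀ , s₀ , nz₀ , K₀ , q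
        oriented (inj₂ q) = (λ i → - κ₀ i) , (λ i e → cong -_ (s₀ i e)) , (proj₁ nz₀ , λ e → proj₂ nz₀ (neg-injective e)) ,
          (λ j → trans (∙-comm (A j) _) (trans (∙-negˡ κ₀ (A j)) (cong -_ (trans (∙-comm κ₀ (A j)) (K₀ j))))) ,
          subst (0ℚ ≤_) (sym (trans (∙-comm ω _) (trans (∙-negˡ κ₀ ω) (cong -_ (∙-comm κ₀ ω))))) (neg-≤ q)
        go : _ → _
        go (κ , sκ , nz , K , ωκ) with ratio-min y κ (positive-entry {κ} nz (kernel-Σ K)) y≥0
        ... | p , t , κp , tκ , t≥0 , nn = step n le
          where
          y' : Vecℚ N
          y' i = y i - t * κ i
          p∈ : lookup τ p ≡ true
          p∈ with lookup τ p in e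
          ... | true = refl
          ... | false = ⊥-elim (<-irrefl (sym (sκ p e)) κp)
          s' : Supp (τ [ p ]≔ false) y'
          s' i e with remove-false τ p i e
          ... | inj₁ refl = trans (cong (λ z → y p - z) tκ) (+-inverseʳ (y p))
          ... | inj₂ e' = trans (cong₂ (λ a b → a - t * b) (s i e') (sκ i e')) (trans (cong (λ z → 0ℚ - z) (*-zeroʳ t)) (+-inverseʳ 0ℚ))
          ω≤ : ω ∙ y' ≤ ω ∙ y
          ω≤ = 0≤q-p⇒p≤q (subst (0ℚ ≤_) (trans (solve 2 (λ a b → b := a :- (a :- b)) refl (ω ∙ y) (t * ω ∙ κ)) (cong (λ z → ω ∙ y - z) (sym (ω-shift y κ t)))) (*-0≤ t≥0 ωκ))
          step : ∀ n → size τ ℕ.≤ n → _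
          step zero l = ⊥-elim (ℕP.1+n≢0 (trans (sym (size-remove τ p p∈)) (ℕP.n≤0⇒n≡0 l)))
          step (suc n) l with caratheodory n (τ [ p ]≔ false) y' (ℕP.≤-pred (subst (ℕ._≤ suc n) (size-remove τ p p∈) l)) s' nn (rep-shift t h K)
          ... | τ' , y'' , a , b , c , d , e = τ' , y'' , a , b , c , d , ≤-trans e ω≤

      feasible-basis : ∀ y {w} → (∀ i → 0ℚ ≤ y i) → Rep y w →
        ∃ λ σ → Basis σ × (∀ i → 0ℚ ≤ coord σ w i) × ω ∙ coord σ w ≤ ω ∙ y
      feasible-basis y {w} y≥0 h with caratheodory (size (replicate N true)) (replicate N true) y ℕP.≤-refl (λ i e → ⊥-elim (true≢false (VecP.lookup-replicate i true) e)) y≥0 h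
      ... | τ , y' , ind , s , y'≥0 , h' , le with extend span (D ℕ.∸ size τ) τ (ℕP.m∸n+n≡m size≤D) ind
        where
        size≤D : size τ ℕ.≤ D
        size≤D with ker A τ
        ... | inj₂ (_ , q) = q
        ... | inj₁ (z , sz , (i , nz) , K) = ⊥-elim (nz (ind z sz K i))
      ... | σ , b , sub = σ , b , (λ i → subst (0ℚ ≤_) (eq i) (y'≥0 i)) , ≤-trans (≤-reflexive (∙-congʳ ω (λ i → sym (eq i)))) le
        where
        eq : ∀ i → y' i ≡ coord σ w i
        eq = coord-unique {σ} b (λ i e → s i (¬true⇒false (λ h → true≢false (sub i h) e))) h'

      -- Dual feasibility: all reduced costs outside σ are positive. The condition does not mention
      -- a right-hand side, so the same masks serve all vectors of the cone; they are the cells of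
      -- the regular triangulation with heights ω.
      InT : Mask N → Set
      InT σ = Basis σ × (∀ i → lookup σ i ≡ false → ω ∙ coord σ (col i) < ω i)

      abstract
       inT? : ∀ σ → Dec (InT σ)
       inT? σ = basis? σ ×-dec FinP.all? (λ i → (lookup σ i ≟ₘ false) →-dec (ω ∙ coord σ (col i) ℚ.<? ω i))

      -- A pivot that lets column i enter. The relation κ has positive cost because ω is generic,
      -- and the step t is positive because the basic solution for w has no zero entry, so the cost
      -- drops strictly.
      improve : Generic-ω ω → ∀ w → GenericV w → ∀ σ → Basis σ → (∀ i → 0ℚ ≤ coord σ w i) → ∀ i → lookup σ i ≡ false → ¬ (ω ∙ coord σ (col i) < ω i) →
        ∃ λ σ' → Basis σ' × (∀ i → 0ℚ ≤ coord σ' w i) × ω ∙ coord σ' w < ω ∙ coord σ w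
      improve gω w gw σ b feas i i∉ q = go (ratio-min y κ (positive-entry {κ} nz (kernel-Σ K)) feas)
        where
        y lam κ : Vecℚ N
        y = coord σ w
        lam = coord σ (col i)
        κ j = lam j - δ i j
        K : Kernel A κ
        K j = trans (∙-comm (A j) κ) (trans (∙--ˡ lam (δ i) (A j)) (trans (cong₂ _-_ (trans (∙-comm lam (A j)) (proj₂ (coord-spec (col i) b) j)) (∙-δˡ i (A j))) (+-inverseʳ (A j i))))
        κi : κ i ≡ - 1ℚ
        κi = cong₂ _-_ (proj₁ (coord-spec (col i) b) i i∉) (δ-diag i)
        nz : NonZeroV κ
        nz = i , λ e → 0≢1ℚ (neg-injective (trans (sym κi) e))
        ωκ : 0ℚ < ω ∙ κ
        ωκ = subst (0ℚ <_) (sym (trans (∙-comm ω κ) (trans (∙--ˡ lam (δ i) ω) (cong₂ _-_ (∙-comm lam ω) (∙-δˡ i ω))))) (p<q⇒0<q-p (≤∧≢⇒< (≮⇒≥ q) (λ e → gω σ b i i∉ (sym e))))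
        go : (∃ λ p → ∃ λ t → 0ℚ < κ p × t * κ p ≡ y p × 0ℚ ≤ t × (∀ i → 0ℚ ≤ y i - t * κ i)) →
          ∃ λ σ' → Basis σ' × (∀ i → 0ℚ ≤ coord σ' w i) × ω ∙ coord σ' w < ω ∙ coord σ w
        go (p , t , κp , tκ , t≥0 , nn) = proj₁ fb , proj₁ (proj₂ fb) , proj₁ (proj₂ (proj₂ fb)) , ≤-<-trans (proj₂ (proj₂ (proj₂ fb))) strict
          where
          y' : Vecℚ N
          y' j = y j - t * κ j
          fb = feasible-basis y' nn (rep-shift {y} {κ} t (proj₂ (coord-spec w b)) K)
          p≢i : p ≢ i
          p≢i refl = <-asym κp (subst (_< 0ℚ) (sym κi) (neg-antimono-< 0<1ℚ))
          p∈ : lookup σ p ≡ true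
          p∈ with lookup σ p in e
          ... | true = refl
          ... | false = ⊥-elim (<-irrefl (sym (trans (cong₂ _-_ (proj₁ (coord-spec (col i) b) p e) (δ-off i p p≢i)) (+-inverseʳ 0ℚ))) κp)
          t>0 : 0ℚ < t
          t>0 = ≤∧≢⇒< t≥0 λ z → gw σ b p p∈ (trans (sym tκ) (trans (cong (_* κ p) (sym z)) (*-zeroˡ (κ p))))
          strict : ω ∙ y' < ω ∙ y
          strict = 0<q-p⇒p<q (subst (0ℚ <_) (trans (solve 2 (λ a b → b := a :- (a :- b)) refl (ω ∙ y) (t * ω ∙ κ)) (cong (λ z → ω ∙ y - z) (sym (ω-shift y κ t)))) (*-0< t>0 ωκ))

      cover : Generic-ω ω → ∀ w → GenericV w → InCone w → ∃ λ σ → InT σ × (∀ i → lookup σ i ≡ true → 0ℚ < coord σ w i)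
      -- The cheapest of the finitely many feasible bases is taken; its minimality replaces the
      -- termination of a pivoting rule.
      cover gω w gw (y₀ , y₀≥0 , h₀) = finish (argmin V (filter feas? (allMasks N)) (mem (proj₁ (proj₂ fb) , proj₁ (proj₂ (proj₂ fb)))))
        where
        Feas : Mask N → Set
        Feas σ = Basis σ × (∀ i → 0ℚ ≤ coord σ w i)
        feas? : ∀ σ → Dec (Feas σ)
        feas? σ = basis? σ ×-dec FinP.all? (λ i → 0ℚ ℚ.≤? coord σ w i)
        V : Mask N → ℚ
        V σ = ω ∙ coord σ w
        fb = feasible-basis y₀ y₀≥0 h₀
        mem : ∀ {σ} → Feas σ → σ ∈ filter feas? (allMasks N)
        mem {σ} f = ∈-filter⁺ feas? (∈-allMasks σ) f
        finish : (∃ λ m → m ∈ filter feas? (allMasks N) × (∀ {z} → z ∈ filter feas? (allMasks N) → V m ≤ V z)) →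
          ∃ λ σ → InT σ × (∀ i → lookup σ i ≡ true → 0ℚ < coord σ w i)
        finish (σ , σ∈ , least) = σ , (b , dual) , λ i e → ≤∧≢⇒< (feas i) (λ z → gw σ b i e (sym z))
          where
          σF : Feas σ
          σF = proj₂ (∈-filter⁻ feas? {xs = allMasks N} σ∈)
          b = proj₁ σF
          feas = proj₂ σF
          dual : ∀ i → lookup σ i ≡ false → ω ∙ coord σ (col i) < ω i
          dual i i∉ = decidable-stable (ω ∙ coord σ (col i) ℚ.<? ω i) λ q → absurd (improve gω w gw σ b feas i i∉ q)
            where
            absurd : ¬ (∃ λ σ' → Basis σ' × (∀ i → 0ℚ ≤ coord σ' w i) × V σ' < V σ)
            absurd (σ' , b' , f' , lt) = <⇒≱ lt (least (mem (b' , f')))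

      reduced : Mask N → Vecℚ N
      reduced σ i = ω i - ω ∙ coord σ (col i)

      reduced-in : ∀ {σ} → Basis σ → ∀ i → lookup σ i ≡ true → reduced σ i ≡ 0ℚ
      reduced-in {σ} b i e = trans (cong (λ z → ω i - z) (trans (∙-congʳ ω (coord-col b i e)) (trans (∙-comm ω (δ i)) (∙-δˡ i ω)))) (+-inverseʳ (ω i))

      reduced-≥0 : ∀ {σ} → InT σ → ∀ i → 0ℚ ≤ reduced σ i
      reduced-≥0 {σ} (b , h) i with lookup σ i in e
      ... | true = ≤-reflexive (sym (reduced-in b i e))
      ... | false = <⇒≤ (p<q⇒0<q-p (h i e))

      -- Weak duality as an identity: the excess of the cost of z over that of the basic solution is
      -- the reduced cost weighted by z.
      gap : ∀ {σ z w} → Basis σ → Rep z w → ω ∙ z - ω ∙ coord σ w ≡ z ∙ reduced σ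
      gap {σ} {z} {w} b h = sym (trans (∙-comm z (reduced σ)) (trans (∙--ˡ ω (λ i → ω ∙ coord σ (col i)) z) (cong (λ t → ω ∙ z - t) e)))
        where
        e : (λ i → ω ∙ coord σ (col i)) ∙ z ≡ ω ∙ coord σ w
        e = trans (∙-comm (λ i → ω ∙ coord σ (col i)) z) (trans (sym (∙-comb-coord σ z ω)) (∙-congʳ ω (comb-coord-eq b h)))

      -- Complementary slackness. The two gaps add up to 0 and have nonnegative terms, but an index
      -- in only one of the masks would contribute a positive coordinate times a positive reduced
      -- cost.
      cover-unique : ∀ {σ τ} w → InT σ → InT τ → (∀ i → lookup σ i ≡ true → 0ℚ < coord σ w i) → (∀ i → lookup τ i ≡ true → 0ℚ < coord τ w i) → σ ≡ τ
      cover-unique {σ} {τ} w hσ hτ pσ pτ = mask-ext λ i → same i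
        where
        nn : ∀ {ρ} → Basis ρ → (∀ i → lookup ρ i ≡ true → 0ℚ < coord ρ w i) → ∀ i → 0ℚ ≤ coord ρ w i
        nn {ρ} b p i with lookup ρ i in e
        ... | true = <⇒≤ (p i e)
        ... | false = ≤-reflexive (sym (proj₁ (coord-spec w b) i e))
        bσ = proj₁ hσ
        bτ = proj₁ hτ
        g₁ : coord τ w ∙ reduced σ ≡ ω ∙ coord τ w - ω ∙ coord σ w
        g₁ = sym (gap bσ (proj₂ (coord-spec w bτ)))
        g₂ : coord σ w ∙ reduced τ ≡ ω ∙ coord σ w - ω ∙ coord τ w
        g₂ = sym (gap bτ (proj₂ (coord-spec w bσ)))
        t₁ : ∀ i → 0ℚ ≤ coord τ w i * reduced σ i
        t₁ i = *-0≤ (nn bτ pτ i) (reduced-≥0 hσ i)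
        t₂ : ∀ i → 0ℚ ≤ coord σ w i * reduced τ i
        t₂ i = *-0≤ (nn bσ pσ i) (reduced-≥0 hτ i)
        zero-sum : coord τ w ∙ reduced σ + coord σ w ∙ reduced τ ≡ 0ℚ
        zero-sum = trans (cong₂ _+_ g₁ g₂) (solve 2 (λ a b → (a :- b) :+ (b :- a) := con 0ℚ) refl (ω ∙ coord τ w) (ω ∙ coord σ w))
        same : ∀ i → lookup σ i ≡ lookup τ i
        same i with lookup σ i in e | lookup τ i in e'
        ... | true | true = refl
        ... | false | false = refl
        ... | false | true = ⊥-elim (<-irrefl (sym zero-sum) (+-0<ˡ (Σ->0 t₁ i (*-0< (pτ i e') (p<q⇒0<q-p (proj₂ hσ i e)))) (Σ-≥0 t₂)))
        ... | true | false = ⊥-elim (<-irrefl (sym zero-sum) (+-0<ʳ (Σ-≥0 t₁) (Σ->0 t₂ i (*-0< (pσ i e) (p<q⇒0<q-p (proj₂ hτ i e'))))))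

      module Sel (v : Vecℚ D) (gv : GenericV v) where

        perturb : Vecℚ D → ℚ → Vecℚ D
        perturb x t j = x j + t * v j

        AllStable : Vecℚ D → ℚ → Set
        AllStable x ε = ∀ σ i → Stable ε (coord σ x i , coord σ v i)

        all-stable : ∀ x → ∃ λ ε → 0ℚ < ε × AllStable x ε
        all-stable x = proj₁ s , proj₁ (proj₂ s) , λ σ i → proj₂ (proj₂ s) (∈-map⁺ f (∈-cartesianProduct⁺ (∈-allMasks σ) (∈-allFin i)))
          where
          f : Mask N × Fin N → ℚ × ℚ
          f (σ , i) = coord σ x i , coord σ v i
          s : _
          s = stable (map f (cartesianProduct (allMasks N) (allFin N)))

        coord-0 : ∀ x t {σ} → Basis σ → ∀ i → coord σ x i ≡ 0ℚ → coord σ (perturb x t) i ≡ t * coord σ v i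
        coord-0 x t {σ} b i e = trans (coord-+* b x t v i) (trans (cong (_+ t * coord σ v i) e) (+-identityˡ (t * coord σ v i)))

        lex⇒pos : ∀ x t → 0ℚ < t → AllStable x t → ∀ {σ} → Basis σ → ∀ i → LexPos (coord σ x i) (coord σ v i) → 0ℚ < coord σ (perturb x t) i
        lex⇒pos x t ht st {σ} b i (inj₁ p) = subst (0ℚ <_) (sym (coord-+* b x t v i)) (proj₁ (st σ i t ht ≤-refl) p)
        lex⇒pos x t ht st {σ} b i (inj₂ (e , p)) = subst (0ℚ <_) (sym (coord-0 x t b i e)) (*-0< ht p)

        pos⇒lex : ∀ x t → 0ℚ < t → AllStable x t → ∀ {σ} → Basis σ → ∀ i → 0ℚ < coord σ (perturb x t) i → LexPos (coord σ x i) (coord σ v i)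
        pos⇒lex x t ht st {σ} b i h = go (trichotomy (coord σ x i))
          where
          go : (coord σ x i < 0ℚ) ⊎ (coord σ x i ≡ 0ℚ) ⊎ (0ℚ < coord σ x i) → LexPos (coord σ x i) (coord σ v i)
          go (inj₁ lt) = ⊥-elim (<-asym (subst (0ℚ <_) (coord-+* b x t v i) h) (proj₂ (st σ i t ht ≤-refl) lt))
          go (inj₂ (inj₂ gt)) = inj₁ gt
          go (inj₂ (inj₁ e)) = inj₂ (e , ≰⇒> λ v≤0 → <⇒≱ (subst (0ℚ <_) (coord-0 x t b i e) h)
              (subst (t * coord σ v i ≤_) (*-zeroʳ t) (*-monoˡ-≤-nonNeg t {{ℚ.nonNegative (<⇒≤ ht)}} v≤0)))

        perturb-generic : ∀ x t → 0ℚ < t → AllStable x t → GenericV (perturb x t)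
        perturb-generic x t ht st σ b i e z = go (trichotomy (coord σ x i))
          where
          z' : coord σ x i + t * coord σ v i ≡ 0ℚ
          z' = trans (sym (coord-+* b x t v i)) z
          go : (coord σ x i < 0ℚ) ⊎ (coord σ x i ≡ 0ℚ) ⊎ (0ℚ < coord σ x i) → ⊥
          go (inj₁ lt) = <-irrefl z' (proj₂ (st σ i t ht ≤-refl) lt)
          go (inj₂ (inj₂ gt)) = <-irrefl (sym z') (proj₁ (st σ i t ht ≤-refl) gt)
          go (inj₂ (inj₁ x0)) = gv σ b i e (*-cancel-0 t (coord σ v i) (λ e → <-irrefl (sym e) ht) (trans (sym (coord-0 x t b i x0)) z))

        Inward : Vecℚ D → Set
        Inward x = ∃ λ ε → 0ℚ < ε × ∀ t → 0ℚ < t → t ≤ ε → InCone (perturb x t)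

        LexIn : Mask N → Vecℚ D → Set
        LexIn σ x = ∀ i → lookup σ i ≡ true → LexPos (coord σ x i) (coord σ v i)

        -- For small t the vector x + t v is generic and in the cone, so `cover` applies;
        -- `AllStable` makes the signs independent of t, and the lexicographic condition records
        -- them.
        sel : Generic-ω ω → ∀ x → Inward x → ∃ λ σ → InT σ × LexIn σ x
        sel gω x (ε₁ , h₁ , c) = go (all-stable x)
          where
          go : (∃ λ ε → 0ℚ < ε × AllStable x ε) → ∃ λ σ → InT σ × LexIn σ x
          go (ε₂ , h₂ , st₂) = fin (both-≤ ε₁ ε₂ h₁ h₂)
            where
            fin : (∃ λ t → 0ℚ < t × t ≤ ε₁ × t ≤ ε₂) → ∃ λ σ → InT σ × LexIn σ x
            fin (t , ht , l₁ , l₂) = res (cover gω (perturb x t) (perturb-generic x t ht st) (c t ht l₁))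
              where
              st : AllStable x t
              st σ i t' ht' le = st₂ σ i t' ht' (≤-trans le l₂)
              res : (∃ λ σ → InT σ × (∀ i → lookup σ i ≡ true → 0ℚ < coord σ (perturb x t) i)) → ∃ λ σ → InT σ × LexIn σ x
              res (σ , hT , pos) = σ , hT , λ i e → pos⇒lex x t ht st (proj₁ hT) i (pos i e)

        sel-unique : ∀ x {σ τ} → InT σ → InT τ → LexIn σ x → LexIn τ x → σ ≡ τ
        sel-unique x {σ} {τ} hσ hτ pσ pτ = go (all-stable x)
          where
          go : (∃ λ ε → 0ℚ < ε × AllStable x ε) → σ ≡ τ
          go (ε , h , st) = cover-unique (perturb x ε) hσ hτ (λ i e → lex⇒pos x ε h st (proj₁ hσ) i (pσ i e)) (λ i e → lex⇒pos x ε h st (proj₁ hτ) i (pτ i e))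

  -- Half-open decompositions of cones

  -- The two half-open unit intervals, [0, 1) for `true` and (0, 1] for `false`.
  HO : Bool → ℚ → Set
  HO true r = 0ℚ ≤ r × r < 1ℚ
  HO false r = 0ℚ < r × r ≤ 1ℚ

  ho? : ∀ b r → Dec (HO b r)
  ho? true r = (0ℚ ℚ.≤? r) ×-dec (r ℚ.<? 1ℚ)
  ho? false r = (0ℚ ℚ.<? r) ×-dec (r ℚ.≤? 1ℚ)

  ho-≥0 : ∀ b {r} → HO b r → 0ℚ ≤ r
  ho-≥0 true h = proj₁ h
  ho-≥0 false h = <⇒≤ (proj₁ h)

  ho-≤1 : ∀ b {r} → HO b r → r ≤ 1ℚ
  ho-≤1 true h = <⇒≤ (proj₂ h)
  ho-≤1 false h = proj₂ h

  ho-floor : ∀ b r → ∃ λ z → HO b (r - toℚ z)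
  ho-floor true r = floor-spec r
  ho-floor false r = go (floor-spec (- r))
    where
    go : (Σ ℤ λ z → (0ℚ ≤ - r - toℚ z) × (- r - toℚ z < 1ℚ)) → ∃ λ z → HO false (r - toℚ z)
    -- With z the floor of -r, the number -(z + 1) is the ceiling of r minus 1, so the difference
    -- lies in (0, 1].
    go (z , lo , up) = ℤ.- (z ℤ.+ ℤ.+ 1) , subst (0ℚ <_) e (p<q⇒0<q-p up) , 0≤q-p⇒p≤q (subst (0ℚ ≤_) e' lo)
      where
      t : toℚ (ℤ.- (z ℤ.+ ℤ.+ 1)) ≡ - (toℚ z + 1ℚ)
      t = trans (toℚ-neg (z ℤ.+ ℤ.+ 1)) (cong -_ (toℚ-+ z (ℤ.+ 1)))
      e : 1ℚ - (- r - toℚ z) ≡ r - toℚ (ℤ.- (z ℤ.+ ℤ.+ 1))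
      e = trans (solve 2 (λ r z → con 1ℚ :- (:- r :- z) := r :- (:- (z :+ con 1ℚ))) refl r (toℚ z)) (cong (λ u → r - u) (sym t))
      e' : - r - toℚ z ≡ 1ℚ - (r - toℚ (ℤ.- (z ℤ.+ ℤ.+ 1)))
      e' = trans (solve 2 (λ r z → :- r :- z := con 1ℚ :- (r :- (:- (z :+ con 1ℚ)))) refl r (toℚ z)) (cong (λ u → 1ℚ - (r - u)) (sym t))

  ho-diff<1 : ∀ b {r r'} → HO b r → HO b r' → r - r' < 1ℚ
  ho-diff<1 true {r} {r'} (_ , h) (h' , _) = ≤-<-trans (subst (r - r' ≤_) (+-identityʳ r) (+-monoʳ-≤ r (neg-antimono-≤ h'))) h
  ho-diff<1 false {r} {r'} (_ , h) (h' , _) = <-≤-trans (subst (r - r' <_) (+-identityʳ r) (+-monoʳ-< r (neg-antimono-< h'))) h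

  ho-unique : ∀ b {r r'} z z' → HO b r → HO b r' → r + toℚ z ≡ r' + toℚ z' → z ≡ z'
  ho-unique b {r} {r'} z z' h h' e = ℤP.≤-antisym (le z' z r' r h' h (sym e)) (le z z' r r' h h' e)
    where
    le : ∀ z z' r r' → HO b r → HO b r' → r + toℚ z ≡ r' + toℚ z' → z' ℤ.≤ z
    le z z' r r' h h' e = ℤP.≮⇒≥ λ lt → <⇒≱ below (toℚ-mono-≤ (ℤP.i<j⇒suc[i]≤j lt))
      where
      eq : 1ℚ - (r - r') ≡ toℚ (ℤ.suc z) - toℚ z'
      eq = begin
        1ℚ - (r - r') ≡⟨ solve 3 (λ r r' z → con 1ℚ :- (r :- r') := con 1ℚ :+ z :+ r' :- (r :+ z)) refl r r' (toℚ z) ⟩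
        1ℚ + toℚ z + r' - (r + toℚ z) ≡⟨ cong (λ t → 1ℚ + toℚ z + r' - t) e ⟩
        1ℚ + toℚ z + r' - (r' + toℚ z') ≡⟨ solve 3 (λ r' z z' → con 1ℚ :+ z :+ r' :- (r' :+ z') := con 1ℚ :+ z :- z') refl r' (toℚ z) (toℚ z') ⟩
        1ℚ + toℚ z - toℚ z' ≡⟨ cong (_- toℚ z') (sym (toℚ-+ (ℤ.+ 1) z)) ⟩
        toℚ (ℤ.suc z) - toℚ z' ∎
        where open ≡-Reasoning
      below : toℚ z' < toℚ (ℤ.suc z)
      below = 0<q-p⇒p<q (subst (0ℚ <_) eq (p<q⇒0<q-p (ho-diff<1 b h h')))

  -- A negative z would make u - z at least 1. The interval (0, 1] contains 1, so there the
  -- positivity of u is what excludes z = -1.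
  ho-nonneg : ∀ b u z → HO b (u - toℚ z) → 0ℚ ≤ u → (b ≡ false → 0ℚ < u) → ℤ.+ 0 ℤ.≤ z
  ho-nonneg b u z h u≥0 hf = ℤP.≮⇒≥ λ z<0 → contra b h hf (toℚ-mono-≤ (ℤP.i<j⇒i≤pred[j] z<0))
    where
    contra : ∀ b → HO b (u - toℚ z) → (b ≡ false → 0ℚ < u) → toℚ z ≤ - 1ℚ → ⊥
    contra true (_ , h) _ le = <⇒≱ h (subst (_≤ u - toℚ z) (+-identityˡ 1ℚ) (+-mono-≤ u≥0 (neg-antimono-≤ le)))
    contra false (_ , h) hf le = <⇒≱ (subst (_< u - toℚ z) (+-identityˡ 1ℚ) (+-mono-<-≤ (hf refl) (neg-antimono-≤ le))) h

  -- The mirror image used for interior points: z is u plus a number of the interval, and at least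
  -- one of the two is positive.
  ho-pos : ∀ b u z → HO b (toℚ z - u) → 0ℚ ≤ u → (b ≡ true → 0ℚ < u) → ℤ.+ 1 ℤ.≤ z
  ho-pos b u z h u≥0 ht = ℤP.i<j⇒suc[i]≤j {ℤ.+ 0} (toℚ-cancel-< {ℤ.+ 0} (subst (0ℚ <_) (solve 2 (λ z u → (z :- u) :+ u := z) refl (toℚ z) u) (tot b h ht)))
    where
    tot : ∀ b → HO b (toℚ z - u) → (b ≡ true → 0ℚ < u) → 0ℚ < (toℚ z - u) + u
    tot true (h , _) ht = +-0<ʳ h (ht refl)
    tot false (h , _) _ = +-0<ˡ h u≥0

  -- Lattice vectors and homogenisation

  ι : ∀ {D} → Vec ℤ D → Vecℚ D
  ι w j = toℚ (lookup w j)

  infixl 6 _⊕_ _⊖_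
  _⊕_ _⊖_ : ∀ {D} → Vec ℤ D → Vec ℤ D → Vec ℤ D
  _⊕_ = zipWith ℤ._+_
  _⊖_ = zipWith ℤ._-_

  ι-⊕ : ∀ {D} (v w : Vec ℤ D) j → ι (v ⊕ w) j ≡ ι v j + ι w j
  ι-⊕ v w j = trans (cong toℚ (VecP.lookup-zipWith ℤ._+_ j v w)) (toℚ-+ (lookup v j) (lookup w j))

  ι-⊖ : ∀ {D} (v w : Vec ℤ D) j → ι (v ⊖ w) j ≡ ι v j - ι w j
  ι-⊖ v w j = trans (cong toℚ (VecP.lookup-zipWith ℤ._-_ j v w)) (toℚ-- (lookup v j) (lookup w j))

  vec-ext : ∀ {A : Set} {n} {v w : Vec A n} → (∀ i → lookup v i ≡ lookup w i) → v ≡ w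
  vec-ext {v = []} {[]} h = refl
  vec-ext {v = a ∷ v} {b ∷ w} h = cong₂ _∷_ (h zero) (vec-ext (λ i → h (suc i)))

  ι-injective : ∀ {D} {v w : Vec ℤ D} → (∀ j → ι v j ≡ ι w j) → v ≡ w
  ι-injective h = vec-ext (λ j → toℚ-injective (h j))

  sumZ : ∀ {n} → (Fin n → ℤ) → ℤ
  sumZ {zero} f = ℤ.+ 0
  sumZ {suc n} f = f zero ℤ.+ sumZ (λ i → f (suc i))

  toℚ-sumZ : ∀ {n} (f : Fin n → ℤ) → toℚ (sumZ f) ≡ sumℚ (λ i → toℚ (f i))
  toℚ-sumZ {zero} f = refl
  toℚ-sumZ {suc n} f = trans (toℚ-+ (f zero) _) (cong (toℚ (f zero) +_) (toℚ-sumZ (λ i → f (suc i))))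

  nat : ∀ {n} → Vec ℕ n → Vec ℤ n
  nat = Vec.map (λ m → ℤ.+ m)

  lookup-nat : ∀ {n} (y : Vec ℕ n) i → lookup (nat y) i ≡ ℤ.+ lookup y i
  lookup-nat y i = VecP.lookup-map i (λ m → ℤ.+ m) y

  toℚ-sum : ∀ {n} (y : Vec ℕ n) → sumℚ (ι (nat y)) ≡ toℚ (ℤ.+ Vec.sum y)
  toℚ-sum [] = refl
  toℚ-sum (m ∷ y) = trans (cong (toℚ (ℤ.+ m) +_) (toℚ-sum y)) (trans (sym (toℚ-+ (ℤ.+ m) (ℤ.+ Vec.sum y))) (cong toℚ (sym (ℤP.pos-+ m (Vec.sum y)))))

  compsShift : ∀ {N} → Mask N → ℕ → ℕ → List (Vec ℕ N)
  compsShift σ zero n = comps σ n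
  compsShift σ (suc e) zero = []
  compsShift σ (suc e) (suc n) = compsShift σ e n

  length-compsShift : ∀ {N} (σ : Mask N) e n → length (compsShift σ e n) ≡ shift (cnt (size σ)) e n
  length-compsShift σ zero n = length-comps σ n
  length-compsShift σ (suc e) zero = refl
  length-compsShift σ (suc e) (suc n) = length-compsShift σ e n

  unique-compsShift : ∀ {N} (σ : Mask N) e n → Unique (compsShift σ e n)
  unique-compsShift σ zero n = unique-comps σ n
  unique-compsShift σ (suc e) zero = []
  unique-compsShift σ (suc e) (suc n) = unique-compsShift σ e n

  ∈-compsShift⁺ : ∀ {N} (σ : Mask N) e {n} y → SuppN σ y → e ℕ.+ Vec.sum y ≡ n → y ∈ compsShift σ e n
  ∈-compsShift⁺ σ zero y s refl = ∈-comps⁺ σ y s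
  ∈-compsShift⁺ σ (suc e) y s refl = ∈-compsShift⁺ σ e y s refl

  ∈-compsShift⁻ : ∀ {N} (σ : Mask N) e n {y} → y ∈ compsShift σ e n → SuppN σ y × e ℕ.+ Vec.sum y ≡ n
  ∈-compsShift⁻ σ zero n p = ∈-comps⁻ σ n p
  ∈-compsShift⁻ σ (suc e) (suc n) p with ∈-compsShift⁻ σ e n p
  ... | s , e' = s , cong suc e'

  maskZ : ∀ {N} → Mask N → Vec ℤ N
  maskZ = Vec.map (λ b → if b then ℤ.+ 1 else ℤ.+ 0)

  maskZ-true : ∀ {N} (σ : Mask N) i → lookup σ i ≡ true → lookup (maskZ σ) i ≡ ℤ.+ 1
  maskZ-true σ i e = trans (VecP.lookup-map i _ σ) (cong (λ b → if b then ℤ.+ 1 else ℤ.+ 0) e)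

  maskZ-false : ∀ {N} (σ : Mask N) i → lookup σ i ≡ false → lookup (maskZ σ) i ≡ ℤ.+ 0
  maskZ-false σ i e = trans (VecP.lookup-map i _ σ) (cong (λ b → if b then ℤ.+ 1 else ℤ.+ 0) e)

  sum-maskZ : ∀ {N} (σ : Mask N) → sumℚ (ι (maskZ σ)) ≡ toℚ (ℤ.+ size σ)
  sum-maskZ [] = refl
  sum-maskZ (true ∷ σ) = trans (cong (1ℚ +_) (sum-maskZ σ)) (sym (toℚ-+ (ℤ.+ 1) (ℤ.+ size σ)))
  sum-maskZ (false ∷ σ) = trans (cong (0ℚ +_) (sum-maskZ σ)) (+-identityˡ _)

  does-true : ∀ {P : Set} (d : Dec P) → does d ≡ true → P
  does-true (yes p) _ = p

  does-false : ∀ {P : Set} (d : Dec P) → does d ≡ false → ¬ P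
  does-false (no p) _ = p

  -- Points are lifted to height one, coordinate `zero` being the height; the n-th dilate is the
  -- slice of the cone at height n.
  module Hom {d N : ℕ} (vs : Vec (Point d) N) where

    D : ℕ
    D = suc d

    hcol : Fin N → Vec ℤ D
    hcol i = ℤ.+ 1 ∷ lookup vs i

    A : Fin D → Vecℚ N
    A j i = ι (hcol i) j

    open Cone A public

    inDilate⇒cone : ∀ {n x} → InDilate vs n x → InCone (ι (ℤ.+ n ∷ x))
    inDilate⇒cone {n} {x} (c , c≥0 , s , h) = c , c≥0 ,
      λ { zero → trans (Σ-cong (λ i → *-identityˡ (c i))) s
        ; (suc j) → trans (∙-comm (A (suc j)) c) (h j) }

    cone⇒inDilate : ∀ {n x} → InCone (ι (ℤ.+ n ∷ x)) → InDilate vs n x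
    cone⇒inDilate {n} {x} (c , c≥0 , r) = c , c≥0 , trans (Σ-cong (λ i → sym (*-identityˡ (c i)))) (r zero) ,
      λ j → trans (∙-comm c (A (suc j))) (r (suc j))

    entry : Vec ℤ N → Fin D → ℤ
    entry z j = sumZ (λ i → lookup (hcol i) j ℤ.* lookup z i)

    lin : Vec ℤ N → Vec ℤ D
    lin z = tabulate (entry z)

    ι-lin : ∀ z j → ι (lin z) j ≡ A j ∙ ι z
    ι-lin z j = trans (cong toℚ (VecP.lookup∘tabulate (entry z) j)) (trans (toℚ-sumZ (λ i → lookup (hcol i) j ℤ.* lookup z i)) (Σ-cong (λ i → toℚ-* (lookup (hcol i) j) (lookup z i))))

    rep-lin : ∀ z → Rep (ι z) (ι (lin z))
    rep-lin z j = sym (ι-lin z j)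

    -- Let f kill all columns, with entry nonzero at j₀. The other d rows, restricted to the d + 1
    -- affinely independent points, have a nonzero kernel vector c; applying f shows that row j₀
    -- kills c too, which contradicts independence.
    spanning : FullDim vs → Spanning
    spanning (σ , aff) f hf j₀ = decidable-stable (f j₀ ℚ.≟ 0ℚ) λ ne → absurd ne (annihilator (λ r → M (punchIn j₀ r)) (ℕP.n<1+n d))
      where
      M : Fin D → Vecℚ D
      M j c = A j (σ c)
      module C = Cone M
      absurd : f j₀ ≢ 0ℚ → (∃ λ c → NonZeroV c × (∀ r → M (punchIn j₀ r) ∙ c ≡ 0ℚ)) → ⊥
      absurd ne (c , (i , nz) , K) = nz (aff c (trans (Σ-cong (λ i → sym (*-identityˡ (c i)))) (rows zero)) (λ j → trans (∙-comm c (M (suc j))) (rows (suc j))) i)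
        where
        w : Vecℚ D
        w j = M j ∙ c
        off : ∀ j → j ≢ j₀ → w j ≡ 0ℚ
        off j ne = trans (cong w (sym (FinP.punchIn-punchOut {i = j₀} {j} (λ e → ne (sym e))))) (K (punchOut (λ e → ne (sym e))))
        total : f ∙ w ≡ 0ℚ
        total = trans (C.rep-dual {y = c} {w = w} f (λ _ → refl)) (trans (∙-comm c (λ i → f ∙ col (σ i))) (∙-0ˡ {f = λ i → f ∙ col (σ i)} c (λ i → hf (σ i))))
        rows : ∀ j → w j ≡ 0ℚ
        rows j with j FinP.≟ j₀
        ... | no jn = off j jn
        ... | yes refl = *-cancel-0 (f j₀) (w j₀) ne (trans (sym (Σ-single j₀ (λ j jn → trans (cong (f j *_) (off j jn)) (*-zeroʳ (f j))))) total)

  record SpanningFamily : Set where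
    constructor spanningFamily
    field
      {d N} : ℕ
      vs : Vec (Point d) N
      span : Hom.Spanning vs

  module Pieces (𝓕 : SpanningFamily) where
    open SpanningFamily 𝓕
    open Hom vs public
    open LP (homogeneous A span zero (λ _ → refl)) public

    abstract
      ω : Vecℚ N
      ω = proj₁ generic-ω
      ω-generic : Generic-ω ω
      ω-generic = proj₂ generic-ω
      γ : Vecℚ N
      γ = proj₁ generic-c
      γ-pos : ∀ i → 0ℚ < γ i
      γ-pos = proj₁ (proj₂ generic-c)
      γ-generic : GenericV (λ j → A j ∙ γ)
      γ-generic = proj₂ (proj₂ generic-c)

    open Opt ω public

    -- All weights in γ are positive, so q is an inner vector of the cone. Selection along q treats
    -- all lattice points, selection along -q the interior ones.
    q q⁻ : Vecℚ D
    q j = A j ∙ γ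
    q⁻ j = - q j

    coord-neg : ∀ {σ} → Basis σ → ∀ w i → coord σ (λ j → - w j) i ≡ - coord σ w i
    coord-neg {σ} b w i = sym (coord-unique {σ} {λ i → - coord σ w i} b (λ i e → cong -_ (proj₁ (coord-spec w b) i e))
      (λ j → trans (∙-comm (A j) _) (trans (∙-negˡ (coord σ w) (A j)) (cong -_ (trans (∙-comm (coord σ w) (A j)) (proj₂ (coord-spec w b) j))))) i)

    q⁻-generic : GenericV q⁻
    q⁻-generic σ b i e z = γ-generic σ b i e (neg-injective (trans (sym (coord-neg b q i)) z))

    module S⁺ = Sel q γ-generic
    module S⁻ = Sel q⁻ q⁻-generic

    abstract
      sgn : Mask N → Fin N → Bool
      sgn σ j = does (0ℚ ℚ.<? coord σ q j)

      sgn-true : ∀ σ j → sgn σ j ≡ true → 0ℚ < coord σ q j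
      sgn-true σ j e = does-true (0ℚ ℚ.<? coord σ q j) e

      sgn-false : ∀ σ j → sgn σ j ≡ false → ¬ (0ℚ < coord σ q j)
      sgn-false σ j e = does-false (0ℚ ℚ.<? coord σ q j) e

    -- A point on the wall opposite to j enters the cone of σ, when moved towards q, exactly if q
    -- has a positive coordinate at j; then the wall belongs to the piece and the interval is [0,
    -- 1).
    InBox : Mask N → Vec ℤ D → Set
    InBox σ w = ∀ j → lookup σ j ≡ true → HO (sgn σ j) (coord σ (ι w) j)

    abstract
      inBox? : ∀ σ w → Dec (InBox σ w)
      inBox? σ w = FinP.all? (λ j → (lookup σ j ≟ₘ true) →-dec ho? (sgn σ j) (coord σ (ι w) j))

    coord-lin : ∀ {σ} → Basis σ → ∀ z → Supp σ (ι z) → ∀ j → coord σ (ι (lin z)) j ≡ ι z j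
    coord-lin {σ} b z s j = sym (coord-unique {σ} b s (rep-lin z) j)

    coord-⊕ : ∀ {σ} → Basis σ → ∀ v w j → coord σ (ι (v ⊕ w)) j ≡ coord σ (ι v) j + coord σ (ι w) j
    coord-⊕ {σ} b v w j = trans (coord-cong b (λ k → trans (ι-⊕ v w k) (cong (ι v k +_) (sym (*-identityˡ (ι w k))))) j)
      (trans (coord-+* b (ι v) 1ℚ (ι w) j) (cong (coord σ (ι v) j +_) (*-identityˡ _)))

    coord-⊖ : ∀ {σ} → Basis σ → ∀ v w j → coord σ (ι (v ⊖ w)) j ≡ coord σ (ι v) j - coord σ (ι w) j
    coord-⊖ {σ} b v w j = trans (coord-cong b (λ k → trans (ι-⊖ v w k) (cong (ι v k +_) (neg-1 (ι w k)))) j)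
      (trans (coord-+* b (ι v) (- 1ℚ) (ι w) j) (cong (coord σ (ι v) j +_) (sym (neg-1 _))))
      where
      neg-1 : ∀ p → - p ≡ - 1ℚ * p
      neg-1 p = solve 1 (λ p → :- p := :- (con 1ℚ) :* p) refl p

    coord-determines : ∀ {σ} → Basis σ → ∀ {v w} → (∀ j → lookup σ j ≡ true → coord σ (ι v) j ≡ coord σ (ι w) j) → v ≡ w
    coord-determines {σ} b {v} {w} h = ι-injective λ j → trans (sym (proj₂ (coord-spec (ι v) b) j)) (trans (∙-congʳ (A j) same) (proj₂ (coord-spec (ι w) b) j))
      where
      same : ∀ i → coord σ (ι v) i ≡ coord σ (ι w) i
      same i with lookup σ i in e
      ... | true = h i e
      ... | false = trans (proj₁ (coord-spec (ι v) b) i e) (sym (proj₁ (coord-spec (ι w) b) i e))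

    height : ∀ {σ} → Basis σ → ∀ w → sumℚ (coord σ w) ≡ w zero
    height {σ} b w = trans (Σ-cong (λ i → sym (*-identityˡ (coord σ w i)))) (proj₂ (coord-spec w b) zero)

    box-≥0 : ∀ {σ w} → Basis σ → InBox σ w → ∀ j → 0ℚ ≤ coord σ (ι w) j
    box-≥0 {σ} {w} b h j with lookup σ j in e
    ... | true = ho-≥0 (sgn σ j) (h j e)
    ... | false = ≤-reflexive (sym (proj₁ (coord-spec (ι w) b) j e))

    Σ-mono : ∀ {n} {f g : Vecℚ n} → (∀ i → f i ≤ g i) → sumℚ f ≤ sumℚ g
    Σ-mono {f = f} {g} h = 0≤q-p⇒p≤q (subst (0ℚ ≤_) (Σ-- g f) (Σ-≥0 (λ i → p≤q⇒0≤q-p (h i))))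

    box-height : ∀ {σ w} → Basis σ → InBox σ w → ∃ λ e → lookup w zero ≡ ℤ.+ e × e ℕ.≤ D
    box-height {σ} {w} b h = go (lookup w zero) refl
      where
      lo : 0ℚ ≤ ι w zero
      lo = subst (0ℚ ≤_) (height b (ι w)) (Σ-≥0 (box-≥0 {σ} {w} b h))
      up : ι w zero ≤ toℚ (ℤ.+ D)
      up = subst₂ _≤_ (height b (ι w)) (trans (sum-maskZ σ) (cong (λ z → toℚ (ℤ.+ z)) (proj₂ b))) (Σ-mono le)
        where
        le : ∀ j → coord σ (ι w) j ≤ ι (maskZ σ) j
        le j with lookup σ j in e
        ... | true = subst (coord σ (ι w) j ≤_) (cong toℚ (sym (maskZ-true σ j e))) (ho-≤1 (sgn σ j) (h j e))
        ... | false = ≤-reflexive (trans (proj₁ (coord-spec (ι w) b) j e) (cong toℚ (sym (maskZ-false σ j e))))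
      go : ∀ z → lookup w zero ≡ z → ∃ λ e → lookup w zero ≡ ℤ.+ e × e ℕ.≤ D
      go (ℤ.+ e) eq = e , eq , ℤP.drop‿+≤+ (toℚ-cancel-≤ (subst (λ z → toℚ z ≤ toℚ (ℤ.+ D)) eq up))
      go (ℤ.-[1+ n ]) eq = ⊥-elim (lem (toℚ-cancel-≤ (subst (λ z → 0ℚ ≤ toℚ z) eq lo)))
        where lem : ¬ (ℤ.+ 0 ℤ.≤ ℤ.-[1+ n ])
              lem ()

    abstract
      -- Each coordinate is rounded with `ho-floor`; this is reduction modulo the sublattice spanned
      -- by the columns of σ.
      normalize : ∀ {σ} → Basis σ → ∀ w → ∃ λ z → Supp σ (ι z) × InBox σ (w ⊖ lin z)
      normalize {σ} b w = z , s , λ j e → subst (HO (sgn σ j)) (sym (eq j)) (zspec j e)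
        where
        fl : Fin N → ℤ
        fl j = proj₁ (ho-floor (sgn σ j) (coord σ (ι w) j))
        z : Vec ℤ N
        z = tabulate (λ j → if lookup σ j then fl j else ℤ.+ 0)
        lz : ∀ j → lookup z j ≡ (if lookup σ j then fl j else ℤ.+ 0)
        lz j = VecP.lookup∘tabulate _ j
        s : Supp σ (ι z)
        s j e = cong toℚ (trans (lz j) (cong (λ b → if b then fl j else ℤ.+ 0) e))
        eq : ∀ j → coord σ (ι (w ⊖ lin z)) j ≡ coord σ (ι w) j - ι z j
        eq j = trans (coord-⊖ b w (lin z) j) (cong (λ t → coord σ (ι w) j - t) (coord-lin b z s j))
        zspec : ∀ j → lookup σ j ≡ true → HO (sgn σ j) (coord σ (ι w) j - ι z j)
        zspec j e = subst (λ t → HO (sgn σ j) (coord σ (ι w) j - toℚ t)) (sym (trans (lz j) (cong (λ b → if b then fl j else ℤ.+ 0) e)))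
          (proj₂ (ho-floor (sgn σ j) (coord σ (ι w) j)))

    split-unique : ∀ {σ} → Basis σ → ∀ {g g'} z z' → InBox σ g → InBox σ g' → Supp σ (ι z) → Supp σ (ι z') →
      g ⊕ lin z ≡ g' ⊕ lin z' → g ≡ g' × z ≡ z'
    split-unique {σ} b {g} {g'} z z' h h' s s' e = coord-determines b gg , vec-ext zz
      where
      ce : ∀ j → coord σ (ι g) j + ι z j ≡ coord σ (ι g') j + ι z' j
      ce j = trans (sym (trans (coord-⊕ b g (lin z) j) (cong (coord σ (ι g) j +_) (coord-lin b z s j))))
        (trans (cong (λ w → coord σ (ι w) j) e) (trans (coord-⊕ b g' (lin z') j) (cong (coord σ (ι g') j +_) (coord-lin b z' s' j))))
      zz : ∀ j → lookup z j ≡ lookup z' j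
      zz j with lookup σ j in eq
      ... | true = ho-unique (sgn σ j) (lookup z j) (lookup z' j) (h j eq) (h' j eq) (ce j)
      ... | false = toℚ-injective (trans (s j eq) (sym (s' j eq)))
      gg : ∀ j → lookup σ j ≡ true → coord σ (ι g) j ≡ coord σ (ι g') j
      gg j _ = trans (solve 2 (λ a b → a := (a :+ b) :- b) refl (coord σ (ι g) j) (ι z j))
        (trans (cong₂ _-_ (ce j) (cong toℚ (zz j))) (solve 2 (λ a b → (a :+ b) :- b := a) refl (coord σ (ι g') j) (ι z' j)))

    -- The interior of the cone without topology: there is room for a step back along q.
    Interior : Vec ℤ D → Set
    Interior w = ∃ λ ε → 0ℚ < ε × InCone (λ j → ι w j + ε * q⁻ j)

    inCone-q : InCone q
    inCone-q = γ , (λ i → <⇒≤ (γ-pos i)) , λ _ → refl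

    interior⇒inward : ∀ w → Interior w → S⁻.Inward (ι w)
    interior⇒inward w (ε , hε , c) = ε , hε , λ t ht le → cone-cong (λ j → solve 4 (λ w e t q → (w :+ e :* (:- q)) :+ (e :- t) :* q := w :+ t :* (:- q)) refl (ι w j) ε t (q j))
      (cone-+ c (cone-* (p≤q⇒0≤q-p le) inCone-q))

    lex⇒interior : ∀ {σ} w → Basis σ → S⁻.LexIn σ (ι w) → Interior w
    lex⇒interior {σ} w b h = go (S⁻.all-stable (ι w))
      where
      go : (∃ λ ε → 0ℚ < ε × S⁻.AllStable (ι w) ε) → Interior w
      go (ε , hε , st) = ε , hε , coord σ w' , nn , proj₂ (coord-spec w' b)
        where
        w' : Vecℚ D
        w' = S⁻.perturb (ι w) ε
        nn : ∀ i → 0ℚ ≤ coord σ w' i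
        nn i with lookup σ i in e
        ... | true = <⇒≤ (S⁻.lex⇒pos (ι w) ε hε st b i (h i e))
        ... | false = ≤-reflexive (sym (proj₁ (coord-spec w' b) i e))

    interior-+ : ∀ {v w} → Interior v → InCone (ι w) → Interior (v ⊕ w)
    interior-+ {v} {w} (ε , hε , c) c' = ε , hε , cone-cong (λ j → trans (solve 3 (λ v w q → (v :+ q) :+ w := (v :+ w) :+ q) refl (ι v j) (ι w j) (ε * q⁻ j)) (cong (_+ ε * q⁻ j) (sym (ι-⊕ v w j)))) (cone-+ c c')

    -- f is positive at q since all weights of γ are positive, and w exceeds a point of the cone by
    -- ε q.
    interior-pos : ∀ {w} → Interior w → ∀ f → (∀ i → 0ℚ ≤ f ∙ col i) → ∀ p → 0ℚ < f ∙ col p → 0ℚ < f ∙ ι w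
    interior-pos {w} (ε , hε , y , y≥0 , r) f f≥0 p fp = subst (0ℚ <_) eq (+-0<ʳ c≥0 (*-0< hε fq))
      where
      fq : 0ℚ < f ∙ q
      fq = subst (0ℚ <_) (sym (rep-dual {y = γ} {w = q} f (λ _ → refl))) (Σ->0 (λ i → *-0≤ (<⇒≤ (γ-pos i)) (f≥0 i)) p (*-0< (γ-pos p) fp))
      c≥0 : 0ℚ ≤ f ∙ (λ j → ι w j + ε * q⁻ j)
      c≥0 = subst (0ℚ ≤_) (sym (rep-dual {y = y} f r)) (Σ-≥0 (λ i → *-0≤ (y≥0 i) (f≥0 i)))
      eq : f ∙ (λ j → ι w j + ε * q⁻ j) + ε * f ∙ q ≡ f ∙ ι w
      eq = trans (cong₂ _+_ (trans (∙-+ʳ f (ι w) (λ j → ε * q⁻ j)) (cong (f ∙ ι w +_) (∙-*ʳ ε f q⁻))) refl)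
        (trans (cong (λ t → f ∙ ι w + ε * t + ε * f ∙ q) (trans (∙-comm f q⁻) (trans (∙-negˡ q f) (cong -_ (∙-comm q f)))))
        (solve 3 (λ a e b → a :+ e :* (:- b) :+ e :* b := a) refl (f ∙ ι w) ε (f ∙ q)))

  -- Counting lattice points and interior lattice points

  record LatticePoints : Set where
    constructor latticePoints
    field
      family : SpanningFamily
    open SpanningFamily family public
    field
      pts : ℕ → List (Point d)
      pts-unique : ∀ n → Unique (pts n)
      pts⇒ : ∀ n {x} → x ∈ pts n → InDilate vs n x
      pts⇐ : ∀ n {x} → InDilate vs n x → x ∈ pts n

  module Count (𝓟 : LatticePoints) where
    open LatticePoints 𝓟
    open Pieces family public

    Piece : Set
    Piece = Mask N × (ℕ × Point d)

    deg : Piece → ℕ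
    deg (σ , e , g) = e

    residue : Piece → Vec ℤ D
    residue (σ , e , g) = ℤ.+ e ∷ g

    triangulation : List (Mask N)
    triangulation = filter inT? (allMasks N)

    boxAt : Mask N → ℕ → List (Point d)
    boxAt σ e = filter (λ g → inBox? σ (ℤ.+ e ∷ g)) (pts e)

    -- By `box-height` the search may stop at height D.
    boxes : Mask N → List (ℕ × Point d)
    boxes σ = tagged (boxAt σ) (upTo (suc D))

    pieces : List Piece
    pieces = tagged boxes triangulation

    unique-triangulation : Unique triangulation
    unique-triangulation = UP.filter⁺ inT? (unique-allMasks N)

    unique-boxes : ∀ σ → Unique (boxes σ)
    unique-boxes σ = unique-tagged (boxAt σ) {upTo (suc D)} (UP.upTo⁺ (suc D)) (λ e → UP.filter⁺ (λ g → inBox? σ (ℤ.+ e ∷ g)) (pts-unique e))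

    unique-pieces : Unique pieces
    unique-pieces = unique-tagged boxes {triangulation} unique-triangulation unique-boxes

    ∈-triangulation⁺ : ∀ {σ} → InT σ → σ ∈ triangulation
    ∈-triangulation⁺ {σ} h = ∈-filter⁺ inT? (∈-allMasks σ) h

    ∈-triangulation⁻ : ∀ {σ} → σ ∈ triangulation → InT σ
    ∈-triangulation⁻ p = proj₂ (∈-filter⁻ inT? {xs = allMasks N} p)

    ∈-boxes⁻ : ∀ σ {e g} → (e , g) ∈ boxes σ → InBox σ (ℤ.+ e ∷ g)
    ∈-boxes⁻ σ {e} {g} p = proj₂ (∈-filter⁻ (λ g → inBox? σ (ℤ.+ e ∷ g)) {xs = pts e} (proj₂ (∈-tagged⁻ (boxAt σ) {upTo (suc D)} p)))

    box-cone : ∀ {σ e g} → Basis σ → InBox σ (ℤ.+ e ∷ g) → InDilate vs e g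
    box-cone {σ} {e} {g} b h = cone⇒inDilate {e} {g} (coord σ w , box-≥0 {σ} {ℤ.+ e ∷ g} b h , proj₂ (coord-spec w b))
      where
      w : Vecℚ D
      w = ι (ℤ.+ e ∷ g)

    box-deg≤ : ∀ {σ e g} → Basis σ → InBox σ (ℤ.+ e ∷ g) → e ℕ.≤ D
    box-deg≤ {σ} {e} {g} b h = go (box-height {σ} {ℤ.+ e ∷ g} b h)
      where
      go : (∃ λ e' → ℤ.+ e ≡ ℤ.+ e' × e' ℕ.≤ D) → e ℕ.≤ D
      go (e' , eq , le) = subst (ℕ._≤ D) (sym (ℤP.+-injective eq)) le

    ∈-boxes⁺ : ∀ {σ e g} → Basis σ → InBox σ (ℤ.+ e ∷ g) → (e , g) ∈ boxes σ
    ∈-boxes⁺ {σ} {e} {g} b h = ∈-tagged⁺ (boxAt σ) {upTo (suc D)} (∈-upTo⁺ (ℕ.s≤s (box-deg≤ {σ} {e} {g} b h)))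
      (∈-filter⁺ (λ g → inBox? σ (ℤ.+ e ∷ g)) (pts⇐ e (box-cone {σ} {e} {g} b h)) h)

    ∈-pieces⁻ : ∀ {σ e g} → (σ , e , g) ∈ pieces → InT σ × InBox σ (ℤ.+ e ∷ g)
    ∈-pieces⁻ {σ} p = ∈-triangulation⁻ (proj₁ (∈-tagged⁻ boxes {triangulation} p)) , ∈-boxes⁻ σ (proj₂ (∈-tagged⁻ boxes {triangulation} p))

    ∈-pieces⁺ : ∀ {σ e g} → InT σ → InBox σ (ℤ.+ e ∷ g) → (σ , e , g) ∈ pieces
    ∈-pieces⁺ h b = ∈-tagged⁺ boxes {triangulation} (∈-triangulation⁺ h) (∈-boxes⁺ (proj₁ h) b)

    degs : List ℕ
    degs = map deg pieces

    point : Piece × Vec ℕ N → Vec ℤ D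
    point (p , y) = residue p ⊕ lin (nat y)

    supp-nat : ∀ {σ : Mask N} y → SuppN σ y → Supp σ (ι (nat y))
    supp-nat y s i e = cong toℚ (trans (lookup-nat y i) (cong (λ m → ℤ.+ m) (s i e)))

    nat-≥0 : ∀ y i → 0ℚ ≤ ι {N} (nat y) i
    nat-≥0 y i = subst (λ z → 0ℚ ≤ toℚ z) (sym (lookup-nat y i)) (toℚ-mono-≤ {ℤ.+ 0} {ℤ.+ lookup y i} (ℤ.+≤+ ℕ.z≤n))

    lin-height : ∀ z → ι (lin z) zero ≡ sumℚ (ι z)
    lin-height z = trans (ι-lin z zero) (Σ-cong (λ i → *-identityˡ (ι z i)))

    point-height : ∀ p y → lookup (point (p , y)) zero ≡ ℤ.+ (deg p ℕ.+ Vec.sum y)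
    point-height p y = toℚ-injective (trans (ι-⊕ (residue p) (lin (nat y)) zero)
      (trans (cong (toℚ (ℤ.+ deg p) +_) (trans (lin-height (nat y)) (toℚ-sum y))) (trans (sym (toℚ-+ (ℤ.+ deg p) (ℤ.+ Vec.sum y))) (cong toℚ (sym (ℤP.pos-+ (deg p) (Vec.sum y)))))))

    coord-point : ∀ {σ e g} y → Basis σ → SuppN σ y → ∀ j → coord σ (ι (point ((σ , e , g) , y))) j ≡ coord σ (ι (ℤ.+ e ∷ g)) j + ι (nat y) j
    coord-point {σ} {e} {g} y b s j = trans (coord-⊕ b (ℤ.+ e ∷ g) (lin (nat y)) j) (cong (coord σ (ι (ℤ.+ e ∷ g)) j +_) (coord-lin {σ} b (nat y) (supp-nat {σ} y s) j))

    -- A coordinate 0 can occur only where the interval contains 0, that is, where q has a positive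
    -- coordinate.
    point-lex : ∀ {σ e g} y → Basis σ → InBox σ (ℤ.+ e ∷ g) → SuppN σ y → S⁺.LexIn σ (ι (point ((σ , e , g) , y)))
    point-lex {σ} {e} {g} y b h s j j∈ = subst (λ u → LexPos u (coord σ q j)) (sym (coord-point {σ} {e} {g} y b s j)) (go (sgn σ j) refl (h j j∈))
      where
      r : ℚ
      r = coord σ (ι (ℤ.+ e ∷ g)) j
      go : ∀ bb → sgn σ j ≡ bb → HO (sgn σ j) r → LexPos (r + ι (nat y) j) (coord σ q j)
      go true eq ho with trichotomy (r + ι (nat y) j)
      ... | inj₁ lt = ⊥-elim (<⇒≱ lt (+-0≤ (ho-≥0 (sgn σ j) ho) (nat-≥0 y j)))
      ... | inj₂ (inj₁ z) = inj₂ (z , sgn-true σ j eq)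
      ... | inj₂ (inj₂ gt) = inj₁ gt
      go false eq ho = inj₁ (+-0<ˡ (proj₁ (subst (λ b → HO b r) eq ho)) (nat-≥0 y j))

    point-cone : ∀ {σ e g} y → Basis σ → InBox σ (ℤ.+ e ∷ g) → SuppN σ y → InCone (ι (point ((σ , e , g) , y)))
    point-cone {σ} {e} {g} y b h s = coord σ w , (λ j → subst (0ℚ ≤_) (sym (coord-point {σ} {e} {g} y b s j)) (+-0≤ (box-≥0 {σ} {ℤ.+ e ∷ g} b h j) (nat-≥0 y j))) , proj₂ (coord-spec w b)
      where w = ι (point ((σ , e , g) , y))

    nat-injective : ∀ {y y' : Vec ℕ N} → nat y ≡ nat y' → y ≡ y'
    nat-injective {y} {y'} e = vec-ext λ i → ℤP.+-injective (trans (sym (lookup-nat y i)) (trans (cong (λ v → lookup v i) e) (lookup-nat y' i)))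

    codes : ℕ → List (Piece × Vec ℕ N)
    codes n = tagged (λ p → compsShift (proj₁ p) (deg p) n) pieces

    unique-codes : ∀ n → Unique (codes n)
    unique-codes n = unique-tagged (λ p → compsShift (proj₁ p) (deg p) n) {pieces} unique-pieces (λ p → unique-compsShift (proj₁ p) (deg p) n)

    ∈-codes⁻ : ∀ n {p y} → (p , y) ∈ codes n → p ∈ pieces × SuppN (proj₁ p) y × deg p ℕ.+ Vec.sum y ≡ n
    ∈-codes⁻ n {p} q = proj₁ r , ∈-compsShift⁻ (proj₁ p) (deg p) n (proj₂ r)
      where r = ∈-tagged⁻ (λ p → compsShift (proj₁ p) (deg p) n) {pieces} q

    -- The point determines its cone by `sel-unique`, and inside one cone the box point and the
    -- multipliers by `split-unique`.
    point-injective : ∀ n {c c'} → c ∈ codes n → c' ∈ codes n → point c ≡ point c' → c ≡ c'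
    point-injective n {(σ , e , g) , y} {(σ' , e' , g') , y'} c∈ c'∈ eq = go (S⁺.sel-unique (ι w) (proj₁ pT) (proj₁ pT') lex lex')
      where
      w = point ((σ , e , g) , y)
      pT = ∈-pieces⁻ (proj₁ (∈-codes⁻ n c∈))
      pT' = ∈-pieces⁻ (proj₁ (∈-codes⁻ n c'∈))
      s = proj₁ (proj₂ (∈-codes⁻ n c∈))
      s' = proj₁ (proj₂ (∈-codes⁻ n c'∈))
      lex : S⁺.LexIn σ (ι w)
      lex = point-lex {σ} {e} {g} y (proj₁ (proj₁ pT)) (proj₂ pT) s
      lex' : S⁺.LexIn σ' (ι w)
      lex' = subst (λ w → S⁺.LexIn σ' (ι w)) (sym eq) (point-lex {σ'} {e'} {g'} y' (proj₁ (proj₁ pT')) (proj₂ pT') s')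
      go : σ ≡ σ' → ((σ , e , g) , y) ≡ ((σ' , e' , g') , y')
      go refl = fin (split-unique (proj₁ (proj₁ pT)) (nat y) (nat y') (proj₂ pT) (proj₂ pT') (supp-nat {σ} y s) (supp-nat {σ} y' s') eq)
        where
        fin : (ℤ.+ e ∷ g) ≡ (ℤ.+ e' ∷ g') × nat y ≡ nat y' → ((σ , e , g) , y) ≡ ((σ , e' , g') , y')
        fin (refl , ey) = cong (_ ,_) (nat-injective ey)

    toNat : (z : Vec ℤ N) → (∀ j → ℤ.+ 0 ℤ.≤ lookup z j) → ∃ λ y → nat y ≡ z
    toNat z h = tabulate f , vec-ext λ j → trans (lookup-nat (tabulate f) j) (trans (cong (λ m → ℤ.+ m) (VecP.lookup∘tabulate f j)) (ℤP.0≤i⇒+∣i∣≡i (h j)))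
      where
      f : Fin N → ℕ
      f j = ℤ.∣ lookup z j ∣

    ⊖⊕ : ∀ {D} (w v : Vec ℤ D) → (w ⊖ v) ⊕ v ≡ w
    ⊖⊕ w v = ι-injective λ j → trans (ι-⊕ (w ⊖ v) v j) (trans (cong (_+ ι v j) (ι-⊖ w v j)) (solve 2 (λ a b → (a :- b) :+ b := a) refl (ι w j) (ι v j)))

    ⊖⊖ : ∀ {D} (w v : Vec ℤ D) → v ⊖ (v ⊖ w) ≡ w
    ⊖⊖ w v = ι-injective λ j → trans (ι-⊖ v (v ⊖ w) j) (trans (cong (λ t → ι v j - t) (ι-⊖ v w j)) (solve 2 (λ a b → b :- (b :- a) := a) refl (ι w j) (ι v j)))

    suppN-nat : ∀ {σ : Mask N} y z → nat y ≡ z → Supp σ (ι z) → SuppN σ y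
    suppN-nat y z refl s j e = ℤP.+-injective (trans (sym (lookup-nat y j)) (toℚ-injective (s j e)))

    box-piece : ∀ {σ w} → InT σ → InBox σ w → ∃ λ p → p ∈ pieces × residue p ≡ w × proj₁ p ≡ σ
    box-piece {σ} {z ∷ g} hT h = go (box-height {σ} {z ∷ g} (proj₁ hT) h)
      where
      go : (∃ λ e → z ≡ ℤ.+ e × e ℕ.≤ D) → ∃ λ p → p ∈ pieces × residue p ≡ z ∷ g × proj₁ p ≡ σ
      go (e , refl , _) = (σ , e , g) , ∈-pieces⁺ hT h , refl , refl

    -- Moving the point towards q selects a cone. The coordinates there are nonnegative, and
    -- positive where the interval is (0, 1], so rounding leaves natural multipliers.
    decode : ∀ n x → InDilate vs n x → ∃ λ c → c ∈ codes n × point c ≡ ℤ.+ n ∷ x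
    decode n x hx = go (S⁺.sel ω-generic (ι w) (1ℚ , 0<1ℚ , λ t ht _ → cone-+ cw (cone-* (<⇒≤ ht) inCone-q)))
      where
      w : Vec ℤ D
      w = ℤ.+ n ∷ x
      cw : InCone (ι w)
      cw = inDilate⇒cone {n} {x} hx
      go : (∃ λ σ → InT σ × S⁺.LexIn σ (ι w)) → ∃ λ c → c ∈ codes n × point c ≡ w
      go (σ , hT , lex) = fin (normalize (proj₁ hT) w)
        where
        b = proj₁ hT
        fin : (∃ λ z → Supp σ (ι z) × InBox σ (w ⊖ lin z)) → ∃ λ c → c ∈ codes n × point c ≡ w
        fin (z , sz , bx) = fin₂ (toNat z z≥0) (box-piece hT bx)
          where
          ceq : ∀ j → coord σ (ι (w ⊖ lin z)) j ≡ coord σ (ι w) j - ι z j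
          ceq j = trans (coord-⊖ b w (lin z) j) (cong (λ t → coord σ (ι w) j - t) (coord-lin b z sz j))
          z≥0 : ∀ j → ℤ.+ 0 ℤ.≤ lookup z j
          z≥0 j with lookup σ j in e
          ... | false = ℤP.≤-reflexive (sym (toℚ-injective {lookup z j} {ℤ.+ 0} (sz j e)))
          ... | true = ho-nonneg (sgn σ j) (coord σ (ι w) j) (lookup z j) (subst (HO (sgn σ j)) (ceq j) (bx j e)) (u≥0 (lex j e)) (λ f → u>0 f (lex j e))
            where
            u≥0 : LexPos (coord σ (ι w) j) (coord σ q j) → 0ℚ ≤ coord σ (ι w) j
            u≥0 (inj₁ p) = <⇒≤ p
            u≥0 (inj₂ (p , _)) = ≤-reflexive (sym p)
            u>0 : sgn σ j ≡ false → LexPos (coord σ (ι w) j) (coord σ q j) → 0ℚ < coord σ (ι w) j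
            u>0 f (inj₁ p) = p
            u>0 f (inj₂ (_ , p)) = ⊥-elim (sgn-false σ j f p)
          fin₂ : (∃ λ y → nat y ≡ z) → (∃ λ p → p ∈ pieces × residue p ≡ w ⊖ lin z × proj₁ p ≡ σ) → ∃ λ c → c ∈ codes n × point c ≡ w
          fin₂ (y , refl) (p , p∈ , rp , refl) = (p , y) , ∈-tagged⁺ (λ p → compsShift (proj₁ p) (deg p) n) {pieces} p∈ (∈-compsShift⁺ σ (deg p) y (suppN-nat {σ} y z refl sz)
               (ℤP.+-injective (trans (sym (point-height p y)) (cong (λ v → lookup v zero) pe)))) , pe
            where
            pe : point (p , y) ≡ w
            pe = trans (cong (_⊕ lin z) rp) (⊖⊕ w (lin z))

    length-codes : ∀ n → length (codes n) ≡ counts D degs n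
    length-codes n = trans (length-tagged (λ p → compsShift (proj₁ p) (deg p) n) pieces) (go pieces (λ p∈ → proj₂ (proj₁ (proj₁ (∈-pieces⁻ p∈)))))
      where
      go : ∀ ps → (∀ {p} → p ∈ ps → size (proj₁ p) ≡ D) → sum (map (λ p → length (compsShift (proj₁ p) (deg p) n)) ps) ≡ counts D (map deg ps) n
      go [] h = refl
      go (p ∷ ps) h = cong₂ ℕ._+_ (trans (length-compsShift (proj₁ p) (deg p) n) (cong (λ z → shift (cnt z) (deg p) n) (h (here refl)))) (go ps (λ q → h (there q)))

    -- `point` is a bijection from codes to lattice points, and the codes of one piece contribute
    -- t^deg/(1 - t)^D.
    length-pts : ∀ n → length (pts n) ≡ counts D degs n
    length-pts n = trans (sym (ListP.length-map (ℤ.+ n ∷_) (pts n))) (trans (PP.↭-length (unique-set img-unique pts'-unique ⊆₁ ⊆₂)) (trans (ListP.length-map point (codes n)) (length-codes n)))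
      where
      img-unique : Unique (map point (codes n))
      img-unique = unique-map (point-injective n) (unique-codes n)
      pts'-unique : Unique (map (ℤ.+ n ∷_) (pts n))
      pts'-unique = UP.map⁺ VecP.∷-injectiveʳ (pts-unique n)
      img : ∀ c → c ∈ codes n → point c ∈ map (ℤ.+ n ∷_) (pts n)
      img ((σ , e , g) , y) c∈ = subst (_∈ map (ℤ.+ n ∷_) (pts n)) (sym shape) (∈-map⁺ (ℤ.+ n ∷_) (pts⇐ n (cone⇒inDilate {n} {x} (subst (λ v → InCone (ι v)) shape (point-cone {σ} {e} {g} y (proj₁ (proj₁ p∈)) (proj₂ p∈) s)))))
        where
        c⁻ : (σ , e , g) ∈ pieces × SuppN σ y × e ℕ.+ Vec.sum y ≡ n
        c⁻ = ∈-codes⁻ n c∈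
        p∈ : InT σ × InBox σ (ℤ.+ e ∷ g)
        p∈ = ∈-pieces⁻ (proj₁ c⁻)
        s : SuppN σ y
        s = proj₁ (proj₂ c⁻)
        x : Point d
        x = Vec.tail (point ((σ , e , g) , y))
        shape : point ((σ , e , g) , y) ≡ ℤ.+ n ∷ x
        shape = cong₂ _∷_ (trans (point-height (σ , e , g) y) (cong (λ m → ℤ.+ m) (proj₂ (proj₂ c⁻)))) refl
      ⊆₁ : ∀ {x} → x ∈ map point (codes n) → x ∈ map (ℤ.+ n ∷_) (pts n)
      ⊆₁ {x} x∈ = go (∈-map⁻ point x∈)
        where
        go : (∃ λ c → c ∈ codes n × x ≡ point c) → x ∈ map (ℤ.+ n ∷_) (pts n)
        go (c , c∈ , e) = subst (_∈ map (ℤ.+ n ∷_) (pts n)) (sym e) (img c c∈)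
      ⊆₂ : ∀ {x} → x ∈ map (ℤ.+ n ∷_) (pts n) → x ∈ map point (codes n)
      ⊆₂ {w} w∈ = go (∈-map⁻ (ℤ.+ n ∷_) w∈)
        where
        go : (∃ λ x → x ∈ pts n × w ≡ ℤ.+ n ∷ x) → w ∈ map point (codes n)
        go (x , p , e) = fin (decode n x (pts⇒ n p))
          where
          fin : (∃ λ c → c ∈ codes n × point c ≡ ℤ.+ n ∷ x) → w ∈ map point (codes n)
          fin (c , c∈ , e') = subst (_∈ map point (codes n)) (trans e' (sym e)) (∈-map⁺ point c∈)

    -- The reflected parametrisation: the box is replaced by its image under g ↦ (sum of the
    -- generators) - g, which exchanges the two kinds of intervals.
    point° : Piece × Vec ℕ N → Vec ℤ D
    point° (p , y) = lin (nat y ⊕ maskZ (proj₁ p)) ⊖ residue p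

    supp-maskZ : ∀ (σ : Mask N) → Supp σ (ι (maskZ σ))
    supp-maskZ σ i e = cong toℚ (maskZ-false σ i e)

    -- An interior point stays in the cone when moved towards -q, which selects a cone. Rounding -w
    -- instead of w writes w as `lin z` minus a point of the same box, and now z is at least 1 on σ.
    decode° : ∀ m w → lookup w zero ≡ ℤ.+ m → Interior w → ∃ λ p → ∃ λ y → p ∈ pieces × SuppN (proj₁ p) y × point° (p , y) ≡ w × deg p ℕ.+ m ≡ D ℕ.+ Vec.sum y
    decode° m w hw int = go (S⁻.sel ω-generic (ι w) (interior⇒inward w int))
      where
      Goal : Set
      Goal = ∃ λ p → ∃ λ y → p ∈ pieces × SuppN (proj₁ p) y × point° (p , y) ≡ w × deg p ℕ.+ m ≡ D ℕ.+ Vec.sum y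
      go : (∃ λ σ → InT σ × S⁻.LexIn σ (ι w)) → Goal
      go (σ , hT , lex) = fin (normalize b (0v ⊖ w))
        where
        b = proj₁ hT
        0v : Vec ℤ D
        0v = Vec.replicate D (ℤ.+ 0)
        fin : (∃ λ z → Supp σ (ι z) × InBox σ ((0v ⊖ w) ⊖ lin z)) → Goal
        fin (z' , sz' , bx') = fin₂ (toNat y₀ y₀≥0) (box-piece hT bx)
          where
          z y₀ : Vec ℤ N
          z = Vec.map ℤ.-_ z'
          y₀ = z ⊖ maskZ σ
          ιz : ∀ j → ι z j ≡ - ι z' j
          ιz j = trans (cong toℚ (VecP.lookup-map j ℤ.-_ z')) (toℚ-neg (lookup z' j))
          sz : Supp σ (ι z)
          sz j e = trans (ιz j) (cong -_ (sz' j e))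
          weq : (0v ⊖ w) ⊖ lin z' ≡ lin z ⊖ w
          weq = ι-injective λ j → trans (ι-⊖ (0v ⊖ w) (lin z') j) (trans (cong₂ _-_ (trans (ι-⊖ 0v w j) (cong (λ t → toℚ t - ι w j) (VecP.lookup-replicate j (ℤ.+ 0)))) (ι-lin z' j))
              (trans (solve 2 (λ w z → (con 0ℚ :- w) :- z := :- z :- w) refl (ι w j) (A j ∙ ι z')) (sym (trans (ι-⊖ (lin z) w j) (cong (_- ι w j) (trans (ι-lin z j) (trans (∙-congʳ (A j) ιz) (trans (∙-comm (A j) _) (trans (∙-negˡ (ι z') (A j)) (cong -_ (∙-comm (ι z') (A j))))))))))))
          bx : InBox σ (lin z ⊖ w)
          bx = subst (InBox σ) weq bx'
          ceq : ∀ j → coord σ (ι (lin z ⊖ w)) j ≡ ι z j - coord σ (ι w) j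
          ceq j = trans (coord-⊖ b (lin z) w j) (cong (_- coord σ (ι w) j) (coord-lin b z sz j))
          y₀≥0 : ∀ j → ℤ.+ 0 ℤ.≤ lookup y₀ j
          y₀≥0 j with lookup σ j in e
          ... | false = ℤP.≤-reflexive (sym (trans (VecP.lookup-zipWith ℤ._-_ j z (maskZ σ)) (cong₂ ℤ._-_ (toℚ-injective {lookup z j} {ℤ.+ 0} (sz j e)) (maskZ-false σ j e))))
          ... | true = subst (ℤ.+ 0 ℤ.≤_) (sym (trans (VecP.lookup-zipWith ℤ._-_ j z (maskZ σ)) (cong (λ t → lookup z j ℤ.- t) (maskZ-true σ j e))))
              (ℤP.i≤j⇒0≤j-i (ho-pos (sgn σ j) (coord σ (ι w) j) (lookup z j) (subst (HO (sgn σ j)) (ceq j) (bx j e)) (u≥0 (lex j e)) (λ t → u>0 t (lex j e))))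
            where
            u≥0 : LexPos (coord σ (ι w) j) (coord σ q⁻ j) → 0ℚ ≤ coord σ (ι w) j
            u≥0 (inj₁ p) = <⇒≤ p
            u≥0 (inj₂ (p , _)) = ≤-reflexive (sym p)
            u>0 : sgn σ j ≡ true → LexPos (coord σ (ι w) j) (coord σ q⁻ j) → 0ℚ < coord σ (ι w) j
            u>0 f (inj₁ p) = p
            u>0 f (inj₂ (_ , p)) = ⊥-elim (<-asym (sgn-true σ j f) (subst₂ _<_ refl refl (lem (subst (0ℚ <_) (coord-neg b q j) p))))
              where lem : 0ℚ < - coord σ q j → coord σ q j < 0ℚ
                    lem h = subst₂ _<_ (solve 1 (λ a → :- (:- a) := a) refl (coord σ q j)) refl (neg-antimono-< h)
          fin₂ : (∃ λ y → nat y ≡ y₀) → (∃ λ p → p ∈ pieces × residue p ≡ lin z ⊖ w × proj₁ p ≡ σ) → Goal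
          fin₂ (y , ey) (p , p∈ , rp , refl) = p , y , p∈ , suppN-nat {σ} y y₀ ey s₀ , pe , heights
            where
            s₀ : Supp σ (ι y₀)
            s₀ j e = trans (ι-⊖ z (maskZ σ) j) (trans (cong₂ _-_ (sz j e) (supp-maskZ σ j e)) (+-identityʳ 0ℚ))
            zeq : nat y ⊕ maskZ σ ≡ z
            zeq = trans (cong (_⊕ maskZ σ) ey) (⊖⊕ z (maskZ σ))
            pe : point° (p , y) ≡ w
            pe = trans (cong₂ _⊖_ (cong lin zeq) rp) (⊖⊖ w (lin z))
            heights : deg p ℕ.+ m ≡ D ℕ.+ Vec.sum y
            heights = ℤP.+-injective (toℚ-injective (begin
              toℚ (ℤ.+ (deg p ℕ.+ m)) ≡⟨ trans (cong toℚ (ℤP.pos-+ (deg p) m)) (toℚ-+ (ℤ.+ deg p) (ℤ.+ m)) ⟩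
              toℚ (ℤ.+ deg p) + toℚ (ℤ.+ m) ≡⟨ cong₂ (λ a b → a + toℚ b) (trans (cong (λ v → ι v zero) rp) (ι-⊖ (lin z) w zero)) (sym hw) ⟩
              ι (lin z) zero - ι w zero + ι w zero ≡⟨ solve 2 (λ a b → a :- b :+ b := a) refl (ι (lin z) zero) (ι w zero) ⟩
              ι (lin z) zero ≡⟨ trans (lin-height z) (Σ-cong (λ i → trans (cong (λ v → ι v i) (sym zeq)) (ι-⊕ (nat y) (maskZ σ) i))) ⟩
              sumℚ (λ i → ι (nat y) i + ι (maskZ σ) i) ≡⟨ Σ-+ (ι (nat y)) (ι (maskZ σ)) ⟩
              sumℚ (ι (nat y)) + sumℚ (ι (maskZ σ)) ≡⟨ cong₂ _+_ (toℚ-sum y) (trans (sum-maskZ σ) (cong (λ t → toℚ (ℤ.+ t)) (proj₂ b))) ⟩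
              toℚ (ℤ.+ Vec.sum y) + toℚ (ℤ.+ D) ≡⟨ trans (+-comm (toℚ (ℤ.+ Vec.sum y)) (toℚ (ℤ.+ D))) (trans (sym (toℚ-+ (ℤ.+ D) (ℤ.+ Vec.sum y))) (cong toℚ (sym (ℤP.pos-+ D (Vec.sum y))))) ⟩
              toℚ (ℤ.+ (D ℕ.+ Vec.sum y)) ∎))
              where open ≡-Reasoning

    f° : ℕ → Piece → List (Vec ℕ N)
    f° m p = compsShift (proj₁ p) D (deg p ℕ.+ m)

    codes° : ℕ → List (Piece × Vec ℕ N)
    codes° m = tagged (f° m) pieces

    length-codes° : ∀ m → length (codes° m) ≡ sum (map (λ e → shift (cnt D) D (e ℕ.+ m)) degs)
    length-codes° m = trans (length-tagged (f° m) pieces) (go pieces (λ p∈ → proj₂ (proj₁ (proj₁ (∈-pieces⁻ p∈)))))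
      where
      go : ∀ ps → (∀ {p} → p ∈ ps → size (proj₁ p) ≡ D) → sum (map (λ p → length (f° m p)) ps) ≡ sum (map (λ e → shift (cnt D) D (e ℕ.+ m)) (map deg ps))
      go [] h = refl
      go (p ∷ ps) h = cong₂ ℕ._+_ (trans (length-compsShift (proj₁ p) D (deg p ℕ.+ m)) (cong (λ z → shift (cnt z) D (deg p ℕ.+ m)) (h (here refl)))) (go ps (λ q → h (there q)))

    interior-code : ∀ m w → Interior w → lookup w zero ≡ ℤ.+ m → w ∈ map point° (codes° m)
    interior-code m w int hw = go (decode° m w hw int)
      where
      go : (∃ λ p → ∃ λ y → p ∈ pieces × SuppN (proj₁ p) y × point° (p , y) ≡ w × deg p ℕ.+ m ≡ D ℕ.+ Vec.sum y) → w ∈ map point° (codes° m)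
      go (p , y , p∈ , s , e , eq) = subst (_∈ map point° (codes° m)) e (∈-map⁺ point° (∈-tagged⁺ (f° m) {pieces} p∈ (∈-compsShift⁺ (proj₁ p) D y s (sym eq))))

    -- Every interior point has a code by `decode°`; this is the half of reciprocity on which
    -- Stanley's argument rests.
    interior-bound : ∀ m (ws : List (Vec ℤ D)) → Unique ws → (∀ {w} → w ∈ ws → Interior w × lookup w zero ≡ ℤ.+ m) →
      length ws ℕ.≤ sum (map (λ e → shift (cnt D) D (e ℕ.+ m)) degs)
    interior-bound m ws u h = subst (length ws ℕ.≤_) (trans (ListP.length-map point° (codes° m)) (length-codes° m))
      (unique⊆⇒≤ u (λ {w} w∈ → interior-code m w (proj₁ (h w∈)) (proj₂ (h w∈))))

    -- The reflection of a box point in the centre of its box, at height D - deg. Pieces of the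
    -- largest degree yield the lowest interior points.
    corner : Piece → Vec ℤ D
    corner p = lin (maskZ (proj₁ p)) ⊖ residue p

    corner-lex : ∀ {p} → p ∈ pieces → S⁻.LexIn (proj₁ p) (ι (corner p))
    corner-lex {σ , e , g} p∈ j j∈ = go (sgn σ j) refl (bx j j∈)
      where
      b = proj₁ (proj₁ (∈-pieces⁻ p∈))
      bx = proj₂ (∈-pieces⁻ p∈)
      r u : ℚ
      r = coord σ (ι (ℤ.+ e ∷ g)) j
      u = coord σ (ι (corner (σ , e , g))) j
      ueq : u ≡ 1ℚ - r
      ueq = trans (coord-⊖ b (lin (maskZ σ)) (ℤ.+ e ∷ g) j) (cong (_- r) (trans (coord-lin b (maskZ σ) (supp-maskZ σ) j) (cong toℚ (maskZ-true σ j j∈))))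
      go : ∀ bb → sgn σ j ≡ bb → HO (sgn σ j) r → LexPos u (coord σ q⁻ j)
      go true eq h = inj₁ (subst (0ℚ <_) (sym ueq) (p<q⇒0<q-p (proj₂ (subst (λ b → HO b r) eq h))))
      go false eq h with trichotomy u
      ... | inj₂ (inj₂ gt) = inj₁ gt
      ... | inj₁ lt = ⊥-elim (<⇒≱ lt (subst (0ℚ ≤_) (sym ueq) (p≤q⇒0≤q-p (ho-≤1 (sgn σ j) h))))
      ... | inj₂ (inj₁ z) = inj₂ (z , subst (0ℚ <_) (sym (coord-neg b q j)) (neg-< (≤∧≢⇒< (≮⇒≥ (sgn-false σ j eq)) (γ-generic σ b j j∈))))

    corner-interior : ∀ {p} → p ∈ pieces → Interior (corner p)
    corner-interior {p} p∈ = lex⇒interior (corner p) (proj₁ (proj₁ (∈-pieces⁻ p∈))) (corner-lex {p} p∈)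

    corner-injective : ∀ {p p'} → p ∈ pieces → p' ∈ pieces → corner p ≡ corner p' → p ≡ p'
    corner-injective {p@(σ , e , g)} {p'@(σ' , e' , g')} p∈ p'∈ eq = go (S⁻.sel-unique (ι (corner p)) (proj₁ (∈-pieces⁻ p∈)) (proj₁ (∈-pieces⁻ p'∈)) (corner-lex {p} p∈)
        (subst (λ w → S⁻.LexIn σ' (ι w)) (sym eq) (corner-lex {p'} p'∈)))
      where
      go : σ ≡ σ' → p ≡ p'
      go refl = fin (trans (sym (⊖⊖ (residue p) (lin (maskZ σ)))) (trans (cong (lin (maskZ σ) ⊖_) eq) (⊖⊖ (residue p') (lin (maskZ σ)))))
        where
        fin : residue p ≡ residue p' → p ≡ p'
        fin refl = refl

    corner-height : ∀ {p} → p ∈ pieces → ∀ m → deg p ℕ.+ m ≡ D → lookup (corner p) zero ≡ ℤ.+ m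
    corner-height {p} p∈ m eq = toℚ-injective (begin
      ι (corner p) zero ≡⟨ ι-⊖ (lin (maskZ (proj₁ p))) (residue p) zero ⟩
      ι (lin (maskZ (proj₁ p))) zero - toℚ (ℤ.+ deg p) ≡⟨ cong (_- toℚ (ℤ.+ deg p)) (trans (lin-height (maskZ (proj₁ p))) (trans (sum-maskZ (proj₁ p)) (cong (λ t → toℚ (ℤ.+ t)) (trans (proj₂ (proj₁ (proj₁ (∈-pieces⁻ p∈)))) (sym eq))))) ⟩
      toℚ (ℤ.+ (deg p ℕ.+ m)) - toℚ (ℤ.+ deg p) ≡⟨ cong (_- toℚ (ℤ.+ deg p)) (trans (cong toℚ (ℤP.pos-+ (deg p) m)) (toℚ-+ (ℤ.+ deg p) (ℤ.+ m))) ⟩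
      toℚ (ℤ.+ deg p) + toℚ (ℤ.+ m) - toℚ (ℤ.+ deg p) ≡⟨ solve 2 (λ a b → a :+ b :- a := b) refl (toℚ (ℤ.+ deg p)) (toℚ (ℤ.+ m)) ⟩
      toℚ (ℤ.+ m) ∎)
      where open ≡-Reasoning

    length-filter-mult : ∀ s → length (filter (λ p → deg p ℕ.≟ s) pieces) ≡ mult degs s
    length-filter-mult s = go pieces
      where
      go : ∀ ps → length (filter (λ p → deg p ℕ.≟ s) ps) ≡ mult (map deg ps) s
      go [] = refl
      go (p ∷ ps) = step (deg p ℕ.≟ s)
        where
        step : Dec (deg p ≡ s) → length (filter (λ p → deg p ℕ.≟ s) (p ∷ ps)) ≡ mult (map deg (p ∷ ps)) s
        step (yes e) = trans (cong length (ListP.filter-accept (λ p → deg p ℕ.≟ s) e)) (cong₂ ℕ._+_ (sym (trans (cong (λ t → ind t s) e) (ind-refl s))) (go ps))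
        step (no ne) = trans (cong length (ListP.filter-reject (λ p → deg p ℕ.≟ s) ne)) (trans (go ps) (cong (ℕ._+ mult (map deg ps) s) (sym (ind-≢ ne))))

    interior-points : ∀ s m → s ℕ.+ m ≡ D → ∃ λ (ws : List (Vec ℤ D)) → Unique ws × (∀ {w} → w ∈ ws → Interior w × lookup w zero ≡ ℤ.+ m) × length ws ≡ mult degs s
    interior-points s m eq = map corner ps , unique-map (λ p∈ q∈ → corner-injective (sub p∈) (sub q∈)) (UP.filter⁺ P? unique-pieces) , prop ,
        trans (ListP.length-map corner ps) (length-filter-mult s)
      where
      P? : ∀ p → Dec (deg p ≡ s)
      P? p = deg p ℕ.≟ s
      ps : List Piece
      ps = filter P? pieces
      sub : ∀ {p} → p ∈ ps → p ∈ pieces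
      sub p∈ = proj₁ (∈-filter⁻ P? p∈)
      prop : ∀ {w} → w ∈ map corner ps → Interior w × lookup w zero ≡ ℤ.+ m
      prop {w} w∈ = go (∈-map⁻ corner w∈)
        where
        go : (∃ λ p → p ∈ ps × w ≡ corner p) → Interior w × lookup w zero ≡ ℤ.+ m
        go (p , p∈ , refl) = corner-interior {p} (sub p∈) , corner-height {p} (sub p∈) m (trans (cong (ℕ._+ m) (proj₂ (∈-filter⁻ P? {xs = pieces} p∈))) eq)

  -- From the δ-polynomial to the degrees of the pieces

  record VolumeFive : Set where
    constructor volumeFive
    field
      family : SpanningFamily
    open SpanningFamily family public
    field
      i₁ i₂ i₃ i₄ : ℕ
      hd : HasDelta vs (hpoly i₁ i₂ i₃ i₄)

  module Ehrhart (𝓥 : VolumeFive) where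
    open VolumeFive 𝓥
    private
      L : ℕ → ℕ
      L = proj₁ hd
      counted : ∀ n → LatticeCount vs (suc n) (L (suc n))
      counted = proj₁ (proj₂ (proj₂ hd))

    pts : ℕ → List (Point d)
    pts zero = Vec.replicate d (ℤ.+ 0) ∷ []
    pts (suc n) = proj₁ (counted n)

    pts-unique : ∀ n → Unique (pts n)
    pts-unique zero = [] ∷ []
    pts-unique (suc n) = proj₁ (proj₂ (counted n))

    private
      origin : Fin d → ℚ
      origin j = ι (Vec.replicate d (ℤ.+ 0)) j
      origin-0 : ∀ j → origin j ≡ 0ℚ
      origin-0 j = cong toℚ (VecP.lookup-replicate j (ℤ.+ 0))

      dilate-0⁺ : InDilate vs 0 (Vec.replicate d (ℤ.+ 0))
      dilate-0⁺ = (λ _ → 0ℚ) , (λ _ → ≤-refl) , Σ-0 {N} {λ _ → 0ℚ} (λ _ → refl) , λ j → trans (Σ-0 (λ i → *-zeroˡ (toℚ (lookup (lookup vs i) j)))) (sym (origin-0 j))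

      dilate-0⁻ : ∀ {x} → InDilate vs 0 x → x ≡ Vec.replicate d (ℤ.+ 0)
      dilate-0⁻ {x} (c , c≥0 , s , h) = ι-injective λ j → trans (sym (h j)) (trans (Σ-0 (λ i → trans (cong (_* toℚ (lookup (lookup vs i) j)) (c0 i)) (*-zeroˡ (toℚ (lookup (lookup vs i) j))))) (sym (origin-0 j)))
        where
        c0 : ∀ i → c i ≡ 0ℚ
        c0 i with trichotomy (c i)
        ... | inj₁ lt = ⊥-elim (<⇒≱ lt (c≥0 i))
        ... | inj₂ (inj₁ e) = e
        ... | inj₂ (inj₂ gt) = ⊥-elim (<-irrefl (sym s) (Σ->0 c≥0 i gt))

    pts⇒ : ∀ n {x} → x ∈ pts n → InDilate vs n x
    pts⇒ zero (here refl) = dilate-0⁺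
    pts⇒ (suc n) {x} p = proj₁ (proj₂ (proj₂ (counted n))) x p

    pts⇐ : ∀ n {x} → InDilate vs n x → x ∈ pts n
    pts⇐ zero h = here (dilate-0⁻ h)
    pts⇐ (suc n) {x} h = proj₁ (proj₂ (proj₂ (proj₂ (counted n)))) x h

    open Count (latticePoints family pts pts-unique pts⇒ pts⇐) public

    exponents : List ℕ
    exponents = 0 ∷ i₁ ∷ i₂ ∷ i₃ ∷ i₄ ∷ []

    L≡ : ∀ n → L n ≡ length (pts n)
    L≡ zero = proj₁ (proj₂ hd)
    L≡ (suc n) = sym (proj₂ (proj₂ (proj₂ (proj₂ (counted n)))))

    mult-exponents : ∀ k → mult exponents k ≡ ind 0 k ℕ.+ ind i₁ k ℕ.+ ind i₂ k ℕ.+ ind i₃ k ℕ.+ ind i₄ k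
    mult-exponents k = begin
      ind 0 k ℕ.+ (ind i₁ k ℕ.+ (ind i₂ k ℕ.+ (ind i₃ k ℕ.+ (ind i₄ k ℕ.+ 0)))) ≡⟨ cong (λ t → ind 0 k ℕ.+ (ind i₁ k ℕ.+ (ind i₂ k ℕ.+ (ind i₃ k ℕ.+ t)))) (ℕP.+-identityʳ (ind i₄ k)) ⟩
      ind 0 k ℕ.+ (ind i₁ k ℕ.+ (ind i₂ k ℕ.+ (ind i₃ k ℕ.+ ind i₄ k))) ≡⟨ sym (ℕP.+-assoc (ind 0 k) (ind i₁ k) _) ⟩
      ind 0 k ℕ.+ ind i₁ k ℕ.+ (ind i₂ k ℕ.+ (ind i₃ k ℕ.+ ind i₄ k)) ≡⟨ sym (ℕP.+-assoc (ind 0 k ℕ.+ ind i₁ k) (ind i₂ k) _) ⟩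
      ind 0 k ℕ.+ ind i₁ k ℕ.+ ind i₂ k ℕ.+ (ind i₃ k ℕ.+ ind i₄ k) ≡⟨ sym (ℕP.+-assoc (ind 0 k ℕ.+ ind i₁ k ℕ.+ ind i₂ k) (ind i₃ k) _) ⟩
      ind 0 k ℕ.+ ind i₁ k ℕ.+ ind i₂ k ℕ.+ ind i₃ k ℕ.+ ind i₄ k ∎
      where open ≡-Reasoning

    -- The δ-coefficients are multiplicities in `degs` by counting and multiplicities in `exponents`
    -- by hypothesis, and multiplicities determine a list up to order.
    degs↭ : degs ↭ exponents
    degs↭ = mult⇒↭ degs exponents λ k → ℤP.+-injective (trans (sym (deltaCoef-counts d L degs (λ n → trans (L≡ n) (length-pts n)) k))
      (trans (proj₂ (proj₂ (proj₂ hd)) k) (cong (λ m → ℤ.+ m) (sym (mult-exponents k)))))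

    sum-degs : ∀ f → sum (map f degs) ≡ sum (map f exponents)
    sum-degs f = LA.sum-↭ (PP.map⁺ f degs↭)

    length-pieces : length pieces ≡ 5
    length-pieces = trans (sym (ListP.length-map deg pieces)) (PP.↭-length degs↭)

    length-pts-exponents : ∀ n → length (pts n) ≡ sum (map (λ e → shift (cnt D) e n) exponents)
    length-pts-exponents n = trans (length-pts n) (sum-degs (λ e → shift (cnt D) e n))

  -- Passing to all lattice points as generators

  module _ {d N N' : ℕ} (vs : Vec (Point d) N) (vs' : Vec (Point d) N') where
    private
      module H = Hom vs
      module H' = Hom vs'

    cone-mono : (∀ i → H'.InCone (ι (H.hcol i))) → ∀ {w} → H.InCone w → H'.InCone w
    cone-mono h {w} (y , y≥0 , r) = y' , (λ j → Σ-≥0 (λ i → *-0≤ (y≥0 i) (proj₁ (proj₂ (h i)) j))) , rep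
      where
      z : Fin N → Vecℚ N'
      z i = proj₁ (h i)
      y' : Vecℚ N'
      y' j = sumℚ (λ i → y i * z i j)
      rep : H'.Rep y' w
      rep k = begin
        sumℚ (λ j → H'.A k j * y' j) ≡⟨ Σ-cong (λ j → sym (Σ-*ˡ (H'.A k j) (λ i → y i * z i j))) ⟩
        sumℚ (λ j → sumℚ (λ i → H'.A k j * (y i * z i j))) ≡⟨ Σ-swap (λ j i → H'.A k j * (y i * z i j)) ⟩
        sumℚ (λ i → sumℚ (λ j → H'.A k j * (y i * z i j))) ≡⟨ Σ-cong (λ i → trans (Σ-cong (λ j → solve 3 (λ a b c → a :* (b :* c) := b :* (a :* c)) refl (H'.A k j) (y i) (z i j))) (Σ-*ˡ (y i) (λ j → H'.A k j * z i j))) ⟩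
        sumℚ (λ i → y i * H'.A k ∙ z i) ≡⟨ Σ-cong (λ i → trans (cong (y i *_) (proj₂ (proj₂ (h i)) k)) (*-comm (y i) (H.A k i))) ⟩
        H.A k ∙ y ≡⟨ r k ⟩
        w k ∎
        where open ≡-Reasoning

    span-mono : (∀ i → ∃ λ j → lookup vs' j ≡ lookup vs i) → H.Spanning → H'.Spanning
    span-mono h sp f hf = sp f λ i → trans (Σ-cong (λ k → cong (λ v → f k * toℚ (lookup (ℤ.+ 1 ∷ v) k)) (sym (proj₂ (h i))))) (hf (proj₁ (h i)))

  vertex-cone : ∀ {d N} (vs : Vec (Point d) N) i → Hom.InCone vs (ι (Hom.hcol vs i))
  vertex-cone vs i = δ i , δ≥0 , Hom.rep-δ vs i
    where
    δ≥0 : ∀ k → 0ℚ ≤ δ i k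
    δ≥0 k with i FinP.≟ k
    ... | yes _ = <⇒≤ 0<1ℚ
    ... | no _ = ≤-refl

  lattice-count-transfer : ∀ {d N N'} (vs : Vec (Point d) N) (vs' : Vec (Point d) N') →
    (∀ n x → InDilate vs n x → InDilate vs' n x) → (∀ n x → InDilate vs' n x → InDilate vs n x) →
    ∀ h → HasDelta vs h → HasDelta vs' h
  lattice-count-transfer vs vs' to from h (L , l0 , c , dl) = L , l0 , (λ n → proj₁ (c n) , proj₁ (proj₂ (c n)) , (λ x p → to (suc n) x (proj₁ (proj₂ (proj₂ (c n))) x p)) ,
    (λ x p → proj₁ (proj₂ (proj₂ (proj₂ (c n)))) x (from (suc n) x p)) , proj₂ (proj₂ (proj₂ (proj₂ (c n))))) , dl

  -- All lattice points of the polytope span the same cone, so no dilate changes. Afterwards the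
  -- generators are distinct and exhaust height one, and their number, the Ehrhart count at n = 1,
  -- is a function of the exponents.
  saturate : ∀ {d N} (vs : Vec (Point d) N) → Hom.Spanning vs → ∀ i₁ i₂ i₃ i₄ → HasDelta vs (hpoly i₁ i₂ i₃ i₄) →
    ∃ λ (xs : List (Point d)) → Unique xs × length xs ≡ sum (map (λ e → shift (cnt (suc d)) e 1) (0 ∷ i₁ ∷ i₂ ∷ i₃ ∷ i₄ ∷ [])) ×
      Hom.Spanning (Vec.fromList xs) × HasDelta (Vec.fromList xs) (hpoly i₁ i₂ i₃ i₄)
  saturate {d} {N} vs sp i₁ i₂ i₃ i₄ hd = xs , E.pts-unique 1 , E.length-pts-exponents 1 , span-mono vs vs' occurs sp ,
      lattice-count-transfer vs vs' to from (hpoly i₁ i₂ i₃ i₄) hd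
    where
    module E = Ehrhart (volumeFive (spanningFamily vs sp) i₁ i₂ i₃ i₄ hd)
    module H = Hom vs
    xs : List (Point d)
    xs = E.pts 1
    vs' : Vec (Point d) (length xs)
    vs' = Vec.fromList xs
    module H' = Hom vs'
    in-list : ∀ {x} → x ∈ xs → ∃ λ j → lookup vs' j ≡ x
    in-list {x} p = go xs p
      where
      go : ∀ ys → x ∈ ys → ∃ λ j → lookup (Vec.fromList ys) j ≡ x
      go (y ∷ ys) (here refl) = zero , refl
      go (y ∷ ys) (there q) with go ys q
      ... | j , e = suc j , e
    from-list : ∀ ys j → lookup (Vec.fromList ys) j ∈ ys
    from-list (y ∷ ys) zero = here refl
    from-list (y ∷ ys) (suc j) = there (from-list ys j)
    occurs : ∀ i → ∃ λ j → lookup vs' j ≡ lookup vs i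
    occurs i = in-list (E.pts⇐ 1 (H.cone⇒inDilate {1} {lookup vs i} (vertex-cone vs i)))
    to : ∀ n x → InDilate vs n x → InDilate vs' n x
    to n x h = H'.cone⇒inDilate {n} {x} (cone-mono vs vs' (λ i → subst (λ v → H'.InCone (ι (ℤ.+ 1 ∷ v))) (proj₂ (occurs i)) (vertex-cone vs' (proj₁ (occurs i)))) (H.inDilate⇒cone {n} {x} h))
    from : ∀ n x → InDilate vs' n x → InDilate vs n x
    from n x h = H.cone⇒inDilate {n} {x} (cone-mono vs' vs (λ j → H.inDilate⇒cone {1} {lookup vs' j} (E.pts⇒ 1 (from-list xs j))) (H'.inDilate⇒cone {n} {x} h))

  -- Simplices of normalized volume five

  sumN : ∀ {n} → (Fin n → ℕ) → ℕ
  sumN {zero} f = 0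
  sumN {suc n} f = f zero ℕ.+ sumN (λ i → f (suc i))

  sumN-mono : ∀ {n} {f g : Fin n → ℕ} → (∀ i → f i ℕ.≤ g i) → sumN f ℕ.≤ sumN g
  sumN-mono {zero} h = ℕ.z≤n
  sumN-mono {suc n} h = ℕP.+-mono-≤ (h zero) (sumN-mono (λ i → h (suc i)))

  sumN-cong : ∀ {n} {f g : Fin n → ℕ} → (∀ i → f i ≡ g i) → sumN f ≡ sumN g
  sumN-cong {zero} h = refl
  sumN-cong {suc n} h = cong₂ ℕ._+_ (h zero) (sumN-cong (λ i → h (suc i)))

  sumN-+ : ∀ {n} (f g : Fin n → ℕ) → sumN (λ i → f i ℕ.+ g i) ≡ sumN f ℕ.+ sumN g
  sumN-+ {zero} f g = refl
  sumN-+ {suc n} f g = trans (cong ((f zero ℕ.+ g zero) ℕ.+_) (sumN-+ (λ i → f (suc i)) (λ i → g (suc i)))) (interchange (f zero) (g zero) _ _)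
    where open import Algebra.Properties.CommutativeSemigroup ℕP.+-commutativeSemigroup using (interchange)

  sumN-const : ∀ n c → sumN {n} (λ _ → c) ≡ n ℕ.* c
  sumN-const zero c = refl
  sumN-const (suc n) c = cong (c ℕ.+_) (sumN-const n c)

  toℚ-sumN : ∀ {n} (f : Fin n → ℕ) → toℚ (ℤ.+ sumN f) ≡ sumℚ (λ i → toℚ (ℤ.+ f i))
  toℚ-sumN {zero} f = refl
  toℚ-sumN {suc n} f = trans (cong toℚ (ℤP.pos-+ (f zero) (sumN (λ i → f (suc i))))) (trans (toℚ-+ (ℤ.+ f zero) (ℤ.+ sumN (λ i → f (suc i)))) (cong (toℚ (ℤ.+ f zero) +_) (toℚ-sumN (λ i → f (suc i)))))

  sumN-0 : ∀ {n} (f : Fin n → ℕ) → sumN f ≡ 0 → ∀ i → f i ≡ 0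
  sumN-0 {suc n} f e zero = ℕP.m+n≡0⇒m≡0 (f zero) e
  sumN-0 {suc n} f e (suc i) = sumN-0 (λ i → f (suc i)) (ℕP.m+n≡0⇒n≡0 (f zero) e) i

  sumL : ∀ {A : Set} → (A → ℚ) → List A → ℚ
  sumL f [] = 0ℚ
  sumL f (x ∷ xs) = f x + sumL f xs

  sumL-↭ : ∀ {A : Set} (f : A → ℚ) {xs ys} → xs ↭ ys → sumL f xs ≡ sumL f ys
  sumL-↭ f _↭_.refl = refl
  sumL-↭ f (_↭_.prep x p) = cong (f x +_) (sumL-↭ f p)
  sumL-↭ f {x ∷ y ∷ xs} {_ ∷ _ ∷ ys} (_↭_.swap x y p) = trans (cong (λ t → f x + (f y + t)) (sumL-↭ f p)) (solve 3 (λ a b c → a :+ (b :+ c) := b :+ (a :+ c)) refl (f x) (f y) (sumL f ys))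
  sumL-↭ f (_↭_.trans p q) = trans (sumL-↭ f p) (sumL-↭ f q)

  -- If a box point has coordinate c/5, this is five times the corresponding coordinate of its k-th
  -- multiple in the group.
  rem : ℕ → Fin 5 → ℕ
  rem k c = (k ℕ.* toℕ c) ℕ.% 5

  -- Opposite residues add up to 0 or to 5, and the multiples 1, 4 and 2, 3 are opposite pairs.
  rem-14 : ∀ c → rem 1 c ℕ.+ rem 4 c ≡ rem 2 c ℕ.+ rem 3 c
  rem-14 = from-yes (FinP.all? λ c → rem 1 c ℕ.+ rem 4 c ℕ.≟ rem 2 c ℕ.+ rem 3 c)

  rem-≤5 : ∀ c → rem 2 c ℕ.+ rem 3 c ℕ.≤ 5
  rem-≤5 = from-yes (FinP.all? λ c → rem 2 c ℕ.+ rem 3 c ℕ.≤? 5)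

  rem-2 : ∀ c → rem 2 c ℕ.≤ rem 1 c ℕ.+ rem 1 c
  rem-2 = from-yes (FinP.all? λ c → rem 2 c ℕ.≤? rem 1 c ℕ.+ rem 1 c)

  rem-3 : ∀ c → rem 3 c ℕ.≤ rem 1 c ℕ.+ rem 2 c
  rem-3 = from-yes (FinP.all? λ c → rem 3 c ℕ.≤? rem 1 c ℕ.+ rem 2 c)

  rem-4 : ∀ c → rem 4 c ℕ.≤ rem 1 c ℕ.+ rem 3 c
  rem-4 = from-yes (FinP.all? λ c → rem 4 c ℕ.≤? rem 1 c ℕ.+ rem 3 c)

  rem-4' : ∀ c → rem 4 c ℕ.≤ rem 2 c ℕ.+ rem 2 c
  rem-4' = from-yes (FinP.all? λ c → rem 4 c ℕ.≤? rem 2 c ℕ.+ rem 2 c)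

  rem-injective? : Dec (∀ c → toℕ c ≢ 0 → ∀ (k l : Fin 5) → rem (toℕ k) c ≡ rem (toℕ l) c → k ≡ l)
  rem-injective? = FinP.all? λ c → ¬? (toℕ c ℕ.≟ 0) →-dec FinP.all? λ k → FinP.all? λ l → (rem (toℕ k) c ℕ.≟ rem (toℕ l) c) →-dec (k FinP.≟ l)

  rem-injective : ∀ c → toℕ c ≢ 0 → ∀ (k l : Fin 5) → rem (toℕ k) c ≡ rem (toℕ l) c → k ≡ l
  rem-injective = toWitness {a? = rem-injective?} _

  sorted-unique : ∀ {a b c a' b' c'} → a ℕ.≤ b → b ℕ.≤ c → a' ℕ.≤ b' → b' ℕ.≤ c' → a ∷ b ∷ c ∷ [] ↭ a' ∷ b' ∷ c' ∷ [] → a ≡ a' × b ≡ b' × c ≡ c'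
  sorted-unique p q p' q' perm with SP.↗↭↗⇒≋ ℕP.≤-totalOrder (p ∷ q ∷ [-]) (p' ∷ q' ∷ [-]) (↭⇒↭ₛ perm)
  ... | e₁ ∷ e₂ ∷ e₃ ∷ [] = e₁ , e₂ , e₃

  cond0-intro : ∀ d i₁ i₂ i₃ i₄ → i₁ ℕ.+ i₄ ≡ i₂ ℕ.+ i₃ → i₂ ℕ.+ i₃ ℕ.≤ suc d → i₂ ℕ.≤ i₁ ℕ.+ i₁ → i₃ ℕ.≤ i₁ ℕ.+ i₂ → i₄ ℕ.≤ i₁ ℕ.+ i₃ → i₄ ℕ.≤ i₂ ℕ.+ i₂ → Cond0 d i₁ i₂ i₃ i₄
  cond0-intro d i₁ i₂ i₃ i₄ a b c₁₁ c₁₂ c₁₃ c₂₂ = a , b , pairs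
    where
    pairs : (k ℓ : ℕ) → 1 ℕ.≤ k → k ℕ.≤ ℓ → k ℕ.+ ℓ ℕ.≤ 4 → iseq i₁ i₂ i₃ i₄ (k ℕ.+ ℓ) ℕ.≤ iseq i₁ i₂ i₃ i₄ k ℕ.+ iseq i₁ i₂ i₃ i₄ ℓ
    pairs 1 1 _ _ _ = c₁₁
    pairs 1 2 _ _ _ = c₁₂
    pairs 1 3 _ _ _ = c₁₃
    pairs 2 2 _ _ _ = c₂₂
    pairs 1 (suc (suc (suc (suc ℓ)))) _ _ (ℕ.s≤s (ℕ.s≤s (ℕ.s≤s (ℕ.s≤s ()))))
    pairs 2 (suc (suc (suc ℓ))) _ _ (ℕ.s≤s (ℕ.s≤s (ℕ.s≤s (ℕ.s≤s ()))))
    pairs (suc (suc (suc k))) (suc (suc ℓ)) _ _ le = ⊥-elim (ℕP.<⇒≱ (ℕ.s≤s (ℕ.s≤s (ℕ.s≤s (ℕP.≤-trans (ℕ.s≤s (ℕ.s≤s ℕ.z≤n)) (ℕP.m≤n+m (suc (suc ℓ)) k))))) le)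
    pairs 2 0 _ () _
    pairs 2 1 _ (ℕ.s≤s ()) _
    pairs (suc (suc (suc k))) 0 _ () _
    pairs (suc (suc (suc k))) 1 _ (ℕ.s≤s ()) _

  -- The degrees of the multiples need not be sorted. As i₁ is the least, i₁ + e₄ = e₂ + e₃ makes e₄
  -- the largest, so only e₂ and e₃ may have to be exchanged; the exchanged inequalities follow from
  -- i₁ ≤ i₂ and the given ones.
  cyclic⇒Cond0 : ∀ d i₁ i₂ i₃ i₄ e₂ e₃ e₄ → i₁ ℕ.≤ i₂ → i₂ ℕ.≤ i₃ → i₃ ℕ.≤ i₄ → i₂ ∷ i₃ ∷ i₄ ∷ [] ↭ e₂ ∷ e₃ ∷ e₄ ∷ [] →
    i₁ ℕ.+ e₄ ≡ e₂ ℕ.+ e₃ → e₂ ℕ.+ e₃ ℕ.≤ suc d → e₂ ℕ.≤ i₁ ℕ.+ i₁ → e₃ ℕ.≤ i₁ ℕ.+ e₂ → e₄ ℕ.≤ i₁ ℕ.+ e₃ → e₄ ℕ.≤ e₂ ℕ.+ e₂ → Cond0 d i₁ i₂ i₃ i₄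
  cyclic⇒Cond0 d i₁ i₂ i₃ i₄ e₂ e₃ e₄ h₁ h₂ h₃ perm sum≡ sum≤ l₂ l₃ l₄ l₄' = go (ℕP.≤-total e₂ e₃)
    where
    i₁≤ : ∀ {e} → e ∈ e₂ ∷ e₃ ∷ e₄ ∷ [] → i₁ ℕ.≤ e
    i₁≤ e∈ with PP.∈-resp-↭ (↭-sym perm) e∈
    ... | here refl = h₁
    ... | there (here refl) = ℕP.≤-trans h₁ h₂
    ... | there (there (here refl)) = ℕP.≤-trans h₁ (ℕP.≤-trans h₂ h₃)
    e₂≤e₄ : e₂ ℕ.≤ e₄
    e₂≤e₄ = ℕP.+-cancelˡ-≤ i₁ e₂ e₄ (subst (i₁ ℕ.+ e₂ ℕ.≤_) (trans (ℕP.+-comm e₃ e₂) (sym sum≡)) (ℕP.+-monoˡ-≤ e₂ (i₁≤ (there (here refl)))))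
    e₃≤e₄ : e₃ ℕ.≤ e₄
    e₃≤e₄ = ℕP.+-cancelˡ-≤ i₁ e₃ e₄ (subst (i₁ ℕ.+ e₃ ℕ.≤_) (sym sum≡) (ℕP.+-monoˡ-≤ e₃ (i₁≤ (here refl))))
    build = cond0-intro d i₁ i₂ i₃ i₄
    go : e₂ ℕ.≤ e₃ ⊎ e₃ ℕ.≤ e₂ → Cond0 d i₁ i₂ i₃ i₄
    go (inj₁ le) with sorted-unique h₂ h₃ le e₃≤e₄ perm
    ... | refl , refl , refl = build sum≡ sum≤ l₂ l₃ l₄ l₄'
    go (inj₂ le) with sorted-unique h₂ h₃ le e₂≤e₄ (↭-trans perm (_↭_.swap e₂ e₃ _↭_.refl))
    ... | refl , refl , refl = build (trans sum≡ (ℕP.+-comm e₂ e₃)) (subst (ℕ._≤ suc d) (ℕP.+-comm e₂ e₃) sum≤) (ℕP.≤-trans h₂ l₂)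
        (ℕP.≤-trans l₂ (ℕP.+-monoʳ-≤ i₁ h₁)) (ℕP.≤-trans l₄ (ℕP.+-monoʳ-≤ i₁ h₂)) (ℕP.≤-trans l₄ (ℕP.+-monoˡ-≤ e₃ h₁))

  record SimplexFive : Set where
    constructor simplexFive
    field
      {d} : ℕ
      vs : Vec (Point d) (suc d)
      span : Hom.Spanning vs
      i₁ i₂ i₃ i₄ : ℕ
      1≤i₁ : 1 ℕ.≤ i₁
      hd : HasDelta vs (hpoly i₁ i₂ i₃ i₄)

  module Simplex (𝓢 : SimplexFive) where
    open SimplexFive 𝓢
    open Ehrhart (volumeFive (spanningFamily vs span) i₁ i₂ i₃ i₄ hd)

    abstract
      full-basis : ∃ λ σ → Basis σ
      full-basis = proj₁ e , proj₁ (proj₂ e)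
        where
        none : Mask D
        none = Vec.replicate D false
        e : ∃ λ σ → Basis σ × (∀ i → lookup none i ≡ true → lookup σ i ≡ true)
        e = extend span (D ℕ.∸ size none) none (ℕP.m∸n+n≡m (size≤ none)) (λ y s _ i → s i (VecP.lookup-replicate i false))

    F : Mask D
    F = proj₁ full-basis

    F-basis : Basis F
    F-basis = proj₂ full-basis

    F-all : ∀ i → lookup F i ≡ true
    F-all = size-full F (proj₂ F-basis)

    F-InT : InT F
    F-InT = F-basis , λ i e → ⊥-elim (true≢false (F-all i) e)

    -- With respect to all vertices q has the positive coordinates γ. Hence every interval is [0,
    -- 1), and the box represents the lattice modulo the vertices.
    F-sgn : ∀ j → sgn F j ≡ true
    F-sgn j with sgn F j in e
    ... | true = refl
    ... | false = ⊥-elim (sgn-false F j e (subst (0ℚ <_) (coord-unique {F} {γ} F-basis (λ i e' → ⊥-elim (true≢false (F-all i) e')) (λ _ → refl) j) (γ-pos j)))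

    piece-mask : ∀ {p} → p ∈ pieces → proj₁ p ≡ F
    piece-mask {σ , e , g} p∈ = mask-ext λ i → trans (size-full σ (proj₂ (proj₁ (proj₁ (∈-pieces⁻ p∈)))) i) (sym (F-all i))

    lam : Vec ℤ D → Fin D → ℚ
    lam w j = coord F (ι w) j

    piece-box : ∀ {p} → p ∈ pieces → InBox F (residue p)
    piece-box {σ , e , g} p∈ = subst (λ s → InBox s (ℤ.+ e ∷ g)) (piece-mask p∈) (proj₂ (∈-pieces⁻ p∈))

    box-lam : ∀ w → InBox F w → ∀ j → 0ℚ ≤ lam w j × lam w j < 1ℚ
    box-lam w h j = subst (λ b → HO b (lam w j)) (F-sgn j) (h j (F-all j))

    all-supp : ∀ (z : Vec ℤ D) → Supp F (ι z)
    all-supp z i e = ⊥-elim (true≢false (F-all i) e)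

    floorOf : Vec ℤ D → Vec ℤ D
    floorOf w = proj₁ (normalize {F} F-basis w)

    abstract
      reduce-spec : ∀ w → ∃ λ p → p ∈ pieces × residue p ≡ w ⊖ lin (floorOf w) × proj₁ p ≡ F
      reduce-spec w = box-piece {F} F-InT (proj₂ (proj₂ (normalize {F} F-basis w)))

    reduce : Vec ℤ D → Piece
    reduce w = proj₁ (reduce-spec w)

    reduce-∈ : ∀ w → reduce w ∈ pieces
    reduce-∈ w = proj₁ (proj₂ (reduce-spec w))

    reduce-residue : ∀ w → residue (reduce w) ≡ w ⊖ lin (floorOf w)
    reduce-residue w = proj₁ (proj₂ (proj₂ (reduce-spec w)))

    lam-reduce : ∀ w j → lam (residue (reduce w)) j ≡ lam w j - ι (floorOf w) j
    lam-reduce w j = trans (cong (λ v → lam v j) (reduce-residue w)) (trans (coord-⊖ F-basis w (lin (floorOf w)) j) (cong (λ t → lam w j - t) (coord-lin F-basis (floorOf w) (all-supp (floorOf w)) j)))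

    residue-injective : ∀ {p p'} → p ∈ pieces → p' ∈ pieces → residue p ≡ residue p' → p ≡ p'
    residue-injective {σ , e , g} {σ' , e' , g'} p∈ p'∈ eq = go (trans (piece-mask p∈) (sym (piece-mask p'∈))) eq
      where
      go : σ ≡ σ' → (ℤ.+ e ∷ g) ≡ (ℤ.+ e' ∷ g') → (σ , e , g) ≡ (σ' , e' , g')
      go refl refl = refl

    -- Addition of x in the quotient group, as a permutation of its five representatives.
    module Translate (x : Piece) (x∈ : x ∈ pieces) where

      τ : Piece → Piece
      τ p = reduce (residue p ⊕ residue x)

      lam-τ : ∀ p j → lam (residue (τ p)) j ≡ lam (residue p) j + lam (residue x) j - ι (floorOf (residue p ⊕ residue x)) j
      lam-τ p j = trans (lam-reduce (residue p ⊕ residue x) j) (cong (_- ι (floorOf (residue p ⊕ residue x)) j) (coord-⊕ F-basis (residue p) (residue x) j))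

      τ-injective : ∀ {p p'} → p ∈ pieces → p' ∈ pieces → τ p ≡ τ p' → p ≡ p'
      τ-injective {p} {p'} p∈ p'∈ eq = residue-injective p∈ p'∈ (proj₁ (split-unique F-basis (floorOf w') (floorOf w) (piece-box p∈) (piece-box p'∈) (all-supp (floorOf w')) (all-supp (floorOf w))
          (coord-determines F-basis λ j _ → begin
            lam (residue p ⊕ lin (floorOf w')) j ≡⟨ trans (coord-⊕ F-basis (residue p) (lin (floorOf w')) j) (cong (a j +_) (coord-lin F-basis (floorOf w') (all-supp (floorOf w')) j)) ⟩
            a j + ι (floorOf w') j ≡⟨ solve 4 (λ a c f f' → a :+ f' := (a :+ c :- f) :+ f :+ f' :- c) refl (a j) (c j) (ι (floorOf w) j) (ι (floorOf w') j) ⟩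
            (a j + c j - ι (floorOf w) j) + ι (floorOf w) j + ι (floorOf w') j - c j ≡⟨ cong (λ t → t + ι (floorOf w) j + ι (floorOf w') j - c j) (trans (sym (lam-τ p j)) (trans (cong (λ r → lam (residue r) j) eq) (lam-τ p' j))) ⟩
            (a' j + c j - ι (floorOf w') j) + ι (floorOf w) j + ι (floorOf w') j - c j ≡⟨ solve 4 (λ a c f f' → (a :+ c :- f') :+ f :+ f' :- c := a :+ f) refl (a' j) (c j) (ι (floorOf w) j) (ι (floorOf w') j) ⟩
            a' j + ι (floorOf w) j ≡⟨ sym (trans (coord-⊕ F-basis (residue p') (lin (floorOf w)) j) (cong (a' j +_) (coord-lin F-basis (floorOf w) (all-supp (floorOf w)) j))) ⟩
            lam (residue p' ⊕ lin (floorOf w)) j ∎)))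
        where
        open ≡-Reasoning
        w = residue p ⊕ residue x
        w' = residue p' ⊕ residue x
        a a' c : Fin D → ℚ
        a = lam (residue p)
        a' = lam (residue p')
        c = lam (residue x)

      τ-perm : pieces ↭ map τ pieces
      τ-perm = unique⊆≥⇒↭ (unique-map τ-injective unique-pieces) sub (ℕP.≤-reflexive (sym (ListP.length-map τ pieces)))
        where
        sub : ∀ {z} → z ∈ map τ pieces → z ∈ pieces
        sub {z} z∈ = go (∈-map⁻ τ z∈)
          where
          go : (∃ λ p → p ∈ pieces × z ≡ τ p) → z ∈ pieces
          go (p , _ , e) = subst (_∈ pieces) (sym e) (reduce-∈ (residue p ⊕ residue x))

      -- summing the coordinates over a translate of the group shows that 5x is integral
      five : ∀ j → ∃ λ m → toℚ (ℤ.+ 5) * lam (residue x) j ≡ toℚ m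
      five j = proj₁ (go pieces) , trans (cong (λ n → toℚ (ℤ.+ n) * c) (sym length-pieces)) (trans (sym (shiftEq (length pieces))) (proj₂ (go pieces)))
        where
        c : ℚ
        c = lam (residue x) j
        f : Piece → ℚ
        f p = lam (residue p) j
        S : ℚ
        S = sumL f pieces
        perm-sum : sumL f (map τ pieces) ≡ S
        perm-sum = sym (sumL-↭ f τ-perm)
        go : ∀ ps → ∃ λ m → sumL f ps + toℚ (ℤ.+ length ps) * c - sumL f (map τ ps) ≡ toℚ m
        go [] = ℤ.+ 0 , solve 1 (λ c → con 0ℚ :+ con 0ℚ :* c :- con 0ℚ := con 0ℚ) refl c
        go (p ∷ ps) = proj₁ r ℤ.+ k , (begin
          (f p + sumL f ps) + toℚ (ℤ.+ suc (length ps)) * c - (f (τ p) + sumL f (map τ ps)) ≡⟨ cong₂ (λ u v → (f p + sumL f ps) + u * c - (v + sumL f (map τ ps))) (toℚ-+ (ℤ.+ 1) (ℤ.+ length ps)) (lam-τ p j) ⟩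
          (f p + sumL f ps) + (1ℚ + toℚ (ℤ.+ length ps)) * c - ((f p + c - toℚ k) + sumL f (map τ ps)) ≡⟨ solve 6 (λ a s n c k t → (a :+ s) :+ (con 1ℚ :+ n) :* c :- ((a :+ c :- k) :+ t) := (s :+ n :* c :- t) :+ k) refl (f p) (sumL f ps) (toℚ (ℤ.+ length ps)) c (toℚ k) (sumL f (map τ ps)) ⟩
          (sumL f ps + toℚ (ℤ.+ length ps) * c - sumL f (map τ ps)) + toℚ k ≡⟨ cong (_+ toℚ k) (proj₂ r) ⟩
          toℚ (proj₁ r) + toℚ k ≡⟨ sym (toℚ-+ (proj₁ r) k) ⟩
          toℚ (proj₁ r ℤ.+ k) ∎)
          where
          open ≡-Reasoning
          r = go ps
          k = lookup (floorOf (residue p ⊕ residue x)) j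
        shiftEq : ∀ n → S + toℚ (ℤ.+ n) * c - sumL f (map τ pieces) ≡ toℚ (ℤ.+ n) * c
        shiftEq n = trans (cong (λ t → S + toℚ (ℤ.+ n) * c - t) perm-sum) (solve 2 (λ s c → s :+ c :- s := c) refl S (toℚ (ℤ.+ n) * c))

    mod5 : ∀ a t z → t ℕ.< 5 → ℤ.+ a ≡ ℤ.+ t ℤ.+ ℤ.+ 5 ℤ.* z → t ≡ a ℕ.% 5
    mod5 a t (ℤ.+ n) lt e = trans (sym (DM.m<n⇒m%n≡m lt)) (trans (sym (DM.[m+kn]%n≡m%n t n 5)) (cong (ℕ._% 5) (ℤP.+-injective (trans (trans (ℤP.pos-+ t (n ℕ.* 5)) (cong (λ z → ℤ.+ t ℤ.+ z) (trans (cong (λ m → ℤ.+ m) (ℕP.*-comm n 5)) (ℤP.pos-* 5 n)))) (sym e)))))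
    mod5 a t (ℤ.-[1+ n ]) lt e = ⊥-elim (ℕP.<⇒≱ lt (subst (5 ℕ.≤_) t≡ (ℕP.≤-trans (ℕP.m≤m*n 5 (suc n)) (ℕP.m≤n+m (5 ℕ.* suc n) a))))
      where
      t≡ : a ℕ.+ 5 ℕ.* suc n ≡ t
      t≡ = ℤP.+-injective (trans (ℤP.pos-+ a (5 ℕ.* suc n)) (trans (cong₂ ℤ._+_ e (ℤP.pos-* 5 (suc n)))
        (Z.solve 3 (λ t f n → (t Z.:+ f Z.:* (Z.:- n)) Z.:+ f Z.:* n Z.:= t) refl (ℤ.+ t) (ℤ.+ 5) (ℤ.+ suc n))))

    fifths : ∀ m p → toℚ (ℤ.+ 5) * p ≡ toℚ m → 0ℚ ≤ p → p < 1ℚ → ∃ λ t → m ≡ ℤ.+ t × t ℕ.< 5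
    fifths m p e lo up = go m (toℚ-cancel-≤ {ℤ.+ 0} {m} (subst (0ℚ ≤_) e (*-0≤ 0≤5 lo)))
        (toℚ-cancel-< {m} {ℤ.+ 5} (subst₂ _<_ e (*-identityʳ (toℚ (ℤ.+ 5))) (*-monoʳ-<-pos (toℚ (ℤ.+ 5)) up)))
      where
      0≤5 : 0ℚ ≤ toℚ (ℤ.+ 5)
      0≤5 = toℚ-mono-≤ {ℤ.+ 0} {ℤ.+ 5} (ℤ.+≤+ ℕ.z≤n)
      go : ∀ m → ℤ.+ 0 ℤ.≤ m → m ℤ.< ℤ.+ 5 → ∃ λ t → m ≡ ℤ.+ t × t ℕ.< 5
      go (ℤ.+ t) _ lt = t , refl , ℤP.drop‿+<+ lt

    rem-1 : ∀ c → rem 1 c ≡ toℕ c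
    rem-1 = from-yes (FinP.all? λ c → rem 1 c ℕ.≟ toℕ c)

    -- A box point of degree i₁ ≥ 1 is nonzero and generates the group of prime order 5; `e k` will
    -- be the degree of its k-th multiple.
    module Generator (x : Piece) (x∈ : x ∈ pieces) (deg-x : deg x ≡ i₁) where
      open Translate x x∈ using (five)

      abstract
        digit : ∀ j → ∃ λ (c : Fin 5) → toℚ (ℤ.+ 5) * lam (residue x) j ≡ toℚ (ℤ.+ toℕ c)
        digit j = fromℕ< (proj₂ (proj₂ t)) , trans (proj₂ (five j)) (cong toℚ (trans (proj₁ (proj₂ t)) (cong (λ m → ℤ.+ m) (sym (FinP.toℕ-fromℕ< (proj₂ (proj₂ t)))))))
          where
          t : ∃ λ t → proj₁ (five j) ≡ ℤ.+ t × t ℕ.< 5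
          t = fifths (proj₁ (five j)) (lam (residue x) j) (proj₂ (five j)) (proj₁ (box-lam (residue x) (piece-box x∈) j)) (proj₂ (box-lam (residue x) (piece-box x∈) j))

      c : Fin D → Fin 5
      c j = proj₁ (digit j)

      multiple : ℕ → Vec ℤ D
      multiple zero = Vec.replicate D (ℤ.+ 0)
      multiple (suc k) = multiple k ⊕ residue x

      lam-multiple : ∀ k j → lam (multiple k) j ≡ toℚ (ℤ.+ k) * lam (residue x) j
      lam-multiple zero j = trans (sym (coord-unique {F} {λ _ → 0ℚ} F-basis (λ _ _ → refl) (λ i → trans (Σ-0 {D} {λ k → A i k * 0ℚ} (λ k → *-zeroʳ (A i k))) (cong toℚ (sym (VecP.lookup-replicate i (ℤ.+ 0))))) j)) (sym (*-zeroˡ (lam (residue x) j)))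
      lam-multiple (suc k) j = trans (coord-⊕ F-basis (multiple k) (residue x) j) (trans (cong (_+ lam (residue x) j) (lam-multiple k j))
        (trans (solve 2 (λ k l → k :* l :+ l := (con 1ℚ :+ k) :* l) refl (toℚ (ℤ.+ k)) (lam (residue x) j)) (cong (_* lam (residue x) j) (sym (toℚ-+ (ℤ.+ 1) (ℤ.+ k))))))

      pc : ℕ → Piece
      pc k = reduce (multiple k)

      pc∈ : ∀ k → pc k ∈ pieces
      pc∈ k = reduce-∈ (multiple k)

      -- Five times the coordinate is an integer between 0 and 4 congruent to k c, hence the residue
      -- itself.
      lam-pc : ∀ k j → toℚ (ℤ.+ 5) * lam (residue (pc k)) j ≡ toℚ (ℤ.+ rem k (c j))
      lam-pc k j = trans e (cong toℚ (trans (proj₁ (proj₂ t)) (cong (λ m → ℤ.+ m) (mod5 (k ℕ.* toℕ (c j)) (proj₁ t) z (proj₂ (proj₂ t)) tz))))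
        where
        z m : ℤ
        z = lookup (floorOf (multiple k)) j
        m = ℤ.+ (k ℕ.* toℕ (c j)) ℤ.- ℤ.+ 5 ℤ.* z
        e : toℚ (ℤ.+ 5) * lam (residue (pc k)) j ≡ toℚ m
        e = begin
          toℚ (ℤ.+ 5) * lam (residue (pc k)) j ≡⟨ cong (toℚ (ℤ.+ 5) *_) (trans (lam-reduce (multiple k) j) (cong (_- toℚ z) (lam-multiple k j))) ⟩
          toℚ (ℤ.+ 5) * (toℚ (ℤ.+ k) * lam (residue x) j - toℚ z) ≡⟨ solve 4 (λ f k l z → f :* (k :* l :- z) := k :* (f :* l) :- f :* z) refl (toℚ (ℤ.+ 5)) (toℚ (ℤ.+ k)) (lam (residue x) j) (toℚ z) ⟩
          toℚ (ℤ.+ k) * (toℚ (ℤ.+ 5) * lam (residue x) j) - toℚ (ℤ.+ 5) * toℚ z ≡⟨ cong₂ (λ a b → toℚ (ℤ.+ k) * a - b) (proj₂ (digit j)) (sym (toℚ-* (ℤ.+ 5) z)) ⟩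
          toℚ (ℤ.+ k) * toℚ (ℤ.+ toℕ (c j)) - toℚ (ℤ.+ 5 ℤ.* z) ≡⟨ cong (_- toℚ (ℤ.+ 5 ℤ.* z)) (trans (sym (toℚ-* (ℤ.+ k) (ℤ.+ toℕ (c j)))) (cong toℚ (sym (ℤP.pos-* k (toℕ (c j)))))) ⟩
          toℚ (ℤ.+ (k ℕ.* toℕ (c j))) - toℚ (ℤ.+ 5 ℤ.* z) ≡⟨ sym (toℚ-- (ℤ.+ (k ℕ.* toℕ (c j))) (ℤ.+ 5 ℤ.* z)) ⟩
          toℚ m ∎
          where open ≡-Reasoning
        t : ∃ λ t → m ≡ ℤ.+ t × t ℕ.< 5
        t = fifths m (lam (residue (pc k)) j) e (proj₁ (box-lam (residue (pc k)) (piece-box (pc∈ k)) j)) (proj₂ (box-lam (residue (pc k)) (piece-box (pc∈ k)) j))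
        tz : ℤ.+ (k ℕ.* toℕ (c j)) ≡ ℤ.+ proj₁ t ℤ.+ ℤ.+ 5 ℤ.* z
        tz = trans (Z.solve 2 (λ a b → a Z.:= (a Z.:- b) Z.:+ b) refl (ℤ.+ (k ℕ.* toℕ (c j))) (ℤ.+ 5 ℤ.* z)) (cong (ℤ._+ ℤ.+ 5 ℤ.* z) (proj₁ (proj₂ t)))

      five-deg : ∀ {p} → p ∈ pieces → (f : Fin D → ℕ) → (∀ j → toℚ (ℤ.+ 5) * lam (residue p) j ≡ toℚ (ℤ.+ f j)) → 5 ℕ.* deg p ≡ sumN f
      five-deg {p} p∈ f h = ℤP.+-injective (toℚ-injective (begin
        toℚ (ℤ.+ (5 ℕ.* deg p)) ≡⟨ trans (cong toℚ (ℤP.pos-* 5 (deg p))) (toℚ-* (ℤ.+ 5) (ℤ.+ deg p)) ⟩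
        toℚ (ℤ.+ 5) * ι (residue p) zero ≡⟨ cong (toℚ (ℤ.+ 5) *_) (sym (height F-basis (ι (residue p)))) ⟩
        toℚ (ℤ.+ 5) * sumℚ (lam (residue p)) ≡⟨ sym (Σ-*ˡ (toℚ (ℤ.+ 5)) (lam (residue p))) ⟩
        sumℚ (λ j → toℚ (ℤ.+ 5) * lam (residue p) j) ≡⟨ Σ-cong h ⟩
        sumℚ (λ j → toℚ (ℤ.+ f j)) ≡⟨ sym (toℚ-sumN f) ⟩
        toℚ (ℤ.+ sumN f) ∎))
        where open ≡-Reasoning

      e : ℕ → ℕ
      e k = deg (pc k)

      five-e : ∀ k → 5 ℕ.* e k ≡ sumN (λ j → rem k (c j))
      five-e k = five-deg (pc∈ k) (λ j → rem k (c j)) (lam-pc k)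

      five-x : 5 ℕ.* i₁ ≡ sumN (λ j → toℕ (c j))
      five-x = trans (cong (5 ℕ.*_) (sym deg-x)) (five-deg x∈ (λ j → toℕ (c j)) (λ j → proj₂ (digit j)))

      nontrivial : ∃ λ j → toℕ (c j) ≢ 0
      nontrivial = go (FinP.any? (λ j → ¬? (toℕ (c j) ℕ.≟ 0)))
        where
        go : Dec (∃ λ j → toℕ (c j) ≢ 0) → ∃ λ j → toℕ (c j) ≢ 0
        go (yes h) = h
        go (no h) = ⊥-elim (ℕP.<⇒≢ (ℕP.≤-trans 1≤i₁ (ℕP.m≤n*m i₁ 5)) (sym (trans five-x (trans (sumN-cong (λ j → decidable-stable (toℕ (c j) ℕ.≟ 0) (λ ne → h (j , ne)))) (trans (sumN-const D 0) (ℕP.*-zeroʳ D))))))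

      -- Multiples of a nonzero residue modulo the prime 5 are distinct, so one nonzero digit
      -- separates the five elements.
      pc-injective : ∀ {k l : Fin 5} → pc (toℕ k) ≡ pc (toℕ l) → k ≡ l
      pc-injective {k} {l} eq = rem-injective (c j) (proj₂ nontrivial) k l (ℤP.+-injective (toℚ-injective (trans (sym (lam-pc (toℕ k) j)) (trans (cong (λ p → toℚ (ℤ.+ 5) * lam (residue p) j) eq) (lam-pc (toℕ l) j)))))
        where j = proj₁ nontrivial

      pcs : List Piece
      pcs = map (λ k → pc (toℕ k)) (List.allFin 5)

      pieces↭ : pieces ↭ pcs
      pieces↭ = unique⊆≥⇒↭ (UP.map⁺ pc-injective (UP.allFin⁺ 5)) sub (ℕP.≤-reflexive length-pieces)
        where
        sub : ∀ {z} → z ∈ pcs → z ∈ pieces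
        sub {z} z∈ = go (∈-map⁻ (λ k → pc (toℕ k)) z∈)
          where
          go : (∃ λ k → k ∈ List.allFin 5 × z ≡ pc (toℕ k)) → z ∈ pieces
          go (k , _ , eq) = subst (_∈ pieces) (sym eq) (pc∈ (toℕ k))

      e0≡0 : e 0 ≡ 0
      e0≡0 = ℕP.*-cancelˡ-≡ (e 0) 0 5 (trans (five-e 0) (trans (sumN-const D 0) (ℕP.*-zeroʳ D)))

      e1≡i₁ : e 1 ≡ i₁
      e1≡i₁ = ℕP.*-cancelˡ-≡ (e 1) i₁ 5 (trans (five-e 1) (trans (sumN-cong (λ j → rem-1 (c j))) (sym five-x)))

      exponents↭ : exponents ↭ 0 ∷ i₁ ∷ e 2 ∷ e 3 ∷ e 4 ∷ []
      exponents↭ = ↭-trans (↭-sym degs↭) (subst₂ (λ a b → degs ↭ a ∷ b ∷ e 2 ∷ e 3 ∷ e 4 ∷ []) e0≡0 e1≡i₁ (PP.map⁺ deg pieces↭))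

      -- Subadditivity of residues, summed over the coordinates and divided by 5.
      le : ∀ a b k → (∀ c → rem k c ℕ.≤ rem a c ℕ.+ rem b c) → e k ℕ.≤ e a ℕ.+ e b
      le a b k h = ℕP.*-cancelˡ-≤ 5 (subst₂ ℕ._≤_ (sym (five-e k)) (trans (sumN-+ (λ j → rem a (c j)) (λ j → rem b (c j))) (trans (cong₂ ℕ._+_ (sym (five-e a)) (sym (five-e b))) (sym (ℕP.*-distribˡ-+ 5 (e a) (e b))))) (sumN-mono (λ j → h (c j))))

      five-sum : ∀ a b → 5 ℕ.* (e a ℕ.+ e b) ≡ sumN (λ j → rem a (c j) ℕ.+ rem b (c j))
      five-sum a b = trans (ℕP.*-distribˡ-+ 5 (e a) (e b)) (trans (cong₂ ℕ._+_ (five-e a) (five-e b)) (sym (sumN-+ (λ j → rem a (c j)) (λ j → rem b (c j)))))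

      cond0 : i₁ ℕ.≤ i₂ → i₂ ℕ.≤ i₃ → i₃ ℕ.≤ i₄ → Cond0 d i₁ i₂ i₃ i₄
      cond0 h₁ h₂ h₃ = cyclic⇒Cond0 d i₁ i₂ i₃ i₄ (e 2) (e 3) (e 4) h₁ h₂ h₃ (PP.drop-∷ (PP.drop-∷ exponents↭))
        (subst (λ t → t ℕ.+ e 4 ≡ e 2 ℕ.+ e 3) e1≡i₁ (ℕP.*-cancelˡ-≡ (e 1 ℕ.+ e 4) (e 2 ℕ.+ e 3) 5 (trans (five-sum 1 4) (trans (sumN-cong (λ j → rem-14 (c j))) (sym (five-sum 2 3))))))
        -- Each of the d + 1 coordinates contributes at most 5 to five times `e 2` plus `e 3`,
        -- whence the bound d + 1.
        (ℕP.*-cancelˡ-≤ 5 (subst₂ ℕ._≤_ (sym (five-sum 2 3)) (trans (sumN-const D 5) (ℕP.*-comm D 5)) (sumN-mono (λ j → rem-≤5 (c j)))))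
        (subst (λ t → e 2 ℕ.≤ t ℕ.+ t) e1≡i₁ (le 1 1 2 rem-2))
        (subst (λ t → e 3 ℕ.≤ t ℕ.+ e 2) e1≡i₁ (le 1 2 3 rem-3))
        (subst (λ t → e 4 ℕ.≤ t ℕ.+ e 3) e1≡i₁ (le 1 3 4 rem-4))
        (le 2 2 4 rem-4')

    cond0 : i₁ ℕ.≤ i₂ → i₂ ℕ.≤ i₃ → i₃ ℕ.≤ i₄ → Cond0 d i₁ i₂ i₃ i₄
    cond0 = go (∈-map⁻ deg (PP.∈-resp-↭ (↭-sym degs↭) (there (here refl))))
      where
      go : (∃ λ p → p ∈ pieces × i₁ ≡ deg p) → i₁ ℕ.≤ i₂ → i₂ ℕ.≤ i₃ → i₃ ℕ.≤ i₄ → Cond0 d i₁ i₂ i₃ i₄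
      go (p , p∈ , e) = Generator.cond0 p p∈ (sym e)

  -- Stanley's inequalities

  cnt-0 : ∀ D → cnt D 0 ≡ 1
  cnt-0 zero = refl
  cnt-0 (suc D) = cnt-0 D

  cnt-1 : ∀ D → cnt D 1 ≡ D
  cnt-1 zero = refl
  cnt-1 (suc D) = trans (cong₂ ℕ._+_ (cnt-1 D) (cnt-0 D)) (ℕP.+-comm D 1)

  shift-cnt-diag : ∀ D n → shift (cnt D) n n ≡ 1
  shift-cnt-diag D n = trans (shift-≤ (cnt D) (ℕP.≤-refl {n})) (trans (cong (cnt D) (ℕP.n∸n≡0 n)) (cnt-0 D))

  shift-cnt-suc : ∀ D n → shift (cnt D) n (suc n) ≡ D
  shift-cnt-suc D n = trans (shift-≤ (cnt D) (ℕP.n≤1+n n)) (trans (cong (cnt D) (trans (ℕP.+-∸-assoc 1 (ℕP.≤-refl {n})) (cong suc (ℕP.n∸n≡0 n)))) (cnt-1 D))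

  shift-cnt-≤1 : ∀ D e n → n ℕ.≤ e → shift (cnt D) e n ℕ.≤ 1
  shift-cnt-≤1 D e n le = go (ℕP.m≤n⇒m<n∨m≡n le)
    where
    go : n ℕ.< e ⊎ n ≡ e → shift (cnt D) e n ℕ.≤ 1
    go (inj₁ lt) = ℕP.≤-trans (ℕP.≤-reflexive (shift-> (cnt D) lt)) ℕ.z≤n
    go (inj₂ refl) = ℕP.≤-reflexive (shift-cnt-diag D n)

  record DistinctVertices : Set where
    constructor distinctVertices
    field
      polytope : VolumeFive
    open VolumeFive polytope public
    field
      distinct : ∀ {i j} → lookup vs i ≡ lookup vs j → i ≡ j

  module Saturated (𝓢 : DistinctVertices) where
    open DistinctVertices 𝓢
    open Ehrhart polytope public

    vertex-inCone : ∀ i → InCone (ι (hcol i))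
    vertex-inCone i = vertex-cone vs i

    ⊕-cancelˡ : ∀ {n} (u v w : Vec ℤ n) → u ⊕ v ≡ u ⊕ w → v ≡ w
    ⊕-cancelˡ u v w e = ι-injective λ j → trans (solve 2 (λ u v → v := (u :+ v) :- u) refl (ι u j) (ι v j))
      (trans (cong (_- ι u j) (trans (sym (ι-⊕ u v j)) (trans (cong (λ z → ι z j) e) (ι-⊕ u w j)))) (solve 2 (λ u v → (u :+ v) :- u := v) refl (ι u j) (ι w j)))

    hcol-injective : ∀ {i j} → hcol i ≡ hcol j → i ≡ j
    hcol-injective e = distinct (VecP.∷-injectiveʳ e)

    IntAt : ℕ → Vec ℤ D → Set
    IntAt m w = Interior w × lookup w zero ≡ ℤ.+ m

    translate : Vec ℤ D → List (Vec ℤ D)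
    translate w = map (λ i → w ⊕ hcol i) (List.allFin N)

    unique-translate : ∀ w → Unique (translate w)
    unique-translate w = UP.map⁺ (λ {i} {j} e → hcol-injective (⊕-cancelˡ w (hcol i) (hcol j) e)) (UP.allFin⁺ N)

    length-translate : ∀ w → length (translate w) ≡ N
    length-translate w = trans (ListP.length-map (λ i → w ⊕ hcol i) (List.allFin N)) (ListP.length-tabulate {n = N} (λ i → i))

    intAt-⊕ : ∀ {m w} i → IntAt m w → IntAt (suc m) (w ⊕ hcol i)
    intAt-⊕ {m} {w} i (int , h) = interior-+ {w} {hcol i} int (vertex-inCone i) ,
      trans (VecP.lookup-zipWith ℤ._+_ zero w (hcol i)) (trans (cong (ℤ._+ ℤ.+ 1) h) (trans (sym (ℤP.pos-+ m 1)) (cong (λ m → ℤ.+ m) (ℕP.+-comm m 1))))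

    intAt-translate : ∀ {m w} → IntAt m w → ∀ {z} → z ∈ translate w → IntAt (suc m) z
    intAt-translate {m} {w} h {z} z∈ = go (∈-map⁻ (λ i → w ⊕ hcol i) z∈)
      where
      go : (∃ λ i → i ∈ List.allFin N × z ≡ w ⊕ hcol i) → IntAt (suc m) z
      go (i , _ , e) = subst (IntAt (suc m)) (sym e) (intAt-⊕ {m} {w} i h)

    -- The number of interior codes at height m, in terms of the exponents alone.
    bound : ℕ → ℕ
    bound m = sum (map (λ e → shift (cnt D) D (e ℕ.+ m)) exponents)

    interior-≤ : ∀ m ws → Unique ws → (∀ {w} → w ∈ ws → IntAt m w) → length ws ℕ.≤ bound m
    interior-≤ m ws u h = subst (length ws ℕ.≤_) (sum-degs (λ e → shift (cnt D) D (e ℕ.+ m))) (interior-bound m ws u h)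

    -- These are the corners of the pieces of largest degree; r = D - i₄ is their height.
    bottom : ∀ r → i₄ ℕ.+ r ≡ D → ∃ λ (ws : List (Vec ℤ D)) → Unique ws × (∀ {w} → w ∈ ws → IntAt r w) × length ws ≡ mult exponents i₄
    bottom r e = go (interior-points i₄ r e)
      where
      go : (∃ λ (ws : List (Vec ℤ D)) → Unique ws × (∀ {w} → w ∈ ws → IntAt r w) × length ws ≡ mult degs i₄) →
        ∃ λ (ws : List (Vec ℤ D)) → Unique ws × (∀ {w} → w ∈ ws → IntAt r w) × length ws ≡ mult exponents i₄
      go (ws , u , h , l) = ws , u , h , trans l (mult-↭ i₄ degs↭)

    -- One interior point at height r, translated by the N distinct generators, gives N interior
    -- points at height r + 1.
    N≤bound : ∀ r → i₄ ℕ.+ r ≡ D → N ℕ.≤ bound (suc r)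
    N≤bound r e = go (bottom r e)
      where
      go : (∃ λ (ws : List (Vec ℤ D)) → Unique ws × (∀ {w} → w ∈ ws → IntAt r w) × length ws ≡ mult exponents i₄) → N ℕ.≤ bound (suc r)
      go ([] , _ , _ , l) = ⊥-elim (zero≢ (ind 0 i₄) (ind i₁ i₄) (ind i₂ i₄) (ind i₃ i₄) (trans l (cong (λ t → ind 0 i₄ ℕ.+ (ind i₁ i₄ ℕ.+ (ind i₂ i₄ ℕ.+ (ind i₃ i₄ ℕ.+ (t ℕ.+ 0))))) (ind-refl i₄))))
        where
        zero≢ : ∀ a b c d → 0 ≡ a ℕ.+ (b ℕ.+ (c ℕ.+ (d ℕ.+ (1 ℕ.+ 0)))) → ⊥
        zero≢ a b c d z = ℕP.1+n≢0 (ℕP.m+n≡0⇒n≡0 d (ℕP.m+n≡0⇒n≡0 c (ℕP.m+n≡0⇒n≡0 b (ℕP.m+n≡0⇒n≡0 a (sym z)))))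
      go (w ∷ ws , u , h , l) = subst (ℕ._≤ bound (suc r)) (length-translate w) (interior-≤ (suc r) (translate w) (unique-translate w) (λ {z} → intAt-translate {r} {w} (h (here refl)) {z}))

    private
      sh : ℕ → ℕ → ℕ
      sh e m = shift (cnt D) D (e ℕ.+ m)

    -- At height r + 1 the contribution of an exponent e depends on e + 1 - i₄: it is 0 if this is
    -- negative, 1 if it is 0, and D if it is 1. The next two lemmas are the other cases.
    sh-low : ∀ e r → i₄ ℕ.+ r ≡ D → suc (suc e) ℕ.≤ i₄ → shift (cnt D) D (e ℕ.+ suc r) ≡ 0
    sh-low e r eq le = shift-> (cnt D) (subst (e ℕ.+ suc r ℕ.<_) eq (subst (ℕ._< i₄ ℕ.+ r) (sym (ℕP.+-suc e r)) (ℕP.+-monoˡ-≤ r le)))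

    sh-mid : ∀ e r → i₄ ℕ.+ r ≡ D → suc e ℕ.≤ i₄ → shift (cnt D) D (e ℕ.+ suc r) ℕ.≤ 1
    sh-mid e r eq le = shift-cnt-≤1 D D (e ℕ.+ suc r) (subst (e ℕ.+ suc r ℕ.≤_) eq (subst (ℕ._≤ i₄ ℕ.+ r) (sym (ℕP.+-suc e r)) (ℕP.+-monoˡ-≤ r le)))

    sh-top : ∀ r → i₄ ℕ.+ r ≡ D → shift (cnt D) D (i₄ ℕ.+ suc r) ≡ D
    sh-top r eq = trans (cong (shift (cnt D) D) (trans (ℕP.+-suc i₄ r) (cong suc eq))) (shift-cnt-suc D D)

    -- Stanley's inequality h₀ + h₁ ≤ h_s + h_{s-1} when h_s = 1
    stanley₁ : ∀ r → i₄ ℕ.+ r ≡ D → 2 ℕ.≤ i₄ → suc (suc i₁) ℕ.≤ i₄ → suc (suc i₂) ℕ.≤ i₄ → suc i₃ ℕ.≤ i₄ → N ℕ.≤ suc D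
    stanley₁ r eq l₀ l₁ l₂ l₃ = ℕP.≤-trans (N≤bound r eq) (go (sh-low 0 r eq l₀) (sh-low i₁ r eq l₁) (sh-low i₂ r eq l₂) (sh-mid i₃ r eq l₃) (sh-top r eq))
      where
      go : sh 0 (suc r) ≡ 0 → sh i₁ (suc r) ≡ 0 → sh i₂ (suc r) ≡ 0 → sh i₃ (suc r) ℕ.≤ 1 → sh i₄ (suc r) ≡ D → bound (suc r) ℕ.≤ suc D
      go a b c e f = ℕP.≤-trans (ℕP.≤-reflexive (cong₂ ℕ._+_ a (cong₂ ℕ._+_ b (cong₂ ℕ._+_ c (cong (sh i₃ (suc r) ℕ.+_) (trans (ℕP.+-identityʳ _) f)))))) (ℕP.+-monoˡ-≤ D e)

    -- If the coefficient just below the top vanishes as well, only the D from the top exponent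
    -- remains, and there is no room for an extra lattice point.
    stanley₀ : ∀ r → i₄ ℕ.+ r ≡ D → 2 ℕ.≤ i₄ → suc (suc i₁) ℕ.≤ i₄ → suc (suc i₂) ℕ.≤ i₄ → suc (suc i₃) ℕ.≤ i₄ → N ℕ.≤ D
    stanley₀ r eq l₀ l₁ l₂ l₃ = ℕP.≤-trans (N≤bound r eq) (go (sh-low 0 r eq l₀) (sh-low i₁ r eq l₁) (sh-low i₂ r eq l₂) (sh-low i₃ r eq l₃) (sh-top r eq))
      where
      go : sh 0 (suc r) ≡ 0 → sh i₁ (suc r) ≡ 0 → sh i₂ (suc r) ≡ 0 → sh i₃ (suc r) ≡ 0 → sh i₄ (suc r) ≡ D → bound (suc r) ℕ.≤ D
      go a b c e f = ℕP.≤-reflexive (cong₂ ℕ._+_ a (cong₂ ℕ._+_ b (cong₂ ℕ._+_ c (cong₂ ℕ._+_ e (trans (ℕP.+-identityʳ _) f)))))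

    module TwoTranslates (w₀ w₁ : Vec ℤ D) (w₀≢w₁ : w₀ ≢ w₁) where

      -- Generator i has a successor in the direction w₁ - w₀; the two families of translates meet
      -- exactly in such pairs.
      Step : Fin N → Set
      Step i = ∃ λ j → w₀ ⊕ hcol j ≡ w₁ ⊕ hcol i

      step? : ∀ i → Dec (Step i)
      step? i = FinP.any? (λ j → VecP.≡-dec ℤ._≟_ (w₀ ⊕ hcol j) (w₁ ⊕ hcol i))

      tops : List (Fin N)
      tops = filter (λ i → ¬? (step? i)) (List.allFin N)

      dir : Vec ℤ D
      dir = w₁ ⊖ w₀

      step-col : ∀ {i j} → w₀ ⊕ hcol j ≡ w₁ ⊕ hcol i → ∀ k → col j k ≡ col i k + ι dir k
      step-col {i} {j} e k = begin
        col j k ≡⟨ solve 2 (λ u v → v := (u :+ v) :- u) refl (ι w₀ k) (col j k) ⟩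
        ι w₀ k + col j k - ι w₀ k ≡⟨ cong (_- ι w₀ k) (trans (sym (ι-⊕ w₀ (hcol j) k)) (trans (cong (λ z → ι z k) e) (ι-⊕ w₁ (hcol i) k))) ⟩
        ι w₁ k + col i k - ι w₀ k ≡⟨ solve 3 (λ a b c → a :+ b :- c := b :+ (a :- c)) refl (ι w₁ k) (col i k) (ι w₀ k) ⟩
        col i k + (ι w₁ k - ι w₀ k) ≡⟨ cong (col i k +_) (sym (ι-⊖ w₁ w₀ k)) ⟩
        col i k + ι dir k ∎
        where open ≡-Reasoning

      -- With fewer than d chain ends, a nonzero f would kill these ends and the direction w₁ - w₀.
      -- It is then constant along every chain i, i + dir, i + 2 dir, ..., each of which reaches an
      -- end, so f kills all generators, against spanning.
      tops-many : d ℕ.≤ length tops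
      tops-many = ℕP.≮⇒≥ λ lt → absurd (annihilator v (ℕ.s≤s lt))
        where
        v : Fin (suc (length tops)) → Vecℚ D
        v zero = ι dir
        v (suc r) = col (List.lookup tops r)
        dir-coord : ∃ λ k → ι dir k ≢ 0ℚ
        dir-coord with FinP.any? (λ k → ¬? (ι dir k ℚ.≟ 0ℚ))
        ... | yes h = h
        ... | no h = ⊥-elim (w₀≢w₁ (ι-injective λ k → sym (p-q≡0⇒p≡q (ι w₁ k) (ι w₀ k) (trans (sym (ι-⊖ w₁ w₀ k)) (decidable-stable (ι dir k ℚ.≟ 0ℚ) (λ ne → h (k , ne)))))))
        absurd : ¬ (∃ λ f → NonZeroV f × (∀ r → v r ∙ f ≡ 0ℚ))
        absurd (f , (j₀ , nz) , K) = nz (span f (λ i → decidable-stable (f ∙ col i ℚ.≟ 0ℚ) (λ ne → chain i ne)) j₀)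
          where
          k : Fin D
          k = proj₁ dir-coord
          dk : ℚ
          dk = ι dir k
          -- The product of `dk` with coordinate k grows by dk² > 0 at each step of a chain;
          -- minimising its negative finds an end.
          g : Fin N → ℚ
          g i = - (dk * col i k)
          P? : ∀ i → Dec (f ∙ col i ≢ 0ℚ)
          P? i = ¬? (f ∙ col i ℚ.≟ 0ℚ)
          f-top : ∀ i → i ∈ tops → f ∙ col i ≡ 0ℚ
          f-top i i∈ = trans (cong (λ i → f ∙ col i) (proj₂ (idx∈ i∈))) (trans (∙-comm f (col (List.lookup tops (proj₁ (idx∈ i∈))))) (K (suc (proj₁ (idx∈ i∈)))))
            where
            idx∈ : ∀ {xs : List (Fin N)} → i ∈ xs → ∃ λ r → i ≡ List.lookup xs r
            idx∈ (here e) = zero , e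
            idx∈ (there p) = suc (proj₁ (idx∈ p)) , proj₂ (idx∈ p)
          chain : ∀ i → f ∙ col i ≢ 0ℚ → ⊥
          chain i ne = fin (argmin g (filter P? (List.allFin N)) (∈-filter⁺ P? (∈-allFin i) ne))
            where
            fin : (∃ λ m → m ∈ filter P? (List.allFin N) × (∀ {z} → z ∈ filter P? (List.allFin N) → g m ≤ g z)) → ⊥
            fin (m , m∈ , least) = step (step? m)
              where
              fm : f ∙ col m ≢ 0ℚ
              fm = proj₂ (∈-filter⁻ P? {xs = List.allFin N} m∈)
              step : Dec (Step m) → ⊥
              step (no h) = fm (f-top m (∈-filter⁺ (λ i → ¬? (step? i)) (∈-allFin m) h))
              step (yes (j , e)) = <⇒≱ lt (least (∈-filter⁺ P? (∈-allFin j) (λ z → fm (trans (sym fj) z))))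
                where
                fj : f ∙ col j ≡ f ∙ col m
                fj = trans (∙-congʳ f (step-col e)) (trans (∙-+ʳ f (col m) (ι dir)) (trans (cong (f ∙ col m +_) (trans (∙-comm f (ι dir)) (K zero))) (+-identityʳ _)))
                sq : ∀ p → p ≢ 0ℚ → 0ℚ < p * p
                sq p ne with trichotomy p
                ... | inj₁ l = subst (0ℚ <_) (solve 1 (λ p → :- p :* :- p := p :* p) refl p) (*-0< (neg-< l) (neg-< l))
                ... | inj₂ (inj₁ z) = ⊥-elim (ne z)
                ... | inj₂ (inj₂ l) = *-0< l l
                lt : g j < g m
                lt = 0<q-p⇒p<q (subst (0ℚ <_) (sym (trans (cong (λ t → - (dk * col m k) - - (dk * t)) (step-col e k)) (solve 2 (λ d c → :- (d :* c) :- :- (d :* (c :+ d)) := d :* d) refl dk (col m k)))) (sq dk (proj₂ dir-coord)))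

      both : List (Vec ℤ D)
      both = translate w₀ ++ map (λ i → w₁ ⊕ hcol i) tops

      unique-both : Unique both
      unique-both = UP.++⁺ (unique-translate w₀) (UP.map⁺ (λ {i} {j} e → hcol-injective (⊕-cancelˡ w₁ (hcol i) (hcol j) e)) (UP.filter⁺ (λ i → ¬? (step? i)) (UP.allFin⁺ N))) disj
        where
        disj : ∀ {z} → z ∈ translate w₀ × z ∈ map (λ i → w₁ ⊕ hcol i) tops → ⊥
        disj {z} (p , p') = go (∈-map⁻ (λ i → w₀ ⊕ hcol i) p) (∈-map⁻ (λ i → w₁ ⊕ hcol i) p')
          where
          go : (∃ λ j → j ∈ List.allFin N × z ≡ w₀ ⊕ hcol j) → (∃ λ i → i ∈ tops × z ≡ w₁ ⊕ hcol i) → ⊥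
          go (j , _ , e) (i , i∈ , e') = proj₂ (∈-filter⁻ (λ i → ¬? (step? i)) {xs = List.allFin N} i∈) (j , trans (sym e) e')

      both-interior : ∀ {m} → IntAt m w₀ → IntAt m w₁ → ∀ {z} → z ∈ both → IntAt (suc m) z
      both-interior {m} h₀ h₁ {z} z∈ = go (∈-++⁻ (translate w₀) z∈)
        where
        go : z ∈ translate w₀ ⊎ z ∈ map (λ i → w₁ ⊕ hcol i) tops → IntAt (suc m) z
        go (inj₁ p) = intAt-translate {m} {w₀} h₀ p
        go (inj₂ p) = fin (∈-map⁻ (λ i → w₁ ⊕ hcol i) p)
          where
          fin : (∃ λ i → i ∈ tops × z ≡ w₁ ⊕ hcol i) → IntAt (suc m) z
          fin (i , _ , e) = subst (IntAt (suc m)) (sym e) (intAt-⊕ {m} {w₁} i h₁)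

      length-both : N ℕ.+ d ℕ.≤ length both
      length-both = subst (N ℕ.+ d ℕ.≤_) (sym (trans (ListP.length-++ (translate w₀)) (cong₂ ℕ._+_ (length-translate w₀) (ListP.length-map (λ i → w₁ ⊕ hcol i) tops)))) (ℕP.+-monoʳ-≤ N tops-many)

    -- Stanley's inequality when h_s = 2 and h_{s-1} = 0
    stanley₂ : ∀ r → i₄ ℕ.+ r ≡ D → 2 ℕ.≤ i₄ → suc (suc i₁) ℕ.≤ i₄ → suc (suc i₂) ℕ.≤ i₄ → i₃ ≡ i₄ → N ℕ.+ d ℕ.≤ D ℕ.+ D
    stanley₂ r eq l₀ l₁ l₂ e₃ = go (bottom r eq)
      where
      bd : bound (suc r) ≡ D ℕ.+ D
      bd = cong₂ ℕ._+_ (sh-low 0 r eq l₀) (cong₂ ℕ._+_ (sh-low i₁ r eq l₁) (cong₂ ℕ._+_ (sh-low i₂ r eq l₂) (cong₂ ℕ._+_ (trans (cong (λ t → sh t (suc r)) e₃) (sh-top r eq)) (trans (ℕP.+-identityʳ _) (sh-top r eq)))))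
      two : mult exponents i₄ ≡ ind 0 i₄ ℕ.+ (ind i₁ i₄ ℕ.+ (ind i₂ i₄ ℕ.+ 2))
      two = cong (λ t → ind 0 i₄ ℕ.+ (ind i₁ i₄ ℕ.+ (ind i₂ i₄ ℕ.+ t))) (cong₂ ℕ._+_ (trans (cong (λ t → ind t i₄) e₃) (ind-refl i₄)) (cong (ℕ._+ 0) (ind-refl i₄)))
      2≤ : 2 ℕ.≤ mult exponents i₄
      2≤ = subst (2 ℕ.≤_) (sym two) (ℕP.≤-trans (ℕP.m≤n+m 2 (ind i₂ i₄)) (ℕP.≤-trans (ℕP.m≤n+m _ (ind i₁ i₄)) (ℕP.m≤n+m _ (ind 0 i₄))))
      go : (∃ λ (ws : List (Vec ℤ D)) → Unique ws × (∀ {w} → w ∈ ws → IntAt r w) × length ws ≡ mult exponents i₄) → N ℕ.+ d ℕ.≤ D ℕ.+ D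
      go ([] , _ , _ , l) = ⊥-elim (ℕP.<⇒≱ (ℕ.s≤s ℕ.z≤n) (subst (2 ℕ.≤_) (sym l) 2≤))
      go (_ ∷ [] , _ , _ , l) = ⊥-elim (ℕP.<⇒≱ (ℕ.s≤s (ℕ.s≤s ℕ.z≤n)) (subst (2 ℕ.≤_) (sym l) 2≤))
      go (w₀ ∷ w₁ ∷ ws , (ne ∷ _) ∷ _ , h , l) = ℕP.≤-trans length-both (subst (length both ℕ.≤_) bd
          (interior-≤ (suc r) both unique-both (λ {z} → both-interior {r} (h (here refl)) (h (there (here refl))) {z})))
        where open TwoTranslates w₀ w₁ ne

  -- Polytopes with one extra lattice point

  posPart negPart : ℤ → ℕ
  posPart (ℤ.+ n) = n
  posPart (ℤ.-[1+ n ]) = 0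
  negPart (ℤ.+ n) = 0
  negPart (ℤ.-[1+ n ]) = suc n

  toℚ-parts : ∀ z → toℚ z ≡ toℚ (ℤ.+ posPart z) - toℚ (ℤ.+ negPart z)
  toℚ-parts (ℤ.+ n) = sym (+-identityʳ (toℚ (ℤ.+ n)))
  toℚ-parts (ℤ.-[1+ n ]) = trans (toℚ-neg (ℤ.+ suc n)) (sym (+-identityˡ (- toℚ (ℤ.+ suc n))))

  sumN-two : ∀ {n} (f : Fin n → ℕ) i j → i ≢ j → f i ℕ.+ f j ℕ.≤ sumN f
  sumN-two {suc n} f zero zero ne = ⊥-elim (ne refl)
  sumN-two {suc n} f zero (suc j) ne = ℕP.+-monoʳ-≤ (f zero) (sumN-one (λ i → f (suc i)) j)
    where
    sumN-one : ∀ {n} (f : Fin n → ℕ) i → f i ℕ.≤ sumN f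
    sumN-one {suc n} f zero = ℕP.m≤m+n (f zero) _
    sumN-one {suc n} f (suc i) = ℕP.≤-trans (sumN-one (λ i → f (suc i)) i) (ℕP.m≤n+m _ (f zero))
  sumN-two {suc n} f (suc i) zero ne = subst (ℕ._≤ sumN f) (ℕP.+-comm (f zero) (f (suc i))) (sumN-two f zero (suc i) λ ())
  sumN-two {suc n} f (suc i) (suc j) ne = ℕP.≤-trans (sumN-two (λ i → f (suc i)) i j (λ e → ne (cong suc e))) (ℕP.m≤n+m _ (f zero))

  infixr 7 _⊙_
  _⊙_ : ∀ {n} → ℤ → Vec ℤ n → Vec ℤ n
  c ⊙ v = Vec.map (c ℤ.*_) v

  ι-⊙ : ∀ {n} c (v : Vec ℤ n) i → ι (c ⊙ v) i ≡ toℚ c * ι v i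
  ι-⊙ c v i = trans (cong toℚ (VecP.lookup-map i (c ℤ.*_) v)) (toℚ-* c (lookup v i))

  lookup-⊙ : ∀ {n} c (v : Vec ℤ n) i → lookup (c ⊙ v) i ≡ c ℤ.* lookup v i
  lookup-⊙ c v i = VecP.lookup-map i (c ℤ.*_) v

  lookup-⊕ : ∀ {n} (v w : Vec ℤ n) i → lookup (v ⊕ w) i ≡ lookup v i ℤ.+ lookup w i
  lookup-⊕ v w i = VecP.lookup-zipWith ℤ._+_ i v w

  lookup-⊖ : ∀ {n} (v w : Vec ℤ n) i → lookup (v ⊖ w) i ≡ lookup v i ℤ.- lookup w i
  lookup-⊖ v w i = VecP.lookup-zipWith ℤ._-_ i v w

  unit : ∀ {n} → Fin n → Vec ℤ n
  unit {suc n} zero = ℤ.+ 1 ∷ Vec.replicate n (ℤ.+ 0)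
  unit (suc i) = ℤ.+ 0 ∷ unit i

  ι-unit : ∀ {n} (i j : Fin n) → ι (unit i) j ≡ δ i j
  ι-unit i j = trans (go i j) refl
    where
    go : ∀ {n} (i j : Fin n) → ι (unit i) j ≡ δ i j
    go zero zero = refl
    go (zero {n}) (suc j) = cong toℚ (VecP.lookup-replicate j (ℤ.+ 0))
    go (suc i) zero = refl
    go (suc i) (suc j) with go i j
    ... | e with i FinP.≟ j
    ... | yes refl = e
    ... | no ne = e

  -- With N = D + 1 generators a basis omits exactly one of them.
  allBut : ∀ {n} → Fin n → Mask n
  allBut {n} i = Vec.replicate n true Vec.[ i ]≔ false

  allBut-self : ∀ {n} (i : Fin n) → lookup (allBut i) i ≡ false
  allBut-self {n} i = VecP.lookup∘update i (Vec.replicate n true) false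

  allBut-other : ∀ {n} (i : Fin n) {j} → j ≢ i → lookup (allBut i) j ≡ true
  allBut-other {n} i {j} ne = trans (VecP.lookup∘update′ ne (Vec.replicate n true) false) (VecP.lookup-replicate j true)

  allBut-false : ∀ {n} (i : Fin n) {j} → lookup (allBut i) j ≡ false → j ≡ i
  allBut-false i {j} e with j FinP.≟ i
  ... | yes p = p
  ... | no ne = ⊥-elim (true≢false (allBut-other i ne) e)

  size-allBut : ∀ {n} (i : Fin n) → suc (size (allBut i)) ≡ n
  size-allBut {n} i = trans (sym (size-remove (Vec.replicate n true) i (VecP.lookup-replicate i true))) (size-all (Vec.replicate n true) (λ j → VecP.lookup-replicate j true))

  corank-one : ∀ {n} (σ : Mask n) → suc (size σ) ≡ n → ∃ λ i → σ ≡ allBut i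
  corank-one {n} σ e with FinP.any? (λ i → lookup σ i ≟ₘ false)
  ... | no h = ⊥-elim (ℕP.1+n≢n (trans e (sym (size-all σ (λ i → ¬false (λ z → h (i , z)))))))
    where
    ¬false : ∀ {b} → b ≢ false → b ≡ true
    ¬false {true} _ = refl
    ¬false {false} h = ⊥-elim (h refl)
  ... | yes (i , i∉) = i , mask-ext go
    where
    go : ∀ j → lookup σ j ≡ lookup (allBut i) j
    go j with j FinP.≟ i
    ... | yes refl = trans i∉ (sym (allBut-self i))
    ... | no ne = trans (trans (sym (VecP.lookup∘update′ ne σ true)) (size-full (σ Vec.[ i ]≔ true) (trans (size-add σ i i∉) e) j)) (sym (allBut-other i ne))

  allBut-injective : ∀ {n} {i j : Fin n} → allBut i ≡ allBut j → i ≡ j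
  allBut-injective {i = i} {j} e = allBut-false j (trans (cong (λ σ → lookup σ i) (sym e)) (allBut-self i))

  record OneRelation : Set where
    constructor oneRelation
    field
      vertices : DistinctVertices
    open DistinctVertices vertices public
    field
      N≡ : suc (suc d) ≡ N

  module Circuit (𝓒 : OneRelation) where
    open OneRelation 𝓒
    open Saturated vertices public

    lin-⊕ : ∀ u v → lin (u ⊕ v) ≡ lin u ⊕ lin v
    lin-⊕ u v = ι-injective λ j → trans (ι-lin (u ⊕ v) j) (trans (∙-congʳ (A j) (ι-⊕ u v)) (trans (∙-+ʳ (A j) (ι u) (ι v)) (trans (cong₂ _+_ (sym (ι-lin u j)) (sym (ι-lin v j))) (sym (ι-⊕ (lin u) (lin v) j)))))

    lin-⊙ : ∀ c v → lin (c ⊙ v) ≡ c ⊙ lin v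
    lin-⊙ c v = ι-injective λ j → trans (ι-lin (c ⊙ v) j) (trans (∙-congʳ (A j) (ι-⊙ c v)) (trans (∙-*ʳ (toℚ c) (A j) (ι v)) (trans (cong (toℚ c *_) (sym (ι-lin v j))) (sym (ι-⊙ c (lin v) j)))))

    lin-unit : ∀ i → lin (unit i) ≡ hcol i
    lin-unit i = ι-injective λ j → trans (ι-lin (unit i) j) (trans (∙-congʳ (A j) (ι-unit i)) (rep-δ i j))

    module Relation (ρ : Vec ℤ N) (ρ-ker : Kernel A (ι ρ)) (ρ≢0 : NonZeroV (ι ρ)) where

      abstract
        a-basis : ∃ λ σ → Basis σ
        a-basis = proj₁ e , proj₁ (proj₂ e)
          where
          none : Mask N
          none = Vec.replicate N false
          size-none : ∀ n → size (Vec.replicate n false) ≡ 0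
          size-none zero = refl
          size-none (suc n) = size-none n
          e : ∃ λ σ → Basis σ × (∀ i → lookup none i ≡ true → lookup σ i ≡ true)
          e = extend span D none (trans (cong (D ℕ.+_) (size-none N)) (ℕP.+-identityʳ D)) (λ y s _ i → s i (VecP.lookup-replicate i false))

      u : Fin N
      u = proj₁ (corank-one (proj₁ a-basis) (trans (cong suc (proj₂ (proj₂ a-basis))) N≡))

      u-basis : Basis (allBut u)
      u-basis = subst Basis (proj₂ (corank-one (proj₁ a-basis) (trans (cong suc (proj₂ (proj₂ a-basis))) N≡))) (proj₂ a-basis)

      r : Vecℚ N
      r = ι ρ

      -- The two sides agree at u, so their difference is a relation supported on the basis
      -- `allBut u` and vanishes: the relations form a line.
      proportional : ∀ z → Kernel A z → ∀ i → r u * z i ≡ z u * r i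
      proportional z K i = p-q≡0⇒p≡q (r u * z i) (z u * r i) (proj₁ u-basis (λ i → r u * z i - z u * r i)
        (λ j e → trans (cong (λ k → r u * z k - z u * r k) (allBut-false u e)) (trans (cong (λ t → r u * z u - t) (*-comm (z u) (r u))) (+-inverseʳ (r u * z u))))
        (λ j → trans (∙-comm (A j) (λ i → r u * z i - z u * r i)) (trans (∙--ˡ (λ i → r u * z i) (λ i → z u * r i) (A j))
          (trans (cong₂ _-_ (trans (∙-*ˡ (r u) z (A j)) (trans (cong (r u *_) (trans (∙-comm z (A j)) (K j))) (*-zeroʳ (r u)))) (trans (∙-*ˡ (z u) r (A j)) (trans (cong (z u *_) (trans (∙-comm r (A j)) (ρ-ker j))) (*-zeroʳ (z u))))) (+-inverseʳ 0ℚ)))) i)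

      basis⇒≢0 : ∀ {i} → Basis (allBut i) → r i ≢ 0ℚ
      basis⇒≢0 {i} b e = proj₂ ρ≢0 (proj₁ b r (λ j j∉ → trans (cong r (allBut-false i j∉)) e) ρ-ker (proj₁ ρ≢0))

      ≢0⇒basis : ∀ {i} → r i ≢ 0ℚ → Basis (allBut i)
      ≢0⇒basis {i} ne = indep , ℕP.suc-injective (trans (size-allBut i) (sym N≡))
        where
        ru≢0 : r u ≢ 0ℚ
        ru≢0 = basis⇒≢0 u-basis
        indep : Indep (allBut i)
        indep y s K j = *-cancel-0 (r u) (y j) ru≢0 (trans (proportional y K j) (trans (cong (_* r j) yu) (*-zeroˡ (r j))))
          where
          yu : y u ≡ 0ℚ
          yu = *-cancel-0 (r i) (y u) ne (trans (*-comm (r i) (y u)) (trans (sym (proportional y K i)) (trans (cong (r u *_) (s i (allBut-self i))) (*-zeroʳ (r u)))))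

      -- The relation, divided by its entry at i, expresses column i by the others. Hence `allBut i`
      -- is a cell exactly if r has at i the sign of ω ∙ r.
      reduced-cost : ∀ {i} (ne : r i ≢ 0ℚ) → ω i - ω ∙ coord (allBut i) (col i) ≡ inv (r i) ne * ω ∙ r
      reduced-cost {i} ne = trans (cong (λ t → ω i - t) (trans (∙-comm ω (coord (allBut i) (col i))) (trans (∙-congˡ ω (λ j → sym (coord-unique {allBut i} {y} (≢0⇒basis ne) ys yr j)))
          (trans (∙--ˡ (δ i) (λ j → c * r j) ω) (cong₂ _-_ (∙-δˡ i ω) (trans (∙-*ˡ c r ω) (cong (c *_) (∙-comm r ω)))))))) (solve 2 (λ a b → a :- (a :- b) := b) refl (ω i) (c * ω ∙ r))
        where
        c : ℚ
        c = inv (r i) ne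
        y : Vecℚ N
        y j = δ i j - c * r j
        ys : Supp (allBut i) y
        ys j e = trans (cong y (allBut-false i e)) (trans (cong₂ _-_ (δ-diag i) (inv-* (r i) ne)) (+-inverseʳ 1ℚ))
        yr : Rep y (col i)
        yr j = trans (∙-comm (A j) y) (trans (∙--ˡ (δ i) (λ j → c * r j) (A j)) (trans (cong₂ _-_ (∙-δˡ i (A j)) (trans (∙-*ˡ c r (A j)) (trans (cong (c *_) (trans (∙-comm r (A j)) (ρ-ker j))) (*-zeroʳ c)))) (+-identityʳ (A j i))))

      height-0 : sumℚ r ≡ 0ℚ
      height-0 = kernel-Σ ρ-ker

      pos neg : Fin N → ℕ
      pos i = posPart (lookup ρ i)
      neg i = negPart (lookup ρ i)

      -- The height coordinate of the relation.
      pos≡neg : sumN pos ≡ sumN neg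
      pos≡neg = ℤP.+-injective (toℚ-injective (p-q≡0⇒p≡q _ _ (trans (cong₂ _-_ (toℚ-sumN pos) (toℚ-sumN neg)) (trans (sym (Σ-- (λ i → toℚ (ℤ.+ pos i)) (λ i → toℚ (ℤ.+ neg i)))) (trans (Σ-cong (λ i → sym (toℚ-parts (lookup ρ i)))) height-0)))))

      -- a relation with one term on each side would identify two vertices
      not-binomial : ∀ a b → pos a ≢ 0 → neg b ≢ 0 → (∀ i → i ≢ a → pos i ≡ 0) → (∀ i → i ≢ b → neg i ≡ 0) → ⊥
      not-binomial a b pa nb ha hb = a≢b (hcol-injective (ι-injective λ j → p-q≡0⇒p≡q (A j a) (A j b) (*-cancel-0 (r a) _ ra≢0 (diff j))))
        where
        pos-neg : ∀ z → posPart z ≢ 0 → negPart z ≢ 0 → ⊥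
        pos-neg (ℤ.+ n) _ h = h refl
        pos-neg (ℤ.-[1+ n ]) h _ = h refl
        a≢b : a ≢ b
        a≢b refl = pos-neg (lookup ρ a) pa nb
        ra≢0 : r a ≢ 0ℚ
        ra≢0 e = pa (lem (lookup ρ a) (toℚ-injective {lookup ρ a} {ℤ.+ 0} e))
          where
          lem : ∀ z → z ≡ ℤ.+ 0 → posPart z ≡ 0
          lem z refl = refl
        shape : ∀ i → r i ≡ r a * δ a i + r b * δ b i
        shape i with i FinP.≟ a | i FinP.≟ b
        ... | yes refl | _ = sym (trans (cong₂ _+_ (trans (cong (r a *_) (δ-diag a)) (*-identityʳ (r a))) (trans (cong (r b *_) (δ-off b a a≢b)) (*-zeroʳ (r b)))) (+-identityʳ (r a)))
        ... | no _ | yes refl = sym (trans (cong₂ _+_ (trans (cong (r a *_) (δ-off a b (λ e → a≢b (sym e)))) (*-zeroʳ (r a))) (trans (cong (r b *_) (δ-diag b)) (*-identityʳ (r b)))) (+-identityˡ (r b)))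
        ... | no na | no nb' = trans (cong toℚ (both0 (lookup ρ i) (ha i na) (hb i nb'))) (sym (trans (cong₂ _+_ (trans (cong (r a *_) (δ-off a i na)) (*-zeroʳ (r a))) (trans (cong (r b *_) (δ-off b i nb')) (*-zeroʳ (r b)))) (+-identityʳ 0ℚ)))
          where
          both0 : ∀ z → posPart z ≡ 0 → negPart z ≡ 0 → z ≡ ℤ.+ 0
          both0 (ℤ.+ .0) refl _ = refl
        combo : ∀ g → g ∙ r ≡ r a * g a + r b * g b
        combo g = trans (∙-congʳ g shape) (trans (∙-+ʳ g (λ i → r a * δ a i) (λ i → r b * δ b i)) (cong₂ _+_ (trans (∙-*ʳ (r a) g (δ a)) (cong (r a *_) (trans (∙-comm g (δ a)) (∙-δˡ a g)))) (trans (∙-*ʳ (r b) g (δ b)) (cong (r b *_) (trans (∙-comm g (δ b)) (∙-δˡ b g))))))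
        diff : ∀ j → r a * (A j a - A j b) ≡ 0ℚ
        diff j = begin
          r a * (A j a - A j b) ≡⟨ solve 4 (λ x y p q → x :* (p :- q) := (x :* p :+ y :* q) :- (x :* con 1ℚ :+ y :* con 1ℚ) :* q) refl (r a) (r b) (A j a) (A j b) ⟩
          (r a * A j a + r b * A j b) - (r a * 1ℚ + r b * 1ℚ) * A j b ≡⟨ cong₂ (λ x y → x - y * A j b) (trans (sym (combo (A j))) (ρ-ker j)) (trans (sym (combo (λ _ → 1ℚ))) (ρ-ker zero)) ⟩
          0ℚ - 0ℚ * A j b ≡⟨ solve 1 (λ q → con 0ℚ :- con 0ℚ :* q := con 0ℚ) refl (A j b) ⟩
          0ℚ ∎
          where open ≡-Reasoning

      single : ∀ (f : Fin N → ℕ) m → sumN f ℕ.< m ℕ.+ m → (∀ i → f i ≢ 0 → m ℕ.≤ f i) → ∀ a → f a ≢ 0 → ∀ i → i ≢ a → f i ≡ 0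
      single f m lt big a fa i ne with f i ℕ.≟ 0
      ... | yes e = e
      ... | no fi = ⊥-elim (ℕP.<⇒≱ lt (ℕP.≤-trans (ℕP.+-mono-≤ (big i fi) (big a fa)) (sumN-two f i a ne)))

      some : ∀ (f : Fin N → ℕ) → sumN f ≢ 0 → ∃ λ a → f a ≢ 0
      some f h with FinP.any? (λ i → ¬? (f i ℕ.≟ 0))
      ... | yes p = p
      ... | no n = ⊥-elim (h (trans (sumN-cong (λ i → decidable-stable (f i ℕ.≟ 0) (λ ne → n (i , ne)))) (trans (sumN-const N 0) (ℕP.*-zeroʳ N))))

      pos-sum≢0 : sumN pos ≢ 0
      pos-sum≢0 e = proj₂ ρ≢0 (trans (toℚ-parts (lookup ρ i)) (trans (cong₂ (λ a b → toℚ (ℤ.+ a) - toℚ (ℤ.+ b)) (sumN-0 pos e i) (sumN-0 neg (trans (sym pos≡neg) e) i)) refl))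
        where i = proj₁ ρ≢0

      -- Nonzero coefficients of size at least m with sum below 2m on each side leave one term per
      -- side, which `not-binomial` excludes.
      two-terms : ∀ m → sumN pos ℕ.< m ℕ.+ m → (∀ i → pos i ≢ 0 → m ℕ.≤ pos i) → (∀ i → neg i ≢ 0 → m ℕ.≤ neg i) → ⊥
      two-terms m lt hp hn = go (some pos pos-sum≢0) (some neg (λ e → pos-sum≢0 (trans pos≡neg e)))
        where
        go : (∃ λ a → pos a ≢ 0) → (∃ λ b → neg b ≢ 0) → ⊥
        go (a , pa) (b , nb) = not-binomial a b pa nb (single pos m lt hp a pa) (single neg m (subst (ℕ._< m ℕ.+ m) pos≡neg lt) hn b nb)

  sum-filter-tabulate : ∀ {A : Set} {n} (p : A → ℕ) (g : Fin n → A) → sum (map p (filter (λ x → ¬? (p x ℕ.≟ 0)) (List.tabulate g))) ≡ sumN (λ i → p (g i))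
  sum-filter-tabulate {n = zero} p g = refl
  sum-filter-tabulate {n = suc n} p g = go (p (g zero) ℕ.≟ 0)
    where
    P? = λ x → ¬? (p x ℕ.≟ 0)
    rest = sum-filter-tabulate p (λ i → g (suc i))
    go : Dec (p (g zero) ≡ 0) → sum (map p (filter P? (List.tabulate g))) ≡ sumN (λ i → p (g i))
    go (yes e) = trans (cong (λ xs → sum (map p xs)) (ListP.filter-reject P? (λ h → h e))) (trans rest (cong (ℕ._+ sumN (λ i → p (g (suc i)))) (sym e)))
    go (no ne) = trans (cong (λ xs → sum (map p xs)) (ListP.filter-accept P? ne)) (cong (p (g zero) ℕ.+_) rest)

  length-cartesian : ∀ {A B : Set} (xs : List A) (ys : List B) → length (cartesianProduct xs ys) ≡ length xs ℕ.* length ys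
  length-cartesian [] ys = refl
  length-cartesian (x ∷ xs) ys = trans (ListP.length-++ (map (x ,_) ys)) (cong₂ ℕ._+_ (ListP.length-map (x ,_) ys) (length-cartesian xs ys))

  congruent-small : ∀ a c c' t → c ℕ.< a → c' ℕ.< a → ℤ.+ c' ℤ.- ℤ.+ c ≡ t ℤ.* ℤ.+ a → c ≡ c'
  congruent-small a c c' t c< c'< e = go t e
    where
    split : ∀ m n k → ℤ.+ m ℤ.- ℤ.+ n ≡ ℤ.+ k → m ≡ n ℕ.+ k
    split m n k e = ℤP.+-injective (trans (trans (Z.solve 2 (λ m n → m Z.:= n Z.:+ (m Z.:- n)) refl (ℤ.+ m) (ℤ.+ n)) (cong (λ z → ℤ.+ n ℤ.+ z) e)) (sym (ℤP.pos-+ n k)))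
    big : ∀ {m n k} → m ≡ n ℕ.+ suc k ℕ.* a → m ℕ.< a → ⊥
    big {m} {n} {k} e lt = ℕP.<⇒≱ lt (subst (a ℕ.≤_) (sym e) (ℕP.≤-trans (ℕP.m≤m+n a (k ℕ.* a)) (ℕP.m≤n+m _ n)))
    go : ∀ t → ℤ.+ c' ℤ.- ℤ.+ c ≡ t ℤ.* ℤ.+ a → c ≡ c'
    go (ℤ.+ zero) e = sym (trans (split c' c 0 e) (ℕP.+-identityʳ c))
    go (ℤ.+ suc k) e = ⊥-elim (big {c'} {c} {k} (split c' c (suc k ℕ.* a) (trans e (sym (ℤP.pos-* (suc k) a)))) c'<)
    go (ℤ.-[1+ k ]) e = ⊥-elim (big {c} {c'} {k} (split c c' (suc k ℕ.* a) (trans (sym (ℤP.neg-involutive (ℤ.+ c ℤ.- ℤ.+ c'))) (trans (cong ℤ.-_ (trans (Z.solve 2 (λ x y → Z.:- (x Z.:- y) Z.:= y Z.:- x) refl (ℤ.+ c) (ℤ.+ c')) e)) (trans (ℤP.neg-distribˡ-* ℤ.-[1+ k ] (ℤ.+ a)) (sym (ℤP.pos-* (suc k) a)))))) c<)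

  module CircuitBoxes (𝓒 : OneRelation) where
    open OneRelation 𝓒
    open Circuit 𝓒 public

    Elt : Set
    Elt = ℕ × Point d

    vec : Elt → Vec ℤ D
    vec (e , g) = ℤ.+ e ∷ g

    vec-injective : ∀ {x y} → vec x ≡ vec y → x ≡ y
    vec-injective {e , g} {e' , g'} refl = refl

    abstract
      normal-form : ∀ {σ} → Basis σ → ∀ w → ∃ λ x → x ∈ boxes σ × ∃ λ z → Supp σ (ι z) × vec x ≡ w ⊖ lin z
      normal-form {σ} b w = go (normalize b w)
        where
        go : (∃ λ z → Supp σ (ι z) × InBox σ (w ⊖ lin z)) → ∃ λ x → x ∈ boxes σ × ∃ λ z → Supp σ (ι z) × vec x ≡ w ⊖ lin z
        go (z , s , bx) = fin (w ⊖ lin z) refl (box-height {σ} {w ⊖ lin z} b bx)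
          where
          fin : ∀ w' → w' ≡ w ⊖ lin z → (∃ λ e → lookup (w ⊖ lin z) zero ≡ ℤ.+ e × e ℕ.≤ D) → ∃ λ x → x ∈ boxes σ × ∃ λ z → Supp σ (ι z) × vec x ≡ w ⊖ lin z
          fin (h ∷ g) eq (e , he , _) = (e , g) , ∈-boxes⁺ {σ} {e} {g} b (subst (InBox σ) (sym eq') bx) , z , s , eq'
            where
            eq' : ℤ.+ e ∷ g ≡ w ⊖ lin z
            eq' = trans (cong (_∷ g) (trans (sym he) (cong (λ v → lookup v zero) (sym eq)))) eq

    box-vec : ∀ {σ x} → x ∈ boxes σ → InBox σ (vec x)
    box-vec {σ} {e , g} p = ∈-boxes⁻ σ p

    0v : Vec ℤ N
    0v = Vec.replicate N (ℤ.+ 0)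

    ι-0v : ∀ i → ι 0v i ≡ 0ℚ
    ι-0v i = cong toℚ (VecP.lookup-replicate i (ℤ.+ 0))

    ι-lin-0v : ∀ j → ι (lin 0v) j ≡ 0ℚ
    ι-lin-0v j = trans (ι-lin 0v j) (trans (∙-comm (A j) (ι 0v)) (∙-0ˡ {f = ι 0v} (A j) ι-0v))

    supp-0v : ∀ {σ : Mask N} → Supp σ (ι 0v)
    supp-0v i _ = ι-0v i

    module BoxBijection (ρ : Vec ℤ N) (ρ-ker : Kernel A (ι ρ)) (ρ≢0 : NonZeroV (ι ρ)) where
      open Relation ρ ρ-ker ρ≢0 public

      ι-lin-ρ : ∀ t j → ι (lin (t ⊙ ρ)) j ≡ 0ℚ
      ι-lin-ρ t j = trans (ι-lin (t ⊙ ρ) j) (trans (∙-congʳ (A j) (ι-⊙ t ρ)) (trans (∙-*ʳ (toℚ t) (A j) (ι ρ)) (trans (cong (toℚ t *_) (ρ-ker j)) (*-zeroʳ (toℚ t)))))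

      module _ (i v : Fin N) (a : ℕ) (ρi : lookup ρ i ≡ ℤ.+ a) .{{a≢0 : ℕ.NonZero a}} (ρv : lookup ρ v ℤ.* lookup ρ v ≡ ℤ.+ 1) where

        σᵢ σᵥ : Mask N
        σᵢ = allBut i
        σᵥ = allBut v

        bᵢ : Basis σᵢ
        bᵢ = ≢0⇒basis {i} λ e → ℕ.≢-nonZero⁻¹ a (ℤP.+-injective (trans (sym ρi) (toℚ-injective {lookup ρ i} {ℤ.+ 0} e)))

        bᵥ : Basis σᵥ
        bᵥ = ≢0⇒basis {v} λ e → one≢ (lookup ρ v) (toℚ-injective {lookup ρ v} {ℤ.+ 0} e) ρv
          where
          one≢ : ∀ z → z ≡ ℤ.+ 0 → z ℤ.* z ≡ ℤ.+ 1 → ⊥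
          one≢ .(ℤ.+ 0) refl ()

        target : Elt × ℕ → Vec ℤ D
        target (x , c) = vec x ⊕ ℤ.+ c ⊙ hcol i

        -- As the coefficient at v is ±1, the generators without v span the whole lattice Λ of the
        -- generators, while those without i span a sublattice of index a in Λ with coset
        -- representatives c times generator i, 0 ≤ c < a. `Φ` adds such a representative to a box
        -- point of `σᵥ` and reduces modulo the sublattice.
        Φ : Elt × ℕ → Elt
        Φ p = proj₁ (normal-form {σᵢ} bᵢ (target p))

        zΦ : Elt × ℕ → Vec ℤ N
        zΦ p = proj₁ (proj₂ (proj₂ (normal-form {σᵢ} bᵢ (target p))))

        Φ∈ : ∀ p → Φ p ∈ boxes σᵢ
        Φ∈ p = proj₁ (proj₂ (normal-form {σᵢ} bᵢ (target p)))

        zΦ-supp : ∀ p → Supp σᵢ (ι (zΦ p))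
        zΦ-supp p = proj₁ (proj₂ (proj₂ (proj₂ (normal-form {σᵢ} bᵢ (target p)))))

        zΦ-i : ∀ p → lookup (zΦ p) i ≡ ℤ.+ 0
        zΦ-i p = toℚ-injective {lookup (zΦ p) i} {ℤ.+ 0} (zΦ-supp p i (allBut-self i))

        Φ-eq : ∀ p j → ι (vec (Φ p)) j ≡ ι (vec (proj₁ p)) j + toℚ (ℤ.+ proj₂ p) * ι (hcol i) j - ι (lin (zΦ p)) j
        Φ-eq p j = trans (cong (λ w → ι w j) (proj₂ (proj₂ (proj₂ (proj₂ (normal-form {σᵢ} bᵢ (target p)))))))
          (trans (ι-⊖ (target p) (lin (zΦ p)) j) (cong (_- ι (lin (zΦ p)) j) (trans (ι-⊕ (vec (proj₁ p)) (ℤ.+ proj₂ p ⊙ hcol i) j) (cong (ι (vec (proj₁ p)) j +_) (ι-⊙ (ℤ.+ proj₂ p) (hcol i) j)))))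

        ι-lin-unit : ∀ t j → ι (lin (t ⊙ unit i)) j ≡ toℚ t * ι (hcol i) j
        ι-lin-unit t j = trans (cong (λ w → ι w j) (trans (lin-⊙ t (unit i)) (cong (t ⊙_) (lin-unit i)))) (ι-⊙ t (hcol i) j)

        unit-diag : lookup (unit i) i ≡ ℤ.+ 1
        unit-diag = toℚ-injective {lookup (unit i) i} {ℤ.+ 1} (trans (ι-unit i i) (δ-diag i))

        ι-lin-⊕ : ∀ x y j → ι (lin (x ⊕ y)) j ≡ ι (lin x) j + ι (lin y) j
        ι-lin-⊕ x y j = trans (cong (λ w → ι w j) (lin-⊕ x y)) (ι-⊕ (lin x) (lin y) j)

        ι-lin-neg : ∀ x j → ι (lin (ℤ.-[1+ 0 ] ⊙ x)) j ≡ - ι (lin x) j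
        ι-lin-neg x j = trans (cong (λ w → ι w j) (lin-⊙ ℤ.-[1+ 0 ] x)) (trans (ι-⊙ ℤ.-[1+ 0 ] (lin x) j) (solve 1 (λ p → (:- con 1ℚ) :* p := :- p) refl (ι (lin x) j)))

        Φ-injective : ∀ {p p'} → p ∈ cartesianProduct (boxes σᵥ) (upTo a) → p' ∈ cartesianProduct (boxes σᵥ) (upTo a) → Φ p ≡ Φ p' → p ≡ p'
        Φ-injective {p@(x , c)} {p'@(x' , c')} p∈ p'∈ eq = fin (split-unique {σᵥ} bᵥ 0v ζ' (box-vec {σᵥ} (proj₁ (∈-cartesianProduct⁻ (boxes σᵥ) (upTo a) p∈))) (box-vec {σᵥ} (proj₁ (∈-cartesianProduct⁻ (boxes σᵥ) (upTo a) p'∈))) (supp-0v {σᵥ}) ζ'-supp (ι-injective same))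
          where
          m : ℤ
          m = ℤ.+ c' ℤ.- ℤ.+ c
          ζ ζ' : Vec ℤ N
          ζ = (zΦ p ⊕ ℤ.-[1+ 0 ] ⊙ zΦ p') ⊕ m ⊙ unit i
          t : ℤ
          -- The square of ρ at v is 1, so subtracting t ρ clears entry v and leaves `lin`
          -- unchanged.
          t = lookup ζ v ℤ.* lookup ρ v
          ζ' = ζ ⊕ (ℤ.- t) ⊙ ρ
          ζ'-lookup : ∀ k → lookup ζ' k ≡ lookup ζ k ℤ.+ (ℤ.- t) ℤ.* lookup ρ k
          ζ'-lookup k = trans (lookup-⊕ ζ ((ℤ.- t) ⊙ ρ) k) (cong (λ y → lookup ζ k ℤ.+ y) (lookup-⊙ (ℤ.- t) ρ k))
          ζ'-supp : Supp σᵥ (ι ζ')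
          ζ'-supp k e = trans (cong (ι ζ') (allBut-false v e)) (cong toℚ (trans (ζ'-lookup v) (trans (Z.solve 2 (λ z r → z Z.:+ (Z.:- (z Z.:* r)) Z.:* r Z.:= z Z.:- z Z.:* (r Z.:* r)) refl (lookup ζ v) (lookup ρ v))
            (trans (cong (λ y → lookup ζ v ℤ.- lookup ζ v ℤ.* y) ρv) (Z.solve 1 (λ z → z Z.:- z Z.:* Z.con (ℤ.+ 1) Z.:= Z.con (ℤ.+ 0)) refl (lookup ζ v))))))
          same : ∀ j → ι (vec x ⊕ lin 0v) j ≡ ι (vec x' ⊕ lin ζ') j
          same j = begin
            ι (vec x ⊕ lin 0v) j ≡⟨ trans (ι-⊕ (vec x) (lin 0v) j) (trans (cong (ι (vec x) j +_) (ι-lin-0v j)) (+-identityʳ _)) ⟩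
            X ≡⟨ solve 5 (λ x c h z q → x := ((x :+ c :* h :- z) :- c :* h) :+ z) refl X C H Z₁ Z₁ ⟩
            ((X + C * H - Z₁) - C * H) + Z₁ ≡⟨ cong (λ y → (y - C * H) + Z₁) (trans (sym (Φ-eq p j)) (trans (cong (λ y → ι (vec y) j) eq) (Φ-eq p' j))) ⟩
            ((X' + C' * H - Z₂) - C * H) + Z₁ ≡⟨ solve 6 (λ x c c' h z z' → ((x :+ c' :* h :- z') :- c :* h) :+ z := x :+ ((z :+ (:- z') :+ (c' :- c) :* h) :+ con 0ℚ)) refl X' C C' H Z₁ Z₂ ⟩
            X' + ((Z₁ + (- Z₂) + (C' - C) * H) + 0ℚ) ≡⟨ cong (X' +_) (sym linζ') ⟩
            X' + ι (lin ζ') j ≡⟨ sym (ι-⊕ (vec x') (lin ζ') j) ⟩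
            ι (vec x' ⊕ lin ζ') j ∎
            where
            open ≡-Reasoning
            X X' C C' H Z₁ Z₂ : ℚ
            X = ι (vec x) j
            X' = ι (vec x') j
            C = toℚ (ℤ.+ c)
            C' = toℚ (ℤ.+ c')
            H = ι (hcol i) j
            Z₁ = ι (lin (zΦ p)) j
            Z₂ = ι (lin (zΦ p')) j
            linζ' : ι (lin ζ') j ≡ (Z₁ + (- Z₂) + (C' - C) * H) + 0ℚ
            linζ' = trans (ι-lin-⊕ ζ ((ℤ.- t) ⊙ ρ) j) (cong₂ _+_ (trans (ι-lin-⊕ (zΦ p ⊕ ℤ.-[1+ 0 ] ⊙ zΦ p') (m ⊙ unit i) j)
              (cong₂ _+_ (trans (ι-lin-⊕ (zΦ p) (ℤ.-[1+ 0 ] ⊙ zΦ p') j) (cong (Z₁ +_) (ι-lin-neg (zΦ p') j))) (trans (ι-lin-unit m j) (cong (_* H) (toℚ-- (ℤ.+ c') (ℤ.+ c)))))) (ι-lin-ρ (ℤ.- t) j))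
          ζi : lookup ζ i ≡ m
          ζi = trans (lookup-⊕ (zΦ p ⊕ ℤ.-[1+ 0 ] ⊙ zΦ p') (m ⊙ unit i) i) (trans (cong₂ ℤ._+_ (trans (lookup-⊕ (zΦ p) (ℤ.-[1+ 0 ] ⊙ zΦ p') i) (cong₂ ℤ._+_ (zΦ-i p) (trans (lookup-⊙ ℤ.-[1+ 0 ] (zΦ p') i) (cong (ℤ.-[1+ 0 ] ℤ.*_) (zΦ-i p')))))
              (trans (lookup-⊙ m (unit i) i) (trans (cong (m ℤ.*_) unit-diag) (ℤP.*-identityʳ m)))) (ℤP.+-identityˡ m))
          fin : vec x ≡ vec x' × 0v ≡ ζ' → p ≡ p'
          fin (e₁ , e₂) = cong₂ _,_ (vec-injective e₁) (congruent-small a c c' t (∈-upTo⁻ (proj₂ (∈-cartesianProduct⁻ (boxes σᵥ) (upTo a) p∈))) (∈-upTo⁻ (proj₂ (∈-cartesianProduct⁻ (boxes σᵥ) (upTo a) p'∈)))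
              (trans (trans (sym ζi) (Z.solve 2 (λ z y → z Z.:= (z Z.:+ (Z.:- y)) Z.:+ y) refl (lookup ζ i) (t ℤ.* ℤ.+ a))) (trans (cong (ℤ._+ t ℤ.* ℤ.+ a) zero-i) (ℤP.+-identityˡ (t ℤ.* ℤ.+ a)))))
            where
            zero-i : lookup ζ i ℤ.+ (ℤ.- (t ℤ.* ℤ.+ a)) ≡ ℤ.+ 0
            zero-i = trans (cong (λ y → lookup ζ i ℤ.+ y) (trans (ℤP.neg-distribˡ-* t (ℤ.+ a)) (cong ((ℤ.- t) ℤ.*_) (sym ρi)))) (trans (sym (ζ'-lookup i)) (trans (cong (λ w → lookup w i) (sym e₂)) (VecP.lookup-replicate i (ℤ.+ 0))))

        Φ-surjective : ∀ {x'} → x' ∈ boxes σᵢ → ∃ λ p → p ∈ cartesianProduct (boxes σᵥ) (upTo a) × Φ p ≡ x'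
        Φ-surjective {x'} x'∈ = go (normal-form {σᵥ} bᵥ (vec x'))
          where
          go : (∃ λ x → x ∈ boxes σᵥ × ∃ λ z → Supp σᵥ (ι z) × vec x ≡ vec x' ⊖ lin z) → ∃ λ p → p ∈ cartesianProduct (boxes σᵥ) (upTo a) × Φ p ≡ x'
          go (x , x∈ , z , sz , ex) = p , ∈-cartesianProduct⁺ x∈ (∈-upTo⁺ (ℤD.n%d<d zi (ℤ.+ a))) , vec-injective (proj₁ (split-unique {σᵢ} bᵢ ζ 0v (box-vec {σᵢ} (Φ∈ p)) (box-vec {σᵢ} x'∈) ζ-supp (supp-0v {σᵢ}) (ι-injective same)))
            where
            zi : ℤ
            zi = lookup z i
            c : ℕ
            -- Division of the multiplier at i with remainder; the quotient is absorbed by the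
            -- relation, whose entry there is a.
            c = zi ℤ.% ℤ.+ a
            t : ℤ
            t = zi ℤ./ ℤ.+ a
            zi≡ : zi ≡ ℤ.+ c ℤ.+ t ℤ.* ℤ.+ a
            zi≡ = ℤD.a≡a%n+[a/n]*n zi (ℤ.+ a)
            p : Elt × ℕ
            p = x , c
            ζ : Vec ℤ N
            ζ = ((zΦ p ⊕ z) ⊕ (ℤ.- ℤ.+ c) ⊙ unit i) ⊕ (ℤ.- t) ⊙ ρ
            ζ-supp : Supp σᵢ (ι ζ)
            ζ-supp k e = trans (cong (ι ζ) (allBut-false i e)) (cong toℚ (begin
              lookup ζ i ≡⟨ trans (lookup-⊕ ((zΦ p ⊕ z) ⊕ (ℤ.- ℤ.+ c) ⊙ unit i) ((ℤ.- t) ⊙ ρ) i) (cong₂ ℤ._+_ (trans (lookup-⊕ (zΦ p ⊕ z) ((ℤ.- ℤ.+ c) ⊙ unit i) i) (cong₂ ℤ._+_ (trans (lookup-⊕ (zΦ p) z i) (cong (ℤ._+ zi) (zΦ-i p))) (trans (lookup-⊙ (ℤ.- ℤ.+ c) (unit i) i) (cong ((ℤ.- ℤ.+ c) ℤ.*_) unit-diag)))) (trans (lookup-⊙ (ℤ.- t) ρ i) (cong ((ℤ.- t) ℤ.*_) ρi))) ⟩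
              ((ℤ.+ 0 ℤ.+ zi) ℤ.+ (ℤ.- ℤ.+ c) ℤ.* ℤ.+ 1) ℤ.+ (ℤ.- t) ℤ.* ℤ.+ a ≡⟨ cong (λ y → ((ℤ.+ 0 ℤ.+ y) ℤ.+ (ℤ.- ℤ.+ c) ℤ.* ℤ.+ 1) ℤ.+ (ℤ.- t) ℤ.* ℤ.+ a) zi≡ ⟩
              ((ℤ.+ 0 ℤ.+ (ℤ.+ c ℤ.+ t ℤ.* ℤ.+ a)) ℤ.+ (ℤ.- ℤ.+ c) ℤ.* ℤ.+ 1) ℤ.+ (ℤ.- t) ℤ.* ℤ.+ a ≡⟨ Z.solve 3 (λ c t a → ((Z.con (ℤ.+ 0) Z.:+ (c Z.:+ t Z.:* a)) Z.:+ (Z.:- c) Z.:* Z.con (ℤ.+ 1)) Z.:+ (Z.:- t) Z.:* a Z.:= Z.con (ℤ.+ 0)) refl (ℤ.+ c) t (ℤ.+ a) ⟩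
              ℤ.+ 0 ∎))
              where open ≡-Reasoning
            same : ∀ j → ι (vec (Φ p) ⊕ lin ζ) j ≡ ι (vec x' ⊕ lin 0v) j
            same j = begin
              ι (vec (Φ p) ⊕ lin ζ) j ≡⟨ trans (ι-⊕ (vec (Φ p)) (lin ζ) j) (cong₂ _+_ (Φ-eq p j) linζ) ⟩
              (ι (vec x) j + C * H - Z₁) + (((Z₁ + Z₂) + (- C) * H) + 0ℚ) ≡⟨ cong (λ y → (y + C * H - Z₁) + (((Z₁ + Z₂) + (- C) * H) + 0ℚ)) (trans (cong (λ w → ι w j) ex) (ι-⊖ (vec x') (lin z) j)) ⟩
              (X' - Z₂ + C * H - Z₁) + (((Z₁ + Z₂) + (- C) * H) + 0ℚ) ≡⟨ solve 5 (λ x c h z z' → (x :- z' :+ c :* h :- z) :+ (((z :+ z') :+ (:- c) :* h) :+ con 0ℚ) := x :+ con 0ℚ) refl X' C H Z₁ Z₂ ⟩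
              X' + 0ℚ ≡⟨ cong (X' +_) (sym (ι-lin-0v j)) ⟩
              X' + ι (lin 0v) j ≡⟨ sym (ι-⊕ (vec x') (lin 0v) j) ⟩
              ι (vec x' ⊕ lin 0v) j ∎
              where
              open ≡-Reasoning
              X' C H Z₁ Z₂ : ℚ
              X' = ι (vec x') j
              C = toℚ (ℤ.+ c)
              H = ι (hcol i) j
              Z₁ = ι (lin (zΦ p)) j
              Z₂ = ι (lin z) j
              linζ : ι (lin ζ) j ≡ ((Z₁ + Z₂) + (- C) * H) + 0ℚ
              linζ = trans (ι-lin-⊕ ((zΦ p ⊕ z) ⊕ (ℤ.- ℤ.+ c) ⊙ unit i) ((ℤ.- t) ⊙ ρ) j) (cong₂ _+_ (trans (ι-lin-⊕ (zΦ p ⊕ z) ((ℤ.- ℤ.+ c) ⊙ unit i) j)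
                (cong₂ _+_ (ι-lin-⊕ (zΦ p) z j) (trans (ι-lin-unit (ℤ.- ℤ.+ c) j) (cong (_* H) (toℚ-neg (ℤ.+ c)))))) (ι-lin-ρ (ℤ.- t) j))

        length-box : length (boxes σᵢ) ≡ length (boxes σᵥ) ℕ.* a
        length-box = trans (PP.↭-length (unique-set (unique-map (λ {p} {p'} → Φ-injective {p} {p'}) (UP.cartesianProduct⁺ (unique-boxes σᵥ) (UP.upTo⁺ a))) (unique-boxes σᵢ) sub sup))
            (trans (ListP.length-map Φ codesΦ) (trans (length-cartesian (boxes σᵥ) (upTo a)) (cong (length (boxes σᵥ) ℕ.*_) (ListP.length-upTo a))))
          where
          codesΦ : List (Elt × ℕ)
          codesΦ = cartesianProduct (boxes σᵥ) (upTo a)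
          sub : ∀ {x} → x ∈ map Φ codesΦ → x ∈ boxes σᵢ
          sub {x} x∈ = go (∈-map⁻ Φ x∈)
            where
            go : (∃ λ p → p ∈ codesΦ × x ≡ Φ p) → x ∈ boxes σᵢ
            go (p , _ , e) = subst (_∈ boxes σᵢ) (sym e) (Φ∈ p)
          sup : ∀ {x} → x ∈ boxes σᵢ → x ∈ map Φ codesΦ
          sup {x} x∈ = go (Φ-surjective x∈)
            where
            go : (∃ λ p → p ∈ codesΦ × Φ p ≡ x) → x ∈ map Φ codesΦ
            go (p , p∈ , e) = subst (_∈ map Φ codesΦ) e (∈-map⁺ Φ p∈)

  posPart-neg : ∀ z → posPart (ℤ.-[1+ 0 ] ℤ.* z) ≡ negPart z
  posPart-neg z = trans (cong posPart (ℤP.-1*i≡-i z)) (go z)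
    where
    go : ∀ z → posPart (ℤ.- z) ≡ negPart z
    go (ℤ.+ zero) = refl
    go (ℤ.+ suc n) = refl
    go (ℤ.-[1+ n ]) = refl

  posPart-⊖ : ∀ m n → posPart (ℤ.+ m ℤ.- ℤ.+ n) ℕ.≤ m
  posPart-⊖ m n = subst (λ z → posPart z ℕ.≤ m) (sym (ℤP.m-n≡m⊖n m n)) (go m n)
    where
    go : ∀ m n → posPart (m ℤ.⊖ n) ℕ.≤ m
    go m n with ℕP.≤-total n m
    ... | inj₁ le = subst (λ z → posPart z ℕ.≤ m) (sym (ℤP.⊖-≥ le)) (ℕP.m∸n≤m m n)
    ... | inj₂ le = subst (λ z → posPart z ℕ.≤ m) (sym (ℤP.⊖-≤ le)) (neg (n ℕ.∸ m))
      where
      neg : ∀ k → posPart (ℤ.- ℤ.+ k) ℕ.≤ m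
      neg zero = ℕ.z≤n
      neg (suc k) = ℕ.z≤n

  posPart-pos : ∀ z → posPart z ≢ 0 → z ≡ ℤ.+ posPart z
  posPart-pos (ℤ.+ n) h = refl
  posPart-pos (ℤ.-[1+ n ]) h = ⊥-elim (h refl)

  sumN-lookup : ∀ {n} (y : Vec ℕ n) → sumN (lookup y) ≡ Vec.sum y
  sumN-lookup [] = refl
  sumN-lookup (m ∷ y) = cong (m ℕ.+_) (sumN-lookup y)

  sum-map-*ˡ : ∀ {A : Set} V (f : A → ℕ) xs → sum (map (λ x → V ℕ.* f x) xs) ≡ V ℕ.* sum (map f xs)
  sum-map-*ˡ V f [] = sym (ℕP.*-zeroʳ V)
  sum-map-*ˡ V f (x ∷ xs) = trans (cong (V ℕ.* f x ℕ.+_) (sum-map-*ˡ V f xs)) (sym (ℕP.*-distribˡ-+ V (f x) (sum (map f xs))))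

  sum-map-cong : ∀ {A : Set} {f g : A → ℕ} xs → (∀ {x} → x ∈ xs → f x ≡ g x) → sum (map f xs) ≡ sum (map g xs)
  sum-map-cong [] h = refl
  sum-map-cong (x ∷ xs) h = cong₂ ℕ._+_ (h (here refl)) (sum-map-cong xs (λ p → h (there p)))

  module SmallRelations (𝓒 : OneRelation) where
    open OneRelation 𝓒
    open CircuitBoxes 𝓒 public

    module Oriented (ρ : Vec ℤ N) (ρ-ker : Kernel A (ι ρ)) (ρ≢0 : NonZeroV (ι ρ)) (ωρ : 0ℚ < ω ∙ ι ρ) where
      open BoxBijection ρ ρ-ker ρ≢0

      posList : List (Fin N)
      posList = filter (λ i → ¬? (pos i ℕ.≟ 0)) (List.allFin N)

      pos⇒r>0 : ∀ i → pos i ≢ 0 → 0ℚ < r i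
      pos⇒r>0 i h = subst (λ z → 0ℚ < toℚ z) (sym (posPart-pos (lookup ρ i) h)) (toℚ-mono-< {ℤ.+ 0} {ℤ.+ pos i} (ℤ.+<+ (ℕP.n≢0⇒n>0 h)))

      r>0⇒pos : ∀ i → 0ℚ < r i → pos i ≢ 0
      r>0⇒pos i h e = go (lookup ρ i) e (toℚ-cancel-< {ℤ.+ 0} {lookup ρ i} h)
        where
        go : ∀ z → posPart z ≡ 0 → ℤ.+ 0 ℤ.< z → ⊥
        go (ℤ.+ .0) refl (ℤ.+<+ ())

      inT-pos : ∀ i → InT (allBut i) → 0ℚ < r i
      inT-pos i (b , h) = go (trichotomy (r i))
        where
        ne : r i ≢ 0ℚ
        ne = basis⇒≢0 b
        cost : 0ℚ < inv (r i) ne * ω ∙ r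
        cost = subst (0ℚ <_) (reduced-cost ne) (p<q⇒0<q-p (h i (allBut-self i)))
        go : (r i < 0ℚ) ⊎ (r i ≡ 0ℚ) ⊎ (0ℚ < r i) → 0ℚ < r i
        go (inj₂ (inj₂ p)) = p
        go (inj₂ (inj₁ e)) = ⊥-elim (ne e)
        go (inj₁ l) = ⊥-elim (<-asym ωρ (subst₂ _<_ (solve 1 (λ a → :- (:- a) := a) refl (ω ∙ r)) refl (neg-antimono-< (subst (0ℚ <_) eq (*-0< (neg-< l) cost)))))
          where
          eq : - r i * (inv (r i) ne * ω ∙ r) ≡ - (ω ∙ r)
          eq = trans (solve 3 (λ a b c → (:- a) :* (b :* c) := :- ((b :* a) :* c)) refl (r i) (inv (r i) ne) (ω ∙ r)) (cong -_ (trans (cong (_* ω ∙ r) (inv-* (r i) ne)) (*-identityˡ (ω ∙ r))))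

      pos-inT : ∀ i → 0ℚ < r i → InT (allBut i)
      pos-inT i h = ≢0⇒basis ne , λ j e → subst (λ j → ω ∙ coord (allBut i) (col j) < ω j) (sym (allBut-false i e)) (0<q-p⇒p<q (subst (0ℚ <_) (sym (reduced-cost ne)) (*-0< (inv-pos h ne) ωρ)))
        where
        ne : r i ≢ 0ℚ
        ne e = <-irrefl (sym e) h

      -- Each cell omits one index, and as ω ∙ r is positive `reduced-cost` makes the omitted
      -- indices those with positive coefficient.
      triangulation↭ : map allBut posList ↭ triangulation
      triangulation↭ = unique-set unique-triangulation (UP.map⁺ allBut-injective (UP.filter⁺ (λ i → ¬? (pos i ℕ.≟ 0)) (UP.allFin⁺ N))) sub sup
        where
        sub : ∀ {σ} → σ ∈ triangulation → σ ∈ map allBut posList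
        sub {σ} p = go (corank-one σ (trans (cong suc (proj₂ (proj₁ hT))) N≡))
          where
          hT : InT σ
          hT = ∈-triangulation⁻ p
          go : (∃ λ i → σ ≡ allBut i) → σ ∈ map allBut posList
          go (i , e) = subst (_∈ map allBut posList) (sym e) (∈-map⁺ allBut (∈-filter⁺ (λ i → ¬? (pos i ℕ.≟ 0)) (∈-allFin i) (r>0⇒pos i (inT-pos i (subst InT e hT)))))
        sup : ∀ {σ} → σ ∈ map allBut posList → σ ∈ triangulation
        sup {σ} p = go (∈-map⁻ allBut p)
          where
          go : (∃ λ i → i ∈ posList × σ ≡ allBut i) → σ ∈ triangulation
          go (i , i∈ , e) = subst (_∈ triangulation) (sym e) (∈-triangulation⁺ (pos-inT i (pos⇒r>0 i (proj₂ (∈-filter⁻ (λ i → ¬? (pos i ℕ.≟ 0)) {xs = List.allFin N} i∈)))))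

      -- The pieces are the box points of all cells, and the box omitting i is `pos i` times as
      -- large as the one omitting v.
      count : ∀ v → lookup ρ v ℤ.* lookup ρ v ≡ ℤ.+ 1 → 5 ≡ length (boxes (allBut v)) ℕ.* sumN pos
      count v ρv = begin
        5 ≡⟨ sym length-pieces ⟩
        length pieces ≡⟨ length-tagged boxes triangulation ⟩
        sum (map (λ σ → length (boxes σ)) triangulation) ≡⟨ LA.sum-↭ (PP.map⁺ (λ σ → length (boxes σ)) (↭-sym triangulation↭)) ⟩
        sum (map (λ σ → length (boxes σ)) (map allBut posList)) ≡⟨ cong sum (sym (ListP.map-∘ posList)) ⟩
        sum (map (λ i → length (boxes (allBut i))) posList) ≡⟨ sum-map-cong posList (λ {i} i∈ → box i (proj₂ (∈-filter⁻ (λ i → ¬? (pos i ℕ.≟ 0)) {xs = List.allFin N} i∈))) ⟩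
        sum (map (λ i → V ℕ.* pos i) posList) ≡⟨ sum-map-*ˡ V pos posList ⟩
        V ℕ.* sum (map pos posList) ≡⟨ cong (V ℕ.*_) (sum-filter-tabulate pos (λ i → i)) ⟩
        V ℕ.* sumN pos ∎
        where
        open ≡-Reasoning
        V : ℕ
        V = length (boxes (allBut v))
        box : ∀ i → pos i ≢ 0 → length (boxes (allBut i)) ≡ V ℕ.* pos i
        box i h = length-box i v (pos i) (posPart-pos (lookup ρ i) h) {{ℕ.≢-nonZero h}} ρv

      pos-big : (∀ v → lookup ρ v ℤ.* lookup ρ v ≢ ℤ.+ 1) → ∀ i → (pos i ≢ 0 → 2 ℕ.≤ pos i) × (neg i ≢ 0 → 2 ℕ.≤ neg i)
      pos-big h i = go (lookup ρ i) (h i)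
        where
        go : ∀ z → z ℤ.* z ≢ ℤ.+ 1 → (posPart z ≢ 0 → 2 ℕ.≤ posPart z) × (negPart z ≢ 0 → 2 ℕ.≤ negPart z)
        go (ℤ.+ zero) n = (λ e → ⊥-elim (e refl)) , λ e → ⊥-elim (e refl)
        go (ℤ.+ 1) n = ⊥-elim (n refl)
        go (ℤ.+ suc (suc k)) n = (λ _ → ℕ.s≤s (ℕ.s≤s ℕ.z≤n)) , λ e → ⊥-elim (e refl)
        go (ℤ.-[1+ zero ]) n = ⊥-elim (n refl)
        go (ℤ.-[1+ suc k ]) n = (λ e → ⊥-elim (e refl)) , λ _ → ℕ.s≤s (ℕ.s≤s ℕ.z≤n)

      -- A coefficient ±1 makes the sum a divisor of 5 that is at most 3, hence 1, and m = 1
      -- applies. Otherwise all nonzero coefficients are at least 2 in absolute value, and 3 < 2 +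
      -- 2.
      absurd : sumN pos ℕ.≤ 3 → ⊥
      absurd le = go (FinP.any? (λ v → lookup ρ v ℤ.* lookup ρ v ℤ.≟ ℤ.+ 1))
        where
        cases : ∀ V k → 5 ≡ V ℕ.* k → k ℕ.≤ 3 → k ≡ 1
        cases V 1 _ _ = refl
        cases V 0 e _ = ⊥-elim (ℕP.1+n≢0 (trans e (ℕP.*-zeroʳ V)))
        cases 0 2 () _
        cases 1 2 () _
        cases 2 2 () _
        cases (suc (suc (suc V))) 2 () _
        cases 0 3 () _
        cases 1 3 () _
        cases (suc (suc V)) 3 () _
        cases V (suc (suc (suc (suc k)))) _ (ℕ.s≤s (ℕ.s≤s (ℕ.s≤s ())))
        go : Dec (∃ λ v → lookup ρ v ℤ.* lookup ρ v ≡ ℤ.+ 1) → ⊥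
        go (no h) = two-terms 2 (ℕ.s≤s le) (λ i → proj₁ (pos-big (λ v e → h (v , e)) i)) (λ i → proj₂ (pos-big (λ v e → h (v , e)) i))
        go (yes (v , ρv)) = two-terms 1 (subst (ℕ._< 2) (sym (cases (length (boxes (allBut v))) (sumN pos) (count v ρv) le)) (ℕ.s≤s (ℕ.s≤s ℕ.z≤n))) (λ i → ℕP.n≢0⇒n>0) (λ i → ℕP.n≢0⇒n>0)

    -- Genericity of ω excludes cost 0, and a relation of negative cost is replaced by its negative,
    -- whose positive part has the same sum.
    no-small-relation : ∀ ρ → Kernel A (ι ρ) → NonZeroV (ι ρ) → sumN (λ i → posPart (lookup ρ i)) ℕ.≤ 3 → ⊥
    no-small-relation ρ K nz le = go (trichotomy (ω ∙ ι ρ))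
      where
      module R = Relation ρ K nz
      ρ⁻ : Vec ℤ N
      ρ⁻ = ℤ.-[1+ 0 ] ⊙ ρ
      r⁻ : ∀ i → ι ρ⁻ i ≡ - ι ρ i
      r⁻ i = trans (ι-⊙ ℤ.-[1+ 0 ] ρ i) (solve 1 (λ p → (:- con 1ℚ) :* p := :- p) refl (ι ρ i))
      neg∙ : ∀ g → g ∙ ι ρ⁻ ≡ - (g ∙ ι ρ)
      neg∙ g = trans (∙-congʳ g r⁻) (trans (∙-comm g (λ i → - ι ρ i)) (trans (∙-negˡ (ι ρ) g) (cong -_ (∙-comm (ι ρ) g))))
      go : (ω ∙ ι ρ < 0ℚ) ⊎ (ω ∙ ι ρ ≡ 0ℚ) ⊎ (0ℚ < ω ∙ ι ρ) → ⊥
      go (inj₂ (inj₂ p)) = Oriented.absurd ρ K nz p le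
      go (inj₂ (inj₁ e)) = ω-generic (allBut R.u) R.u-basis R.u (allBut-self R.u) (sym (p-q≡0⇒p≡q (ω R.u) (ω ∙ coord (allBut R.u) (col R.u)) (trans (R.reduced-cost (R.basis⇒≢0 R.u-basis)) (trans (cong (inv (R.r R.u) (R.basis⇒≢0 R.u-basis) *_) e) (*-zeroʳ (inv (R.r R.u) (R.basis⇒≢0 R.u-basis)))))))
      go (inj₁ l) = Oriented.absurd ρ⁻ (λ j → trans (neg∙ (A j)) (cong -_ (K j))) (proj₁ nz , λ e → proj₂ nz (neg-injective (trans (sym (r⁻ (proj₁ nz))) e)))
        (subst (0ℚ <_) (sym (neg∙ ω)) (neg-< l))
        (subst (ℕ._≤ 3) (trans R.pos≡neg (sumN-cong (λ i → sym (trans (cong posPart (lookup-⊙ ℤ.-[1+ 0 ] ρ i)) (posPart-neg (lookup ρ i)))))) le)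

    -- The difference of two representations is a relation whose positive part is bounded by y.
    sums-injective : ∀ (y y' : Vec ℕ N) → Vec.sum y ℕ.≤ 3 → lin (nat y) ≡ lin (nat y') → y ≡ y'
    sums-injective y y' le e = vec-ext λ i → decidable-stable (lookup y i ℕ.≟ lookup y' i) λ ne → no-small-relation ρ K (i , nz i ne) small
      where
      ρ : Vec ℤ N
      ρ = nat y ⊖ nat y'
      ρ-lookup : ∀ i → lookup ρ i ≡ ℤ.+ lookup y i ℤ.- ℤ.+ lookup y' i
      ρ-lookup i = trans (lookup-⊖ (nat y) (nat y') i) (cong₂ ℤ._-_ (lookup-nat y i) (lookup-nat y' i))
      K : Kernel A (ι ρ)
      K j = trans (∙-congʳ (A j) (ι-⊖ (nat y) (nat y'))) (trans (∙-comm (A j) (λ i → ι (nat y) i - ι (nat y') i)) (trans (∙--ˡ (ι (nat y)) (ι (nat y')) (A j))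
        (trans (cong₂ _-_ (trans (∙-comm (ι (nat y)) (A j)) (sym (ι-lin (nat y) j))) (trans (∙-comm (ι (nat y')) (A j)) (sym (ι-lin (nat y') j)))) (trans (cong (λ w → ι w j - ι (lin (nat y')) j) e) (+-inverseʳ (ι (lin (nat y')) j))))))
      nz : ∀ i → lookup y i ≢ lookup y' i → ι ρ i ≢ 0ℚ
      nz i ne z = ne (ℤP.+-injective (ℤP.i-j≡0⇒i≡j (ℤ.+ lookup y i) (ℤ.+ lookup y' i) (trans (sym (ρ-lookup i)) (toℚ-injective {lookup ρ i} {ℤ.+ 0} z))))
      small : sumN (λ i → posPart (lookup ρ i)) ℕ.≤ 3
      small = ℕP.≤-trans (sumN-mono (λ i → subst (λ z → posPart z ℕ.≤ lookup y i) (sym (ρ-lookup i)) (posPart-⊖ (lookup y i) (lookup y' i)))) (subst (ℕ._≤ 3) (sym (sumN-lookup y)) le)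

    full : Mask N
    full = Vec.replicate N true

    full-supp : ∀ y → SuppN full y
    full-supp y i e = ⊥-elim (true≢false (VecP.lookup-replicate i true) e)

    sumsOf : ℕ → List (Vec ℤ D)
    sumsOf n = map (λ y → lin (nat y)) (comps full n)

    length-sums : ∀ n → length (sumsOf n) ≡ cnt N n
    length-sums n = trans (ListP.length-map (λ y → lin (nat y)) (comps full n)) (trans (length-comps full n) (cong (λ z → cnt z n) (size-all full (λ i → VecP.lookup-replicate i true))))

    unique-sums : ∀ n → n ℕ.≤ 3 → Unique (sumsOf n)
    unique-sums n le = unique-map (λ {y} {y'} y∈ _ e → sums-injective y y' (subst (ℕ._≤ 3) (sym (proj₂ (∈-comps⁻ full n y∈))) le) e) (unique-comps full n)

    sums-pts : ∀ n {w} → w ∈ sumsOf n → w ∈ map (ℤ.+ n ∷_) (pts n)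
    sums-pts n {w} w∈ = go (∈-map⁻ (λ y → lin (nat y)) w∈)
      where
      go : (∃ λ y → y ∈ comps full n × w ≡ lin (nat y)) → w ∈ map (ℤ.+ n ∷_) (pts n)
      go (y , y∈ , e) = subst (_∈ map (ℤ.+ n ∷_) (pts n)) (sym (trans e shape)) (∈-map⁺ (ℤ.+ n ∷_) (pts⇐ n (cone⇒inDilate {n} {Vec.tail (lin (nat y))} (subst (λ v → InCone (ι v)) shape (ι (nat y) , nat-≥0 y , rep-lin (nat y))))))
        where
        head≡ : lookup (lin (nat y)) zero ≡ ℤ.+ n
        head≡ = toℚ-injective (trans (lin-height (nat y)) (trans (toℚ-sum y) (cong (λ m → toℚ (ℤ.+ m)) (proj₂ (∈-comps⁻ full n y∈)))))
        shape : lin (nat y) ≡ ℤ.+ n ∷ Vec.tail (lin (nat y))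
        shape = cong (_∷ Vec.tail (lin (nat y))) head≡

    sums-≤ : ∀ n → n ℕ.≤ 3 → cnt N n ℕ.≤ length (pts n)
    sums-≤ n le = subst₂ ℕ._≤_ (length-sums n) (ListP.length-map (ℤ.+ n ∷_) (pts n)) (unique⊆⇒≤ (unique-sums n le) (λ {w} → sums-pts n {w}))

    -- Equality of cardinalities turns the inclusion of the distinct sums in the dilate into a
    -- permutation.
    pts-sums : ∀ n → n ℕ.≤ 3 → length (pts n) ℕ.≤ cnt N n → ∀ {x} → x ∈ pts n → ∃ λ y → Vec.sum y ≡ n × lin (nat y) ≡ ℤ.+ n ∷ x
    pts-sums n le few {x} x∈ = go (∈-map⁻ (λ y → lin (nat y)) (PP.∈-resp-↭ perm (∈-map⁺ (ℤ.+ n ∷_) x∈)))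
      where
      perm : map (ℤ.+ n ∷_) (pts n) ↭ sumsOf n
      perm = unique⊆≥⇒↭ (unique-sums n le) (λ {w} → sums-pts n {w}) (subst₂ ℕ._≤_ (sym (ListP.length-map (ℤ.+ n ∷_) (pts n))) (sym (length-sums n)) few)
      go : (∃ λ y → y ∈ comps full n × ℤ.+ n ∷ x ≡ lin (nat y)) → ∃ λ y → Vec.sum y ≡ n × lin (nat y) ≡ ℤ.+ n ∷ x
      go (y , y∈ , e) = y , proj₂ (∈-comps⁻ full n y∈) , sym e

  -- Hibi's inequality and the exceptional four-dimensional case

  module Hibi (𝓢 : DistinctVertices) where
    open DistinctVertices 𝓢
    open Saturated 𝓢 public

    interior⇒cone : ∀ {w} → Interior w → InCone (ι w)
    interior⇒cone {w} (ε , hε , c) = cone-cong (λ j → solve 3 (λ w e q → (w :+ e :* (:- q)) :+ e :* q := w) refl (ι w j) ε (q j)) (cone-+ c (cone-* (<⇒≤ hε) inCone-q))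

    all-vertices : length (pts 1) ≡ N → ∀ {x} → x ∈ pts 1 → ∃ λ i → hcol i ≡ ℤ.+ 1 ∷ x
    all-vertices len {x} x∈ = go (∈-tabulate⁻ (PP.∈-resp-↭ perm x∈))
      where
      vlist : List (Point d)
      vlist = List.tabulate (lookup vs)
      vsub : ∀ {y} → y ∈ vlist → y ∈ pts 1
      vsub {y} y∈ = fin (∈-tabulate⁻ y∈)
        where
        fin : (∃ λ i → y ≡ lookup vs i) → y ∈ pts 1
        fin (i , e) = subst (_∈ pts 1) (sym e) (pts⇐ 1 (cone⇒inDilate {1} {lookup vs i} (vertex-inCone i)))
      perm : pts 1 ↭ vlist
      perm = unique⊆≥⇒↭ (UP.tabulate⁺ distinct) vsub (ℕP.≤-reflexive (trans len (sym (ListP.length-tabulate (lookup vs)))))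
      go : (∃ λ i → x ≡ lookup vs i) → ∃ λ i → hcol i ≡ ℤ.+ 1 ∷ x
      go (i , e) = i , cong (ℤ.+ 1 ∷_) (sym e)

    interior-pts : ∀ m {w} → IntAt m w → ∃ λ x → w ≡ ℤ.+ m ∷ x × x ∈ pts m
    interior-pts m {h ∷ x} (int , e) = x , cong (_∷ x) e , pts⇐ m (cone⇒inDilate {m} {x} (subst (λ h → InCone (ι (h ∷ x))) e (interior⇒cone {h ∷ x} int)))

    -- Hibi's inequality h_d ≤ h₁: a linear functional cannot be minimal at an interior vertex
    hibi : length (pts 1) ≡ N → i₄ ≡ d → mult exponents i₄ ℕ.< N → D ℕ.+ mult exponents i₄ ℕ.≤ N
    hibi len e₄ lt = go (bottom 1 (trans (ℕP.+-comm i₄ 1) (cong suc e₄)))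
      where
      go : (∃ λ (ws : List (Vec ℤ D)) → Unique ws × (∀ {w} → w ∈ ws → IntAt 1 w) × length ws ≡ mult exponents i₄) → D ℕ.+ mult exponents i₄ ℕ.≤ N
      go (ws , u , h , l) = ℕP.≮⇒≥ λ small → contra (annihilator (λ r → col (List.lookup O r)) (ℕP.+-cancelʳ-< (mult exponents i₄) (length O) D (ℕP.≤-<-trans O-small small)))
        where
        open import Data.List.Membership.DecPropositional (VecP.≡-dec {n = D} ℤ._≟_) using (_∈?_)
        O? : ∀ i → Dec (¬ (hcol i ∈ ws))
        O? i = ¬? (hcol i ∈? ws)
        O : List (Fin N)
        O = filter O? (List.allFin N)
        cols : List (Vec ℤ D)
        cols = map hcol (List.allFin N)
        length-cols : length cols ≡ N
        length-cols = trans (ListP.length-map hcol (List.allFin N)) (ListP.length-tabulate {n = N} (λ i → i))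
        disj : ∀ {z} → z ∈ map hcol O × z ∈ ws → ⊥
        disj {z} (p , p') = fin (∈-map⁻ hcol p)
          where
          fin : (∃ λ i → i ∈ O × z ≡ hcol i) → ⊥
          fin (i , i∈ , e) = proj₂ (∈-filter⁻ O? {xs = List.allFin N} i∈) (subst (_∈ ws) e p')
        sub : ∀ {z} → z ∈ map hcol O ++ ws → z ∈ cols
        sub {z} z∈ = case (∈-++⁻ (map hcol O) z∈)
          where
          case : z ∈ map hcol O ⊎ z ∈ ws → z ∈ cols
          case (inj₁ p) = fin (∈-map⁻ hcol p)
            where
            fin : (∃ λ i → i ∈ O × z ≡ hcol i) → z ∈ cols
            fin (i , _ , e) = subst (_∈ cols) (sym e) (∈-map⁺ hcol (∈-allFin i))
          case (inj₂ p) = fin (interior-pts 1 (h p))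
            where
            fin : (∃ λ x → z ≡ ℤ.+ 1 ∷ x × x ∈ pts 1) → z ∈ cols
            fin (x , e , x∈) = fin' (all-vertices len x∈)
              where
              fin' : (∃ λ i → hcol i ≡ ℤ.+ 1 ∷ x) → z ∈ cols
              fin' (i , e') = subst (_∈ cols) (trans e' (sym e)) (∈-map⁺ hcol (∈-allFin i))
        O-small : length O ℕ.+ mult exponents i₄ ℕ.≤ N
        O-small = subst₂ ℕ._≤_ (trans (ListP.length-++ (map hcol O)) (cong₂ ℕ._+_ (ListP.length-map hcol O) l)) length-cols
          (unique⊆⇒≤ (UP.++⁺ (UP.map⁺ hcol-injective (UP.filter⁺ O? (UP.allFin⁺ N))) u disj) sub)
        O-nonempty : ∃ λ o → ¬ (hcol o ∈ ws)
        O-nonempty with FinP.any? O?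
        ... | yes p = p
        ... | no n = ⊥-elim (ℕP.<⇒≱ lt (subst₂ ℕ._≤_ length-cols l (unique⊆⇒≤ (UP.map⁺ hcol-injective (UP.allFin⁺ N)) all-in)))
          where
          all-in : ∀ {z} → z ∈ cols → z ∈ ws
          all-in {z} p = fin (∈-map⁻ hcol p)
            where
            fin : (∃ λ i → i ∈ List.allFin N × z ≡ hcol i) → z ∈ ws
            fin (i , _ , e) = subst (_∈ ws) (sym e) (decidable-stable (hcol i ∈? ws) (λ q → n (i , q)))
        -- f vanishes on the generators outside `ws`, so a negative minimum is attained at an
        -- interior one.
        descend : ∀ f → (∀ i → ¬ (hcol i ∈ ws) → f ∙ col i ≡ 0ℚ) → ∀ i → f ∙ col i < 0ℚ → ⊥
        descend f fO i fi = fin (argmin (λ i → f ∙ col i) (List.allFin N) (∈-allFin i))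
          where
          fin : (∃ λ m → m ∈ List.allFin N × (∀ {z} → z ∈ List.allFin N → f ∙ col m ≤ f ∙ col z)) → ⊥
          fin (m , _ , least) = <-irrefl (sym gm) (interior-pos {hcol m} (proj₁ (h m∈)) g g≥0 o g-o)
            where
            c : ℚ
            c = f ∙ col m
            c<0 : c < 0ℚ
            c<0 = ≤-<-trans (least (∈-allFin i)) fi
            m∈ : hcol m ∈ ws
            m∈ = decidable-stable (hcol m ∈? ws) (λ n → <-irrefl (fO m n) c<0)
            o : Fin N
            o = proj₁ O-nonempty
            g : Vecℚ D
            -- The height is 1 on all generators, so subtracting c times it raises the minimum to 0.
            g j = f j - c * δ zero j
            g-col : ∀ k → g ∙ col k ≡ f ∙ col k - c
            g-col k = trans (∙--ˡ f (λ j → c * δ zero j) (col k)) (cong (λ t → f ∙ col k - t) (trans (∙-*ˡ c (δ zero) (col k)) (trans (cong (c *_) (∙-δˡ zero (col k))) (*-identityʳ c))))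
            g≥0 : ∀ k → 0ℚ ≤ g ∙ col k
            g≥0 k = subst (0ℚ ≤_) (sym (g-col k)) (p≤q⇒0≤q-p (least (∈-allFin k)))
            g-o : 0ℚ < g ∙ col o
            g-o = subst (0ℚ <_) (sym (trans (g-col o) (trans (cong (_- c) (fO o (proj₂ O-nonempty))) (+-identityˡ (- c))))) (neg-< c<0)
            gm : g ∙ ι (hcol m) ≡ 0ℚ
            gm = trans (g-col m) (+-inverseʳ c)
        contra : ¬ (∃ λ f → NonZeroV f × (∀ r → col (List.lookup O r) ∙ f ≡ 0ℚ))
        contra (f , (j , nz) , K) = nz (span f (λ i → fi0 i) j)
          where
          idx∈ : ∀ {i} {xs : List (Fin N)} → i ∈ xs → ∃ λ r → List.lookup xs r ≡ i
          idx∈ (here e) = zero , sym e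
          idx∈ (there p) = suc (proj₁ (idx∈ p)) , proj₂ (idx∈ p)
          fO : ∀ i → ¬ (hcol i ∈ ws) → f ∙ col i ≡ 0ℚ
          fO i n = fin (idx∈ (∈-filter⁺ O? (∈-allFin i) n))
            where
            fin : (∃ λ r → List.lookup O r ≡ i) → f ∙ col i ≡ 0ℚ
            fin (r , e) = trans (∙-comm f (col i)) (subst (λ i → col i ∙ f ≡ 0ℚ) e (K r))
          -f∙ : ∀ i → (λ j → - f j) ∙ col i ≡ - (f ∙ col i)
          -f∙ i = ∙-negˡ f (col i)
          fi0 : ∀ i → f ∙ col i ≡ 0ℚ
          fi0 i = case (trichotomy (f ∙ col i))
            where
            case : (f ∙ col i < 0ℚ) ⊎ (f ∙ col i ≡ 0ℚ) ⊎ (0ℚ < f ∙ col i) → f ∙ col i ≡ 0ℚ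
            case (inj₁ l) = ⊥-elim (descend f fO i l)
            case (inj₂ (inj₁ e)) = e
            case (inj₂ (inj₂ g)) = ⊥-elim (descend (λ j → - f j) (λ k n → trans (-f∙ k) (cong -_ (fO k n))) i (subst (_< 0ℚ) (sym (-f∙ i)) (neg-antimono-< g)))

  sumN-≤-eq : ∀ {n} (e f : Fin n → ℕ) → (∀ i → e i ℕ.≤ f i) → sumN f ℕ.≤ sumN e → ∀ i → e i ≡ f i
  sumN-≤-eq {suc n} e f le s zero = ℕP.≤-antisym (le zero) (ℕP.+-cancelʳ-≤ (sumN (λ i → e (suc i))) (f zero) (e zero) (ℕP.≤-trans (ℕP.+-monoʳ-≤ (f zero) (sumN-mono (λ i → le (suc i)))) s))
  sumN-≤-eq {suc n} e f le s (suc i) = sumN-≤-eq (λ i → e (suc i)) (λ i → f (suc i)) (λ i → le (suc i)) (ℕP.+-cancelˡ-≤ (e zero) _ _ (ℕP.≤-trans (ℕP.+-monoˡ-≤ _ (le zero)) s)) i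

  indN : ∀ {n} → Fin n → Fin n → ℕ
  indN i j with i FinP.≟ j
  ... | yes _ = 1
  ... | no _ = 0

  sumN-indN : ∀ {n} (i : Fin n) → sumN (indN i) ≡ 1
  sumN-indN {suc n} zero = cong suc (trans (sumN-const n 0) (ℕP.*-zeroʳ n))
  sumN-indN {suc n} (suc i) = trans (sumN-cong (λ j → step j)) (sumN-indN i)
    where
    step : ∀ j → indN (suc i) (suc j) ≡ indN i j
    step j with i FinP.≟ j
    ... | yes refl = refl
    ... | no _ = refl

  record FourDimensional : Set where
    constructor fourDimensional
    field
      {N} : ℕ
      N≡ : 6 ≡ N
      vs : Vec (Point 4) N
      distinct : ∀ {i j} → lookup vs i ≡ lookup vs j → i ≡ j
      span : Hom.Spanning vs
      hd : HasDelta vs (hpoly 1 2 3 3)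

    vertices : DistinctVertices
    vertices = distinctVertices (volumeFive (spanningFamily vs span) 1 2 3 3 hd) distinct

  -- The second dilate has as many lattice points as there are sums of two generators, so its two
  -- interior lattice points are such sums. The facets are read from the signs of the single
  -- relation κ, and an interior sum has to involve a generator off each facet; two different sums
  -- cannot do so.
  module DimensionFour (𝓠 : FourDimensional) where
    open FourDimensional 𝓠
    open SmallRelations (oneRelation vertices N≡)
    private module HB = Hibi vertices

    kernel : ∃ λ κ → NonZeroV κ × Kernel A κ
    kernel = annihilator A (subst (5 ℕ.<_) N≡ ℕP.≤-refl)

    module _ (κ : Vecℚ N) (K : Kernel A κ) where

      -- Four of the six generators lie in a hyperplane of the five-dimensional space.
      pair-functional : ∀ i j → i ≢ j → ∃ λ f → NonZeroV f × (∀ k → k ≢ i → k ≢ j → f ∙ col k ≡ 0ℚ)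
      pair-functional i j ne = fin (annihilator (λ r → col (idx σ r)) (ℕ.s≤s (ℕP.≤-reflexive sz)))
        where
        σ : Mask N
        σ = allBut i Vec.[ j ]≔ false
        sz : size σ ≡ 4
        sz = ℕP.suc-injective (ℕP.suc-injective (trans (cong suc (sym (size-remove (allBut i) j (allBut-other i (λ e → ne (sym e)))))) (trans (size-allBut i) (sym N≡))))
        fin : (∃ λ f → NonZeroV f × (∀ r → col (idx σ r) ∙ f ≡ 0ℚ)) → ∃ λ f → NonZeroV f × (∀ k → k ≢ i → k ≢ j → f ∙ col k ≡ 0ℚ)
        fin (f , nz , h) = f , nz , λ k ki kj → go k (idx-surj σ k (trans (VecP.lookup∘update′ kj (allBut i) false) (allBut-other i ki)))
          where
          go : ∀ k → (∃ λ r → idx σ r ≡ k) → f ∙ col k ≡ 0ℚ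
          go k (r , e) = trans (∙-comm f (col k)) (subst (λ k → col k ∙ f ≡ 0ℚ) e (h r))

      -- Applied to the relation, f leaves only the terms at i and j.
      balance : ∀ i j → i ≢ j → ∀ f → (∀ k → k ≢ i → k ≢ j → f ∙ col k ≡ 0ℚ) → κ i * (f ∙ col i) + κ j * (f ∙ col j) ≡ 0ℚ
      balance i j ne f h = trans (sym two) (trans (sym (rep-dual {κ} {λ _ → 0ℚ} f K)) (trans (∙-comm f (λ _ → 0ℚ)) (∙-0ˡ {f = λ _ → 0ℚ} f (λ _ → refl))))
        where
        g : Vecℚ N
        g k = κ k * (f ∙ col k)
        two : sumℚ g ≡ g i + g j
        two = trans (Σ-cong shape) (trans (Σ-+ (λ k → δ i k * g k) (λ k → δ j k * g k)) (cong₂ _+_ (∙-δˡ i g) (∙-δˡ j g)))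
          where
          shape : ∀ k → g k ≡ δ i k * g k + δ j k * g k
          shape k with k FinP.≟ i | k FinP.≟ j
          ... | yes refl | _ = sym (trans (cong₂ _+_ (trans (cong (_* g k) (δ-diag k)) (*-identityˡ (g k))) (trans (cong (_* g k) (δ-off j k ne)) (*-zeroˡ (g k)))) (+-identityʳ (g k)))
          ... | no ki | yes refl = sym (trans (cong₂ _+_ (trans (cong (_* g k) (δ-off i k ki)) (*-zeroˡ (g k))) (trans (cong (_* g k) (δ-diag k)) (*-identityˡ (g k)))) (+-identityˡ (g k)))
          ... | no ki | no kj = trans (trans (cong (κ k *_) (h k ki kj)) (*-zeroʳ (κ k))) (sym (trans (cong₂ _+_ (trans (cong (_* g k) (δ-off i k ki)) (*-zeroˡ (g k))) (trans (cong (_* g k) (δ-off j k kj)) (*-zeroˡ (g k)))) (+-identityʳ 0ℚ)))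

      -- the support of a sum of vertices lying in the interior meets every face complement
      meets : ∀ y → Interior (lin (nat y)) → ∀ f → (∀ k → 0ℚ ≤ f ∙ col k) → ∀ p → 0ℚ < f ∙ col p → ¬ (∀ k → 0ℚ < f ∙ col k → lookup y k ≡ 0)
      meets y int f f≥0 p fp h = <-irrefl (sym z) (interior-pos {lin (nat y)} int f f≥0 p fp)
        where
        z : f ∙ ι (lin (nat y)) ≡ 0ℚ
        z = trans (rep-dual {ι (nat y)} f (rep-lin (nat y))) (Σ-0 {N} {λ k → ι (nat y) k * (f ∙ col k)} λ k → term k (trichotomy (f ∙ col k)))
          where
          term : ∀ k → (f ∙ col k < 0ℚ) ⊎ (f ∙ col k ≡ 0ℚ) ⊎ (0ℚ < f ∙ col k) → ι (nat y) k * (f ∙ col k) ≡ 0ℚ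
          term k (inj₁ l) = ⊥-elim (<⇒≱ l (f≥0 k))
          term k (inj₂ (inj₁ e)) = trans (cong (ι (nat y) k *_) e) (*-zeroʳ (ι (nat y) k))
          term k (inj₂ (inj₂ g)) = trans (cong (_* (f ∙ col k)) (cong toℚ (trans (lookup-nat y k) (cong (λ m → ℤ.+ m) (h k g))))) (*-zeroˡ (f ∙ col k))

      -- By `balance`, opposite signs of κ at i and j force equal signs of f there: f defines a
      -- facet missing exactly i and j. If κ vanishes at i, the facet misses i alone.
      oriented : ∀ i j → i ≢ j → 0ℚ ≤ κ i → κ j < 0ℚ → ∃ λ f → (∀ k → k ≢ i → k ≢ j → f ∙ col k ≡ 0ℚ) × 0ℚ < f ∙ col i × (0ℚ < κ i → 0ℚ < f ∙ col j) × (κ i ≡ 0ℚ → f ∙ col j ≡ 0ℚ)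
      oriented i j ne κi κj = fin (pair-functional i j ne)
        where
        Res : Set
        Res = ∃ λ f → (∀ k → k ≢ i → k ≢ j → f ∙ col k ≡ 0ℚ) × 0ℚ < f ∙ col i × (0ℚ < κ i → 0ℚ < f ∙ col j) × (κ i ≡ 0ℚ → f ∙ col j ≡ 0ℚ)
        κj≢0 : κ j ≢ 0ℚ
        κj≢0 e = <-irrefl e κj
        fin : (∃ λ f → NonZeroV f × (∀ k → k ≢ i → k ≢ j → f ∙ col k ≡ 0ℚ)) → Res
        fin (f , (l , nz) , h) = case (trichotomy (f ∙ col i))
          where
          positive : ∀ f → (∀ k → k ≢ i → k ≢ j → f ∙ col k ≡ 0ℚ) → 0ℚ < f ∙ col i → Res
          positive f h p = f , h , p , (λ q → pos (trichotomy (f ∙ col j)) q) , λ z → *-cancel-0 (κ j) (f ∙ col j) κj≢0 (trans (sym (trans (cong (_+ κ j * (f ∙ col j)) (trans (cong (_* (f ∙ col i)) z) (*-zeroˡ (f ∙ col i)))) (+-identityˡ _))) (balance i j ne f h))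
            where
            pos : (f ∙ col j < 0ℚ) ⊎ (f ∙ col j ≡ 0ℚ) ⊎ (0ℚ < f ∙ col j) → 0ℚ < κ i → 0ℚ < f ∙ col j
            pos (inj₂ (inj₂ g)) _ = g
            pos (inj₂ (inj₁ e)) q = ⊥-elim (<-irrefl (sym (balance i j ne f h)) (+-0<ˡ (*-0< q p) (≤-reflexive (sym (trans (cong (κ j *_) e) (*-zeroʳ (κ j)))))))
            pos (inj₁ l) q = ⊥-elim (<-irrefl (sym (balance i j ne f h)) (+-0<ˡ (*-0< q p) (<⇒≤ (subst (0ℚ <_) (solve 2 (λ a b → (:- a) :* (:- b) := a :* b) refl (κ j) (f ∙ col j)) (*-0< (neg-< κj) (neg-< l))))))
          case : (f ∙ col i < 0ℚ) ⊎ (f ∙ col i ≡ 0ℚ) ⊎ (0ℚ < f ∙ col i) → Res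
          case (inj₂ (inj₂ g)) = positive f h g
          case (inj₁ l) = positive (λ j → - f j) (λ k a b → trans (∙-negˡ f (col k)) (cong -_ (h k a b))) (subst (0ℚ <_) (sym (∙-negˡ f (col i))) (neg-< l))
          case (inj₂ (inj₁ e)) = ⊥-elim (nz (span f all0 l))
            where
            fj : f ∙ col j ≡ 0ℚ
            fj = *-cancel-0 (κ j) (f ∙ col j) κj≢0 (trans (sym (trans (cong (_+ κ j * (f ∙ col j)) (trans (cong (κ i *_) e) (*-zeroʳ (κ i)))) (+-identityˡ _))) (balance i j ne f h))
            all0 : ∀ k → f ∙ col k ≡ 0ℚ
            all0 k with k FinP.≟ i | k FinP.≟ j
            ... | yes refl | _ = e
            ... | no _ | yes refl = fj
            ... | no a | no b = h k a b

      distinct-sign : ∀ {i j} → 0ℚ ≤ κ i → κ j < 0ℚ → i ≢ j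
      distinct-sign p n refl = <⇒≱ n p

      meets-pair : ∀ y → Interior (lin (nat y)) → ∀ i j → 0ℚ < κ i → κ j < 0ℚ → lookup y i ≡ 0 → lookup y j ≢ 0
      meets-pair y int i j κi κj yi yj = fin (oriented i j ne (<⇒≤ κi) κj)
        where
        ne = distinct-sign (<⇒≤ κi) κj
        fin : _ → ⊥
        fin (f , h , fi , fj , _) = meets y int f nn i fi supp
          where
          nn : ∀ k → 0ℚ ≤ f ∙ col k
          nn k with k FinP.≟ i | k FinP.≟ j
          ... | yes refl | _ = <⇒≤ fi
          ... | no _ | yes refl = <⇒≤ (fj κi)
          ... | no a | no b = ≤-reflexive (sym (h k a b))
          supp : ∀ k → 0ℚ < f ∙ col k → lookup y k ≡ 0
          supp k p with k FinP.≟ i | k FinP.≟ j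
          ... | yes refl | _ = yi
          ... | no _ | yes refl = yj
          ... | no a | no b = ⊥-elim (<-irrefl (sym (h k a b)) p)

      meets-zero : ∀ y → Interior (lin (nat y)) → ∀ i j → κ i ≡ 0ℚ → κ j < 0ℚ → lookup y i ≢ 0
      meets-zero y int i j κi κj yi = fin (oriented i j ne (≤-reflexive (sym κi)) κj)
        where
        ne = distinct-sign (≤-reflexive (sym κi)) κj
        fin : _ → ⊥
        fin (f , h , fi , _ , fj) = meets y int f nn i fi supp
          where
          nn : ∀ k → 0ℚ ≤ f ∙ col k
          nn k with k FinP.≟ i | k FinP.≟ j
          ... | yes refl | _ = <⇒≤ fi
          ... | no _ | yes refl = ≤-reflexive (sym (fj κi))
          ... | no a | no b = ≤-reflexive (sym (h k a b))
          supp : ∀ k → 0ℚ < f ∙ col k → lookup y k ≡ 0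
          supp k p with k FinP.≟ i | k FinP.≟ j
          ... | yes refl | _ = yi
          ... | no _ | yes refl = ⊥-elim (<-irrefl (sym (fj κi)) p)
          ... | no a | no b = ⊥-elim (<-irrefl (sym (h k a b)) p)

    interior-positive : ∀ w y → (∀ i → 0ℚ < y i) → Rep y (ι w) → Interior w
    interior-positive w y y>0 rep = go (stable (map (λ i → y i , - γ i) (List.allFin N)))
      where
      go : (∃ λ ε → 0ℚ < ε × (∀ {p} → p ∈ map (λ i → y i , - γ i) (List.allFin N) → Stable ε p)) → Interior w
      go (ε , hε , st) = ε , hε , (λ i → y i + ε * (- γ i)) , (λ i → <⇒≤ (proj₁ (st (∈-map⁺ (λ i → y i , - γ i) (∈-allFin i)) ε hε ≤-refl) (y>0 i))) ,
        rep-+ rep (rep-* ε {λ i → - γ i} {q⁻} (λ j → trans (∙-comm (A j) (λ i → - γ i)) (trans (∙-negˡ γ (A j)) (cong -_ (∙-comm γ (A j))))))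

    -- With exponents at most 3 and D = 5 no interior code exists below height 2; the bound at
    -- height 1 evaluates to 0.
    no-interior-vertex : ∀ i → ¬ Interior (hcol i)
    no-interior-vertex i int = one≰ (interior-≤ 1 (hcol i ∷ []) ([] ∷ []) prop)
      where
      one≰ : ¬ (1 ℕ.≤ 0)
      one≰ ()
      prop : ∀ {w} → w ∈ hcol i ∷ [] → IntAt 1 w
      prop (here e) = subst (IntAt 1) (sym e) (int , refl)

    module _ (κ : Vecℚ N) (K : Kernel A κ) (i : Fin N) (κi : 0ℚ < κ i) (y y' : Vec ℕ N) (y≢y' : y ≢ y') (sy : Vec.sum y ≡ 2) (sy' : Vec.sum y' ≡ 2)
      (h : ∀ j → 0ℚ ≤ κ j → lookup y j ≢ 0) (h' : ∀ j → 0ℚ ≤ κ j → lookup y' j ≢ 0) where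

      -- If κ were nonnegative at a second index j, both y and y' would be the sum of the generators
      -- i and j.
      others-negative : ∀ j → j ≢ i → κ j < 0ℚ
      others-negative j ne = decidable-stable (κ j ℚ.<? 0ℚ) λ n → y≢y' (vec-ext λ k → trans (sym (eq y sy h (≮⇒≥ n) k)) (eq y' sy' h' (≮⇒≥ n) k))
        where
        eq : ∀ y → Vec.sum y ≡ 2 → (∀ j → 0ℚ ≤ κ j → lookup y j ≢ 0) → 0ℚ ≤ κ j → ∀ k → indN i k ℕ.+ indN j k ≡ lookup y k
        eq y sy h κj = sumN-≤-eq (λ k → indN i k ℕ.+ indN j k) (lookup y) le (ℕP.≤-reflexive (trans (sumN-lookup y) (trans sy (sym (trans (sumN-+ (indN i) (indN j)) (cong₂ ℕ._+_ (sumN-indN i) (sumN-indN j)))))))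
          where
          le : ∀ k → indN i k ℕ.+ indN j k ℕ.≤ lookup y k
          le k with i FinP.≟ k | j FinP.≟ k
          ... | yes refl | yes refl = ⊥-elim (ne refl)
          ... | yes refl | no _ = ℕP.n≢0⇒n>0 (h k (<⇒≤ κi))
          ... | no _ | yes refl = ℕP.n≢0⇒n>0 (h k κj)
          ... | no _ | no _ = ℕ.z≤n

      interior-vertex : ⊥
      interior-vertex = no-interior-vertex i (interior-positive (hcol i) z z>0 (rep-shift {δ i} {κ} t (rep-δ i) K))
        where
        s : ℚ
        s = κ i + κ i
        hs : 0ℚ < s
        hs = +-0<ˡ κi (<⇒≤ κi)
        s≢0 : s ≢ 0ℚ
        s≢0 e = <-irrefl (sym e) hs
        t : ℚ
        -- With t = 1/(2κᵢ) the vector δ i - t κ has entry 1/2 at i and positive entries elsewhere,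
        -- so generator i would be interior.
        t = inv s s≢0
        t>0 : 0ℚ < t
        t>0 = inv-pos hs s≢0
        z : Vecℚ N
        z j = δ i j - t * κ j
        z>0 : ∀ j → 0ℚ < z j
        z>0 j = case (j FinP.≟ i)
         where
         case : Dec (j ≡ i) → 0ℚ < z j
         case (yes refl) = subst (0ℚ <_) (sym (trans (cong (_- t * κ i) (trans (δ-diag i) (sym (inv-* s s≢0)))) (solve 2 (λ t k → t :* (k :+ k) :- t :* k := t :* k) refl t (κ i)))) (*-0< t>0 κi)
         case (no ne) = subst (0ℚ <_) (sym (trans (cong (_- t * κ j) (δ-off i j ne)) (solve 2 (λ t k → con 0ℚ :- t :* k := t :* (:- k)) refl t (κ j)))) (*-0< t>0 (neg-< (others-negative j ne)))

    module _ (κ : Vecℚ N) (K : Kernel A κ) (nz : NonZeroV κ) where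
      κ⁻ : Vecℚ N
      κ⁻ i = - κ i
      K⁻ : Kernel A κ⁻
      K⁻ j = trans (∙-comm (A j) κ⁻) (trans (∙-negˡ κ (A j)) (cong -_ (trans (∙-comm κ (A j)) (K j))))
      nz⁻ : NonZeroV κ⁻
      nz⁻ = proj₁ nz , λ e → proj₂ nz (neg-injective e)

      p m : Fin N
      p = proj₁ (positive-entry {κ} nz (kernel-Σ K))
      m = proj₁ (positive-entry {κ⁻} nz⁻ (kernel-Σ K⁻))
      κp : 0ℚ < κ p
      κp = proj₂ (positive-entry {κ} nz (kernel-Σ K))
      κm : κ m < 0ℚ
      κm = subst₂ _<_ (solve 1 (λ a → :- (:- a) := a) refl (κ m)) refl (neg-antimono-< (proj₂ (positive-entry {κ⁻} nz⁻ (kernel-Σ K⁻))))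

      Covers : Vecℚ N → Vec ℕ N → Set
      Covers κ y = ∀ j → 0ℚ ≤ κ j → lookup y j ≢ 0

      -- A sum missing one generator of positive sign must contain all of negative sign by
      -- `meets-pair`; those with κ = 0 are contained in any case by `meets-zero`.
      classify : ∀ y → Interior (lin (nat y)) → Covers κ y ⊎ Covers κ⁻ y
      classify y int = go (FinP.any? (λ i → (0ℚ ℚ.<? κ i) ×-dec (lookup y i ℕ.≟ 0)))
        where
        zero-case : ∀ j → κ j ≡ 0ℚ → lookup y j ≢ 0
        zero-case j e = meets-zero κ K y int j m e κm
        go : Dec (∃ λ i → 0ℚ < κ i × lookup y i ≡ 0) → Covers κ y ⊎ Covers κ⁻ y
        go (no n) = inj₁ λ j κj yj → case j κj yj (trichotomy (κ j))
          where
          case : ∀ j → 0ℚ ≤ κ j → lookup y j ≡ 0 → (κ j < 0ℚ) ⊎ (κ j ≡ 0ℚ) ⊎ (0ℚ < κ j) → ⊥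
          case j κj yj (inj₁ l) = <⇒≱ l κj
          case j κj yj (inj₂ (inj₁ e)) = zero-case j e yj
          case j κj yj (inj₂ (inj₂ g)) = n (j , g , yj)
        go (yes (i , κi , yi)) = inj₂ λ j κj yj → case j κj yj (trichotomy (κ j))
          where
          case : ∀ j → 0ℚ ≤ κ⁻ j → lookup y j ≡ 0 → (κ j < 0ℚ) ⊎ (κ j ≡ 0ℚ) ⊎ (0ℚ < κ j) → ⊥
          case j κj yj (inj₁ l) = meets-pair κ K y int i j κi l yi yj
          case j κj yj (inj₂ (inj₁ e)) = zero-case j e yj
          case j κj yj (inj₂ (inj₂ g)) = <⇒≱ (neg-antimono-< g) κj

      -- Together the two sums would contain all six generators, but they have four terms.
      mixed : ∀ y y' → Vec.sum y ≡ 2 → Vec.sum y' ≡ 2 → Covers κ y → Covers κ⁻ y' → ⊥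
      mixed y y' sy sy' h h' = ℕP.<⇒≱ {4} {6} (ℕP.m≤n+m 5 1) (subst₂ ℕ._≤_ (trans (sumN-const N 1) (trans (ℕP.*-identityʳ N) (sym N≡))) (trans (sumN-+ (lookup y) (lookup y')) (cong₂ ℕ._+_ (trans (sumN-lookup y) sy) (trans (sumN-lookup y') sy'))) (sumN-mono one))
        where
        one : ∀ k → 1 ℕ.≤ lookup y k ℕ.+ lookup y' k
        one k = case (≤-total 0ℚ (κ k))
          where
          case : 0ℚ ≤ κ k ⊎ κ k ≤ 0ℚ → 1 ℕ.≤ lookup y k ℕ.+ lookup y' k
          case (inj₁ a) = ℕP.≤-trans (ℕP.n≢0⇒n>0 (h k a)) (ℕP.m≤m+n (lookup y k) (lookup y' k))
          case (inj₂ b) = ℕP.≤-trans (ℕP.n≢0⇒n>0 (h' k (neg-≤ b))) (ℕP.m≤n+m (lookup y' k) (lookup y k))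

      two-interior-sums : ∀ y y' → y ≢ y' → Vec.sum y ≡ 2 → Vec.sum y' ≡ 2 → Interior (lin (nat y)) → Interior (lin (nat y')) → ⊥
      two-interior-sums y y' ne sy sy' int int' = go (classify y int) (classify y' int')
        where
        go : Covers κ y ⊎ Covers κ⁻ y → Covers κ y' ⊎ Covers κ⁻ y' → ⊥
        go (inj₁ a) (inj₁ b) = interior-vertex κ K p κp y y' ne sy sy' a b
        go (inj₂ a) (inj₂ b) = interior-vertex κ⁻ K⁻ m (neg-< κm) y y' ne sy sy' a b
        go (inj₁ a) (inj₂ b) = mixed y y' sy sy' a b
        go (inj₂ a) (inj₁ b) = mixed y' y sy' sy b a

    -- Both sides are 21: the exponents 0, 1, 2 contribute 15, 5 and 1, and six generators have 21
    -- sums of two.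
    few : length (pts 2) ℕ.≤ cnt N 2
    few = ℕP.≤-reflexive (trans (length-pts-exponents 2) (cong (λ n → cnt n 2) N≡))

    impossible : ⊥
    impossible = go (bottom 2 refl)
      where
      as-sum : ∀ {w} → IntAt 2 w → ∃ λ y → Vec.sum y ≡ 2 × lin (nat y) ≡ w
      as-sum {w} h = fin (HB.interior-pts 2 {w} h)
        where
        fin : (∃ λ x → w ≡ ℤ.+ 2 ∷ x × x ∈ pts 2) → ∃ λ y → Vec.sum y ≡ 2 × lin (nat y) ≡ w
        fin (x , e , x∈) = fin' (pts-sums 2 (ℕ.s≤s (ℕ.s≤s ℕ.z≤n)) few x∈)
          where
          fin' : (∃ λ y → Vec.sum y ≡ 2 × lin (nat y) ≡ ℤ.+ 2 ∷ x) → ∃ λ y → Vec.sum y ≡ 2 × lin (nat y) ≡ w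
          fin' (y , s , e') = y , s , trans e' (sym e)
      go : (∃ λ (ws : List (Vec ℤ 5)) → Unique ws × (∀ {w} → w ∈ ws → IntAt 2 w) × length ws ≡ 2) → ⊥
      go (w ∷ w' ∷ [] , (ne ∷ _) ∷ _ , h , _) = fin (as-sum {w} (h (here refl))) (as-sum {w'} (h (there (here refl))))
        where
        fin : (∃ λ y → Vec.sum y ≡ 2 × lin (nat y) ≡ w) → (∃ λ y → Vec.sum y ≡ 2 × lin (nat y) ≡ w') → ⊥
        fin (y , s , e) (y' , s' , e') = two-interior-sums (proj₁ kernel) (proj₂ (proj₂ kernel)) (proj₁ (proj₂ kernel)) y y' (λ q → ne (trans (sym e) (trans (cong (λ y → lin (nat y)) q) e'))) s s'
          (subst Interior (sym e) (proj₁ (h (here refl)))) (subst Interior (sym e') (proj₁ (h (there (here refl)))))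

  -- The necessary conditions

  fromList-distinct : ∀ {A : Set} {xs : List A} → Unique xs → ∀ {i j} → lookup (Vec.fromList xs) i ≡ lookup (Vec.fromList xs) j → i ≡ j
  fromList-distinct {xs = x ∷ xs} (h ∷ u) {zero} {zero} e = refl
  fromList-distinct {xs = x ∷ xs} (h ∷ u) {zero} {suc j} e = ⊥-elim (All.lookup h (VecM.∈-fromList⁻ (VecM.∈-lookup j (Vec.fromList xs))) e)
  fromList-distinct {xs = x ∷ xs} (h ∷ u) {suc i} {zero} e = ⊥-elim (All.lookup h (VecM.∈-fromList⁻ (VecM.∈-lookup i (Vec.fromList xs))) (sym e))
  fromList-distinct {xs = x ∷ xs} (h ∷ u) {suc i} {suc j} e = cong suc (fromList-distinct u e)

  Conclusion : ℕ → ℕ → ℕ → ℕ → ℕ → Set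
  Conclusion d i₁ i₂ i₃ i₄ = Cond0 d i₁ i₂ i₃ i₄ ⊎ Cond1 d i₁ i₂ i₃ i₄ ⊎ Cond2 d i₁ i₂ i₃ i₄ ⊎ Cond3 d i₁ i₂ i₃ i₄

  shift-cnt-1 : ∀ D {i} → 2 ℕ.≤ i → shift (cnt D) i 1 ≡ 0
  shift-cnt-1 D h = shift-> (cnt D) h

  simplex-case : ∀ {d N} (vs : Vec (Point d) N) → N ≡ suc d → Hom.Spanning vs → ∀ i₁ i₂ i₃ i₄ → 1 ℕ.≤ i₁ → i₁ ℕ.≤ i₂ → i₂ ℕ.≤ i₃ → i₃ ℕ.≤ i₄ → HasDelta vs (hpoly i₁ i₂ i₃ i₄) → Cond0 d i₁ i₂ i₃ i₄
  simplex-case vs refl sp i₁ i₂ i₃ i₄ h₁ h₂ h₃ h₄ hd = Simplex.cond0 (simplexFive vs sp i₁ i₂ i₃ i₄ h₁ hd) h₂ h₃ h₄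

  module Vertices {d N : ℕ} (vs : Vec (Point d) N) (distinct : ∀ {i j} → lookup vs i ≡ lookup vs j → i ≡ j) (span : Hom.Spanning vs)
    (i₂ i₃ i₄ : ℕ) (hd : HasDelta vs (hpoly 1 i₂ i₃ i₄)) (i₄≤d : i₄ ℕ.≤ d)
    (size-N : N ≡ sum (map (λ e → shift (cnt (suc d)) e 1) (0 ∷ 1 ∷ i₂ ∷ i₃ ∷ i₄ ∷ []))) where
    private
      vertices : DistinctVertices
      vertices = distinctVertices (volumeFive (spanningFamily vs span) 1 i₂ i₃ i₄ hd) distinct
      module S = Saturated vertices
      module HB = Hibi vertices
      D = suc d
      sh : ℕ → ℕ → ℕ
      sh e n = shift (cnt D) e n
      r : ℕ
      r = D ℕ.∸ i₄
      i₄+r : i₄ ℕ.+ r ≡ D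
      i₄+r = ℕP.m+[n∸m]≡n (ℕP.m≤n⇒m≤1+n i₄≤d)

    len-pts : length (HB.pts 1) ≡ N
    len-pts = trans (HB.length-pts-exponents 1) (sym size-N)

    rich : i₂ ≡ 1 → suc (suc D) ℕ.≤ N × (i₃ ≡ i₄ → 2 ℕ.≤ i₄ → N ≡ suc (suc D))
    rich refl = subst (suc (suc D) ℕ.≤_) (sym size-N) (ℕP.≤-trans (ℕP.≤-reflexive e₀) (ℕP.+-monoʳ-≤ (cnt D 1) (ℕP.+-mono-≤ (ℕP.≤-reflexive (sym (cnt-0 D))) (ℕP.≤-trans (ℕP.≤-reflexive (sym (cnt-0 D))) (ℕP.m≤m+n (cnt D 0) _))))) ,
        λ { refl h → trans size-N (trans (cong₂ ℕ._+_ (cnt-1 D) (cong₂ ℕ._+_ (cnt-0 D) (cong₂ ℕ._+_ (cnt-0 D) (cong₂ ℕ._+_ (shift-cnt-1 D h) (cong (ℕ._+ 0) (shift-cnt-1 D h)))))) (ℕP.+-comm D 2)) }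
      where
      e₀ : suc (suc D) ≡ cnt D 1 ℕ.+ 2
      e₀ = trans (ℕP.+-comm 2 D) (cong (ℕ._+ 2) (sym (cnt-1 D)))

    -- Two extra points give N ≥ D + 2. A simple top exponent contradicts N ≤ D + 1 in `stanley₁`, a
    -- double one N + d ≤ 2 D = D + d + 1 in `stanley₂`.
    two-ones : i₂ ≡ 1 → i₂ ℕ.≤ i₃ → i₃ ℕ.≤ i₄ → 3 ℕ.≤ i₄ → ⊥
    two-ones refl l₃ l₄ big = go (ℕP.m≤n⇒m<n∨m≡n l₄)
      where
      go : i₃ ℕ.< i₄ ⊎ i₃ ≡ i₄ → ⊥
      go (inj₁ lt) = ℕP.<⇒≱ (proj₁ (rich refl)) (S.stanley₁ r i₄+r (ℕP.≤-trans (ℕP.n≤1+n 2) big) big big lt)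
      go (inj₂ e) = ℕP.<⇒≱ (ℕP.+-monoˡ-≤ d (proj₁ (rich refl))) (ℕP.≤-trans (S.stanley₂ r i₄+r (ℕP.≤-trans (ℕP.n≤1+n 2) big) big big e) (ℕP.≤-reflexive (ℕP.+-suc D d)))

    one-extra : 2 ℕ.≤ i₂ → i₂ ℕ.≤ i₃ → i₃ ℕ.≤ i₄ → suc D ≡ N
    one-extra l₂ l₃ l₄ = sym (trans size-N (trans (cong₂ ℕ._+_ (cnt-1 D) (cong₂ ℕ._+_ (cnt-0 D) (cong₂ ℕ._+_ (shift-cnt-1 D l₂) (cong₂ ℕ._+_ (shift-cnt-1 D (ℕP.≤-trans l₂ l₃)) (cong (ℕ._+ 0) (shift-cnt-1 D (ℕP.≤-trans l₂ (ℕP.≤-trans l₃ l₄)))))))) (ℕP.+-comm D 1)))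

    no-gap : 2 ℕ.≤ i₂ → i₂ ℕ.≤ i₃ → i₃ ℕ.≤ i₄ → 3 ℕ.≤ i₄ → i₄ ℕ.≤ suc i₃
    no-gap l₂ l₃ l₄ big = ℕP.≮⇒≥ λ lt → ℕP.<⇒≱ (ℕP.≤-reflexive (one-extra l₂ l₃ l₄)) (S.stanley₀ r i₄+r (ℕP.≤-trans (ℕP.n≤1+n 2) big) big (ℕP.≤-trans (ℕ.s≤s (ℕ.s≤s l₃)) lt) lt)

    -- The sums of n ≤ 3 out of d + 2 generators are distinct lattice points of the n-th dilate.
    -- Their number exceeds the Ehrhart count by one for n = 2 if i₂ > 2, and for n = 3 if i₂ = 2
    -- and i₃ > 3.
    second-two : (l₂ : 2 ℕ.≤ i₂) (l₃ : i₂ ℕ.≤ i₃) (l₄ : i₃ ℕ.≤ i₄) → i₂ ≡ 2 × i₃ ℕ.≤ 3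
    second-two l₂ l₃ l₄ = i₂≡2 , ℕP.≮⇒≥ λ lt → no-three lt
      where
      module R = SmallRelations (oneRelation vertices (one-extra l₂ l₃ l₄))
      sums : ∀ n → n ℕ.≤ 3 → cnt (suc D) n ℕ.≤ sum (map (λ e → sh e n) (0 ∷ 1 ∷ i₂ ∷ i₃ ∷ i₄ ∷ []))
      sums n le = subst₂ ℕ._≤_ (cong (λ z → cnt z n) (sym (one-extra l₂ l₃ l₄))) (R.length-pts-exponents n) (R.sums-≤ n le)
      i₂≡2 : i₂ ≡ 2
      i₂≡2 = sym (ℕP.≤-antisym l₂ (ℕP.≮⇒≥ λ lt → ℕP.1+n≰n (ℕP.≤-trans (ℕP.≤-reflexive (e₁ lt)) (ℕP.≤-trans (sums 2 (ℕ.s≤s (ℕ.s≤s ℕ.z≤n))) (ℕP.≤-reflexive (e₂ lt))))))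
        where
        e₁ : 2 ℕ.< i₂ → suc (cnt D 2 ℕ.+ cnt D 1) ≡ cnt (suc D) 2
        e₁ _ = sym (trans (cong (λ t → cnt D 2 ℕ.+ (cnt D 1 ℕ.+ t)) (cnt-0 D)) (trans (cong (cnt D 2 ℕ.+_) (ℕP.+-comm (cnt D 1) 1)) (ℕP.+-suc (cnt D 2) (cnt D 1))))
        e₂ : 2 ℕ.< i₂ → sum (map (λ e → sh e 2) (0 ∷ 1 ∷ i₂ ∷ i₃ ∷ i₄ ∷ [])) ≡ cnt D 2 ℕ.+ cnt D 1
        e₂ lt = cong (cnt D 2 ℕ.+_) (trans (cong (cnt D 1 ℕ.+_) (cong₂ ℕ._+_ (shift-> (cnt D) lt) (cong₂ ℕ._+_ (shift-> (cnt D) (ℕP.≤-trans lt l₃)) (cong (ℕ._+ 0) (shift-> (cnt D) (ℕP.≤-trans lt (ℕP.≤-trans l₃ l₄))))))) (ℕP.+-identityʳ (cnt D 1)))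
      no-three : 3 ℕ.< i₃ → ⊥
      no-three lt = ℕP.1+n≰n (ℕP.≤-trans (ℕP.≤-reflexive e₁) (ℕP.≤-trans (sums 3 ℕP.≤-refl) (ℕP.≤-reflexive e₂)))
        where
        e₁ : suc (cnt D 3 ℕ.+ (cnt D 2 ℕ.+ cnt D 1)) ≡ cnt (suc D) 3
        e₁ = sym (trans (cong (λ t → cnt D 3 ℕ.+ (cnt D 2 ℕ.+ (cnt D 1 ℕ.+ t))) (cnt-0 D)) (trans (cong (λ t → cnt D 3 ℕ.+ (cnt D 2 ℕ.+ t)) (ℕP.+-comm (cnt D 1) 1)) (trans (cong (cnt D 3 ℕ.+_) (ℕP.+-suc (cnt D 2) (cnt D 1))) (ℕP.+-suc (cnt D 3) _))))
        e₂ : sum (map (λ e → sh e 3) (0 ∷ 1 ∷ i₂ ∷ i₃ ∷ i₄ ∷ [])) ≡ cnt D 3 ℕ.+ (cnt D 2 ℕ.+ cnt D 1)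
        e₂ = cong (λ t → cnt D 3 ℕ.+ (cnt D 2 ℕ.+ t)) (trans (cong₂ ℕ._+_ (cong (λ t → sh t 3) i₂≡2) (cong₂ ℕ._+_ (shift-> (cnt D) lt) (cong (ℕ._+ 0) (shift-> (cnt D) (ℕP.≤-trans lt l₄))))) (ℕP.+-identityʳ (cnt D 1)))

    -- As N = D + 1 here, Hibi's inequality leaves room for a single interior lattice point.
    hibi-bound : (l₂ : 2 ℕ.≤ i₂) (l₃ : i₂ ℕ.≤ i₃) (l₄ : i₃ ℕ.≤ i₄) → i₄ ≡ d → mult (0 ∷ 1 ∷ i₂ ∷ i₃ ∷ i₄ ∷ []) i₄ ℕ.≤ suc d → mult (0 ∷ 1 ∷ i₂ ∷ i₃ ∷ i₄ ∷ []) i₄ ℕ.≤ 1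
    hibi-bound l₂ l₃ l₄ e small = ℕP.+-cancelˡ-≤ D _ 1 (subst (D ℕ.+ mult (0 ∷ 1 ∷ i₂ ∷ i₃ ∷ i₄ ∷ []) i₄ ℕ.≤_) (trans (sym (one-extra l₂ l₃ l₄)) (ℕP.+-comm 1 D))
      (HB.hibi len-pts e (subst (mult (0 ∷ 1 ∷ i₂ ∷ i₃ ∷ i₄ ∷ []) i₄ ℕ.<_) (one-extra l₂ l₃ l₄) (ℕ.s≤s small))))

  necessity-1 : ∀ {d N} (vs : Vec (Point d) N) → (∀ {i j} → lookup vs i ≡ lookup vs j → i ≡ j) → Hom.Spanning vs → ∀ i₂ i₃ i₄ → HasDelta vs (hpoly 1 i₂ i₃ i₄) →
    1 ℕ.≤ i₂ → i₂ ℕ.≤ i₃ → i₃ ℕ.≤ i₄ → i₄ ℕ.≤ d → N ≡ sum (map (λ e → shift (cnt (suc d)) e 1) (0 ∷ 1 ∷ i₂ ∷ i₃ ∷ i₄ ∷ [])) → Conclusion d 1 i₂ i₃ i₄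
  necessity-1 {d} {N} vs distinct span i₂ i₃ i₄ hd h₂ h₃ h₄ h₅ size-N = go (ℕP.m≤n⇒m<n∨m≡n h₂)
    where
    module V = Vertices vs distinct span i₂ i₃ i₄ hd h₅ size-N
    ones : ∀ i₃ i₄ → 1 ℕ.≤ i₃ → i₃ ℕ.≤ i₄ → i₄ ℕ.≤ d → ¬ (3 ℕ.≤ i₄) → Conclusion d 1 1 i₃ i₄
    ones 1 1 _ _ l _ = inj₁ (cond0-intro d 1 1 1 1 refl (ℕ.s≤s l) (ℕ.s≤s ℕ.z≤n) (ℕ.s≤s ℕ.z≤n) (ℕ.s≤s ℕ.z≤n) (ℕ.s≤s ℕ.z≤n))
    ones 1 2 _ _ l _ = inj₂ (inj₁ (refl , refl , refl , refl , l))
    ones 2 2 _ _ l _ = inj₁ (cond0-intro d 1 1 2 2 refl (ℕ.s≤s l) (ℕ.s≤s ℕ.z≤n) ℕP.≤-refl (ℕ.s≤s (ℕ.s≤s ℕ.z≤n)) ℕP.≤-refl)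
    ones (suc (suc (suc i₃))) i₄ _ l _ n = ⊥-elim (n (ℕP.≤-trans (ℕ.s≤s (ℕ.s≤s (ℕ.s≤s ℕ.z≤n))) l))
    ones i₃ (suc (suc (suc i₄))) _ _ _ n = ⊥-elim (n (ℕ.s≤s (ℕ.s≤s (ℕ.s≤s ℕ.z≤n))))
    ones 2 1 _ (ℕ.s≤s ()) _ _
    ones 1 0 _ () _ _
    ones 2 0 _ () _ _
    twos : ∀ i₃ i₄ → i₂ ≡ 2 → HasDelta vs (hpoly 1 2 i₃ i₄) → 2 ℕ.≤ i₃ → i₃ ℕ.≤ 3 → i₃ ℕ.≤ i₄ → i₄ ℕ.≤ d → (3 ℕ.≤ i₄ → i₄ ℕ.≤ suc i₃) →
      (i₄ ≡ d → mult (0 ∷ 1 ∷ 2 ∷ i₃ ∷ i₄ ∷ []) i₄ ℕ.≤ suc d → mult (0 ∷ 1 ∷ 2 ∷ i₃ ∷ i₄ ∷ []) i₄ ℕ.≤ 1) → suc (suc d) ≡ N → Conclusion d 1 2 i₃ i₄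
    twos 2 2 refl hd' _ _ _ l _ hib _ = case (ℕP.m≤n⇒m<n∨m≡n l)
      where
      case : 2 ℕ.< d ⊎ 2 ≡ d → Conclusion d 1 2 2 2
      case (inj₁ lt) = inj₂ (inj₂ (inj₁ (refl , refl , refl , refl , lt)))
      -- For d = 2 the exponent 2 = d occurs three times, against Hibi's bound 1.
      case (inj₂ e) = ⊥-elim (ℕP.<⇒≱ (ℕ.s≤s (ℕ.s≤s ℕ.z≤n)) (hib e (subst (λ d → 3 ℕ.≤ suc d) e ℕP.≤-refl)))
    twos 2 3 refl hd' _ _ _ l _ _ _ = inj₁ (cond0-intro d 1 2 2 3 refl (ℕ.s≤s l) ℕP.≤-refl (ℕ.s≤s (ℕ.s≤s ℕ.z≤n)) ℕP.≤-refl (ℕ.s≤s (ℕ.s≤s (ℕ.s≤s ℕ.z≤n))))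
    twos 3 4 refl hd' _ _ _ l _ _ _ = inj₁ (cond0-intro d 1 2 3 4 refl (ℕ.s≤s l) ℕP.≤-refl ℕP.≤-refl ℕP.≤-refl ℕP.≤-refl)
    twos 3 3 refl hd' _ _ _ l _ hib N≡ = case (ℕP.m≤n⇒m<n∨m≡n l)
      where
      four : ∀ {d N} (vs : Vec (Point d) N) → (∀ {i j} → lookup vs i ≡ lookup vs j → i ≡ j) → Hom.Spanning vs → HasDelta vs (hpoly 1 2 3 3) → suc (suc d) ≡ N → d ≢ 4
      four vs dist sp hd N≡ refl = DimensionFour.impossible (fourDimensional N≡ vs dist sp hd)
      case : 3 ℕ.< d ⊎ 3 ≡ d → Conclusion d 1 2 3 3
      -- For d = 3 the exponent 3 = d occurs twice, again more than 1.
      case (inj₂ e) = ⊥-elim (ℕP.<⇒≱ (ℕ.s≤s (ℕ.s≤s ℕ.z≤n)) (hib e (ℕP.≤-trans (ℕ.s≤s (ℕ.s≤s ℕ.z≤n)) (ℕP.m≤n⇒m≤1+n l))))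
      case (inj₁ lt) = case₄ (ℕP.m≤n⇒m<n∨m≡n lt)
        where
        case₄ : 4 ℕ.< d ⊎ 4 ≡ d → Conclusion d 1 2 3 3
        case₄ (inj₁ lt) = inj₂ (inj₂ (inj₂ (refl , refl , refl , refl , lt)))
        case₄ (inj₂ e) = ⊥-elim (four vs distinct span hd' N≡ (sym e))
    twos 2 (suc (suc (suc (suc k)))) _ _ _ _ _ _ g _ _ with g (ℕ.s≤s (ℕ.s≤s (ℕ.s≤s ℕ.z≤n)))
    ... | ℕ.s≤s (ℕ.s≤s (ℕ.s≤s ()))
    twos 3 (suc (suc (suc (suc (suc k))))) _ _ _ _ _ _ g _ _ with g (ℕ.s≤s (ℕ.s≤s (ℕ.s≤s ℕ.z≤n)))
    ... | ℕ.s≤s (ℕ.s≤s (ℕ.s≤s (ℕ.s≤s ())))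
    twos 2 1 _ _ _ _ (ℕ.s≤s ()) _ _ _ _
    twos 3 1 _ _ _ _ (ℕ.s≤s ()) _ _ _ _
    twos 3 2 _ _ _ _ (ℕ.s≤s (ℕ.s≤s ())) _ _ _ _
    twos 1 _ _ _ (ℕ.s≤s ()) _ _ _ _ _ _
    twos (suc (suc (suc (suc k)))) _ _ _ _ (ℕ.s≤s (ℕ.s≤s (ℕ.s≤s ()))) _ _ _ _ _
    go : 1 ℕ.< i₂ ⊎ 1 ≡ i₂ → Conclusion d 1 i₂ i₃ i₄
    go (inj₂ refl) = ones i₃ i₄ h₃ h₄ h₅ (λ big → V.two-ones refl h₃ h₄ big)
    go (inj₁ lt) = subst (λ t → Conclusion d 1 t i₃ i₄) (sym (proj₁ st)) (twos i₃ i₄ (proj₁ st) (subst (λ t → HasDelta vs (hpoly 1 t i₃ i₄)) (proj₁ st) hd)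
        (ℕP.≤-trans lt h₃) (proj₂ st) h₄ h₅ (V.no-gap lt h₃ h₄)
        (subst (λ t → i₄ ≡ d → mult (0 ∷ 1 ∷ t ∷ i₃ ∷ i₄ ∷ []) i₄ ℕ.≤ suc d → mult (0 ∷ 1 ∷ t ∷ i₃ ∷ i₄ ∷ []) i₄ ℕ.≤ 1) (proj₁ st) (V.hibi-bound lt h₃ h₄)) (V.one-extra lt h₃ h₄))
      where
      st : i₂ ≡ 2 × i₃ ℕ.≤ 3
      st = V.second-two lt h₃ h₄

  necessity : ∀ d i₁ i₂ i₃ i₄ → 1 ℕ.≤ i₁ → i₁ ℕ.≤ i₂ → i₂ ℕ.≤ i₃ → i₃ ℕ.≤ i₄ → i₄ ℕ.≤ d → ExistsPolytope d (hpoly i₁ i₂ i₃ i₄) → Conclusion d i₁ i₂ i₃ i₄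
  necessity d i₁ i₂ i₃ i₄ h₁ h₂ h₃ h₄ h₅ (k , vs , fd , hd) = go (saturate vs (Hom.spanning vs fd) i₁ i₂ i₃ i₄ hd)
    where
    go : (∃ λ (xs : List (Point d)) → Unique xs × length xs ≡ sum (map (λ e → shift (cnt (suc d)) e 1) (0 ∷ i₁ ∷ i₂ ∷ i₃ ∷ i₄ ∷ [])) ×
      Hom.Spanning (Vec.fromList xs) × HasDelta (Vec.fromList xs) (hpoly i₁ i₂ i₃ i₄)) → Conclusion d i₁ i₂ i₃ i₄
    go (xs , u , len , sp , hd') = case (ℕP.m≤n⇒m<n∨m≡n h₁)
      where
      case : 1 ℕ.< i₁ ⊎ 1 ≡ i₁ → Conclusion d i₁ i₂ i₃ i₄
      case (inj₂ refl) = necessity-1 (Vec.fromList xs) (fromList-distinct u) sp i₂ i₃ i₄ hd' h₂ h₃ h₄ h₅ len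
      case (inj₁ lt) = inj₁ (simplex-case (Vec.fromList xs) (trans len N≡) sp i₁ i₂ i₃ i₄ h₁ h₂ h₃ h₄ hd')
        where
        D = suc d
        N≡ : sum (map (λ e → shift (cnt D) e 1) (0 ∷ i₁ ∷ i₂ ∷ i₃ ∷ i₄ ∷ [])) ≡ suc d
        N≡ = trans (cong₂ ℕ._+_ (cnt-1 D) (cong₂ ℕ._+_ (shift-cnt-1 D lt) (cong₂ ℕ._+_ (shift-cnt-1 D (ℕP.≤-trans lt h₂)) (cong₂ ℕ._+_ (shift-cnt-1 D (ℕP.≤-trans lt (ℕP.≤-trans h₂ h₃))) (cong (ℕ._+ 0) (shift-cnt-1 D (ℕP.≤-trans lt (ℕP.≤-trans h₂ (ℕP.≤-trans h₃ h₄))))))))) (ℕP.+-identityʳ D)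

  simplex-necessity : ∀ d i₁ i₂ i₃ i₄ → 1 ℕ.≤ i₁ → i₁ ℕ.≤ i₂ → i₂ ℕ.≤ i₃ → i₃ ℕ.≤ i₄ → ExistsSimplex d (hpoly i₁ i₂ i₃ i₄) → Cond0 d i₁ i₂ i₃ i₄
  simplex-necessity d i₁ i₂ i₃ i₄ h₁ h₂ h₃ h₄ (vs , aff , hd) = simplex-case vs refl (Hom.spanning vs ((λ i → i) , aff)) i₁ i₂ i₃ i₄ h₁ h₂ h₃ h₄ hd

  -- A simplex satisfies i₁ + i₄ = i₂ + i₃, but in the three cases the two sums are 3 and 2, 3 and
  -- 4, 4 and 5.
  not-simplex : ∀ d i₁ i₂ i₃ i₄ → 1 ℕ.≤ i₁ → i₁ ℕ.≤ i₂ → i₂ ℕ.≤ i₃ → i₃ ℕ.≤ i₄ → Cond1 d i₁ i₂ i₃ i₄ ⊎ Cond2 d i₁ i₂ i₃ i₄ ⊎ Cond3 d i₁ i₂ i₃ i₄ → ¬ ExistsSimplex d (hpoly i₁ i₂ i₃ i₄)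
  not-simplex d i₁ i₂ i₃ i₄ h₁ h₂ h₃ h₄ c ex = go c (proj₁ (simplex-necessity d i₁ i₂ i₃ i₄ h₁ h₂ h₃ h₄ ex))
    where
    go : Cond1 d i₁ i₂ i₃ i₄ ⊎ Cond2 d i₁ i₂ i₃ i₄ ⊎ Cond3 d i₁ i₂ i₃ i₄ → i₁ ℕ.+ i₄ ≢ i₂ ℕ.+ i₃
    go (inj₁ (refl , refl , refl , refl , _)) ()
    go (inj₂ (inj₁ (refl , refl , refl , refl , _))) ()
    go (inj₂ (inj₂ (refl , refl , refl , refl , _))) ()

  -- Constructions

  -- A parametrisation of the lattice points of all dilates by five classes with natural multipliers
  -- plays the part of the half-open decomposition: the codes have generating function Σ t^es over
  -- (1 - t)^(d+1). Positive exponents make the count at 0 equal to 1.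
  has-delta : ∀ {d K} (vs : Vec (Point d) K) (es : Fin 5 → ℕ) (φ : Fin 5 → Vec ℕ (suc d) → Point d) →
    (∀ p y → InDilate vs (es p ℕ.+ Vec.sum y) (φ p y)) →
    (∀ p y p' y' → es p ℕ.+ Vec.sum y ≡ es p' ℕ.+ Vec.sum y' → φ p y ≡ φ p' y' → p ≡ p' × y ≡ y') →
    (∀ n x → InDilate vs n x → ∃ λ p → ∃ λ y → es p ℕ.+ Vec.sum y ≡ n × φ p y ≡ x) →
    ∀ i₁ i₂ i₃ i₄ → 1 ℕ.≤ i₁ → 1 ℕ.≤ i₂ → 1 ℕ.≤ i₃ → 1 ℕ.≤ i₄ → map es (List.allFin 5) ↭ 0 ∷ i₁ ∷ i₂ ∷ i₃ ∷ i₄ ∷ [] → HasDelta vs (hpoly i₁ i₂ i₃ i₄)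
  has-delta {d} vs es φ into inj onto i₁ i₂ i₃ i₄ h₁ h₂ h₃ h₄ perm = L , L0 , counted , λ k → trans (deltaCoef-counts d L exps (λ n → refl) k) (cong (λ m → ℤ.+ m) (mult-eq k))
    where
    exps : List ℕ
    exps = 0 ∷ i₁ ∷ i₂ ∷ i₃ ∷ i₄ ∷ []
    D : ℕ
    D = suc d
    L : ℕ → ℕ
    L n = counts D exps n
    full : Mask D
    full = Vec.replicate D true
    full-supp : ∀ y → SuppN full y
    full-supp y i e = ⊥-elim (true≢false (VecP.lookup-replicate i true) e)
    mult-eq : ∀ k → mult exps k ≡ ind 0 k ℕ.+ ind i₁ k ℕ.+ ind i₂ k ℕ.+ ind i₃ k ℕ.+ ind i₄ k
    mult-eq k = NS.solve 5 (λ a b c d e → a NS.:+ (b NS.:+ (c NS.:+ (d NS.:+ (e NS.:+ NS.con 0)))) NS.:= a NS.:+ b NS.:+ c NS.:+ d NS.:+ e) refl (ind 0 k) (ind i₁ k) (ind i₂ k) (ind i₃ k) (ind i₄ k)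
    L0 : L 0 ≡ 1
    L0 = cong₂ ℕ._+_ (cnt-0 D) (cong₂ ℕ._+_ (shift-> (cnt D) h₁) (cong₂ ℕ._+_ (shift-> (cnt D) h₂) (cong₂ ℕ._+_ (shift-> (cnt D) h₃) (cong (ℕ._+ 0) (shift-> (cnt D) h₄)))))
    f : ℕ → Fin 5 → List (Vec ℕ D)
    f n p = compsShift full (es p) n
    codes : ℕ → List (Fin 5 × Vec ℕ D)
    codes n = tagged (f n) (List.allFin 5)
    Φ : Fin 5 × Vec ℕ D → Point d
    Φ (p , y) = φ p y
    codes⁻ : ∀ n {p y} → (p , y) ∈ codes n → es p ℕ.+ Vec.sum y ≡ n
    codes⁻ n {p} c = proj₂ (∈-compsShift⁻ full (es p) n (proj₂ (∈-tagged⁻ (f n) {List.allFin 5} c)))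
    length-codes : ∀ n → length (codes n) ≡ L n
    length-codes n = trans (length-tagged (f n) (List.allFin 5)) (trans (sum-map-cong (List.allFin 5) (λ {p} _ → trans (length-compsShift full (es p) n) (cong (λ z → shift (cnt z) (es p) n) (size-all full (λ i → VecP.lookup-replicate i true)))))
      (LA.sum-↭ (PP.map⁺ (λ e → shift (cnt D) e n) perm)))
    Φ-injective : ∀ n {c c'} → c ∈ codes n → c' ∈ codes n → Φ c ≡ Φ c' → c ≡ c'
    Φ-injective n {p , y} {p' , y'} c∈ c'∈ e = cong₂ _,_ (proj₁ r) (proj₂ r)
      where r = inj p y p' y' (trans (codes⁻ n c∈) (sym (codes⁻ n c'∈))) e
    counted : (n : ℕ) → LatticeCount vs (suc n) (L (suc n))
    counted n = map Φ (codes (suc n)) , unique-map (Φ-injective (suc n)) (unique-tagged (f (suc n)) {List.allFin 5} (UP.allFin⁺ 5) (λ p → unique-compsShift full (es p) (suc n))) ,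
        (λ x x∈ → member x (∈-map⁻ Φ x∈)) , (λ x h → covered x (onto (suc n) x h)) , trans (ListP.length-map Φ (codes (suc n))) (length-codes (suc n))
      where
      member : ∀ x → (∃ λ c → c ∈ codes (suc n) × x ≡ Φ c) → InDilate vs (suc n) x
      member x ((p , y) , c∈ , e) = subst₂ (InDilate vs) (codes⁻ (suc n) c∈) (sym e) (into p y)
      covered : ∀ x → (∃ λ p → ∃ λ y → es p ℕ.+ Vec.sum y ≡ suc n × φ p y ≡ x) → x ∈ map Φ (codes (suc n))
      covered x (p , y , s , e) = subst (_∈ map Φ (codes (suc n))) e (∈-map⁺ Φ (∈-tagged⁺ (f (suc n)) {List.allFin 5} (∈-allFin p) (∈-compsShift⁺ full (es p) y (full-supp y) s)))

  zeros : ∀ d → Point d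
  zeros d = Vec.replicate d (ℤ.+ 0)

  total : ∀ {d} → Vec ℤ d → ℤ
  total v = sumZ (lookup v)

  -- barycentric coordinates, the origin coming first
  bary : ∀ {d} → ℤ → Vec ℤ d → Vec ℤ (suc d)
  bary n x = (n ℤ.- total x) ∷ x

  -- The convex hull of v and the standard simplex. Once the weight s of v is fixed, the other
  -- weights are forced to be the barycentric coordinates of x minus s times those of v; membership
  -- is thus a condition on s alone.
  module Apex {d : ℕ} (v : Point d) where

    unit-sum : ∀ (g : Fin d → ℚ) j → sumℚ (λ k → g k * ι (lookup (tabulate unit) k) j) ≡ g j
    unit-sum g j = trans (Σ-single j (λ k ne → trans (cong (g k *_) (trans (cong (λ u → ι u j) (VecP.lookup∘tabulate unit k)) (trans (ι-unit k j) (δ-off k j (λ e → ne (sym e)))))) (*-zeroʳ (g k))))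
      (trans (cong (g j *_) (trans (cong (λ u → ι u j) (VecP.lookup∘tabulate unit j)) (trans (ι-unit j j) (δ-diag j)))) (*-identityʳ (g j)))

    module _ (c : Fin (suc (suc d)) → ℚ) (n : ℤ) (x : Point d) where
      private
        s o : ℚ
        s = c zero
        o = c (suc zero)
        g : Fin d → ℚ
        g k = c (suc (suc k))

      Sum Coords Solved : Set
      Sum = sumℚ c ≡ toℚ n
      Coords = ∀ j → s * ι v j + (o * ι (zeros d) j + sumℚ (λ k → g k * ι (lookup (tabulate unit) k) j)) ≡ ι x j
      Solved = ∀ j → c (suc j) ≡ ι (bary n x) j - s * ι (bary (ℤ.+ 1) v) j

      coords-simp : ∀ j → s * ι v j + (o * ι (zeros d) j + sumℚ (λ k → g k * ι (lookup (tabulate unit) k) j)) ≡ s * ι v j + g j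
      coords-simp j = cong (s * ι v j +_) (trans (cong₂ _+_ (trans (cong (o *_) (cong toℚ (VecP.lookup-replicate j (ℤ.+ 0)))) (*-zeroʳ o)) (unit-sum g j)) (+-identityˡ (g j)))

      origin-coefficient : ι (bary n x) zero - s * ι (bary (ℤ.+ 1) v) zero ≡ toℚ n - s - sumℚ (λ k → ι x k - s * ι v k)
      origin-coefficient = trans (cong₂ (λ a b → a - s * b) (trans (toℚ-- n (total x)) (cong (λ t → toℚ n - t) (toℚ-sumZ (lookup x)))) (trans (toℚ-- (ℤ.+ 1) (total v)) (cong (λ t → 1ℚ - t) (toℚ-sumZ (lookup v)))))
        (trans (solve 4 (λ n a s b → (n :- a) :- s :* (con 1ℚ :- b) := n :- s :- (a :- s :* b)) refl (toℚ n) (sumℚ (ι x)) s (sumℚ (ι v)))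
        (cong (λ t → toℚ n - s - t) (sym (trans (Σ-- (ι x) (λ k → s * ι v k)) (cong (λ t → sumℚ (ι x) - t) (Σ-*ˡ s (ι v)))))))

      solved : Sum → Coords → Solved
      solved hs hc (suc k) = trans (solve 2 (λ a b → b := (a :+ b) :- a) refl (s * ι v k) (g k)) (cong (_- s * ι v k) (trans (sym (coords-simp k)) (hc k)))
      solved hs hc zero = trans (solve 3 (λ s o g → o := (s :+ (o :+ g)) :- s :- g) refl s o (sumℚ g)) (trans (cong₂ (λ a b → a - s - b) hs (Σ-cong (λ k → solved hs hc (suc k)))) (sym origin-coefficient))

      unsolved : Solved → Sum × Coords
      unsolved h = trans (cong (λ t → s + t) (cong₂ _+_ (trans (h zero) origin-coefficient) (Σ-cong (λ k → h (suc k))))) (solve 3 (λ s n g → s :+ ((n :- s :- g) :+ g) := n) refl s (toℚ n) (sumℚ (λ k → ι x k - s * ι v k))) ,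
        λ j → trans (coords-simp j) (trans (cong (s * ι v j +_) (h (suc j))) (solve 2 (λ a x → a :+ (x :- a) := x) refl (s * ι v j) (ι x j)))

    solved-0 : ∀ c → c zero ≡ 0ℚ → Solved c (ℤ.+ 0) (zeros d) → ∀ j → c (suc j) ≡ 0ℚ
    solved-0 c e h j = trans (h j) (trans (cong₂ (λ a b → a - b * ι (bary (ℤ.+ 1) v) j) (bary-0 j) e) (trans (cong (λ t → 0ℚ - t) (*-zeroˡ (ι (bary (ℤ.+ 1) v) j))) (+-inverseʳ 0ℚ)))
      where
      bary-0 : ∀ j → ι (bary (ℤ.+ 0) (zeros d)) j ≡ 0ℚ
      bary-0 zero = trans (toℚ-- (ℤ.+ 0) (total (zeros d))) (trans (cong (λ t → 0ℚ - t) (trans (toℚ-sumZ (lookup (zeros d))) (Σ-0 {d} {ι (zeros d)} (λ k → cong toℚ (VecP.lookup-replicate k (ℤ.+ 0)))))) (+-inverseʳ 0ℚ))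
      bary-0 (suc k) = cong toℚ (VecP.lookup-replicate k (ℤ.+ 0))

    vertices : Vec (Point d) (suc (suc d))
    vertices = v ∷ zeros d ∷ tabulate unit

    inDilate⁻ : ∀ n x → InDilate vertices n x → ∃ λ s → 0ℚ ≤ s × ∀ j → 0ℚ ≤ ι (bary (ℤ.+ n) x) j - s * ι (bary (ℤ.+ 1) v) j
    inDilate⁻ n x (c , c≥0 , hs , hc) = c zero , c≥0 zero , λ j → subst (0ℚ ≤_) (solved c (ℤ.+ n) x hs hc j) (c≥0 (suc j))

    inDilate⁺ : ∀ n x s → 0ℚ ≤ s → (∀ j → 0ℚ ≤ ι (bary (ℤ.+ n) x) j - s * ι (bary (ℤ.+ 1) v) j) → InDilate vertices n x
    inDilate⁺ n x s hs h = c , c≥0 , proj₁ r , proj₂ r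
      where
      c : Fin (suc (suc d)) → ℚ
      c zero = s
      c (suc j) = ι (bary (ℤ.+ n) x) j - s * ι (bary (ℤ.+ 1) v) j
      c≥0 : ∀ i → 0ℚ ≤ c i
      c≥0 zero = hs
      c≥0 (suc j) = h j
      r = unsolved c (ℤ.+ n) x (λ j → refl)

    fullDim : FullDim vertices
    fullDim = suc , aff
      where
      aff : AffIndep (λ i → lookup vertices (suc i))
      aff c hs hc = solved-0 c' refl (solved c' (ℤ.+ 0) (zeros d) (trans (+-identityˡ (sumℚ c)) hs)
          (λ j → trans (trans (cong (_+ (c zero * ι (zeros d) j + sumℚ (λ k → c (suc k) * ι (lookup (tabulate unit) k) j))) (*-zeroˡ (ι v j))) (trans (+-identityˡ _) (hc j))) (cong toℚ (sym (VecP.lookup-replicate j (ℤ.+ 0))))))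
        where
        c' : Fin (suc (suc d)) → ℚ
        c' zero = 0ℚ
        c' (suc i) = c i

  ℤ-cancelʳ : ∀ c a b → a ℤ.+ c ≡ b ℤ.+ c → a ≡ b
  ℤ-cancelʳ c a b e = trans (Z.solve 2 (λ a c → a Z.:= (a Z.:+ c) Z.:- c) refl a c) (trans (cong (ℤ._- c) e) (Z.solve 2 (λ a c → (a Z.:+ c) Z.:- c Z.:= a) refl b c))

  sumZ-cong : ∀ {n} {f g : Fin n → ℤ} → (∀ i → f i ≡ g i) → sumZ f ≡ sumZ g
  sumZ-cong {zero} h = refl
  sumZ-cong {suc n} h = cong₂ ℤ._+_ (h zero) (sumZ-cong (λ i → h (suc i)))

  sumZ-pos : ∀ {n} (f : Fin n → ℕ) → sumZ (λ i → ℤ.+ f i) ≡ ℤ.+ sumN f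
  sumZ-pos {zero} f = refl
  sumZ-pos {suc n} f = trans (cong (λ z → ℤ.+ f zero ℤ.+ z) (sumZ-pos (λ i → f (suc i)))) (sym (ℤP.pos-+ (f zero) (sumN (λ i → f (suc i)))))

  sumZ-affine : ∀ {n} (a b c : Fin n → ℤ) w → sumZ (λ i → a i ℤ.+ (b i ℤ.* w ℤ.+ c i)) ≡ sumZ a ℤ.+ (sumZ b ℤ.* w ℤ.+ sumZ c)
  sumZ-affine {zero} a b c w = sym (Z.solve 1 (λ w → Z.con (ℤ.+ 0) Z.:+ (Z.con (ℤ.+ 0) Z.:* w Z.:+ Z.con (ℤ.+ 0)) Z.:= Z.con (ℤ.+ 0)) refl w)
  sumZ-affine {suc n} a b c w = trans (cong (λ z → (a zero ℤ.+ (b zero ℤ.* w ℤ.+ c zero)) ℤ.+ z) (sumZ-affine (λ i → a (suc i)) (λ i → b (suc i)) (λ i → c (suc i)) w))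
    (Z.solve 7 (λ a b c A B C w → (a Z.:+ (b Z.:* w Z.:+ c)) Z.:+ (A Z.:+ (B Z.:* w Z.:+ C)) Z.:= (a Z.:+ A) Z.:+ ((b Z.:+ B) Z.:* w Z.:+ (c Z.:+ C))) refl
      (a zero) (b zero) (c zero) (sumZ (λ i → a (suc i))) (sumZ (λ i → b (suc i))) (sumZ (λ i → c (suc i))) w)

  sumZ-neg : ∀ {n} (f : Fin n → ℤ) → sumZ (λ i → ℤ.- f i) ≡ ℤ.- sumZ f
  sumZ-neg {zero} f = refl
  sumZ-neg {suc n} f = trans (cong (λ z → ℤ.- f zero ℤ.+ z) (sumZ-neg (λ i → f (suc i)))) (sym (ℤP.neg-distrib-+ (f zero) _))

  -- a + r/m ≥ 0 with 0 ≤ r < m forces a ≥ 0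
  floor-nonneg : ∀ m a r → r ℕ.< m → ℤ.+ 0 ℤ.≤ ℤ.+ m ℤ.* a ℤ.+ ℤ.+ r → ℤ.+ 0 ℤ.≤ a
  floor-nonneg m (ℤ.+ n) r lt h = ℤ.+≤+ ℕ.z≤n
  floor-nonneg m (ℤ.-[1+ n ]) r lt h = ⊥-elim (ℕP.<⇒≱ lt (ℕP.≤-trans (ℕP.m≤m*n m (suc n)) (ℤP.drop‿+≤+ (subst₂ ℤ._≤_ (Z.solve 1 (λ x → Z.con (ℤ.+ 0) Z.:+ x Z.:= x) refl (ℤ.+ (m ℕ.* suc n)))
      (trans (cong (λ t → (ℤ.+ m ℤ.* ℤ.-[1+ n ] ℤ.+ ℤ.+ r) ℤ.+ t) (ℤP.pos-* m (suc n))) (Z.solve 3 (λ m n r → (m Z.:* (Z.:- n) Z.:+ r) Z.:+ m Z.:* n Z.:= r) refl (ℤ.+ m) (ℤ.+ suc n) (ℤ.+ r))) (ℤP.+-monoˡ-≤ (ℤ.+ (m ℕ.* suc n)) h)))))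

  nonneg-abs : ∀ {a} → ℤ.+ 0 ℤ.≤ a → ℤ.+ ℤ.∣ a ∣ ≡ a
  nonneg-abs h = ℤP.0≤i⇒+∣i∣≡i h

  -- The box point in which the apex has weight k/5 has the fractional parts of Xⱼ k/5 as its other
  -- weights. The total weight k (1 + ΣX)/5 - Σ⌊Xⱼ k/5⌋ is its degree; `hX` and `hes` say that it
  -- equals `es k`.
  record FacetData : Set where
    constructor facetData
    field
      d : ℕ
      X : Vec ℕ (suc d)
      δ₁ : ℕ
      es : Fin 5 → ℕ
      hX : 1 ℕ.+ sumN (lookup X) ≡ 5 ℕ.* δ₁
      hes : ∀ k → es k ℕ.+ sumN (λ j → (lookup X j ℕ.* toℕ k) ℕ./ 5) ≡ toℕ k ℕ.* δ₁

  -- The standard simplex is the facet at height 0 and the opposite vertex has height 5, so a box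
  -- point is determined by its height.
  module FacetSimplex (𝓕 : FacetData) where
    open FacetData 𝓕

    x : Vec ℕ d
    x = Vec.tail X

    X-suc : ∀ j → lookup X (suc j) ≡ lookup x j
    X-suc j = go X
      where
      go : (X : Vec ℕ (suc d)) → lookup X (suc j) ≡ lookup (Vec.tail X) j
      go (_ ∷ _) = refl

    v : Point d
    v = tabulate (λ j → ℤ.- ℤ.+ lookup x j)

    module Ap = Apex v

    unit' : Fin d → Point (suc d)
    unit' j = ℤ.+ 0 ∷ unit j

    vertices : Vec (Point (suc d)) (suc (suc d))
    vertices = (ℤ.+ 5 ∷ v) ∷ zeros (suc d) ∷ tabulate unit'

    module _ (c : Fin (suc (suc d)) → ℚ) where
      first-coordinate : sumℚ (λ i → c i * ι (lookup vertices i) zero) ≡ c zero * toℚ (ℤ.+ 5)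
      first-coordinate = trans (cong (c zero * toℚ (ℤ.+ 5) +_) (trans (cong₂ _+_ (*-zeroʳ (c (suc zero))) (Σ-0 {d} {λ k → c (suc (suc k)) * ι (lookup (tabulate unit') k) zero} (λ k → trans (cong (λ u → c (suc (suc k)) * ι u zero) (VecP.lookup∘tabulate unit' k)) (*-zeroʳ (c (suc (suc k))))))) (+-identityʳ 0ℚ))) (+-identityʳ _)

      later-coordinate : ∀ j → sumℚ (λ i → c i * ι (lookup vertices i) (suc j)) ≡ c zero * ι v j + (c (suc zero) * ι (zeros d) j + sumℚ (λ k → c (suc (suc k)) * ι (lookup (tabulate unit) k) j))
      later-coordinate j = cong (λ t → c zero * ι v j + (c (suc zero) * ι (zeros d) j + t)) (Σ-cong (λ k → cong (λ z → c (suc (suc k)) * toℚ z) (trans (cong (λ u → lookup u (suc j)) (VecP.lookup∘tabulate unit' k)) (cong (λ u → lookup u j) (sym (VecP.lookup∘tabulate unit k))))))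

    affIndep : AffIndep (lookup vertices)
    affIndep c hs hc = all
      where
      c0 : c zero ≡ 0ℚ
      c0 = *-cancel-0 (toℚ (ℤ.+ 5)) (c zero) (λ ()) (trans (*-comm (toℚ (ℤ.+ 5)) (c zero)) (trans (sym (first-coordinate c)) (hc zero)))
      all : ∀ i → c i ≡ 0ℚ
      all zero = c0
      all (suc j) = Ap.solved-0 c c0 (Ap.solved c (ℤ.+ 0) (zeros d) hs (λ j → trans (sym (later-coordinate c j)) (trans (hc (suc j)) (cong toℚ (sym (VecP.lookup-replicate j (ℤ.+ 0))))))) j

    -- the coordinates with respect to the facet, after removing the multiple f of the extra generator
    T : ℤ → ℤ → Point d → Fin (suc d) → ℤ
    T n f t zero = n ℤ.- total t ℤ.- ℤ.+ δ₁ ℤ.* f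
    T n f t (suc j) = lookup t j

    Inside : ℤ → ℤ → Point d → Set
    Inside n f t = ℤ.+ 0 ℤ.≤ f × ∀ j → ℤ.+ 0 ℤ.≤ ℤ.+ 5 ℤ.* T n f t j ℤ.+ ℤ.+ lookup X j ℤ.* f

    total-v : total v ≡ ℤ.- ℤ.+ sumN (lookup x)
    total-v = trans (sumZ-cong (VecP.lookup∘tabulate (λ j → ℤ.- ℤ.+ lookup x j))) (trans (sumZ-neg (λ j → ℤ.+ lookup x j)) (cong ℤ.-_ (sumZ-pos (lookup x))))

    hX' : ℤ.+ 1 ℤ.+ (ℤ.+ lookup X zero ℤ.+ ℤ.+ sumN (lookup x)) ≡ ℤ.+ 5 ℤ.* ℤ.+ δ₁
    hX' = trans (cong (λ z → ℤ.+ 1 ℤ.+ z) (trans (sym (ℤP.pos-+ (lookup X zero) (sumN (lookup x)))) (cong (λ m → ℤ.+ (lookup X zero ℕ.+ m)) (sumN-cong (λ j → sym (X-suc j)))))) (trans (sym (ℤP.pos-+ 1 (sumN (lookup X)))) (trans (cong (λ m → ℤ.+ m) hX) (ℤP.pos-* 5 δ₁)))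

    scaled : ∀ n f t j → ℤ.+ 5 ℤ.* lookup (bary n t) j ℤ.- f ℤ.* lookup (bary (ℤ.+ 1) v) j ≡ ℤ.+ 5 ℤ.* T n f t j ℤ.+ ℤ.+ lookup X j ℤ.* f
    scaled n f t (suc j) = trans (cong (λ z → ℤ.+ 5 ℤ.* lookup t j ℤ.- f ℤ.* z) (VecP.lookup∘tabulate (λ j → ℤ.- ℤ.+ lookup x j) j)) (trans (Z.solve 3 (λ t f x → Z.con (ℤ.+ 5) Z.:* t Z.:- f Z.:* (Z.:- x) Z.:= Z.con (ℤ.+ 5) Z.:* t Z.:+ x Z.:* f) refl (lookup t j) f (ℤ.+ lookup x j)) (cong (λ m → ℤ.+ 5 ℤ.* lookup t j ℤ.+ ℤ.+ m ℤ.* f) (sym (X-suc j))))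
    scaled n f t zero = begin
      ℤ.+ 5 ℤ.* (n ℤ.- total t) ℤ.- f ℤ.* (ℤ.+ 1 ℤ.- total v) ≡⟨ cong (λ z → ℤ.+ 5 ℤ.* (n ℤ.- total t) ℤ.- f ℤ.* (ℤ.+ 1 ℤ.- z)) total-v ⟩
      ℤ.+ 5 ℤ.* (n ℤ.- total t) ℤ.- f ℤ.* (ℤ.+ 1 ℤ.- (ℤ.- s)) ≡⟨ Z.solve 5 (λ n t f s x → Z.con (ℤ.+ 5) Z.:* (n Z.:- t) Z.:- f Z.:* (Z.con (ℤ.+ 1) Z.:- (Z.:- s)) Z.:= Z.con (ℤ.+ 5) Z.:* (n Z.:- t) Z.:- (Z.con (ℤ.+ 1) Z.:+ (x Z.:+ s)) Z.:* f Z.:+ x Z.:* f) refl n (total t) f s x₀ ⟩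
      ℤ.+ 5 ℤ.* (n ℤ.- total t) ℤ.- (ℤ.+ 1 ℤ.+ (x₀ ℤ.+ s)) ℤ.* f ℤ.+ x₀ ℤ.* f ≡⟨ cong (λ z → ℤ.+ 5 ℤ.* (n ℤ.- total t) ℤ.- z ℤ.* f ℤ.+ x₀ ℤ.* f) hX' ⟩
      ℤ.+ 5 ℤ.* (n ℤ.- total t) ℤ.- (ℤ.+ 5 ℤ.* ℤ.+ δ₁) ℤ.* f ℤ.+ x₀ ℤ.* f ≡⟨ Z.solve 5 (λ n t f e x → Z.con (ℤ.+ 5) Z.:* (n Z.:- t) Z.:- (Z.con (ℤ.+ 5) Z.:* e) Z.:* f Z.:+ x Z.:* f Z.:= Z.con (ℤ.+ 5) Z.:* (n Z.:- t Z.:- e Z.:* f) Z.:+ x Z.:* f) refl n (total t) f (ℤ.+ δ₁) x₀ ⟩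
      ℤ.+ 5 ℤ.* (n ℤ.- total t ℤ.- ℤ.+ δ₁ ℤ.* f) ℤ.+ x₀ ℤ.* f ∎
      where
      open ≡-Reasoning
      s x₀ : ℤ
      s = ℤ.+ sumN (lookup x)
      x₀ = ℤ.+ lookup X zero

    0<5 : 0ℚ < toℚ (ℤ.+ 5)
    0<5 = toℚ-mono-< {ℤ.+ 0} {ℤ.+ 5} (ℤ.+<+ (ℕ.s≤s ℕ.z≤n))

    5≢0 : toℚ (ℤ.+ 5) ≢ 0ℚ
    5≢0 e = <-irrefl (sym e) 0<5

    fifth : ℚ
    fifth = inv (toℚ (ℤ.+ 5)) 5≢0

    scaledℚ : ∀ n f t j s → s * toℚ (ℤ.+ 5) ≡ toℚ f → toℚ (ℤ.+ 5) * (ι (bary n t) j - s * ι (bary (ℤ.+ 1) v) j) ≡ toℚ (ℤ.+ 5 ℤ.* T n f t j ℤ.+ ℤ.+ lookup X j ℤ.* f)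
    scaledℚ n f t j s e = trans (solve 4 (λ a b s w → a :* (b :- s :* w) := a :* b :- (s :* a) :* w) refl (toℚ (ℤ.+ 5)) (ι (bary n t) j) s (ι (bary (ℤ.+ 1) v) j))
      (trans (cong₂ _-_ (sym (toℚ-* (ℤ.+ 5) (lookup (bary n t) j))) (trans (cong (_* ι (bary (ℤ.+ 1) v) j) e) (sym (toℚ-* f (lookup (bary (ℤ.+ 1) v) j)))))
      (trans (sym (toℚ-- (ℤ.+ 5 ℤ.* lookup (bary n t) j) (f ℤ.* lookup (bary (ℤ.+ 1) v) j))) (cong toℚ (scaled n f t j))))

    inside⁻ : ∀ n f t → InDilate vertices n (f ∷ t) → Inside (ℤ.+ n) f t
    inside⁻ n f t (c , c≥0 , hs , hc) = toℚ-cancel-≤ {ℤ.+ 0} {f} (subst (0ℚ ≤_) e (*-0≤ (c≥0 zero) (<⇒≤ 0<5))) ,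
        λ j → toℚ-cancel-≤ {ℤ.+ 0} {ℤ.+ 5 ℤ.* T (ℤ.+ n) f t j ℤ.+ ℤ.+ lookup X j ℤ.* f} (subst (0ℚ ≤_) (scaledℚ (ℤ.+ n) f t j (c zero) e) (*-0≤ (<⇒≤ 0<5) (subst (0ℚ ≤_) (Ap.solved c (ℤ.+ n) t hs (λ j → trans (sym (later-coordinate c j)) (hc (suc j))) j) (c≥0 (suc j)))))
      where
      e : c zero * toℚ (ℤ.+ 5) ≡ toℚ f
      e = trans (sym (first-coordinate c)) (hc zero)

    inside⁺ : ∀ n f t → Inside (ℤ.+ n) f t → InDilate vertices n (f ∷ t)
    inside⁺ n f t (f≥0 , h) = c , c≥0 , proj₁ r , λ { zero → trans (first-coordinate c) e ; (suc j) → trans (later-coordinate c j) (proj₂ r j) }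
      where
      s : ℚ
      s = toℚ f * fifth
      e : s * toℚ (ℤ.+ 5) ≡ toℚ f
      e = trans (*-assoc (toℚ f) fifth (toℚ (ℤ.+ 5))) (trans (cong (toℚ f *_) (inv-* (toℚ (ℤ.+ 5)) 5≢0)) (*-identityʳ (toℚ f)))
      c : Fin (suc (suc d)) → ℚ
      c zero = s
      c (suc j) = ι (bary (ℤ.+ n) t) j - s * ι (bary (ℤ.+ 1) v) j
      r = Ap.unsolved c (ℤ.+ n) t (λ j → refl)
      c≥0 : ∀ i → 0ℚ ≤ c i
      c≥0 zero = *-0≤ (toℚ-mono-≤ {ℤ.+ 0} {f} f≥0) (<⇒≤ (inv-pos 0<5 5≢0))
      c≥0 (suc j) = subst (0ℚ ≤_) (trans (cong (fifth *_) (sym (scaledℚ (ℤ.+ n) f t j s e))) (trans (sym (*-assoc fifth (toℚ (ℤ.+ 5)) (c (suc j)))) (trans (cong (_* c (suc j)) (inv-* (toℚ (ℤ.+ 5)) 5≢0)) (*-identityˡ (c (suc j))))))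
        (*-0≤ (<⇒≤ (inv-pos 0<5 5≢0)) (toℚ-mono-≤ {ℤ.+ 0} {ℤ.+ 5 ℤ.* T (ℤ.+ n) f t j ℤ.+ ℤ.+ lookup X j ℤ.* f} (h j)))

    quot : Fin 5 → Fin (suc d) → ℕ
    quot k j = (lookup X j ℕ.* toℕ k) ℕ./ 5

    val : Fin 5 → ℕ → Vec ℕ (suc d) → Fin (suc d) → ℤ
    val k w y j = ℤ.+ lookup y j ℤ.+ ((ℤ.- ℤ.+ lookup X j) ℤ.* ℤ.+ w ℤ.+ (ℤ.- ℤ.+ quot k j))

    apexHeight : Fin 5 → ℕ → ℤ
    apexHeight k w = ℤ.+ (toℕ k ℕ.+ w ℕ.* 5)

    φ : Fin 5 → Vec ℕ (suc (suc d)) → Point (suc d)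
    φ k (w ∷ y) = apexHeight k w ∷ tabulate (λ j → val k w y (suc j))

    apexHeight≡ : ∀ k w → apexHeight k w ≡ ℤ.+ toℕ k ℤ.+ ℤ.+ w ℤ.* ℤ.+ 5
    apexHeight≡ k w = trans (ℤP.pos-+ (toℕ k) (w ℕ.* 5)) (cong (λ z → ℤ.+ toℕ k ℤ.+ z) (ℤP.pos-* w 5))

    -- `hX` leaves one unit of degree per copy w of the apex, and `hes` turns k δ₁ minus the
    -- quotients into `es k`.
    degree : ∀ k w y → sumZ (val k w y) ℤ.+ ℤ.+ δ₁ ℤ.* apexHeight k w ≡ ℤ.+ (es k ℕ.+ (w ℕ.+ Vec.sum y))
    degree k w y = begin
      sumZ (val k w y) ℤ.+ ℤ.+ δ₁ ℤ.* apexHeight k w ≡⟨ cong₂ (λ a b → a ℤ.+ ℤ.+ δ₁ ℤ.* b) (trans (sumZ-affine (λ j → ℤ.+ lookup y j) (λ j → ℤ.- ℤ.+ lookup X j) (λ j → ℤ.- ℤ.+ quot k j) (ℤ.+ w)) (cong₂ ℤ._+_ (sumZ-pos (lookup y)) (cong₂ (λ a b → a ℤ.* ℤ.+ w ℤ.+ b) (trans (sumZ-neg (λ j → ℤ.+ lookup X j)) (cong ℤ.-_ (sumZ-pos (lookup X)))) (trans (sumZ-neg (λ j → ℤ.+ quot k j)) (cong ℤ.-_ (sumZ-pos (quot k))))))) (apexHeight≡ k w) ⟩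
      (Y ℤ.+ ((ℤ.- ΣX) ℤ.* W ℤ.+ (ℤ.- Q))) ℤ.+ Δ ℤ.* (Kk ℤ.+ W ℤ.* ℤ.+ 5) ≡⟨ Z.solve 6 (λ y x w q e k → (y Z.:+ ((Z.:- x) Z.:* w Z.:+ (Z.:- q))) Z.:+ e Z.:* (k Z.:+ w Z.:* Z.con (ℤ.+ 5)) Z.:= (k Z.:* e Z.:- q) Z.:+ ((Z.con (ℤ.+ 5) Z.:* e Z.:- x) Z.:* w Z.:+ y)) refl Y ΣX W Q Δ Kk ⟩
      (Kk ℤ.* Δ ℤ.- Q) ℤ.+ ((ℤ.+ 5 ℤ.* Δ ℤ.- ΣX) ℤ.* W ℤ.+ Y) ≡⟨ cong₂ (λ a b → (a ℤ.- Q) ℤ.+ ((b ℤ.- ΣX) ℤ.* W ℤ.+ Y)) (trans (sym (ℤP.pos-* (toℕ k) δ₁)) (trans (cong (λ m → ℤ.+ m) (sym (hes k))) (ℤP.pos-+ (es k) (sumN (quot k))))) (trans (sym (ℤP.pos-* 5 δ₁)) (trans (cong (λ m → ℤ.+ m) (sym hX)) (ℤP.pos-+ 1 (sumN (lookup X))))) ⟩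
      ((ℤ.+ es k ℤ.+ Q) ℤ.- Q) ℤ.+ (((ℤ.+ 1 ℤ.+ ΣX) ℤ.- ΣX) ℤ.* W ℤ.+ Y) ≡⟨ Z.solve 5 (λ e q x w y → ((e Z.:+ q) Z.:- q) Z.:+ (((Z.con (ℤ.+ 1) Z.:+ x) Z.:- x) Z.:* w Z.:+ y) Z.:= e Z.:+ (w Z.:+ y)) refl (ℤ.+ es k) Q ΣX W Y ⟩
      ℤ.+ es k ℤ.+ (W ℤ.+ Y) ≡⟨ cong (λ z → ℤ.+ es k ℤ.+ (W ℤ.+ z)) (cong (λ m → ℤ.+ m) (sumN-lookup y)) ⟩
      ℤ.+ es k ℤ.+ (W ℤ.+ ℤ.+ Vec.sum y) ≡⟨ sym (trans (ℤP.pos-+ (es k) (w ℕ.+ Vec.sum y)) (cong (λ z → ℤ.+ es k ℤ.+ z) (ℤP.pos-+ w (Vec.sum y)))) ⟩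
      ℤ.+ (es k ℕ.+ (w ℕ.+ Vec.sum y)) ∎
      where
      open ≡-Reasoning
      Y ΣX W Q Δ Kk : ℤ
      Y = ℤ.+ sumN (lookup y)
      ΣX = ℤ.+ sumN (lookup X)
      W = ℤ.+ w
      Q = ℤ.+ sumN (quot k)
      Δ = ℤ.+ δ₁
      Kk = ℤ.+ toℕ k

    tail-total : ∀ k w y → total (tabulate (λ j → val k w y (suc j))) ≡ sumZ (λ j → val k w y (suc j))
    tail-total k w y = sumZ-cong (VecP.lookup∘tabulate (λ j → val k w y (suc j)))

    T-φ : ∀ k w y j → T (ℤ.+ (es k ℕ.+ (w ℕ.+ Vec.sum y))) (apexHeight k w) (tabulate (λ j → val k w y (suc j))) j ≡ val k w y j
    T-φ k w y (suc j) = VecP.lookup∘tabulate (λ j → val k w y (suc j)) j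
    T-φ k w y zero = trans (cong₂ (λ a b → a ℤ.- b ℤ.- ℤ.+ δ₁ ℤ.* apexHeight k w) (sym (degree k w y)) (tail-total k w y))
      (Z.solve 3 (λ a b c → ((a Z.:+ b) Z.:+ c) Z.:- b Z.:- c Z.:= a) refl (val k w y zero) (sumZ (λ j → val k w y (suc j))) (ℤ.+ δ₁ ℤ.* apexHeight k w))

    remainder : ∀ k j → ℤ.+ lookup X j ℤ.* ℤ.+ toℕ k ≡ ℤ.+ ((lookup X j ℕ.* toℕ k) ℕ.% 5) ℤ.+ ℤ.+ quot k j ℤ.* ℤ.+ 5
    remainder k j = trans (sym (ℤP.pos-* (lookup X j) (toℕ k))) (trans (cong (λ m → ℤ.+ m) (DM.m≡m%n+[m/n]*n (lookup X j ℕ.* toℕ k) 5)) (trans (ℤP.pos-+ ((lookup X j ℕ.* toℕ k) ℕ.% 5) (quot k j ℕ.* 5)) (cong (λ z → ℤ.+ ((lookup X j ℕ.* toℕ k) ℕ.% 5) ℤ.+ z) (ℤP.pos-* (quot k j) 5))))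

    -- The height is split as k + 5 w and Xⱼ k by division with remainder. What is left over is less
    -- than 5, so `floor-nonneg` can read off an integral condition.
    form : ∀ k w j a → ℤ.+ 5 ℤ.* a ℤ.+ ℤ.+ lookup X j ℤ.* apexHeight k w ≡ ℤ.+ 5 ℤ.* (a ℤ.+ (ℤ.+ lookup X j ℤ.* ℤ.+ w ℤ.+ ℤ.+ quot k j)) ℤ.+ ℤ.+ ((lookup X j ℕ.* toℕ k) ℕ.% 5)
    form k w j a = trans (cong (λ z → ℤ.+ 5 ℤ.* a ℤ.+ ℤ.+ lookup X j ℤ.* z) (apexHeight≡ k w)) (trans (Z.solve 4 (λ a x k w → Z.con (ℤ.+ 5) Z.:* a Z.:+ x Z.:* (k Z.:+ w Z.:* Z.con (ℤ.+ 5)) Z.:= Z.con (ℤ.+ 5) Z.:* (a Z.:+ x Z.:* w) Z.:+ x Z.:* k) refl a (ℤ.+ lookup X j) (ℤ.+ toℕ k) (ℤ.+ w))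
      (trans (cong (λ z → ℤ.+ 5 ℤ.* (a ℤ.+ ℤ.+ lookup X j ℤ.* ℤ.+ w) ℤ.+ z) (remainder k j)) (Z.solve 4 (λ a b r q → Z.con (ℤ.+ 5) Z.:* (a Z.:+ b) Z.:+ (r Z.:+ q Z.:* Z.con (ℤ.+ 5)) Z.:= Z.con (ℤ.+ 5) Z.:* (a Z.:+ (b Z.:+ q)) Z.:+ r) refl a (ℤ.+ lookup X j ℤ.* ℤ.+ w) (ℤ.+ ((lookup X j ℕ.* toℕ k) ℕ.% 5)) (ℤ.+ quot k j))))

    into : ∀ k y → InDilate vertices (es k ℕ.+ Vec.sum y) (φ k y)
    into k (w ∷ y) = inside⁺ (es k ℕ.+ (w ℕ.+ Vec.sum y)) (apexHeight k w) (tabulate (λ j → val k w y (suc j))) (ℤ.+≤+ ℕ.z≤n , λ j → subst (ℤ.+ 0 ℤ.≤_) (sym (eq j)) (nn j))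
      where
      nn : ∀ j → ℤ.+ 0 ℤ.≤ ℤ.+ 5 ℤ.* ℤ.+ lookup y j ℤ.+ ℤ.+ ((lookup X j ℕ.* toℕ k) ℕ.% 5)
      nn j = subst (ℤ.+ 0 ℤ.≤_) (trans (ℤP.pos-+ (5 ℕ.* lookup y j) ((lookup X j ℕ.* toℕ k) ℕ.% 5)) (cong (ℤ._+ ℤ.+ ((lookup X j ℕ.* toℕ k) ℕ.% 5)) (ℤP.pos-* 5 (lookup y j)))) (ℤ.+≤+ ℕ.z≤n)
      eq : ∀ j → ℤ.+ 5 ℤ.* T (ℤ.+ (es k ℕ.+ (w ℕ.+ Vec.sum y))) (apexHeight k w) (tabulate (λ j → val k w y (suc j))) j ℤ.+ ℤ.+ lookup X j ℤ.* apexHeight k w ≡ ℤ.+ 5 ℤ.* ℤ.+ lookup y j ℤ.+ ℤ.+ ((lookup X j ℕ.* toℕ k) ℕ.% 5)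
      eq j = trans (cong (λ z → ℤ.+ 5 ℤ.* z ℤ.+ ℤ.+ lookup X j ℤ.* apexHeight k w) (T-φ k w y j)) (trans (form k w j (val k w y j)) (cong (λ z → ℤ.+ 5 ℤ.* z ℤ.+ ℤ.+ ((lookup X j ℕ.* toℕ k) ℕ.% 5))
        (Z.solve 4 (λ y x w q → (y Z.:+ ((Z.:- x) Z.:* w Z.:+ (Z.:- q))) Z.:+ (x Z.:* w Z.:+ q) Z.:= y) refl (ℤ.+ lookup y j) (ℤ.+ lookup X j) (ℤ.+ w) (ℤ.+ quot k j))))

    val-injective : ∀ k w y y' j → val k w y j ≡ val k w y' j → lookup y j ≡ lookup y' j
    val-injective k w y y' j e = ℤP.+-injective (ℤ-cancelʳ ((ℤ.- ℤ.+ lookup X j) ℤ.* ℤ.+ w ℤ.+ (ℤ.- ℤ.+ quot k j)) (ℤ.+ lookup y j) (ℤ.+ lookup y' j) e)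

    inj : ∀ k y k' y' → es k ℕ.+ Vec.sum y ≡ es k' ℕ.+ Vec.sum y' → φ k y ≡ φ k' y' → k ≡ k' × y ≡ y'
    inj k (w ∷ y) k' (w' ∷ y') s e = go k≡ w≡
      where
      h : toℕ k ℕ.+ w ℕ.* 5 ≡ toℕ k' ℕ.+ w' ℕ.* 5
      h = ℤP.+-injective (VecP.∷-injectiveˡ e)
      mod : ∀ (k : Fin 5) w → (toℕ k ℕ.+ w ℕ.* 5) ℕ.% 5 ≡ toℕ k
      mod k w = trans (DM.[m+kn]%n≡m%n (toℕ k) w 5) (DM.m<n⇒m%n≡m (FinP.toℕ<n k))
      k≡ : k ≡ k'
      k≡ = FinP.toℕ-injective (trans (sym (mod k w)) (trans (cong (ℕ._% 5) h) (mod k' w')))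
      w≡ : w ≡ w'
      w≡ = ℕP.*-cancelʳ-≡ w w' 5 (ℕP.+-cancelˡ-≡ (toℕ k) _ _ (trans h (cong (λ k → toℕ k ℕ.+ w' ℕ.* 5) (sym k≡))))
      go : k ≡ k' → w ≡ w' → k ≡ k' × w ∷ y ≡ w' ∷ y'
      go refl refl = refl , cong (w ∷_) (vec-ext same)
        where
        tails : ∀ j → lookup y (suc j) ≡ lookup y' (suc j)
        tails j = val-injective k w y y' (suc j) (trans (sym (VecP.lookup∘tabulate (λ j → val k w y (suc j)) j)) (trans (cong (λ u → lookup u j) (VecP.∷-injectiveʳ e)) (VecP.lookup∘tabulate (λ j → val k w y' (suc j)) j)))
        sums : sumN (lookup y) ≡ sumN (lookup y')
        sums = trans (sumN-lookup y) (trans (ℕP.+-cancelˡ-≡ w _ _ (ℕP.+-cancelˡ-≡ (es k) _ _ s)) (sym (sumN-lookup y')))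
        same : ∀ j → lookup y j ≡ lookup y' j
        same (suc j) = tails j
        same zero = ℕP.+-cancelʳ-≡ (sumN (λ j → lookup y (suc j))) (lookup y zero) (lookup y' zero) (trans sums (cong (lookup y' zero ℕ.+_) (sumN-cong (λ j → sym (tails j)))))

    onto : ∀ n z → InDilate vertices n z → ∃ λ k → ∃ λ y → es k ℕ.+ Vec.sum y ≡ n × φ k y ≡ z
    onto n (f ∷ t) hz = go f (inside⁻ n f t hz)
      where
      go : ∀ f → Inside (ℤ.+ n) f t → ∃ λ k → ∃ λ y → es k ℕ.+ Vec.sum y ≡ n × φ k y ≡ f ∷ t
      go (ℤ.-[1+ m ]) (() , _)
      go (ℤ.+ F) (_ , h) = k , w ∷ y , deg≡ , cong₂ _∷_ height≡ tail≡
        where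
        k : Fin 5
        k = fromℕ< (DM.m%n<n F 5)
        w : ℕ
        w = F ℕ./ 5
        height≡ : apexHeight k w ≡ ℤ.+ F
        height≡ = cong (λ m → ℤ.+ m) (trans (cong (ℕ._+ w ℕ.* 5) (FinP.toℕ-fromℕ< (DM.m%n<n F 5))) (sym (DM.m≡m%n+[m/n]*n F 5)))
        a : Fin (suc d) → ℤ
        a j = T (ℤ.+ n) (ℤ.+ F) t j ℤ.+ (ℤ.+ lookup X j ℤ.* ℤ.+ w ℤ.+ ℤ.+ quot k j)
        a≥0 : ∀ j → ℤ.+ 0 ℤ.≤ a j
        a≥0 j = floor-nonneg 5 (a j) ((lookup X j ℕ.* toℕ k) ℕ.% 5) (DM.m%n<n (lookup X j ℕ.* toℕ k) 5) (subst (ℤ.+ 0 ℤ.≤_) (trans (cong (λ z → ℤ.+ 5 ℤ.* T (ℤ.+ n) (ℤ.+ F) t j ℤ.+ ℤ.+ lookup X j ℤ.* z) (sym height≡)) (form k w j (T (ℤ.+ n) (ℤ.+ F) t j))) (h j))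
        yf : Fin (suc d) → ℕ
        yf j = ℤ.∣ a j ∣
        y : Vec ℕ (suc d)
        y = tabulate yf
        val≡ : ∀ j → val k w y j ≡ T (ℤ.+ n) (ℤ.+ F) t j
        val≡ j = trans (cong (ℤ._+ ((ℤ.- ℤ.+ lookup X j) ℤ.* ℤ.+ w ℤ.+ (ℤ.- ℤ.+ quot k j))) (trans (cong (λ m → ℤ.+ m) (VecP.lookup∘tabulate yf j)) (nonneg-abs (a≥0 j))))
          (Z.solve 4 (λ t x w q → (t Z.:+ (x Z.:* w Z.:+ q)) Z.:+ ((Z.:- x) Z.:* w Z.:+ (Z.:- q)) Z.:= t) refl (T (ℤ.+ n) (ℤ.+ F) t j) (ℤ.+ lookup X j) (ℤ.+ w) (ℤ.+ quot k j))
        tail≡ : tabulate (λ j → val k w y (suc j)) ≡ t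
        tail≡ = vec-ext λ j → trans (VecP.lookup∘tabulate (λ j → val k w y (suc j)) j) (val≡ (suc j))
        deg≡ : es k ℕ.+ (w ℕ.+ Vec.sum y) ≡ n
        deg≡ = ℤP.+-injective (trans (sym (degree k w y)) (trans (cong₂ (λ p q → p ℤ.+ ℤ.+ δ₁ ℤ.* q) (sumZ-cong val≡) height≡)
          (Z.solve 3 (λ n s c → ((n Z.:- s Z.:- c) Z.:+ s) Z.:+ c Z.:= n) refl (ℤ.+ n) (total t) (ℤ.+ δ₁ ℤ.* ℤ.+ F))))

    polytope : ∀ i₁ i₂ i₃ i₄ → 1 ℕ.≤ i₁ → 1 ℕ.≤ i₂ → 1 ℕ.≤ i₃ → 1 ℕ.≤ i₄ → map es (List.allFin 5) ↭ 0 ∷ i₁ ∷ i₂ ∷ i₃ ∷ i₄ ∷ [] → ExistsPolytope (suc d) (hpoly i₁ i₂ i₃ i₄)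
    polytope i₁ i₂ i₃ i₄ h₁ h₂ h₃ h₄ perm = suc (suc d) , vertices , ((λ i → i) , affIndep) , has-delta vertices es φ into inj onto i₁ i₂ i₃ i₄ h₁ h₂ h₃ h₄ perm

  -- Apexes with negative coordinates, for the cases (1), (2) and (3)

  0<suc : ∀ m → 0ℚ < toℚ (ℤ.+ suc m)
  0<suc m = toℚ-mono-< {ℤ.+ 0} {ℤ.+ suc m} (ℤ.+<+ (ℕ.s≤s ℕ.z≤n))

  -- As c is nonnegative, lowering the apex weight from s to p/(m + 1) only increases z - s c; so
  -- the least weight permitted by the negative coordinates may be used.
  clear⁻ : ∀ m p s z c → 0ℚ ≤ toℚ z - s * toℚ (ℤ.+ c) → toℚ p ≤ toℚ (ℤ.+ suc m) * s → ℤ.+ 0 ℤ.≤ ℤ.+ suc m ℤ.* z ℤ.- p ℤ.* ℤ.+ c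
  clear⁻ m p s z c h le = toℚ-cancel-≤ {ℤ.+ 0} {ℤ.+ suc m ℤ.* z ℤ.- p ℤ.* ℤ.+ c} (subst (0ℚ ≤_) eq (+-0≤ (*-0≤ (<⇒≤ (0<suc m)) h) (*-0≤ (p≤q⇒0≤q-p le) (toℚ-mono-≤ {ℤ.+ 0} {ℤ.+ c} (ℤ.+≤+ ℕ.z≤n)))))
    where
    M : ℚ
    M = toℚ (ℤ.+ suc m)
    eq : M * (toℚ z - s * toℚ (ℤ.+ c)) + (M * s - toℚ p) * toℚ (ℤ.+ c) ≡ toℚ (ℤ.+ suc m ℤ.* z ℤ.- p ℤ.* ℤ.+ c)
    eq = trans (solve 5 (λ m z s c p → m :* (z :- s :* c) :+ (m :* s :- p) :* c := m :* z :- p :* c) refl M (toℚ z) s (toℚ (ℤ.+ c)) (toℚ p))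
      (trans (cong₂ _-_ (sym (toℚ-* (ℤ.+ suc m) z)) (sym (toℚ-* p (ℤ.+ c)))) (sym (toℚ-- (ℤ.+ suc m ℤ.* z) (p ℤ.* ℤ.+ c))))

  clear⁺ : ∀ m p s z c → toℚ (ℤ.+ suc m) * s ≡ toℚ p → ℤ.+ 0 ℤ.≤ ℤ.+ suc m ℤ.* z ℤ.- p ℤ.* c → 0ℚ ≤ toℚ z - s * toℚ c
  clear⁺ m p s z c e h = subst (0ℚ ≤_) (trans (cong (i *_) (sym eq)) (trans (sym (*-assoc i M (toℚ z - s * toℚ c))) (trans (cong (_* (toℚ z - s * toℚ c)) (inv-* M M≢0)) (*-identityˡ _))))
      (*-0≤ (<⇒≤ (inv-pos (0<suc m) M≢0)) (toℚ-mono-≤ {ℤ.+ 0} {ℤ.+ suc m ℤ.* z ℤ.- p ℤ.* c} h))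
    where
    M : ℚ
    M = toℚ (ℤ.+ suc m)
    M≢0 : M ≢ 0ℚ
    M≢0 e = <-irrefl (sym e) (0<suc m)
    i : ℚ
    i = inv M M≢0
    eq : M * (toℚ z - s * toℚ c) ≡ toℚ (ℤ.+ suc m ℤ.* z ℤ.- p ℤ.* c)
    eq = trans (solve 4 (λ m z s c → m :* (z :- s :* c) := m :* z :- (m :* s) :* c) refl M (toℚ z) s (toℚ c))
      (trans (cong₂ _-_ (sym (toℚ-* (ℤ.+ suc m) z)) (trans (cong (_* toℚ c) e) (sym (toℚ-* p c)))) (sym (toℚ-- (ℤ.+ suc m ℤ.* z) (p ℤ.* c))))

  ratio : ℕ → ℤ → ℚ
  ratio m p = inv (toℚ (ℤ.+ suc m)) (λ e → <-irrefl (sym e) (0<suc m)) * toℚ p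

  ratio-eq : ∀ m p → toℚ (ℤ.+ suc m) * ratio m p ≡ toℚ p
  ratio-eq m p = trans (sym (*-assoc M i (toℚ p))) (trans (cong (_* toℚ p) (trans (*-comm M i) (inv-* M (λ e → <-irrefl (sym e) (0<suc m))))) (*-identityˡ (toℚ p)))
    where
    M i : ℚ
    M = toℚ (ℤ.+ suc m)
    i = inv M (λ e → <-irrefl (sym e) (0<suc m))

  ratio-≥0 : ∀ m p → ℤ.+ 0 ℤ.≤ p → 0ℚ ≤ ratio m p
  ratio-≥0 m p h = *-0≤ (<⇒≤ (inv-pos (0<suc m) (λ e → <-irrefl (sym e) (0<suc m)))) (toℚ-mono-≤ {ℤ.+ 0} {p} h)

  -- The ceiling of k c/(m + 1).
  ceil : ℕ → ℕ → ℕ → ℕ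
  ceil m k c = (k ℕ.* c ℕ.+ m) ℕ./ suc m

  ceil-spec : ∀ m k c → ∃ λ r → r ℕ.< suc m × suc m ℕ.* ceil m k c ≡ k ℕ.* c ℕ.+ r
  ceil-spec m k c = m ℕ.∸ R , ℕ.s≤s (ℕP.m∸n≤m m R) , ℕP.+-cancelˡ-≡ R _ _ (trans (trans (cong (R ℕ.+_) (ℕP.*-comm (suc m) (ceil m k c))) (sym (DM.m≡m%n+[m/n]*n (k ℕ.* c ℕ.+ m) (suc m))))
      (trans (cong (k ℕ.* c ℕ.+_) (sym (ℕP.m+[n∸m]≡n R≤m))) (NS.solve 3 (λ a r s → a NS.:+ (r NS.:+ s) NS.:= r NS.:+ (a NS.:+ s)) refl (k ℕ.* c) R (m ℕ.∸ R))))
    where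
    R : ℕ
    R = (k ℕ.* c ℕ.+ m) ℕ.% suc m
    R≤m : R ℕ.≤ m
    R≤m = ℕP.≤-pred (DM.m%n<n (k ℕ.* c ℕ.+ m) (suc m))

  pos-sum : ∀ {n} (y C : Vec ℕ n) m k w → sumZ (λ j → ℤ.+ lookup y j ℤ.+ (ℤ.+ lookup C j ℤ.* ℤ.+ w ℤ.+ ℤ.+ ceil m k (lookup C j))) ≡ ℤ.+ Vec.sum y ℤ.+ (ℤ.+ sumN (lookup C) ℤ.* ℤ.+ w ℤ.+ ℤ.+ sumN (λ j → ceil m k (lookup C j)))
  pos-sum y C m k w = trans (sumZ-affine (λ j → ℤ.+ lookup y j) (λ j → ℤ.+ lookup C j) (λ j → ℤ.+ ceil m k (lookup C j)) (ℤ.+ w))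
    (cong₂ ℤ._+_ (trans (sumZ-pos (lookup y)) (cong (λ m → ℤ.+ m) (sumN-lookup y))) (cong₂ (λ a b → a ℤ.* ℤ.+ w ℤ.+ b) (sumZ-pos (lookup C)) (sumZ-pos (λ j → ceil m k (lookup C j)))))

  -- With apex weight w + k/(m + 1), a coordinate in which the apex has c ≥ 0 must be at least c w +
  -- ⌈k c/(m + 1)⌉; y is the excess over this minimum.
  posval : ℕ → ℕ → ℕ → ℕ → ℕ → ℤ
  posval m k w c y = ℤ.+ y ℤ.+ (ℤ.+ c ℤ.* ℤ.+ w ℤ.+ ℤ.+ ceil m k c)

  -- The numerator of the apex weight w + k/(m + 1).
  step : ℕ → ℕ → ℕ → ℤ
  step m k w = ℤ.+ suc m ℤ.* ℤ.+ w ℤ.+ ℤ.+ k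

  posval-≥ : ∀ m k w c y → ℤ.+ 0 ℤ.≤ ℤ.+ suc m ℤ.* posval m k w c y ℤ.- step m k w ℤ.* ℤ.+ c
  posval-≥ m k w c y = subst (ℤ.+ 0 ℤ.≤_) (sym eq) (ℤ.+≤+ ℕ.z≤n)
    where
    r = proj₁ (ceil-spec m k c)
    M Y Cc W K' Ce : ℤ
    M = ℤ.+ suc m
    Y = ℤ.+ y
    Cc = ℤ.+ c
    W = ℤ.+ w
    K' = ℤ.+ k
    Ce = ℤ.+ ceil m k c
    ce : M ℤ.* Ce ≡ K' ℤ.* Cc ℤ.+ ℤ.+ r
    ce = trans (sym (ℤP.pos-* (suc m) (ceil m k c))) (trans (cong (λ n → ℤ.+ n) (proj₂ (proj₂ (ceil-spec m k c)))) (trans (ℤP.pos-+ (k ℕ.* c) r) (cong (ℤ._+ ℤ.+ r) (ℤP.pos-* k c))))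
    eq : M ℤ.* (Y ℤ.+ (Cc ℤ.* W ℤ.+ Ce)) ℤ.- (M ℤ.* W ℤ.+ K') ℤ.* Cc ≡ ℤ.+ (suc m ℕ.* y ℕ.+ r)
    eq = trans (Z.solve 6 (λ m y c w k e → m Z.:* (y Z.:+ (c Z.:* w Z.:+ e)) Z.:- (m Z.:* w Z.:+ k) Z.:* c Z.:= m Z.:* y Z.:+ (m Z.:* e Z.:- k Z.:* c)) refl M Y Cc W K' Ce)
      (trans (cong (λ t → M ℤ.* Y ℤ.+ (t ℤ.- K' ℤ.* Cc)) ce) (trans (Z.solve 3 (λ a b r → a Z.:+ ((b Z.:+ r) Z.:- b) Z.:= a Z.:+ r) refl (M ℤ.* Y) (K' ℤ.* Cc) (ℤ.+ r)) (trans (cong (ℤ._+ ℤ.+ r) (sym (ℤP.pos-* (suc m) y))) (sym (ℤP.pos-+ (suc m ℕ.* y) r)))))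

  posval-onto : ∀ m k w c z → ℤ.+ 0 ℤ.≤ ℤ.+ suc m ℤ.* z ℤ.- step m k w ℤ.* ℤ.+ c → ∃ λ y → posval m k w c y ≡ z
  posval-onto m k w c z h = ℤ.∣ a ∣ , trans (cong (ℤ._+ b) (nonneg-abs a≥0)) (Z.solve 2 (λ z b → (z Z.:- b) Z.:+ b Z.:= z) refl z b)
    where
    b a : ℤ
    b = ℤ.+ c ℤ.* ℤ.+ w ℤ.+ ℤ.+ ceil m k c
    a = z ℤ.- b
    r = proj₁ (ceil-spec m k c)
    ce : ℤ.+ suc m ℤ.* ℤ.+ ceil m k c ≡ ℤ.+ k ℤ.* ℤ.+ c ℤ.+ ℤ.+ r
    ce = trans (sym (ℤP.pos-* (suc m) (ceil m k c))) (trans (cong (λ n → ℤ.+ n) (proj₂ (proj₂ (ceil-spec m k c)))) (trans (ℤP.pos-+ (k ℕ.* c) r) (cong (ℤ._+ ℤ.+ r) (ℤP.pos-* k c))))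
    a≥0 : ℤ.+ 0 ℤ.≤ a
    a≥0 = floor-nonneg (suc m) a r (proj₁ (proj₂ (ceil-spec m k c))) (subst (ℤ.+ 0 ℤ.≤_) eq h)
      where
      eq : ℤ.+ suc m ℤ.* z ℤ.- step m k w ℤ.* ℤ.+ c ≡ ℤ.+ suc m ℤ.* a ℤ.+ ℤ.+ r
      eq = trans (Z.solve 6 (λ m z c w k e → m Z.:* z Z.:- (m Z.:* w Z.:+ k) Z.:* c Z.:= m Z.:* (z Z.:- (c Z.:* w Z.:+ e)) Z.:+ (m Z.:* e Z.:- k Z.:* c)) refl (ℤ.+ suc m) z (ℤ.+ c) (ℤ.+ w) (ℤ.+ k) (ℤ.+ ceil m k c))
        (cong (λ t → ℤ.+ suc m ℤ.* a ℤ.+ t) (trans (cong (ℤ._- ℤ.+ k ℤ.* ℤ.+ c) ce) (Z.solve 2 (λ b r → (b Z.:+ r) Z.:- b Z.:= r) refl (ℤ.+ k ℤ.* ℤ.+ c) (ℤ.+ r))))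

  posval-injective : ∀ m k w c y y' → posval m k w c y ≡ posval m k w c y' → y ≡ y'
  posval-injective m k w c y y' e = ℤP.+-injective (ℤ-cancelʳ (ℤ.+ c ℤ.* ℤ.+ w ℤ.+ ℤ.+ ceil m k c) (ℤ.+ y) (ℤ.+ y') e)

  -- The nonnegative barycentric coordinates of the apex. All coordinates add up to 1, so the
  -- negative ones have sum -4.
  record PositivePart : Set where
    constructor positivePart
    field
      {J} : ℕ
      C : Vec ℕ (suc J)
      C-sum : sumN (lookup C) ≡ 5

  module Positive (𝓟 : PositivePart) where
    open PositivePart 𝓟

    tailC : Point J
    tailC = tabulate (λ j → ℤ.+ lookup C (suc j))

    total-tailC : total tailC ≡ ℤ.+ 5 ℤ.- ℤ.+ lookup C zero
    total-tailC = trans (sumZ-cong (VecP.lookup∘tabulate (λ j → ℤ.+ lookup C (suc j)))) (trans (sumZ-pos (λ j → lookup C (suc j))) (trans (Z.solve 2 (λ a b → b Z.:= (a Z.:+ b) Z.:- a) refl (ℤ.+ lookup C zero) (ℤ.+ sumN (λ j → lookup C (suc j))))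
      (cong (ℤ._- ℤ.+ lookup C zero) (trans (sym (ℤP.pos-+ (lookup C zero) (sumN (λ j → lookup C (suc j))))) (cong (λ m → ℤ.+ m) C-sum)))))

    -- the point with given values on the positive coordinates, the first one being implicit
    points : (Fin (suc J) → ℤ) → Point J
    points f = tabulate (λ j → f (suc j))

    total-points : ∀ f → total (points f) ≡ sumZ (λ j → f (suc j))
    total-points f = sumZ-cong (VecP.lookup∘tabulate (λ j → f (suc j)))

    Zc : ℤ → Point J → Fin (suc J) → ℤ
    Zc n t zero = n ℤ.- total t
    Zc n t (suc j) = lookup t j

    Zc-points : ∀ n f → n ≡ sumZ f → ∀ j → Zc n (points f) j ≡ f j
    Zc-points n f e (suc j) = VecP.lookup∘tabulate (λ j → f (suc j)) j
    Zc-points n f e zero = trans (cong₂ ℤ._-_ e (total-points f)) (Z.solve 2 (λ a b → (a Z.:+ b) Z.:- b Z.:= a) refl (f zero) (sumZ (λ j → f (suc j))))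

    Zc-sum : ∀ n t → sumZ (Zc n t) ≡ n
    Zc-sum n t = Z.solve 2 (λ n t → (n Z.:- t) Z.:+ t Z.:= n) refl n (total t)

    points-Zc : ∀ n t f → (∀ j → f j ≡ Zc n t j) → points f ≡ t
    points-Zc n t f h = vec-ext λ j → trans (VecP.lookup∘tabulate (λ j → f (suc j)) j) (h (suc j))

    points-injective : ∀ f g → sumZ f ≡ sumZ g → points f ≡ points g → ∀ j → f j ≡ g j
    points-injective f g s e (suc j) = trans (sym (VecP.lookup∘tabulate (λ j → f (suc j)) j)) (trans (cong (λ v → lookup v j) e) (VecP.lookup∘tabulate (λ j → g (suc j)) j))
    points-injective f g s e zero = ℤ-cancelʳ (sumZ (λ j → f (suc j))) (f zero) (g zero) (trans s (cong (λ z → g zero ℤ.+ z) (sumZ-cong (λ j → sym (points-injective f g s e (suc j))))))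

    valsum : ∀ m k w (y : Vec ℕ (suc J)) → sumZ (λ j → posval m k w (lookup C j) (lookup y j)) ≡ ℤ.+ Vec.sum y ℤ.+ (ℤ.+ 5 ℤ.* ℤ.+ w ℤ.+ ℤ.+ sumN (λ j → ceil m k (lookup C j)))
    valsum m k w y = trans (pos-sum y C m k w) (cong (λ s → ℤ.+ Vec.sum y ℤ.+ (ℤ.+ s ℤ.* ℤ.+ w ℤ.+ ℤ.+ sumN (λ j → ceil m k (lookup C j)))) C-sum)

    natsum : ∀ (y : Vec ℕ (suc J)) → sumZ (λ j → ℤ.+ lookup y j) ≡ ℤ.+ Vec.sum y
    natsum y = trans (sumZ-pos (lookup y)) (cong (λ m → ℤ.+ m) (sumN-lookup y))

    choose : ∀ {P : Fin (suc J) → ℕ → Set} → (∀ j → ∃ λ y → P j y) → ∃ λ (y : Vec ℕ (suc J)) → ∀ j → P j (lookup y j)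
    choose {P} h = tabulate (λ j → proj₁ (h j)) , λ j → subst (P j) (sym (VecP.lookup∘tabulate (λ j → proj₁ (h j)) j)) (proj₂ (h j))

  -- `e k` is the degree of the smallest point whose negative coordinate is -(k + 1): the sum of the
  -- least positive coordinates ⌈(k + 1) c/4⌉, diminished by k + 1.
  record OneNegativeData : Set where
    constructor oneNegative
    field
      positive : PositivePart
    open PositivePart positive public
    field
      e : Fin 4 → ℕ
      e-spec : ∀ k → e k ℕ.+ suc (toℕ k) ≡ sumN (λ j → ceil 3 (suc (toℕ k)) (lookup C j))

  -- The apex has −4 as its only negative coordinate, so a point with first coordinate −(4w + k),
  -- 1 ≤ k ≤ 4, needs the multiple w + k/4 of it.
  module OneNegative (𝓞 : OneNegativeData) where
    open OneNegativeData 𝓞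
    open Positive positive

    v : Point (suc J)
    v = ℤ.-[1+ 3 ] ∷ tailC

    module Ap = Apex v

    es : Fin 5 → ℕ
    es zero = 0
    es (suc k) = e k

    bary-v : ∀ j → lookup (bary (ℤ.+ 1) v) j ≡ lookup (ℤ.+ lookup C zero ∷ v) j
    bary-v zero = trans (cong (λ t → ℤ.+ 1 ℤ.- (ℤ.-[1+ 3 ] ℤ.+ t)) total-tailC) (Z.solve 1 (λ c → Z.con (ℤ.+ 1) Z.:- (Z.con ℤ.-[1+ 3 ] Z.:+ (Z.con (ℤ.+ 5) Z.:- c)) Z.:= c) refl (ℤ.+ lookup C zero))
    bary-v (suc j) = refl

    Inside : ℤ → ℤ → Point J → ℚ → Set
    Inside n a t s = 0ℚ ≤ toℚ a - s * toℚ ℤ.-[1+ 3 ] × (∀ j → 0ℚ ≤ toℚ (Zc (n ℤ.- a) t j) - s * toℚ (ℤ.+ lookup C j))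

    bary-0 : ∀ n a (t : Point J) → n ℤ.- total (a ∷ t) ≡ n ℤ.- a ℤ.- total t
    bary-0 n a t = Z.solve 3 (λ n a t → n Z.:- (a Z.:+ t) Z.:= n Z.:- a Z.:- t) refl n a (total t)

    inside⁻ : ∀ n a t → InDilate Ap.vertices n (a ∷ t) → ∃ λ s → 0ℚ ≤ s × Inside (ℤ.+ n) a t s
    inside⁻ n a t h = go (Ap.inDilate⁻ n (a ∷ t) h)
      where
      go : (∃ λ s → 0ℚ ≤ s × ∀ j → 0ℚ ≤ ι (bary (ℤ.+ n) (a ∷ t)) j - s * ι (bary (ℤ.+ 1) v) j) → ∃ λ s → 0ℚ ≤ s × Inside (ℤ.+ n) a t s
      go (s , hs , g) = s , hs , g (suc zero) ,
        λ { zero → subst (0ℚ ≤_) (cong₂ (λ x y → toℚ x - s * toℚ y) (bary-0 (ℤ.+ n) a t) (bary-v zero)) (g zero)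
          ; (suc j) → subst (λ y → 0ℚ ≤ toℚ (lookup t j) - s * toℚ y) (VecP.lookup∘tabulate (λ j → ℤ.+ lookup C (suc j)) j) (g (suc (suc j))) }

    inside⁺ : ∀ n a t s → 0ℚ ≤ s → Inside (ℤ.+ n) a t s → InDilate Ap.vertices n (a ∷ t)
    inside⁺ n a t s hs (ha , h) = Ap.inDilate⁺ n (a ∷ t) s hs
        λ { zero → subst (0ℚ ≤_) (sym (cong₂ (λ x y → toℚ x - s * toℚ y) (bary-0 (ℤ.+ n) a t) (bary-v zero))) (h zero)
          ; (suc zero) → ha
          ; (suc (suc j)) → subst (λ y → 0ℚ ≤ toℚ (lookup t j) - s * toℚ y) (sym (VecP.lookup∘tabulate (λ j → ℤ.+ lookup C (suc j)) j)) (h (suc j)) }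

    neg : Fin 4 → ℕ → ℤ
    neg k w = ℤ.-[1+ toℕ k ℕ.+ w ℕ.* 4 ]

    neg≡ : ∀ k w → neg k w ≡ ℤ.- step 3 (suc (toℕ k)) w
    neg≡ k w = cong ℤ.-_ (trans (trans (cong (λ m → ℤ.+ m) (trans (ℕP.+-comm (suc (toℕ k)) (w ℕ.* 4)) (cong (ℕ._+ suc (toℕ k)) (ℕP.*-comm w 4)))) (ℤP.pos-+ (4 ℕ.* w) (suc (toℕ k)))) (cong (ℤ._+ ℤ.+ suc (toℕ k)) (ℤP.pos-* 4 w)))

    vals : Fin 4 → ℕ → Vec ℕ (suc J) → Fin (suc J) → ℤ
    vals k w y j = posval 3 (suc (toℕ k)) w (lookup C j) (lookup y j)

    -- Class `zero` uses no apex and has first coordinate a ≥ 0. In the other classes the apex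
    -- weight is w plus 1/4, 2/4, 3/4 or 4/4; the last stands for a whole copy, which keeps these
    -- classes away from first coordinate 0.
    φ : Fin 5 → Vec ℕ (suc (suc J)) → Point (suc J)
    φ zero (a ∷ y) = ℤ.+ a ∷ points (λ j → ℤ.+ lookup y j)
    φ (suc k) (w ∷ y) = neg k w ∷ points (vals k w y)

    -- A further copy of the apex adds 5 to the positive coordinates and -4 to the negative one,
    -- hence 1 to the degree.
    degree : ∀ k w y → sumZ (vals k w y) ℤ.+ neg k w ≡ ℤ.+ (e k ℕ.+ (w ℕ.+ Vec.sum y))
    degree k w y = begin
      sumZ (vals k w y) ℤ.+ neg k w ≡⟨ cong₂ ℤ._+_ (valsum 3 (suc (toℕ k)) w y) (neg≡ k w) ⟩
      (Y ℤ.+ (ℤ.+ 5 ℤ.* W ℤ.+ ℤ.+ Q)) ℤ.+ (ℤ.- (ℤ.+ 4 ℤ.* W ℤ.+ K')) ≡⟨ cong (λ q → (Y ℤ.+ (ℤ.+ 5 ℤ.* W ℤ.+ q)) ℤ.+ (ℤ.- (ℤ.+ 4 ℤ.* W ℤ.+ K'))) (trans (cong (λ m → ℤ.+ m) (sym (e-spec k))) (ℤP.pos-+ (e k) (suc (toℕ k)))) ⟩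
      (Y ℤ.+ (ℤ.+ 5 ℤ.* W ℤ.+ (ℤ.+ e k ℤ.+ K'))) ℤ.+ (ℤ.- (ℤ.+ 4 ℤ.* W ℤ.+ K')) ≡⟨ Z.solve 4 (λ y w e k → (y Z.:+ (Z.con (ℤ.+ 5) Z.:* w Z.:+ (e Z.:+ k))) Z.:+ (Z.:- (Z.con (ℤ.+ 4) Z.:* w Z.:+ k)) Z.:= e Z.:+ (w Z.:+ y)) refl Y W (ℤ.+ e k) K' ⟩
      ℤ.+ e k ℤ.+ (W ℤ.+ Y) ≡⟨ sym (trans (ℤP.pos-+ (e k) (w ℕ.+ Vec.sum y)) (cong (λ z → ℤ.+ e k ℤ.+ z) (ℤP.pos-+ w (Vec.sum y)))) ⟩
      ℤ.+ (e k ℕ.+ (w ℕ.+ Vec.sum y)) ∎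
      where
      open ≡-Reasoning
      Y W K' : ℤ
      Y = ℤ.+ Vec.sum y
      W = ℤ.+ w
      K' = ℤ.+ suc (toℕ k)
      Q : ℕ
      Q = sumN (λ j → ceil 3 (suc (toℕ k)) (lookup C j))

    move : ∀ {a b c : ℤ} → a ℤ.+ b ≡ c → c ℤ.- b ≡ a
    move {a} {b} e = trans (cong (ℤ._- b) (sym e)) (Z.solve 2 (λ a b → (a Z.:+ b) Z.:- b Z.:= a) refl a b)

    into : ∀ p y → InDilate Ap.vertices (es p ℕ.+ Vec.sum y) (φ p y)
    into zero (a ∷ y) = inside⁺ (a ℕ.+ Vec.sum y) (ℤ.+ a) (points f) 0ℚ ≤-refl
        (subst (0ℚ ≤_) (solve 2 (λ a c → a := a :- con 0ℚ :* c) refl (toℚ (ℤ.+ a)) (toℚ ℤ.-[1+ 3 ])) (toℚ-mono-≤ {ℤ.+ 0} {ℤ.+ a} (ℤ.+≤+ ℕ.z≤n)) ,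
         λ j → subst (0ℚ ≤_) (trans (cong toℚ (sym (Zc-points (ℤ.+ (a ℕ.+ Vec.sum y) ℤ.- ℤ.+ a) f n≡ j))) (solve 2 (λ a c → a := a :- con 0ℚ :* c) refl (toℚ (Zc (ℤ.+ (a ℕ.+ Vec.sum y) ℤ.- ℤ.+ a) (points f) j)) (toℚ (ℤ.+ lookup C j)))) (toℚ-mono-≤ {ℤ.+ 0} {ℤ.+ lookup y j} (ℤ.+≤+ ℕ.z≤n)))
      where
      f : Fin (suc J) → ℤ
      f j = ℤ.+ lookup y j
      n≡ : ℤ.+ (a ℕ.+ Vec.sum y) ℤ.- ℤ.+ a ≡ sumZ f
      n≡ = trans (cong (ℤ._- ℤ.+ a) (trans (ℤP.pos-+ a (Vec.sum y)) (ℤP.+-comm (ℤ.+ a) (ℤ.+ Vec.sum y)))) (trans (Z.solve 2 (λ a b → (b Z.:+ a) Z.:- a Z.:= b) refl (ℤ.+ a) (ℤ.+ Vec.sum y)) (sym (natsum y)))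
    into (suc k) (w ∷ y) = inside⁺ (e k ℕ.+ (w ℕ.+ Vec.sum y)) (neg k w) (points (vals k w y)) s (ratio-≥0 3 p (ℤ.+≤+ ℕ.z≤n))
        (clear⁺ 3 p s (neg k w) ℤ.-[1+ 3 ] (ratio-eq 3 p) (ℤP.≤-reflexive (sym (trans (cong (λ z → ℤ.+ 4 ℤ.* z ℤ.- p ℤ.* ℤ.-[1+ 3 ]) (trans (neg≡ k w) (cong ℤ.-_ (sym p≡)))) (Z.solve 1 (λ p → Z.con (ℤ.+ 4) Z.:* (Z.:- p) Z.:- p Z.:* Z.con ℤ.-[1+ 3 ] Z.:= Z.con (ℤ.+ 0)) refl p)))) ,
         λ j → clear⁺ 3 p s (Zc (ℤ.+ (e k ℕ.+ (w ℕ.+ Vec.sum y)) ℤ.- neg k w) (points (vals k w y)) j) (ℤ.+ lookup C j) (ratio-eq 3 p)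
           (subst₂ (λ z p → ℤ.+ 0 ℤ.≤ ℤ.+ 4 ℤ.* z ℤ.- p ℤ.* ℤ.+ lookup C j) (sym (Zc-points (ℤ.+ (e k ℕ.+ (w ℕ.+ Vec.sum y)) ℤ.- neg k w) (vals k w y) (move (degree k w y)) j)) (sym p≡) (posval-≥ 3 (suc (toℕ k)) w (lookup C j) (lookup y j))))
      where
      p : ℤ
      p = ℤ.+ suc (toℕ k ℕ.+ w ℕ.* 4)
      p≡ : p ≡ step 3 (suc (toℕ k)) w
      p≡ = trans (cong ℤ.-_ (neg≡ k w)) (ℤP.neg-involutive (step 3 (suc (toℕ k)) w))
      s : ℚ
      s = ratio 3 p

    neg-injective' : ∀ k w k' w' → neg k w ≡ neg k' w' → k ≡ k' × w ≡ w'
    neg-injective' k w k' w' h = k≡ , ℕP.*-cancelʳ-≡ w w' 4 (ℕP.+-cancelˡ-≡ (toℕ k) _ _ (trans h' (cong (λ k → toℕ k ℕ.+ w' ℕ.* 4) (sym k≡))))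
      where
      h' : toℕ k ℕ.+ w ℕ.* 4 ≡ toℕ k' ℕ.+ w' ℕ.* 4
      h' = ℤP.-[1+-injective h
      mod : ∀ (k : Fin 4) w → (toℕ k ℕ.+ w ℕ.* 4) ℕ.% 4 ≡ toℕ k
      mod k w = trans (DM.[m+kn]%n≡m%n (toℕ k) w 4) (DM.m<n⇒m%n≡m (FinP.toℕ<n k))
      k≡ : k ≡ k'
      k≡ = FinP.toℕ-injective (trans (sym (mod k w)) (trans (cong (ℕ._% 4) h') (mod k' w')))

    inj : ∀ p y p' y' → es p ℕ.+ Vec.sum y ≡ es p' ℕ.+ Vec.sum y' → φ p y ≡ φ p' y' → p ≡ p' × y ≡ y'
    inj zero (a ∷ y) zero (a' ∷ y') s h = refl , cong₂ _∷_ a≡ (vec-ext λ j → ℤP.+-injective (points-injective (λ j → ℤ.+ lookup y j) (λ j → ℤ.+ lookup y' j) sums (VecP.∷-injectiveʳ h) j))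
      where
      a≡ : a ≡ a'
      a≡ = ℤP.+-injective (VecP.∷-injectiveˡ h)
      sums : sumZ (λ j → ℤ.+ lookup y j) ≡ sumZ (λ j → ℤ.+ lookup y' j)
      sums = trans (natsum y) (trans (cong (λ m → ℤ.+ m) (ℕP.+-cancelˡ-≡ a _ _ (trans s (cong (ℕ._+ Vec.sum y') (sym a≡))))) (sym (natsum y')))
    inj (suc k) (w ∷ y) (suc k') (w' ∷ y') s h = go (neg-injective' k w k' w' (VecP.∷-injectiveˡ h))
      where
      go : k ≡ k' × w ≡ w' → suc k ≡ suc k' × w ∷ y ≡ w' ∷ y'
      go (refl , refl) = refl , cong (w ∷_) (vec-ext λ j → posval-injective 3 (suc (toℕ k)) w (lookup C j) (lookup y j) (lookup y' j) (points-injective (vals k w y) (vals k w y') sums (VecP.∷-injectiveʳ h) j))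
        where
        sums : sumZ (vals k w y) ≡ sumZ (vals k w y')
        sums = ℤ-cancelʳ (neg k w) _ _ (trans (degree k w y) (trans (cong (λ m → ℤ.+ m) s) (sym (degree k w y'))))
    inj zero (a ∷ y) (suc k) (w ∷ y') s h with VecP.∷-injectiveˡ h
    ... | ()
    inj (suc k) (w ∷ y) zero (a ∷ y') s h with VecP.∷-injectiveˡ h
    ... | ()

    onto : ∀ n x → InDilate Ap.vertices n x → ∃ λ p → ∃ λ y → es p ℕ.+ Vec.sum y ≡ n × φ p y ≡ x
    onto n (a ∷ t) h = go a (inside⁻ n a t h)
      where
      go : ∀ a → (∃ λ s → 0ℚ ≤ s × Inside (ℤ.+ n) a t s) → ∃ λ p → ∃ λ y → es p ℕ.+ Vec.sum y ≡ n × φ p y ≡ a ∷ t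
      go (ℤ.+ a) (s , hs , ha , hj) = fin (choose (λ j → nonneg j))
        where
        f : Fin (suc J) → ℤ
        f = Zc (ℤ.+ n ℤ.- ℤ.+ a) t
        nonneg : ∀ j → ∃ λ y → ℤ.+ y ≡ f j
        nonneg j = ℤ.∣ f j ∣ , nonneg-abs (toℚ-cancel-≤ {ℤ.+ 0} {f j} (subst (0ℚ ≤_) (solve 3 (λ z s c → (z :- s :* c) :+ s :* c := z) refl (toℚ (f j)) s (toℚ (ℤ.+ lookup C j))) (+-0≤ (hj j) (*-0≤ hs (toℚ-mono-≤ {ℤ.+ 0} {ℤ.+ lookup C j} (ℤ.+≤+ ℕ.z≤n))))))
        fin : (∃ λ (y : Vec ℕ (suc J)) → ∀ j → ℤ.+ lookup y j ≡ f j) → ∃ λ p → ∃ λ y → es p ℕ.+ Vec.sum y ≡ n × φ p y ≡ ℤ.+ a ∷ t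
        fin (y , hy) = zero , a ∷ y , ℤP.+-injective (trans (ℤP.pos-+ a (Vec.sum y)) (trans (cong (λ z → ℤ.+ a ℤ.+ z) (trans (sym (natsum y)) (trans (sumZ-cong hy) (Zc-sum (ℤ.+ n ℤ.- ℤ.+ a) t)))) (Z.solve 2 (λ a n → a Z.:+ (n Z.:- a) Z.:= n) refl (ℤ.+ a) (ℤ.+ n)))) ,
          cong (ℤ.+ a ∷_) (points-Zc (ℤ.+ n ℤ.- ℤ.+ a) t (λ j → ℤ.+ lookup y j) hy)
      go (ℤ.-[1+ q ]) (s , hs , ha , hj) = fin (choose (λ j → posval-onto 3 (suc (toℕ k)) w (lookup C j) (f j) (subst (λ p → ℤ.+ 0 ℤ.≤ ℤ.+ 4 ℤ.* f j ℤ.- p ℤ.* ℤ.+ lookup C j) p≡ (clear⁻ 3 (ℤ.+ suc q) s (f j) (lookup C j) (hj j) p≤))))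
        where
        k : Fin 4
        k = fromℕ< (DM.m%n<n q 4)
        w : ℕ
        w = q ℕ./ 4
        neg-eq : neg k w ≡ ℤ.-[1+ q ]
        neg-eq = cong ℤ.-[1+_] (trans (cong (ℕ._+ w ℕ.* 4) (FinP.toℕ-fromℕ< (DM.m%n<n q 4))) (sym (DM.m≡m%n+[m/n]*n q 4)))
        f : Fin (suc J) → ℤ
        f = Zc (ℤ.+ n ℤ.- ℤ.-[1+ q ]) t
        p≡ : ℤ.+ suc q ≡ step 3 (suc (toℕ k)) w
        p≡ = trans (cong ℤ.-_ (trans (sym neg-eq) (neg≡ k w))) (ℤP.neg-involutive (step 3 (suc (toℕ k)) w))
        p≤ : toℚ (ℤ.+ suc q) ≤ toℚ (ℤ.+ 4) * s
        p≤ = 0≤q-p⇒p≤q (subst (0ℚ ≤_) (trans (cong₂ (λ a b → a - s * b) (toℚ-neg (ℤ.+ suc q)) (toℚ-neg (ℤ.+ 4))) (solve 3 (λ q s f → :- q :- s :* (:- f) := f :* s :- q) refl (toℚ (ℤ.+ suc q)) s (toℚ (ℤ.+ 4)))) ha)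
        fin : (∃ λ (y : Vec ℕ (suc J)) → ∀ j → posval 3 (suc (toℕ k)) w (lookup C j) (lookup y j) ≡ f j) → ∃ λ p → ∃ λ y → es p ℕ.+ Vec.sum y ≡ n × φ p y ≡ ℤ.-[1+ q ] ∷ t
        fin (y , hy) = suc k , w ∷ y , ℤP.+-injective (trans (sym (degree k w y)) (trans (cong₂ ℤ._+_ (trans (sumZ-cong hy) (Zc-sum (ℤ.+ n ℤ.- ℤ.-[1+ q ]) t)) neg-eq) (Z.solve 2 (λ a n → (n Z.:- a) Z.:+ a Z.:= n) refl ℤ.-[1+ q ] (ℤ.+ n)))) ,
          cong₂ _∷_ neg-eq (points-Zc (ℤ.+ n ℤ.- ℤ.-[1+ q ]) t (vals k w y) hy)

    polytope : ∀ i₁ i₂ i₃ i₄ → 1 ℕ.≤ i₁ → 1 ℕ.≤ i₂ → 1 ℕ.≤ i₃ → 1 ℕ.≤ i₄ → map es (List.allFin 5) ↭ 0 ∷ i₁ ∷ i₂ ∷ i₃ ∷ i₄ ∷ [] → ExistsPolytope (suc J) (hpoly i₁ i₂ i₃ i₄)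
    polytope i₁ i₂ i₃ i₄ h₁ h₂ h₃ h₄ perm = suc (suc (suc J)) , Ap.vertices , Ap.fullDim , has-delta Ap.vertices es φ into inj onto i₁ i₂ i₃ i₄ h₁ h₂ h₃ h₄ perm

  sumN-zeros : ∀ J (g : ℕ → ℕ) → g 0 ≡ 0 → sumN (λ j → g (lookup (Vec.replicate J 0) j)) ≡ 0
  sumN-zeros zero g h = refl
  sumN-zeros (suc J) g h = cong₂ ℕ._+_ h (sumN-zeros J g h)

  cleared : ∀ m q s → 0ℚ ≤ toℚ ℤ.-[1+ q ] - s * toℚ ℤ.-[1+ m ] → toℚ (ℤ.+ suc q) ≤ toℚ (ℤ.+ suc m) * s
  cleared m q s h = 0≤q-p⇒p≤q (subst (0ℚ ≤_) (trans (cong₂ (λ a b → a - s * b) (toℚ-neg (ℤ.+ suc q)) (toℚ-neg (ℤ.+ suc m))) (solve 3 (λ q s f → :- q :- s :* (:- f) := f :* s :- q) refl (toℚ (ℤ.+ suc q)) s (toℚ (ℤ.+ suc m)))) h)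

  step-1 : ∀ w → ℤ.+ suc w ≡ step 0 1 w
  step-1 w = sym (trans (cong (ℤ._+ ℤ.+ 1) (ℤP.*-identityˡ (ℤ.+ w))) (cong (λ m → ℤ.+ m) (ℕP.+-comm w 1)))

  move : ∀ {a b c : ℤ} → a ℤ.+ b ≡ c → c ℤ.- b ≡ a
  move {a} {b} e = trans (cong (ℤ._- b) (sym e)) (Z.solve 2 (λ a b → (a Z.:+ b) Z.:- b Z.:= a) refl a b)

  -- In the classes `e k` the first coordinate is -(k + 1), and the second is then at least -⌊(k +
  -- 1)/3⌋. In the class of `e₁` the second coordinate is -1 and the first at least -2, since -3
  -- belongs to the other classes; together they lower the degree by 3.
  record TwoNegativeData : Set where
    constructor twoNegative
    field
      positive : PositivePart
    open PositivePart positive public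
    field
      e : Fin 3 → ℕ
      e-spec : ∀ k → e k ℕ.+ (suc (toℕ k) ℕ.+ suc (toℕ k) ℕ./ 3) ≡ sumN (λ j → ceil 2 (suc (toℕ k)) (lookup C j))
      e₁ : ℕ
      e₁-spec : e₁ ℕ.+ 3 ≡ sumN (λ j → ceil 0 1 (lookup C j))

  -- The apex has the negative coordinates −3 and −1, so a point (a, b, …) needs the multiple
  -- max(−a/3, −b, 0) of it, which is −a/3 exactly if a ≤ 0 and a ≤ 3b.
  module TwoNegative (𝓣 : TwoNegativeData) where
    open TwoNegativeData 𝓣
    open Positive positive

    v : Point (suc (suc J))
    v = ℤ.-[1+ 2 ] ∷ ℤ.-[1+ 0 ] ∷ tailC

    module Ap = Apex v

    es : Fin 5 → ℕ
    es zero = 0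
    es (suc zero) = e₁
    es (suc (suc k)) = e k

    bary-v : lookup (bary (ℤ.+ 1) v) zero ≡ ℤ.+ lookup C zero
    bary-v = trans (cong (λ t → ℤ.+ 1 ℤ.- (ℤ.-[1+ 2 ] ℤ.+ (ℤ.-[1+ 0 ] ℤ.+ t))) total-tailC) (Z.solve 1 (λ c → Z.con (ℤ.+ 1) Z.:- (Z.con ℤ.-[1+ 2 ] Z.:+ (Z.con ℤ.-[1+ 0 ] Z.:+ (Z.con (ℤ.+ 5) Z.:- c))) Z.:= c) refl (ℤ.+ lookup C zero))

    Inside : ℤ → ℤ → ℤ → Point J → ℚ → Set
    Inside n a b t s = 0ℚ ≤ toℚ a - s * toℚ ℤ.-[1+ 2 ] × 0ℚ ≤ toℚ b - s * toℚ ℤ.-[1+ 0 ] × (∀ j → 0ℚ ≤ toℚ (Zc (n ℤ.- (a ℤ.+ b)) t j) - s * toℚ (ℤ.+ lookup C j))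

    bary-0 : ∀ n a b (t : Point J) → n ℤ.- total (a ∷ b ∷ t) ≡ n ℤ.- (a ℤ.+ b) ℤ.- total t
    bary-0 n a b t = Z.solve 4 (λ n a b t → n Z.:- (a Z.:+ (b Z.:+ t)) Z.:= n Z.:- (a Z.:+ b) Z.:- t) refl n a b (total t)

    inside⁻ : ∀ n a b t → InDilate Ap.vertices n (a ∷ b ∷ t) → ∃ λ s → 0ℚ ≤ s × Inside (ℤ.+ n) a b t s
    inside⁻ n a b t h = go (Ap.inDilate⁻ n (a ∷ b ∷ t) h)
      where
      go : (∃ λ s → 0ℚ ≤ s × ∀ j → 0ℚ ≤ ι (bary (ℤ.+ n) (a ∷ b ∷ t)) j - s * ι (bary (ℤ.+ 1) v) j) → ∃ λ s → 0ℚ ≤ s × Inside (ℤ.+ n) a b t s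
      go (s , hs , g) = s , hs , g (suc zero) , g (suc (suc zero)) ,
        λ { zero → subst (0ℚ ≤_) (cong₂ (λ x y → toℚ x - s * toℚ y) (bary-0 (ℤ.+ n) a b t) bary-v) (g zero)
          ; (suc j) → subst (λ y → 0ℚ ≤ toℚ (lookup t j) - s * toℚ y) (VecP.lookup∘tabulate (λ j → ℤ.+ lookup C (suc j)) j) (g (suc (suc (suc j)))) }

    inside⁺ : ∀ n a b t s → 0ℚ ≤ s → Inside (ℤ.+ n) a b t s → InDilate Ap.vertices n (a ∷ b ∷ t)
    inside⁺ n a b t s hs (ha , hb , h) = Ap.inDilate⁺ n (a ∷ b ∷ t) s hs
        λ { zero → subst (0ℚ ≤_) (sym (cong₂ (λ x y → toℚ x - s * toℚ y) (bary-0 (ℤ.+ n) a b t) bary-v)) (h zero)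
          ; (suc zero) → ha
          ; (suc (suc zero)) → hb
          ; (suc (suc (suc j))) → subst (λ y → 0ℚ ≤ toℚ (lookup t j) - s * toℚ y) (sym (VecP.lookup∘tabulate (λ j → ℤ.+ lookup C (suc j)) j)) (h (suc j)) }

    κ fl : Fin 3 → ℕ
    κ k = suc (toℕ k)
    fl k = κ k ℕ./ 3

    κ≡ : ∀ k → ℤ.+ κ k ≡ ℤ.+ (κ k ℕ.% 3) ℤ.+ ℤ.+ fl k ℤ.* ℤ.+ 3
    κ≡ k = trans (cong (λ m → ℤ.+ m) (DM.m≡m%n+[m/n]*n (κ k) 3)) (trans (ℤP.pos-+ (κ k ℕ.% 3) (fl k ℕ.* 3)) (cong (λ z → ℤ.+ (κ k ℕ.% 3) ℤ.+ z) (ℤP.pos-* (fl k) 3)))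

    neg : Fin 3 → ℕ → ℤ
    neg k w = ℤ.-[1+ toℕ k ℕ.+ w ℕ.* 3 ]

    neg≡ : ∀ k w → neg k w ≡ ℤ.- step 2 (κ k) w
    neg≡ k w = cong ℤ.-_ (trans (trans (cong (λ m → ℤ.+ m) (trans (ℕP.+-comm (κ k) (w ℕ.* 3)) (cong (ℕ._+ κ k) (ℕP.*-comm w 3)))) (ℤP.pos-+ (3 ℕ.* w) (κ k))) (cong (ℤ._+ ℤ.+ κ k) (ℤP.pos-* 3 w)))

    -- For b = -(w + 1) this class requires a > 3b, so a begins at -(3w + 2); the boundary a = 3b
    -- belongs to the other classes.
    aB : ℕ → ℕ → ℤ
    aB w y = ℤ.+ y ℤ.- (ℤ.+ 3 ℤ.* ℤ.+ w ℤ.+ ℤ.+ 2)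

    -- For a = -(3w + κ) the condition a ≤ 3b makes b begin at -(w + ⌊κ/3⌋).
    bA : Fin 3 → ℕ → ℕ → ℤ
    bA k w y = ℤ.+ y ℤ.- (ℤ.+ w ℤ.+ ℤ.+ fl k)

    valsA : Fin 3 → ℕ → Vec ℕ (suc J) → Fin (suc J) → ℤ
    valsA k w y j = posval 2 (κ k) w (lookup C j) (lookup y j)

    valsB : ℕ → Vec ℕ (suc J) → Fin (suc J) → ℤ
    valsB w y j = posval 0 1 w (lookup C j) (lookup y j)

    φ : Fin 5 → Vec ℕ (suc (suc (suc J))) → Point (suc (suc J))
    φ zero (a ∷ b ∷ y) = ℤ.+ a ∷ ℤ.+ b ∷ points (λ j → ℤ.+ lookup y j)
    φ (suc zero) (w ∷ a ∷ y) = aB w a ∷ ℤ.-[1+ w ] ∷ points (valsB w y)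
    φ (suc (suc k)) (w ∷ b ∷ y) = neg k w ∷ bA k w b ∷ points (valsA k w y)

    degreeA : ∀ k w b y → sumZ (valsA k w y) ℤ.+ (neg k w ℤ.+ bA k w b) ≡ ℤ.+ (e k ℕ.+ (w ℕ.+ (b ℕ.+ Vec.sum y)))
    degreeA k w b y = begin
      sumZ (valsA k w y) ℤ.+ (neg k w ℤ.+ bA k w b) ≡⟨ cong₂ (λ a c → a ℤ.+ (c ℤ.+ bA k w b)) (valsum 2 (κ k) w y) (neg≡ k w) ⟩
      (Y ℤ.+ (ℤ.+ 5 ℤ.* W ℤ.+ ℤ.+ Q)) ℤ.+ (ℤ.- (ℤ.+ 3 ℤ.* W ℤ.+ K') ℤ.+ (B ℤ.- (W ℤ.+ F))) ≡⟨ cong (λ q → (Y ℤ.+ (ℤ.+ 5 ℤ.* W ℤ.+ q)) ℤ.+ (ℤ.- (ℤ.+ 3 ℤ.* W ℤ.+ K') ℤ.+ (B ℤ.- (W ℤ.+ F)))) (cong (λ m → ℤ.+ m) (sym (e-spec k))) ⟩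
      (Y ℤ.+ (ℤ.+ 5 ℤ.* W ℤ.+ (ℤ.+ e k ℤ.+ (K' ℤ.+ F)))) ℤ.+ (ℤ.- (ℤ.+ 3 ℤ.* W ℤ.+ K') ℤ.+ (B ℤ.- (W ℤ.+ F)))
        ≡⟨ Z.solve 6 (λ y w e k f b → (y Z.:+ (Z.con (ℤ.+ 5) Z.:* w Z.:+ (e Z.:+ (k Z.:+ f)))) Z.:+ (Z.:- (Z.con (ℤ.+ 3) Z.:* w Z.:+ k) Z.:+ (b Z.:- (w Z.:+ f))) Z.:= e Z.:+ (w Z.:+ (b Z.:+ y))) refl Y W (ℤ.+ e k) K' F B ⟩
      ℤ.+ e k ℤ.+ (W ℤ.+ (B ℤ.+ Y)) ∎
      where
      open ≡-Reasoning
      Y W K' F B : ℤ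
      Y = ℤ.+ Vec.sum y
      W = ℤ.+ w
      K' = ℤ.+ κ k
      F = ℤ.+ fl k
      B = ℤ.+ b
      Q : ℕ
      Q = sumN (λ j → ceil 2 (κ k) (lookup C j))

    degreeB : ∀ w a y → sumZ (valsB w y) ℤ.+ (aB w a ℤ.+ ℤ.-[1+ w ]) ≡ ℤ.+ (e₁ ℕ.+ (w ℕ.+ (a ℕ.+ Vec.sum y)))
    degreeB w a y = begin
      sumZ (valsB w y) ℤ.+ (aB w a ℤ.+ ℤ.-[1+ w ]) ≡⟨ cong₂ (λ x c → x ℤ.+ (aB w a ℤ.+ c)) (valsum 0 1 w y) (cong ℤ.-_ (step-1 w)) ⟩
      (Y ℤ.+ (ℤ.+ 5 ℤ.* W ℤ.+ ℤ.+ Q)) ℤ.+ ((A ℤ.- (ℤ.+ 3 ℤ.* W ℤ.+ ℤ.+ 2)) ℤ.+ ℤ.- (ℤ.+ 1 ℤ.* W ℤ.+ ℤ.+ 1)) ≡⟨ cong (λ q → (Y ℤ.+ (ℤ.+ 5 ℤ.* W ℤ.+ q)) ℤ.+ ((A ℤ.- (ℤ.+ 3 ℤ.* W ℤ.+ ℤ.+ 2)) ℤ.+ ℤ.- (ℤ.+ 1 ℤ.* W ℤ.+ ℤ.+ 1))) (cong (λ m → ℤ.+ m) (sym e₁-spec)) ⟩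
      (Y ℤ.+ (ℤ.+ 5 ℤ.* W ℤ.+ (ℤ.+ e₁ ℤ.+ ℤ.+ 3))) ℤ.+ ((A ℤ.- (ℤ.+ 3 ℤ.* W ℤ.+ ℤ.+ 2)) ℤ.+ ℤ.- (ℤ.+ 1 ℤ.* W ℤ.+ ℤ.+ 1))
        ≡⟨ Z.solve 4 (λ y w e a → (y Z.:+ (Z.con (ℤ.+ 5) Z.:* w Z.:+ (e Z.:+ Z.con (ℤ.+ 3)))) Z.:+ ((a Z.:- (Z.con (ℤ.+ 3) Z.:* w Z.:+ Z.con (ℤ.+ 2))) Z.:+ Z.:- (Z.con (ℤ.+ 1) Z.:* w Z.:+ Z.con (ℤ.+ 1))) Z.:= e Z.:+ (w Z.:+ (a Z.:+ y))) refl Y W (ℤ.+ e₁) A ⟩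
      ℤ.+ e₁ ℤ.+ (W ℤ.+ (A ℤ.+ Y)) ∎
      where
      open ≡-Reasoning
      Y W A : ℤ
      Y = ℤ.+ Vec.sum y
      W = ℤ.+ w
      A = ℤ.+ a
      Q : ℕ
      Q = sumN (λ j → ceil 0 1 (lookup C j))

    degree₀ : ∀ a b y → sumZ (λ j → ℤ.+ lookup y j) ℤ.+ (ℤ.+ a ℤ.+ ℤ.+ b) ≡ ℤ.+ (a ℕ.+ (b ℕ.+ Vec.sum y))
    degree₀ a b y = trans (cong (ℤ._+ (ℤ.+ a ℤ.+ ℤ.+ b)) (natsum y)) (Z.solve 3 (λ s a b → s Z.:+ (a Z.:+ b) Z.:= a Z.:+ (b Z.:+ s)) refl (ℤ.+ Vec.sum y) (ℤ.+ a) (ℤ.+ b))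

    into-pos : ∀ m k w n y → n ≡ sumZ (λ j → posval m k w (lookup C j) (lookup y j)) → ∀ p → p ≡ step m k w →
      ∀ j → 0ℚ ≤ toℚ (Zc n (points (λ j → posval m k w (lookup C j) (lookup y j))) j) - ratio m p * toℚ (ℤ.+ lookup C j)
    into-pos m k w n y n≡ p p≡ j = clear⁺ m p (ratio m p) (Zc n (points vals) j) (ℤ.+ lookup C j) (ratio-eq m p)
        (subst₂ (λ z p → ℤ.+ 0 ℤ.≤ ℤ.+ suc m ℤ.* z ℤ.- p ℤ.* ℤ.+ lookup C j) (sym (Zc-points n vals n≡ j)) (sym p≡) (posval-≥ m k w (lookup C j) (lookup y j)))
      where
      vals : Fin (suc J) → ℤ
      vals j = posval m k w (lookup C j) (lookup y j)

    minus-0 : ∀ a c → 0ℚ ≤ a → 0ℚ ≤ a - 0ℚ * c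
    minus-0 a c = subst (0ℚ ≤_) (solve 2 (λ a c → a := a :- con 0ℚ :* c) refl a c)

    into : ∀ p y → InDilate Ap.vertices (es p ℕ.+ Vec.sum y) (φ p y)
    into zero (a ∷ b ∷ y) = inside⁺ n (ℤ.+ a) (ℤ.+ b) (points f) 0ℚ ≤-refl
        (minus-0 (toℚ (ℤ.+ a)) (toℚ ℤ.-[1+ 2 ]) (toℚ-mono-≤ {ℤ.+ 0} {ℤ.+ a} (ℤ.+≤+ ℕ.z≤n)) , minus-0 (toℚ (ℤ.+ b)) (toℚ ℤ.-[1+ 0 ]) (toℚ-mono-≤ {ℤ.+ 0} {ℤ.+ b} (ℤ.+≤+ ℕ.z≤n)) ,
         λ j → subst (λ z → 0ℚ ≤ toℚ z - 0ℚ * toℚ (ℤ.+ lookup C j)) (sym (Zc-points (ℤ.+ n ℤ.- (ℤ.+ a ℤ.+ ℤ.+ b)) f (move (degree₀ a b y)) j)) (minus-0 (toℚ (f j)) (toℚ (ℤ.+ lookup C j)) (toℚ-mono-≤ {ℤ.+ 0} {f j} (ℤ.+≤+ ℕ.z≤n))))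
      where
      n : ℕ
      n = a ℕ.+ (b ℕ.+ Vec.sum y)
      f : Fin (suc J) → ℤ
      f j = ℤ.+ lookup y j
    into (suc zero) (w ∷ a ∷ y) = inside⁺ n (aB w a) ℤ.-[1+ w ] (points (valsB w y)) (ratio 0 p) (ratio-≥0 0 p (ℤ.+≤+ ℕ.z≤n))
        (clear⁺ 0 p (ratio 0 p) (aB w a) ℤ.-[1+ 2 ] (ratio-eq 0 p) (subst (ℤ.+ 0 ℤ.≤_) (sym (trans (cong (λ q → ℤ.+ 1 ℤ.* aB w a ℤ.- q ℤ.* ℤ.-[1+ 2 ]) (step-1 w)) (Z.solve 2 (λ a w → Z.con (ℤ.+ 1) Z.:* (a Z.:- (Z.con (ℤ.+ 3) Z.:* w Z.:+ Z.con (ℤ.+ 2))) Z.:- (Z.con (ℤ.+ 1) Z.:* w Z.:+ Z.con (ℤ.+ 1)) Z.:* Z.con ℤ.-[1+ 2 ] Z.:= a Z.:+ Z.con (ℤ.+ 1)) refl (ℤ.+ a) (ℤ.+ w)))) (ℤ.+≤+ ℕ.z≤n)) ,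
         clear⁺ 0 p (ratio 0 p) ℤ.-[1+ w ] ℤ.-[1+ 0 ] (ratio-eq 0 p) (ℤP.≤-reflexive (sym (Z.solve 1 (λ p → Z.con (ℤ.+ 1) Z.:* (Z.:- p) Z.:- p Z.:* Z.con ℤ.-[1+ 0 ] Z.:= Z.con (ℤ.+ 0)) refl p))) ,
         into-pos 0 1 w (ℤ.+ n ℤ.- (aB w a ℤ.+ ℤ.-[1+ w ])) y (move (degreeB w a y)) p (step-1 w))
      where
      n : ℕ
      n = e₁ ℕ.+ (w ℕ.+ (a ℕ.+ Vec.sum y))
      p : ℤ
      p = ℤ.+ suc w
    into (suc (suc k)) (w ∷ b ∷ y) = inside⁺ n (neg k w) (bA k w b) (points (valsA k w y)) (ratio 2 p) (ratio-≥0 2 p (ℤ.+≤+ ℕ.z≤n))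
        (clear⁺ 2 p (ratio 2 p) (neg k w) ℤ.-[1+ 2 ] (ratio-eq 2 p) (ℤP.≤-reflexive (sym (Z.solve 1 (λ p → Z.con (ℤ.+ 3) Z.:* (Z.:- p) Z.:- p Z.:* Z.con ℤ.-[1+ 2 ] Z.:= Z.con (ℤ.+ 0)) refl p))) ,
         clear⁺ 2 p (ratio 2 p) (bA k w b) ℤ.-[1+ 0 ] (ratio-eq 2 p) (subst (ℤ.+ 0 ℤ.≤_) (sym b≡) (ℤ.+≤+ ℕ.z≤n)) ,
         into-pos 2 (κ k) w (ℤ.+ n ℤ.- (neg k w ℤ.+ bA k w b)) y (move (degreeA k w b y)) p p≡)
      where
      n : ℕ
      n = e k ℕ.+ (w ℕ.+ (b ℕ.+ Vec.sum y))
      p : ℤ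
      p = ℤ.+ suc (toℕ k ℕ.+ w ℕ.* 3)
      p≡ : p ≡ step 2 (κ k) w
      p≡ = trans (cong ℤ.-_ (neg≡ k w)) (ℤP.neg-involutive (step 2 (κ k) w))
      b≡ : ℤ.+ 3 ℤ.* bA k w b ℤ.- p ℤ.* ℤ.-[1+ 0 ] ≡ ℤ.+ (3 ℕ.* b ℕ.+ κ k ℕ.% 3)
      b≡ = trans (cong (λ q → ℤ.+ 3 ℤ.* bA k w b ℤ.- q ℤ.* ℤ.-[1+ 0 ]) (trans p≡ (cong (λ z → ℤ.+ 3 ℤ.* ℤ.+ w ℤ.+ z) (κ≡ k))))
        (trans (Z.solve 4 (λ b w f r → Z.con (ℤ.+ 3) Z.:* (b Z.:- (w Z.:+ f)) Z.:- (Z.con (ℤ.+ 3) Z.:* w Z.:+ (r Z.:+ f Z.:* Z.con (ℤ.+ 3))) Z.:* Z.con ℤ.-[1+ 0 ] Z.:= Z.con (ℤ.+ 3) Z.:* b Z.:+ r) refl (ℤ.+ b) (ℤ.+ w) (ℤ.+ fl k) (ℤ.+ (κ k ℕ.% 3)))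
        (cong (ℤ._+ ℤ.+ (κ k ℕ.% 3)) (sym (ℤP.pos-* 3 b))))

    neg-injective' : ∀ k w k' w' → neg k w ≡ neg k' w' → k ≡ k' × w ≡ w'
    neg-injective' k w k' w' h = k≡ , ℕP.*-cancelʳ-≡ w w' 3 (ℕP.+-cancelˡ-≡ (toℕ k) _ _ (trans h' (cong (λ k → toℕ k ℕ.+ w' ℕ.* 3) (sym k≡))))
      where
      h' : toℕ k ℕ.+ w ℕ.* 3 ≡ toℕ k' ℕ.+ w' ℕ.* 3
      h' = ℤP.-[1+-injective h
      mod : ∀ (k : Fin 3) w → (toℕ k ℕ.+ w ℕ.* 3) ℕ.% 3 ≡ toℕ k
      mod k w = trans (DM.[m+kn]%n≡m%n (toℕ k) w 3) (DM.m<n⇒m%n≡m (FinP.toℕ<n k))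
      k≡ : k ≡ k'
      k≡ = FinP.toℕ-injective (trans (sym (mod k w)) (trans (cong (ℕ._% 3) h') (mod k' w')))

    -- The classes are separated by a > 3b and a ≤ 3b. For a common point, adding the two
    -- differences would make a positive natural number equal to 0.
    disjoint : ∀ w a k w' b → aB w a ≡ neg k w' → ℤ.-[1+ w ] ≡ bA k w' b → ⊥
    disjoint w a k w' b ea eb = ℕP.<-irrefl refl (ℕP.<-≤-trans (ℕP.≤-<-trans (ℕP.≤-trans (ℕP.m≤m+n r (3 ℕ.* b)) (ℕP.m≤n+m (r ℕ.+ 3 ℕ.* b) a)) (ℕP.n<1+n (a ℕ.+ (r ℕ.+ 3 ℕ.* b)))) (subst (ℕ._≤ r) (sym (ℤP.+-injective eq)) ℕ.z≤n))
      where
      r : ℕ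
      r = κ k ℕ.% 3
      eq : ℤ.+ suc (a ℕ.+ (r ℕ.+ 3 ℕ.* b)) ≡ ℤ.+ 0
      eq = begin
        ℤ.+ suc (a ℕ.+ (r ℕ.+ 3 ℕ.* b)) ≡⟨ cong (λ z → ℤ.+ 1 ℤ.+ (ℤ.+ a ℤ.+ (ℤ.+ r ℤ.+ z))) (ℤP.pos-* 3 b) ⟩
        ℤ.+ 1 ℤ.+ (ℤ.+ a ℤ.+ (ℤ.+ r ℤ.+ ℤ.+ 3 ℤ.* ℤ.+ b)) ≡⟨ Z.solve 6 (λ a r b w v f → Z.con (ℤ.+ 1) Z.:+ (a Z.:+ (r Z.:+ Z.con (ℤ.+ 3) Z.:* b)) Z.:= ((a Z.:- (Z.con (ℤ.+ 3) Z.:* w Z.:+ Z.con (ℤ.+ 2))) Z.:- Z.con (ℤ.+ 3) Z.:* (Z.:- (Z.con (ℤ.+ 1) Z.:* w Z.:+ Z.con (ℤ.+ 1)))) Z.:+ (Z.con (ℤ.+ 3) Z.:* (b Z.:- (v Z.:+ f)) Z.:- (Z.:- (Z.con (ℤ.+ 3) Z.:* v Z.:+ (r Z.:+ f Z.:* Z.con (ℤ.+ 3)))))) refl (ℤ.+ a) (ℤ.+ r) (ℤ.+ b) (ℤ.+ w) (ℤ.+ w') (ℤ.+ fl k) ⟩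
        (aB w a ℤ.- ℤ.+ 3 ℤ.* (ℤ.- step 0 1 w)) ℤ.+ (ℤ.+ 3 ℤ.* bA k w' b ℤ.- (ℤ.- (ℤ.+ 3 ℤ.* ℤ.+ w' ℤ.+ (ℤ.+ r ℤ.+ ℤ.+ fl k ℤ.* ℤ.+ 3)))) ≡⟨ cong₂ (λ x y → (aB w a ℤ.- ℤ.+ 3 ℤ.* x) ℤ.+ (ℤ.+ 3 ℤ.* bA k w' b ℤ.- y)) (trans (cong ℤ.-_ (sym (step-1 w))) eb) (trans (cong (λ z → ℤ.- (ℤ.+ 3 ℤ.* ℤ.+ w' ℤ.+ z)) (sym (κ≡ k))) (trans (sym (neg≡ k w')) (sym ea))) ⟩
        (aB w a ℤ.- ℤ.+ 3 ℤ.* bA k w' b) ℤ.+ (ℤ.+ 3 ℤ.* bA k w' b ℤ.- aB w a) ≡⟨ Z.solve 2 (λ a b → (a Z.:- b) Z.:+ (b Z.:- a) Z.:= Z.con (ℤ.+ 0)) refl (aB w a) (ℤ.+ 3 ℤ.* bA k w' b) ⟩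
        ℤ.+ 0 ∎
        where open ≡-Reasoning

    sums : ∀ (f g : Fin (suc J) → ℤ) c c' {n n'} → sumZ f ℤ.+ c ≡ ℤ.+ n → sumZ g ℤ.+ c' ≡ ℤ.+ n' → c ≡ c' → n ≡ n' → sumZ f ≡ sumZ g
    sums f g c .c hf hg refl nn = ℤ-cancelʳ c (sumZ f) (sumZ g) (trans hf (trans (cong (λ m → ℤ.+ m) nn) (sym hg)))

    inj : ∀ p y p' y' → es p ℕ.+ Vec.sum y ≡ es p' ℕ.+ Vec.sum y' → φ p y ≡ φ p' y' → p ≡ p' × y ≡ y'
    inj zero (a ∷ b ∷ y) zero (a' ∷ b' ∷ y') s h = go (ℤP.+-injective (VecP.∷-injectiveˡ h)) (ℤP.+-injective (VecP.∷-injectiveˡ (VecP.∷-injectiveʳ h)))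
      where
      go : a ≡ a' → b ≡ b' → zero ≡ zero × a ∷ b ∷ y ≡ a' ∷ b' ∷ y'
      go refl refl = refl , cong (λ y → a ∷ b ∷ y) (vec-ext λ j → ℤP.+-injective (points-injective (λ j → ℤ.+ lookup y j) (λ j → ℤ.+ lookup y' j) (sums (λ j → ℤ.+ lookup y j) (λ j → ℤ.+ lookup y' j) (ℤ.+ a ℤ.+ ℤ.+ b) (ℤ.+ a ℤ.+ ℤ.+ b) (degree₀ a b y) (degree₀ a b y') refl s) (VecP.∷-injectiveʳ (VecP.∷-injectiveʳ h)) j))
    inj (suc zero) (w ∷ a ∷ y) (suc zero) (w' ∷ a' ∷ y') s h = go (ℤP.-[1+-injective (VecP.∷-injectiveˡ (VecP.∷-injectiveʳ h))) (VecP.∷-injectiveˡ h)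
      where
      go : w ≡ w' → aB w a ≡ aB w' a' → suc zero ≡ suc zero × w ∷ a ∷ y ≡ w' ∷ a' ∷ y'
      go refl ha = refl , cong₂ (λ a y → w ∷ a ∷ y) (ℤP.+-injective (ℤ-cancelʳ (ℤ.- (ℤ.+ 3 ℤ.* ℤ.+ w ℤ.+ ℤ.+ 2)) (ℤ.+ a) (ℤ.+ a') ha))
        (vec-ext λ j → posval-injective 0 1 w (lookup C j) (lookup y j) (lookup y' j) (points-injective (valsB w y) (valsB w y') (sums (valsB w y) (valsB w y') (aB w a ℤ.+ ℤ.-[1+ w ]) (aB w a' ℤ.+ ℤ.-[1+ w ]) (degreeB w a y) (degreeB w a' y') (cong (ℤ._+ ℤ.-[1+ w ]) ha) s) (VecP.∷-injectiveʳ (VecP.∷-injectiveʳ h)) j))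
    inj (suc (suc k)) (w ∷ b ∷ y) (suc (suc k')) (w' ∷ b' ∷ y') s h = go (neg-injective' k w k' w' (VecP.∷-injectiveˡ h)) (VecP.∷-injectiveˡ (VecP.∷-injectiveʳ h))
      where
      go : k ≡ k' × w ≡ w' → bA k w b ≡ bA k' w' b' → suc (suc k) ≡ suc (suc k') × w ∷ b ∷ y ≡ w' ∷ b' ∷ y'
      go (refl , refl) hb = refl , cong₂ (λ b y → w ∷ b ∷ y) (ℤP.+-injective (ℤ-cancelʳ (ℤ.- (ℤ.+ w ℤ.+ ℤ.+ fl k)) (ℤ.+ b) (ℤ.+ b') hb))
        (vec-ext λ j → posval-injective 2 (κ k) w (lookup C j) (lookup y j) (lookup y' j) (points-injective (valsA k w y) (valsA k w y') (sums (valsA k w y) (valsA k w y') (neg k w ℤ.+ bA k w b) (neg k w ℤ.+ bA k w b') (degreeA k w b y) (degreeA k w b' y') (cong (λ z → neg k w ℤ.+ z) hb) s) (VecP.∷-injectiveʳ (VecP.∷-injectiveʳ h)) j))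
    inj (suc zero) (w ∷ a ∷ y) (suc (suc k)) (w' ∷ b ∷ y') s h = ⊥-elim (disjoint w a k w' b (VecP.∷-injectiveˡ h) (VecP.∷-injectiveˡ (VecP.∷-injectiveʳ h)))
    inj (suc (suc k)) (w' ∷ b ∷ y') (suc zero) (w ∷ a ∷ y) s h = ⊥-elim (disjoint w a k w' b (sym (VecP.∷-injectiveˡ h)) (sym (VecP.∷-injectiveˡ (VecP.∷-injectiveʳ h))))
    inj zero (a ∷ b ∷ y) (suc zero) (w ∷ a' ∷ y') s h with VecP.∷-injectiveˡ (VecP.∷-injectiveʳ h)
    ... | ()
    inj (suc zero) (w ∷ a' ∷ y') zero (a ∷ b ∷ y) s h with VecP.∷-injectiveˡ (VecP.∷-injectiveʳ h)
    ... | ()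
    inj zero (a ∷ b ∷ y) (suc (suc k)) (w ∷ b' ∷ y') s h with VecP.∷-injectiveˡ h
    ... | ()
    inj (suc (suc k)) (w ∷ b' ∷ y') zero (a ∷ b ∷ y) s h with VecP.∷-injectiveˡ h
    ... | ()

    Preimage : ℕ → ℤ → ℤ → Point J → Set
    Preimage n a b t = ∃ λ p → ∃ λ y → es p ℕ.+ Vec.sum y ≡ n × φ p y ≡ a ∷ b ∷ t

    collect : ∀ n a b (f : Fin (suc J) → ℤ) t {n'} → sumZ f ℤ.+ (a ℤ.+ b) ≡ ℤ.+ n' → (∀ j → f j ≡ Zc (ℤ.+ n ℤ.- (a ℤ.+ b)) t j) → n' ≡ n
    collect n a b f t hd hf = ℤP.+-injective (trans (sym hd) (trans (cong (ℤ._+ (a ℤ.+ b)) (trans (sumZ-cong hf) (Zc-sum (ℤ.+ n ℤ.- (a ℤ.+ b)) t))) (Z.solve 2 (λ n c → (n Z.:- c) Z.:+ c Z.:= n) refl (ℤ.+ n) (a ℤ.+ b))))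

    onto-vals : ∀ m k w s n t p → p ≡ step m k w → toℚ p ≤ toℚ (ℤ.+ suc m) * s → (∀ j → 0ℚ ≤ toℚ (Zc n t j) - s * toℚ (ℤ.+ lookup C j)) →
      ∃ λ (y : Vec ℕ (suc J)) → ∀ j → posval m k w (lookup C j) (lookup y j) ≡ Zc n t j
    onto-vals m k w s n t p p≡ le h = choose (λ j → posval-onto m k w (lookup C j) (Zc n t j) (subst (λ p → ℤ.+ 0 ℤ.≤ ℤ.+ suc m ℤ.* Zc n t j ℤ.- p ℤ.* ℤ.+ lookup C j) p≡ (clear⁻ m p s (Zc n t j) (lookup C j) (h j) le)))

    onto₀ : ∀ n a b t s → 0ℚ ≤ s → Inside (ℤ.+ n) (ℤ.+ a) (ℤ.+ b) t s → Preimage n (ℤ.+ a) (ℤ.+ b) t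
    onto₀ n a b t s hs (_ , _ , hj) = fin (choose (λ j → nonneg j))
      where
      f : Fin (suc J) → ℤ
      f = Zc (ℤ.+ n ℤ.- (ℤ.+ a ℤ.+ ℤ.+ b)) t
      nonneg : ∀ j → ∃ λ y → ℤ.+ y ≡ f j
      nonneg j = ℤ.∣ f j ∣ , nonneg-abs (toℚ-cancel-≤ {ℤ.+ 0} {f j} (subst (0ℚ ≤_) (solve 3 (λ z s c → (z :- s :* c) :+ s :* c := z) refl (toℚ (f j)) s (toℚ (ℤ.+ lookup C j))) (+-0≤ (hj j) (*-0≤ hs (toℚ-mono-≤ {ℤ.+ 0} {ℤ.+ lookup C j} (ℤ.+≤+ ℕ.z≤n))))))
      fin : (∃ λ (y : Vec ℕ (suc J)) → ∀ j → ℤ.+ lookup y j ≡ f j) → Preimage n (ℤ.+ a) (ℤ.+ b) t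
      fin (y , hy) = zero , a ∷ b ∷ y , collect n (ℤ.+ a) (ℤ.+ b) (λ j → ℤ.+ lookup y j) t (degree₀ a b y) hy , cong (λ t → ℤ.+ a ∷ ℤ.+ b ∷ t) (points-Zc (ℤ.+ n ℤ.- (ℤ.+ a ℤ.+ ℤ.+ b)) t (λ j → ℤ.+ lookup y j) hy)

    ontoB : ∀ n a r t s → ℤ.+ 0 ℤ.≤ a ℤ.+ (ℤ.+ 3 ℤ.* ℤ.+ r ℤ.+ ℤ.+ 2) → Inside (ℤ.+ n) a ℤ.-[1+ r ] t s → Preimage n a ℤ.-[1+ r ] t
    ontoB n a r t s a≥ (_ , hb , hj) = fin a a≡ (onto-vals 0 1 r s (ℤ.+ n ℤ.- (a ℤ.+ ℤ.-[1+ r ])) t (ℤ.+ suc r) (step-1 r) (cleared 0 r s hb) hj)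
      where
      ya : ℕ
      ya = ℤ.∣ a ℤ.+ (ℤ.+ 3 ℤ.* ℤ.+ r ℤ.+ ℤ.+ 2) ∣
      a≡ : aB r ya ≡ a
      a≡ = trans (cong (ℤ._- (ℤ.+ 3 ℤ.* ℤ.+ r ℤ.+ ℤ.+ 2)) (nonneg-abs a≥)) (Z.solve 2 (λ a c → (a Z.:+ c) Z.:- c Z.:= a) refl a (ℤ.+ 3 ℤ.* ℤ.+ r ℤ.+ ℤ.+ 2))
      fin : ∀ a → aB r ya ≡ a → (∃ λ (y : Vec ℕ (suc J)) → ∀ j → posval 0 1 r (lookup C j) (lookup y j) ≡ Zc (ℤ.+ n ℤ.- (a ℤ.+ ℤ.-[1+ r ])) t j) → Preimage n a ℤ.-[1+ r ] t
      fin .(aB r ya) refl (y , hy) = suc zero , r ∷ ya ∷ y , collect n (aB r ya) ℤ.-[1+ r ] (valsB r y) t (degreeB r ya y) hy , cong (λ t → aB r ya ∷ ℤ.-[1+ r ] ∷ t) (points-Zc (ℤ.+ n ℤ.- (aB r ya ℤ.+ ℤ.-[1+ r ])) t (valsB r y) hy)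

    ontoA : ∀ n q b t s → ℤ.+ 0 ℤ.≤ ℤ.+ 3 ℤ.* b ℤ.+ ℤ.+ suc q → Inside (ℤ.+ n) ℤ.-[1+ q ] b t s → Preimage n ℤ.-[1+ q ] b t
    ontoA n q b t s b≥ (ha , _ , hj) = fin ℤ.-[1+ q ] b neg-eq b≡ (onto-vals 2 (κ k) w s (ℤ.+ n ℤ.- (ℤ.-[1+ q ] ℤ.+ b)) t (ℤ.+ suc q) p≡ (cleared 2 q s ha) hj)
      where
      k : Fin 3
      k = fromℕ< (DM.m%n<n q 3)
      w : ℕ
      w = q ℕ./ 3
      neg-eq : neg k w ≡ ℤ.-[1+ q ]
      neg-eq = cong ℤ.-[1+_] (trans (cong (ℕ._+ w ℕ.* 3) (FinP.toℕ-fromℕ< (DM.m%n<n q 3))) (sym (DM.m≡m%n+[m/n]*n q 3)))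
      p≡ : ℤ.+ suc q ≡ step 2 (κ k) w
      p≡ = trans (cong ℤ.-_ (trans (sym neg-eq) (neg≡ k w))) (ℤP.neg-involutive (step 2 (κ k) w))
      c : ℤ
      c = ℤ.+ w ℤ.+ ℤ.+ fl k
      shifted : ℤ.+ 3 ℤ.* b ℤ.+ ℤ.+ suc q ≡ ℤ.+ 3 ℤ.* (b ℤ.+ c) ℤ.+ ℤ.+ (κ k ℕ.% 3)
      shifted = trans (cong (λ z → ℤ.+ 3 ℤ.* b ℤ.+ z) (trans p≡ (cong (λ z → ℤ.+ 3 ℤ.* ℤ.+ w ℤ.+ z) (κ≡ k)))) (Z.solve 4 (λ b w f r → Z.con (ℤ.+ 3) Z.:* b Z.:+ (Z.con (ℤ.+ 3) Z.:* w Z.:+ (r Z.:+ f Z.:* Z.con (ℤ.+ 3))) Z.:= Z.con (ℤ.+ 3) Z.:* (b Z.:+ (w Z.:+ f)) Z.:+ r) refl b (ℤ.+ w) (ℤ.+ fl k) (ℤ.+ (κ k ℕ.% 3)))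
      yb : ℕ
      yb = ℤ.∣ b ℤ.+ c ∣
      b≡ : bA k w yb ≡ b
      b≡ = trans (cong (ℤ._- c) (nonneg-abs (floor-nonneg 3 (b ℤ.+ c) (κ k ℕ.% 3) (DM.m%n<n (κ k) 3) (subst (ℤ.+ 0 ℤ.≤_) shifted b≥)))) (Z.solve 2 (λ a c → (a Z.:+ c) Z.:- c Z.:= a) refl b c)
      fin : ∀ a b → neg k w ≡ a → bA k w yb ≡ b → (∃ λ (y : Vec ℕ (suc J)) → ∀ j → posval 2 (κ k) w (lookup C j) (lookup y j) ≡ Zc (ℤ.+ n ℤ.- (a ℤ.+ b)) t j) → Preimage n a b t
      fin .(neg k w) .(bA k w yb) refl refl (y , hy) = suc (suc k) , w ∷ yb ∷ y , collect n (neg k w) (bA k w yb) (valsA k w y) t (degreeA k w yb y) hy , cong (λ t → neg k w ∷ bA k w yb ∷ t) (points-Zc (ℤ.+ n ℤ.- (neg k w ℤ.+ bA k w yb)) t (valsA k w y) hy)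

    onto : ∀ n x → InDilate Ap.vertices n x → ∃ λ p → ∃ λ y → es p ℕ.+ Vec.sum y ≡ n × φ p y ≡ x
    onto n (a ∷ b ∷ t) h = go a b (inside⁻ n a b t h)
      where
      go : ∀ a b → (∃ λ s → 0ℚ ≤ s × Inside (ℤ.+ n) a b t s) → Preimage n a b t
      go (ℤ.+ a) (ℤ.+ b) (s , hs , i) = onto₀ n a b t s hs i
      go (ℤ.+ a) ℤ.-[1+ r ] (s , hs , i) = ontoB n (ℤ.+ a) r t s (subst (λ z → ℤ.+ 0 ℤ.≤ ℤ.+ a ℤ.+ (z ℤ.+ ℤ.+ 2)) (ℤP.pos-* 3 r) (ℤ.+≤+ ℕ.z≤n)) i
      go ℤ.-[1+ q ] (ℤ.+ b) (s , hs , i) = ontoA n q (ℤ.+ b) t s (subst (λ z → ℤ.+ 0 ℤ.≤ z ℤ.+ ℤ.+ suc q) (ℤP.pos-* 3 b) (ℤ.+≤+ ℕ.z≤n)) i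
      -- Comparing a with 3b decides which of the two negative coordinates demands the larger apex
      -- weight.
      go ℤ.-[1+ q ] ℤ.-[1+ r ] (s , hs , i) = decide (3 ℕ.* suc r ℕ.≤? suc q)
        where
        decide : Dec (3 ℕ.* suc r ℕ.≤ suc q) → Preimage n ℤ.-[1+ q ] ℤ.-[1+ r ] t
        decide (yes le) = ontoA n q ℤ.-[1+ r ] t s (subst (ℤ.+ 0 ℤ.≤_) (trans (cong (λ z → ℤ.+ suc q ℤ.- z) (ℤP.pos-* 3 (suc r))) (Z.solve 2 (λ q r → q Z.:- Z.con (ℤ.+ 3) Z.:* r Z.:= Z.con (ℤ.+ 3) Z.:* (Z.:- r) Z.:+ q) refl (ℤ.+ suc q) (ℤ.+ suc r))) (ℤP.i≤j⇒0≤j-i (ℤ.+≤+ le))) i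
        decide (no ¬le) = ontoB n ℤ.-[1+ q ] r t s (subst (ℤ.+ 0 ℤ.≤_) (trans (cong (λ z → z ℤ.+ ℤ.+ 2 ℤ.- ℤ.+ suc q) (ℤP.pos-* 3 r)) (ℤP.+-comm (ℤ.+ 3 ℤ.* ℤ.+ r ℤ.+ ℤ.+ 2) ℤ.-[1+ q ])) (ℤP.i≤j⇒0≤j-i (ℤ.+≤+ {suc q} {3 ℕ.* r ℕ.+ 2} (ℕP.≤-pred (subst (suc (suc q) ℕ.≤_) (NS.solve 1 (λ r → NS.con 3 NS.:* (NS.con 1 NS.:+ r) NS.:= NS.con 1 NS.:+ (NS.con 3 NS.:* r NS.:+ NS.con 2)) refl r) (ℕP.≰⇒> ¬le)))))) i

    polytope : ∀ i₁ i₂ i₃ i₄ → 1 ℕ.≤ i₁ → 1 ℕ.≤ i₂ → 1 ℕ.≤ i₃ → 1 ℕ.≤ i₄ → map es (List.allFin 5) ↭ 0 ∷ i₁ ∷ i₂ ∷ i₃ ∷ i₄ ∷ [] → ExistsPolytope (suc (suc J)) (hpoly i₁ i₂ i₃ i₄)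
    polytope i₁ i₂ i₃ i₄ h₁ h₂ h₃ h₄ perm = suc (suc (suc (suc J))) , Ap.vertices , Ap.fullDim , has-delta Ap.vertices es φ into inj onto i₁ i₂ i₃ i₄ h₁ h₂ h₃ h₄ perm

  -- Choosing the simplex for condition (0)

  sumN-replicate : ∀ n a {D} (X : Vec ℕ D) (g : ℕ → ℕ) → sumN (λ j → g (lookup (Vec.replicate n a Vec.++ X) j)) ≡ n ℕ.* g a ℕ.+ sumN (λ j → g (lookup X j))
  sumN-replicate zero a X g = refl
  sumN-replicate (suc n) a X g = trans (cong (g a ℕ.+_) (sumN-replicate n a X g)) (sym (ℕP.+-assoc (g a) (n ℕ.* g a) (sumN (λ j → g (lookup X j)))))

  -- Only the numbers of entries 1, 2, 3, 4 enter the sums; zeros fill up the dimension.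
  multiset : ∀ {D} n₁ n₂ n₃ n₄ → n₁ ℕ.+ (n₂ ℕ.+ (n₃ ℕ.+ n₄)) ℕ.≤ D →
    ∃ λ (X : Vec ℕ D) → ∀ (g : ℕ → ℕ) → g 0 ≡ 0 → sumN (λ j → g (lookup X j)) ≡ n₁ ℕ.* g 1 ℕ.+ (n₂ ℕ.* g 2 ℕ.+ (n₃ ℕ.* g 3 ℕ.+ n₄ ℕ.* g 4))
  multiset {D} n₁ n₂ n₃ n₄ h = go (D ℕ.∸ n) (trans (NS.solve 5 (λ a b c d r → a NS.:+ (b NS.:+ (c NS.:+ (d NS.:+ r))) NS.:= a NS.:+ (b NS.:+ (c NS.:+ d)) NS.:+ r) refl n₁ n₂ n₃ n₄ (D ℕ.∸ n)) (ℕP.m+[n∸m]≡n h))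
    where
    n : ℕ
    n = n₁ ℕ.+ (n₂ ℕ.+ (n₃ ℕ.+ n₄))
    go : ∀ {D} r → n₁ ℕ.+ (n₂ ℕ.+ (n₃ ℕ.+ (n₄ ℕ.+ r))) ≡ D → ∃ λ (X : Vec ℕ D) → ∀ (g : ℕ → ℕ) → g 0 ≡ 0 → sumN (λ j → g (lookup X j)) ≡ n₁ ℕ.* g 1 ℕ.+ (n₂ ℕ.* g 2 ℕ.+ (n₃ ℕ.* g 3 ℕ.+ n₄ ℕ.* g 4))
    go r refl = Vec.replicate n₁ 1 Vec.++ X₂ , λ g g0 →
        trans (sumN-replicate n₁ 1 X₂ g) (cong (n₁ ℕ.* g 1 ℕ.+_) (trans (sumN-replicate n₂ 2 X₃ g) (cong (n₂ ℕ.* g 2 ℕ.+_) (trans (sumN-replicate n₃ 3 X₄ g) (cong (n₃ ℕ.* g 3 ℕ.+_)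
          (trans (sumN-replicate n₄ 4 (Vec.replicate r 0) g) (trans (cong (n₄ ℕ.* g 4 ℕ.+_) (sumN-zeros r g g0)) (ℕP.+-identityʳ (n₄ ℕ.* g 4)))))))))
      where
      X₄ : Vec ℕ (n₄ ℕ.+ r)
      X₄ = Vec.replicate n₄ 4 Vec.++ Vec.replicate r 0
      X₃ : Vec ℕ (n₃ ℕ.+ (n₄ ℕ.+ r))
      X₃ = Vec.replicate n₃ 3 Vec.++ X₄
      X₂ : Vec ℕ (n₂ ℕ.+ (n₃ ℕ.+ (n₄ ℕ.+ r)))
      X₂ = Vec.replicate n₂ 2 Vec.++ X₃

  -- Linear combinations of equations in ℕ: s = t is a sum of known equations and the other premise
  -- a ring identity, so no subtraction has to be manipulated.
  difference-zero : ∀ {a b s t} → a ℕ.+ t ≡ b ℕ.+ s → s ≡ t → a ≡ b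
  difference-zero {a} {b} {s} h refl = ℕP.+-cancelʳ-≡ s a b h

  infixl 6 _⊞_
  _⊞_ : ∀ {a b c d : ℕ} → a ≡ b → c ≡ d → a ℕ.+ c ≡ b ℕ.+ d
  _⊞_ = cong₂ ℕ._+_

  module _ {d : ℕ} {i₁ i₂ i₃ i₄ : ℕ} (1≤i₁ : 1 ℕ.≤ i₁) (i₁≤i₂ : i₁ ℕ.≤ i₂) (i₂≤i₃ : i₂ ℕ.≤ i₃) (i₃≤i₄ : i₃ ℕ.≤ i₄) where

    -- nⱼ is the number of entries of X equal to j
    simplex-with : ∀ n₁ n₂ n₃ n₄ → n₁ ℕ.+ (n₂ ℕ.+ (n₃ ℕ.+ n₄)) ℕ.≤ suc d →
      1 ℕ.+ (n₁ ℕ.+ (n₂ ℕ.* 2 ℕ.+ (n₃ ℕ.* 3 ℕ.+ n₄ ℕ.* 4))) ≡ 5 ℕ.* i₁ →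
      i₂ ℕ.+ (n₃ ℕ.+ n₄) ≡ 2 ℕ.* i₁ → i₃ ℕ.+ (n₂ ℕ.+ (n₃ ℕ.+ n₄ ℕ.* 2)) ≡ 3 ℕ.* i₁ → i₄ ℕ.+ (n₂ ℕ.+ (n₃ ℕ.* 2 ℕ.+ n₄ ℕ.* 3)) ≡ 4 ℕ.* i₁ →
      ExistsPolytope (suc d) (hpoly i₁ i₂ i₃ i₄)
    simplex-with n₁ n₂ n₃ n₄ size total₅ h₂ h₃ h₄ = go (multiset n₁ n₂ n₃ n₄ size)
      where
      es : Fin 5 → ℕ
      es = lookup (0 ∷ i₁ ∷ i₂ ∷ i₃ ∷ i₄ ∷ [])
      go : (∃ λ (X : Vec ℕ (suc d)) → ∀ (g : ℕ → ℕ) → g 0 ≡ 0 → sumN (λ j → g (lookup X j)) ≡ n₁ ℕ.* g 1 ℕ.+ (n₂ ℕ.* g 2 ℕ.+ (n₃ ℕ.* g 3 ℕ.+ n₄ ℕ.* g 4))) → ExistsPolytope (suc d) (hpoly i₁ i₂ i₃ i₄)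
      go (X , sums) = FacetSimplex.polytope (facetData d X i₁ es hX hes) i₁ i₂ i₃ i₄ 1≤i₁ (ℕP.≤-trans 1≤i₁ i₁≤i₂) (ℕP.≤-trans 1≤i₁ (ℕP.≤-trans i₁≤i₂ i₂≤i₃)) (ℕP.≤-trans 1≤i₁ (ℕP.≤-trans i₁≤i₂ (ℕP.≤-trans i₂≤i₃ i₃≤i₄))) Perm.refl
        where
        hX : 1 ℕ.+ sumN (lookup X) ≡ 5 ℕ.* i₁
        hX = trans (cong suc (sums (λ x → x) refl)) (trans (cong (λ m → suc (m ℕ.+ (n₂ ℕ.* 2 ℕ.+ (n₃ ℕ.* 3 ℕ.+ n₄ ℕ.* 4)))) (ℕP.*-identityʳ n₁)) total₅)
        hes : ∀ k → es k ℕ.+ sumN (λ j → (lookup X j ℕ.* toℕ k) ℕ./ 5) ≡ toℕ k ℕ.* i₁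
        hes zero = trans (sums (λ x → (x ℕ.* 0) ℕ./ 5) refl) (NS.solve 4 (λ a b c d → a NS.:* NS.con 0 NS.:+ (b NS.:* NS.con 0 NS.:+ (c NS.:* NS.con 0 NS.:+ d NS.:* NS.con 0)) NS.:= NS.con 0) refl n₁ n₂ n₃ n₄)
        hes (suc zero) = trans (cong (i₁ ℕ.+_) (sums (λ x → (x ℕ.* 1) ℕ./ 5) refl)) (NS.solve 5 (λ i a b c d → i NS.:+ (a NS.:* NS.con 0 NS.:+ (b NS.:* NS.con 0 NS.:+ (c NS.:* NS.con 0 NS.:+ d NS.:* NS.con 0))) NS.:= NS.con 1 NS.:* i) refl i₁ n₁ n₂ n₃ n₄)
        hes (suc (suc zero)) = trans (cong (i₂ ℕ.+_) (trans (sums (λ x → (x ℕ.* 2) ℕ./ 5) refl) (NS.solve 4 (λ a b c d → a NS.:* NS.con 0 NS.:+ (b NS.:* NS.con 0 NS.:+ (c NS.:* NS.con 1 NS.:+ d NS.:* NS.con 1)) NS.:= c NS.:+ d) refl n₁ n₂ n₃ n₄))) h₂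
        hes (suc (suc (suc zero))) = trans (cong (i₃ ℕ.+_) (trans (sums (λ x → (x ℕ.* 3) ℕ./ 5) refl) (NS.solve 4 (λ a b c d → a NS.:* NS.con 0 NS.:+ (b NS.:* NS.con 1 NS.:+ (c NS.:* NS.con 1 NS.:+ d NS.:* NS.con 2)) NS.:= b NS.:+ (c NS.:+ d NS.:* NS.con 2)) refl n₁ n₂ n₃ n₄))) h₃
        hes (suc (suc (suc (suc zero)))) = trans (cong (i₄ ℕ.+_) (trans (sums (λ x → (x ℕ.* 4) ℕ./ 5) refl) (NS.solve 4 (λ a b c d → a NS.:* NS.con 0 NS.:+ (b NS.:* NS.con 1 NS.:+ (c NS.:* NS.con 2 NS.:+ d NS.:* NS.con 3)) NS.:= b NS.:+ (c NS.:* NS.con 2 NS.:+ d NS.:* NS.con 3)) refl n₁ n₂ n₃ n₄))) h₄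

    -- With n₄ = 0 the system has the solution n₃ = 2i₁ - i₂, n₂ = i₁ + i₂ - i₃, n₁ = i₂ + 2i₃ - 3i₁
    -- - 1. Two inequalities of (0) make n₃ and n₂ nonnegative, i₁ < i₃ does it for n₁, the total is
    -- i₂ + i₃ - 1, and i₁ + i₄ = i₂ + i₃ yields the equation for i₄.
    simplex-generic : i₁ ℕ.< i₃ → i₁ ℕ.+ i₄ ≡ i₂ ℕ.+ i₃ → i₂ ℕ.+ i₃ ℕ.≤ suc (suc d) → i₂ ℕ.≤ i₁ ℕ.+ i₁ → i₃ ℕ.≤ i₁ ℕ.+ i₂ → ExistsPolytope (suc d) (hpoly i₁ i₂ i₃ i₄)
    simplex-generic i₁<i₃ e₀ h h₃ h₂ = simplex-with n₁ n₂ n₃ 0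
        (ℕP.≤-pred (subst (ℕ._≤ suc (suc d)) (sym (difference-zero {t = i₂ ℕ.+ 2 ℕ.* i₃ ℕ.+ (i₁ ℕ.+ i₂) ℕ.+ (i₁ ℕ.+ i₁)} (NS.solve 6 (λ a b c x y z → NS.con 1 NS.:+ (x NS.:+ (y NS.:+ (z NS.:+ NS.con 0))) NS.:+ (b NS.:+ NS.con 2 NS.:* c NS.:+ (a NS.:+ b) NS.:+ (a NS.:+ a)) NS.:=
          b NS.:+ c NS.:+ (NS.con 1 NS.:+ (a NS.:+ NS.con 2 NS.:* a) NS.:+ x NS.:+ (c NS.:+ y) NS.:+ (b NS.:+ z))) refl i₁ i₂ i₃ n₁ n₂ n₃) (e₁ ⊞ e₂ ⊞ e₃))) h))
        (difference-zero {t = i₂ ℕ.+ 2 ℕ.* i₃ ℕ.+ 2 ℕ.* (i₁ ℕ.+ i₂) ℕ.+ 3 ℕ.* (i₁ ℕ.+ i₁)} (NS.solve 6 (λ a b c x y z → NS.con 1 NS.:+ (x NS.:+ (y NS.:* NS.con 2 NS.:+ (z NS.:* NS.con 3 NS.:+ NS.con 0))) NS.:+ (b NS.:+ NS.con 2 NS.:* c NS.:+ NS.con 2 NS.:* (a NS.:+ b) NS.:+ NS.con 3 NS.:* (a NS.:+ a)) NS.:=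
          NS.con 5 NS.:* a NS.:+ (NS.con 1 NS.:+ (a NS.:+ NS.con 2 NS.:* a) NS.:+ x NS.:+ NS.con 2 NS.:* (c NS.:+ y) NS.:+ NS.con 3 NS.:* (b NS.:+ z))) refl i₁ i₂ i₃ n₁ n₂ n₃) (e₁ ⊞ cong (2 ℕ.*_) e₂ ⊞ cong (3 ℕ.*_) e₃))
        (trans (cong (i₂ ℕ.+_) (ℕP.+-identityʳ n₃)) (trans e₃ (NS.solve 1 (λ a → a NS.:+ a NS.:= NS.con 2 NS.:* a) refl i₁)))
        (difference-zero {t = i₁ ℕ.+ i₂ ℕ.+ (i₁ ℕ.+ i₁)} (NS.solve 5 (λ a b c y z → c NS.:+ (y NS.:+ (z NS.:+ NS.con 0)) NS.:+ (a NS.:+ b NS.:+ (a NS.:+ a)) NS.:= NS.con 3 NS.:* a NS.:+ (c NS.:+ y NS.:+ (b NS.:+ z))) refl i₁ i₂ i₃ n₂ n₃) (e₂ ⊞ e₃))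
        (difference-zero {t = i₂ ℕ.+ i₃ ℕ.+ (i₁ ℕ.+ i₂) ℕ.+ 2 ℕ.* (i₁ ℕ.+ i₁)} (NS.solve 6 (λ a b c d y z → d NS.:+ (y NS.:+ (z NS.:* NS.con 2 NS.:+ NS.con 0)) NS.:+ (b NS.:+ c NS.:+ (a NS.:+ b) NS.:+ NS.con 2 NS.:* (a NS.:+ a)) NS.:=
          NS.con 4 NS.:* a NS.:+ (a NS.:+ d NS.:+ (c NS.:+ y) NS.:+ NS.con 2 NS.:* (b NS.:+ z))) refl i₁ i₂ i₃ i₄ n₂ n₃) (e₀ ⊞ e₂ ⊞ cong (2 ℕ.*_) e₃))
      where
      n₁ n₂ n₃ : ℕ
      n₁ = i₂ ℕ.+ 2 ℕ.* i₃ ℕ.∸ (1 ℕ.+ (i₁ ℕ.+ 2 ℕ.* i₁))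
      n₂ = i₁ ℕ.+ i₂ ℕ.∸ i₃
      n₃ = i₁ ℕ.+ i₁ ℕ.∸ i₂
      e₁ : 1 ℕ.+ (i₁ ℕ.+ 2 ℕ.* i₁) ℕ.+ n₁ ≡ i₂ ℕ.+ 2 ℕ.* i₃
      e₁ = ℕP.m+[n∸m]≡n (ℕP.≤-trans (ℕP.≤-reflexive (sym (ℕP.+-suc i₁ (2 ℕ.* i₁)))) (ℕP.+-mono-≤ i₁≤i₂ (ℕP.*-monoʳ-< 2 i₁<i₃)))
      e₂ : i₃ ℕ.+ n₂ ≡ i₁ ℕ.+ i₂
      e₂ = ℕP.m+[n∸m]≡n h₂
      e₃ : i₂ ℕ.+ n₃ ≡ i₁ ℕ.+ i₁
      e₃ = ℕP.m+[n∸m]≡n h₃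

    -- if all exponents agree, the generic solution has n₁ = −1 and is corrected by (1, −1, −1, 1)
    simplex-constant : i₁ ≡ i₂ → i₁ ≡ i₃ → i₁ ≡ i₄ → i₂ ℕ.+ i₃ ℕ.≤ suc (suc d) → ExistsPolytope (suc d) (hpoly i₁ i₂ i₃ i₄)
    simplex-constant refl refl refl h = go i₁ refl 1≤i₁ h
      where
      go : ∀ i → i ≡ i₁ → 1 ℕ.≤ i → i ℕ.+ i ℕ.≤ suc (suc d) → ExistsPolytope (suc d) (hpoly i₁ i₁ i₁ i₁)
      go (suc n) refl _ h = simplex-with 0 n n 1
        (ℕP.≤-pred (subst (ℕ._≤ suc (suc d)) (NS.solve 1 (λ n → NS.con 1 NS.:+ n NS.:+ (NS.con 1 NS.:+ n) NS.:= NS.con 1 NS.:+ (n NS.:+ (n NS.:+ NS.con 1))) refl n) h))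
        (NS.solve 1 (λ n → NS.con 1 NS.:+ (n NS.:* NS.con 2 NS.:+ (n NS.:* NS.con 3 NS.:+ NS.con 4)) NS.:= NS.con 5 NS.:* (NS.con 1 NS.:+ n)) refl n)
        (NS.solve 1 (λ n → NS.con 1 NS.:+ n NS.:+ (n NS.:+ NS.con 1) NS.:= NS.con 2 NS.:* (NS.con 1 NS.:+ n)) refl n)
        (NS.solve 1 (λ n → NS.con 1 NS.:+ n NS.:+ (n NS.:+ (n NS.:+ NS.con 2)) NS.:= NS.con 3 NS.:* (NS.con 1 NS.:+ n)) refl n)
        (NS.solve 1 (λ n → NS.con 1 NS.:+ n NS.:+ (n NS.:+ (n NS.:* NS.con 2 NS.:+ NS.con 3)) NS.:= NS.con 4 NS.:* (NS.con 1 NS.:+ n)) refl n)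

    -- If i₁ < i₃ fails, i₂ is squeezed between equal numbers, and i₁ + i₄ = i₂ + i₃ forces i₄ to
    -- agree as well.
    simplex-sufficiency : Cond0 (suc d) i₁ i₂ i₃ i₄ → ExistsPolytope (suc d) (hpoly i₁ i₂ i₃ i₄)
    simplex-sufficiency (e₀ , h , ineq) = go (i₁ ℕ.<? i₃)
      where
      go : Dec (i₁ ℕ.< i₃) → ExistsPolytope (suc d) (hpoly i₁ i₂ i₃ i₄)
      go (yes i₁<i₃) = simplex-generic i₁<i₃ e₀ h (ineq 1 1 (ℕ.s≤s ℕ.z≤n) ℕP.≤-refl (from-yes (2 ℕ.≤? 4))) (ineq 1 2 (ℕ.s≤s ℕ.z≤n) (from-yes (1 ℕ.≤? 2)) (from-yes (3 ℕ.≤? 4)))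
      go (no i₁≮i₃) = simplex-constant e₁₂ e₁₃ (sym (trans (ℕP.+-cancelˡ-≡ i₁ i₄ i₃ (trans e₀ (cong (ℕ._+ i₃) (sym e₁₂)))) (sym e₁₃))) h
        where
        e₁₃ : i₁ ≡ i₃
        e₁₃ = ℕP.≤-antisym (ℕP.≤-trans i₁≤i₂ i₂≤i₃) (ℕP.≮⇒≥ i₁≮i₃)
        e₁₂ : i₁ ≡ i₂
        e₁₂ = ℕP.≤-antisym i₁≤i₂ (ℕP.≤-trans i₂≤i₃ (ℕP.≤-reflexive (sym e₁₃)))

  pad : ∀ {k} → Vec ℕ k → ∀ J → Vec ℕ (k ℕ.+ J)
  pad xs J = xs Vec.++ Vec.replicate J 0

  -- The apex has barycentric coordinates 3, 2, -4, and ⌈3k/4⌉ + ⌈2k/4⌉ - k is 1, 1, 2, 1 for k = 1,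
  -- ..., 4. The zeros of `pad` amount to lattice pyramids, which keep the δ-polynomial in higher
  -- dimensions.
  case-1112 : ∀ J → ExistsPolytope (2 ℕ.+ J) (hpoly 1 1 1 2)
  case-1112 J = OneNegative.polytope (oneNegative (positivePart (pad (3 ∷ 2 ∷ []) J) (cong (5 ℕ.+_) (sumN-zeros J (λ x → x) refl))) (lookup (1 ∷ 1 ∷ 2 ∷ 1 ∷ [])) spec) 1 1 1 2 1≤ 1≤ 1≤ 1≤ (Perm.prep 0 (Perm.prep 1 (Perm.prep 1 (Perm.swap 2 1 Perm.refl))))
    where
    1≤ : ∀ {n} → 1 ℕ.≤ suc n
    1≤ = ℕ.s≤s ℕ.z≤n
    spec : ∀ k → lookup (1 ∷ 1 ∷ 2 ∷ 1 ∷ []) k ℕ.+ suc (toℕ k) ≡ sumN (λ j → ceil 3 (suc (toℕ k)) (lookup (pad (3 ∷ 2 ∷ []) J) j))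
    spec zero = cong (2 ℕ.+_) (sym (sumN-zeros J (ceil 3 1) refl))
    spec (suc zero) = cong (3 ℕ.+_) (sym (sumN-zeros J (ceil 3 2) refl))
    spec (suc (suc zero)) = cong (5 ℕ.+_) (sym (sumN-zeros J (ceil 3 3) refl))
    spec (suc (suc (suc zero))) = cong (5 ℕ.+_) (sym (sumN-zeros J (ceil 3 4) refl))

  -- The apex has barycentric coordinates 3, 1, 1, -4, and ⌈3k/4⌉ + 2⌈k/4⌉ - k is 2, 2, 2, 1 for k =
  -- 1, ..., 4.
  case-1222 : ∀ J → ExistsPolytope (3 ℕ.+ J) (hpoly 1 2 2 2)
  case-1222 J = OneNegative.polytope (oneNegative (positivePart (pad (3 ∷ 1 ∷ 1 ∷ []) J) (cong (5 ℕ.+_) (sumN-zeros J (λ x → x) refl))) (lookup (2 ∷ 2 ∷ 2 ∷ 1 ∷ [])) spec) 1 2 2 2 1≤ 1≤ 1≤ 1≤ (Perm.prep 0 (PP.shift 1 (2 ∷ 2 ∷ 2 ∷ []) []))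
    where
    1≤ : ∀ {n} → 1 ℕ.≤ suc n
    1≤ = ℕ.s≤s ℕ.z≤n
    spec : ∀ k → lookup (2 ∷ 2 ∷ 2 ∷ 1 ∷ []) k ℕ.+ suc (toℕ k) ≡ sumN (λ j → ceil 3 (suc (toℕ k)) (lookup (pad (3 ∷ 1 ∷ 1 ∷ []) J) j))
    spec zero = cong (3 ℕ.+_) (sym (sumN-zeros J (ceil 3 1) refl))
    spec (suc zero) = cong (4 ℕ.+_) (sym (sumN-zeros J (ceil 3 2) refl))
    spec (suc (suc zero)) = cong (5 ℕ.+_) (sym (sumN-zeros J (ceil 3 3) refl))
    spec (suc (suc (suc zero))) = cong (5 ℕ.+_) (sym (sumN-zeros J (ceil 3 4) refl))

  -- The apex has barycentric coordinates 2, 1, 1, 1, -3, -1. For κ = 1, 2, 3 the degree ⌈2κ/3⌉ +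
  -- 3⌈κ/3⌉ - κ - ⌊κ/3⌋ is 3, 3, 1, and the remaining class has degree 5 - 3 = 2.
  case-1233 : ∀ J → ExistsPolytope (5 ℕ.+ J) (hpoly 1 2 3 3)
  case-1233 J = TwoNegative.polytope (twoNegative (positivePart (pad (2 ∷ 1 ∷ 1 ∷ 1 ∷ []) J) (cong (5 ℕ.+_) (sumN-zeros J (λ x → x) refl))) (lookup (3 ∷ 3 ∷ 1 ∷ [])) spec 2 (cong (5 ℕ.+_) (sym (sumN-zeros J (ceil 0 1) refl)))) 1 2 3 3 1≤ 1≤ 1≤ 1≤ (Perm.prep 0 (PP.shift 1 (2 ∷ 3 ∷ 3 ∷ []) []))
    where
    1≤ : ∀ {n} → 1 ℕ.≤ suc n
    1≤ = ℕ.s≤s ℕ.z≤n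
    spec : ∀ k → lookup (3 ∷ 3 ∷ 1 ∷ []) k ℕ.+ (suc (toℕ k) ℕ.+ suc (toℕ k) ℕ./ 3) ≡ sumN (λ j → ceil 2 (suc (toℕ k)) (lookup (pad (2 ∷ 1 ∷ 1 ∷ 1 ∷ []) J) j))
    spec zero = cong (4 ℕ.+_) (sym (sumN-zeros J (ceil 2 1) refl))
    spec (suc zero) = cong (5 ℕ.+_) (sym (sumN-zeros J (ceil 2 2) refl))
    spec (suc (suc zero)) = cong (5 ℕ.+_) (sym (sumN-zeros J (ceil 2 3) refl))

  sufficiency : ∀ d i₁ i₂ i₃ i₄ → 1 ℕ.≤ d → 1 ℕ.≤ i₁ → i₁ ℕ.≤ i₂ → i₂ ℕ.≤ i₃ → i₃ ℕ.≤ i₄ → Conclusion d i₁ i₂ i₃ i₄ → ExistsPolytope d (hpoly i₁ i₂ i₃ i₄)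
  sufficiency (suc d) i₁ i₂ i₃ i₄ _ h₁ h₂ h₃ h₄ (inj₁ c) = simplex-sufficiency h₁ h₂ h₃ h₄ c
  sufficiency (suc (suc d)) _ _ _ _ _ _ _ _ _ (inj₂ (inj₁ (refl , refl , refl , refl , _))) = case-1112 d
  sufficiency (suc zero) _ _ _ _ _ _ _ _ _ (inj₂ (inj₁ (refl , refl , refl , refl , ℕ.s≤s ())))
  sufficiency d _ _ _ _ _ _ _ _ _ (inj₂ (inj₂ (inj₁ (refl , refl , refl , refl , ℕ.s≤s (ℕ.s≤s (ℕ.s≤s {n = n} _)))))) = case-1222 n
  sufficiency d _ _ _ _ _ _ _ _ _ (inj₂ (inj₂ (inj₂ (refl , refl , refl , refl , ℕ.s≤s (ℕ.s≤s (ℕ.s≤s (ℕ.s≤s (ℕ.s≤s {n = n} _)))))))) = case-1233 n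

open Polytopes using (necessity; sufficiency; not-simplex)
open import Data.Nat using (_≤_)

theorem0p4 : (d i₁ i₂ i₃ i₄ : ℕ) → 1 ≤ d → 1 ≤ i₁ → i₁ ≤ i₂ → i₂ ≤ i₃ → i₃ ≤ i₄ → i₄ ≤ d →
    (ExistsPolytope d (hpoly i₁ i₂ i₃ i₄)
    ⇔ (Cond0 d i₁ i₂ i₃ i₄ ⊎ Cond1 d i₁ i₂ i₃ i₄ ⊎ Cond2 d i₁ i₂ i₃ i₄ ⊎ Cond3 d i₁ i₂ i₃ i₄))
    × ((Cond1 d i₁ i₂ i₃ i₄ ⊎ Cond2 d i₁ i₂ i₃ i₄ ⊎ Cond3 d i₁ i₂ i₃ i₄)
    → ¬ ExistsSimplex d (hpoly i₁ i₂ i₃ i₄))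
theorem0p4 d i₁ i₂ i₃ i₄ 1≤d h₁ h₂ h₃ h₄ h₅ =
  mk⇔ (necessity d i₁ i₂ i₃ i₄ h₁ h₂ h₃ h₄ h₅) (sufficiency d i₁ i₂ i₃ i₄ 1≤d h₁ h₂ h₃ h₄) ,
  not-simplex d i₁ i₂ i₃ i₄ h₁ h₂ h₃ h₄
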